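{- Let $\Delta\ge 3$, $c\in[0,\Delta-2]$, $\kappa=\Delta+c$. Against an oblivious adversary, in the fully dynamic model (for rooted or general forests of maximum degree at most $\Delta$ on $n$ vertices), the expected recourse per update of {\textsc{DistMaint}} is $\Theta\!\left(\min\{\Delta/c,\ \log_{\kappa-1} n\}\right)$ (with $\Delta/c$ read as $+\infty$ when $c=0$): every update has expected recourse $O(\min\{\Delta/c,\log_{\kappa-1}n\})$, and there are update sequences for which the expected amortized recourse is $\Omega(\min\{\Delta/c,\log_{\kappa-1}n\})$.
   Context: A dynamic forest on $n$ fixed vertices starts empty; each update either inserts an edge joining two distinct trees or deletes an existing edge; maximum degree stays at most $\Delta$. (In the rooted model each tree has a root, an insertion $(p,r)$ requires $r$ to be a root and makes it a child of $p$, and deleting $(p,r)$ with $p$ the parent of $r$ makes $r$ a root.) The palette is $[\kappa]$; $A(x)$ is the set of colors not used on edges at $x$. Recourse of an update = number of previously colored edges whose color changes. The update sequence is fixed in advance (oblivious adversary). {\textsc{DistMaint}}: every tree has a designated root (initially every vertex is a root; rerooting changes only the designation). FixForbidden$(v,\alpha,\beta)$: if no child edge of $v$ has color $\beta$, stop; else recolor that child edge $(v,w)$ to $\alpha$ and call FixForbidden$(w,\beta,\alpha)$. Insertion of $(p,r)$ with $r$ a root: choose $\beta$ uniformly from $A(p)$, color $(p,r)$ by $\beta$; if no child edge of $r$ has color $\beta$ stop, else let $(r,w)$ be that edge, choose $\alpha$ uniformly from $A(r)$, recolor $(r,w)$ to $\alpha$, call FixForbidden$(w,\beta,\alpha)$.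 In general (unrooted) forests, an insertion $(u,v)$ first names endpoints so that $\deg(v)\le\deg(u)$ if both trees have at most $\Delta$ edges and otherwise so that $v$'s tree has at most as many edges as $u$'s, reroots $v$'s tree at $v$, and then performs the rooted insertion $(u,v)$. Deletion of $(p,r)$ with $p$ the parent of $r$ (in the current rooting) and color $\alpha$: delete it; let $\ell$ be the number of children of $r$; with probability $(\kappa-\ell)/\kappa$ stop; otherwise pick a uniformly random child $w$, let $\beta=\mathrm{color}(r,w)$, recolor $(r,w)$ to $\alpha$, and call FixForbidden$(w,\beta,\alpha)$. Random choices are independent.
   Formalization: The lower bound is stated for every n ≥ κ; without a lower bound on n of order κ it fails (for n = 2 the recourse is always 0, while min{Δ/c, log_{κ-1} n} is positive). -}

module Defs where

open import Data.Nat as ℕ using (ℕ; zero; suc; _+_; _*_; _∸_; _^_; _<_; _≤ᵇ_; _<ᵇ_)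
open import Data.Fin using (Fin)
import Data.Fin as F
open import Data.Fin.Properties using () renaming (_≟_ to _≟F_)
open import Data.Maybe as M using (Maybe; just; nothing)
open import Data.Product using (_×_; _,_; proj₁; proj₂; ∃)
open import Data.Sum using (_⊎_)
open import Data.List using (List; []; _∷_; _++_; length; map; concatMap; foldl; foldr; filterᵇ; head; allFin; cartesianProduct; _∷ʳ_)
open import Data.Bool using (Bool; true; false; if_then_else_; _∧_; _∨_; not)
open import Data.Unit using (⊤; tt)
open import Data.Empty using (⊥)
open import Data.Integer using (ℤ; +_; -[1+_])
open import Data.Rational as ℚ using (ℚ; _/_; 0ℚ; 1ℚ)
open import Relation.Nullary using (does; ¬_)
open import Relation.Binary.PropositionalEquality using (_≡_; _≢_)

private
  variable
    A B L : Set

eqᵇ : ∀ {k} → Fin k → Fin k → Bool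
eqᵇ x y = does (x ≟F y)

memᵇ : ∀ {k} → Fin k → List (Fin k) → Bool
memᵇ x []       = false
memᵇ x (y ∷ ys) = eqᵇ x y ∨ memᵇ x ys

Dist : Set → Set
Dist A = List (ℚ × A)

frac : ℕ → ℕ → ℚ
frac a zero    = 0ℚ
frac a (suc k) = (+ a) / suc k

ℕtoℚ : ℕ → ℚ
ℕtoℚ a = (+ a) / 1

returnD : A → Dist A
returnD x = (1ℚ , x) ∷ []

scaleD : ℚ → Dist A → Dist A
scaleD p = map (λ qy → (p ℚ.* proj₁ qy , proj₂ qy))

bindD : Dist A → (A → Dist B) → Dist B
bindD d f = concatMap (λ px → scaleD (proj₁ px) (f (proj₂ px))) d

uniform : List A → Dist A
uniform xs = map (λ x → (frac 1 (length xs) , x)) xs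

expect : Dist A → (A → ℚ) → ℚ
expect d f = foldr (λ px acc → proj₁ px ℚ.* f (proj₂ px) ℚ.+ acc) 0ℚ d

-- Comparisons with C·(Δ/c) and C·log_b n, done exactly in integers.
-- For x = p/q ≥ 0 (q > 0):  x ≤ C·log_b n  ⇔  b^p ≤ n^(C·q)
--                           x ≥ log_b n / K ⇔  n^q ≤ b^(K·p)

LeLog : ℚ → ℕ → ℕ → ℕ → Set    -- LeLog x C b n  :  x ≤ C · log_b n
LeLog x C b n with ℚ.numerator x
... | + p      = b ^ p ℕ.≤ n ^ (C * ℚ.denominatorℕ x)
... | -[1+ _ ] = ⊤

GeLog : ℚ → ℕ → ℕ → ℕ → Set    -- GeLog x K b n  :  K · x ≥ log_b n
GeLog x K b n with ℚ.numerator x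
... | + p      = n ^ ℚ.denominatorℕ x ℕ.≤ b ^ (K * p)
... | -[1+ _ ] = ⊥

-- x ≤ C · min{Δ/c , log_{κ-1} n}   with κ = Δ + c and Δ/c = +∞ when c = 0
UpperBound : (C Δ c n : ℕ) → ℚ → Set
UpperBound C Δ c n x =
  (x ℚ.* ℕtoℚ c ℚ.≤ ℕtoℚ (C * Δ)) × LeLog x C (Δ + c ∸ 1) n

-- x ≥ (1/K) · min{Δ/c , log_{κ-1} n}   with κ = Δ + c and Δ/c = +∞ when c = 0
LowerBound : (K Δ c n : ℕ) → ℚ → Set
LowerBound K Δ c n x =
  (ℕtoℚ Δ ℚ.≤ ℕtoℚ (K * c) ℚ.* x) ⊎ GeLog x K (Δ + c ∸ 1) n

-- Rooted forests on the vertex set Fin n, stored by parent pointers.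
-- s v = nothing : v is a root;  s v = just (p , l) : p is the parent of v
-- and l is the label (colour) of the edge (p , v).

module Forest (n : ℕ) where

  V : Set
  V = Fin n

  Rooted : Set → Set
  Rooted L = V → Maybe (V × L)

  vertices : List V
  vertices = allFin n

  emptyForest : Rooted L
  emptyForest _ = nothing

  isChildOf : Rooted L → V → V → Bool
  isChildOf s v w with s w
  ... | just (p , _) = eqᵇ p v
  ... | nothing      = false

  children : Rooted L → V → List V
  children s v = filterᵇ (isChildOf s v) vertices

  degree : Rooted L → V → ℕ
  degree s v with s v
  ... | just _  = suc (length (children s v))
  ... | nothing = length (children s v)

  -- root of the tree of v (follow parents; n steps suffice in a forest)
  rootOf : Rooted L → V → V
  rootOf s v = go n v
    where
    go : ℕ → V → V
    go zero    x = x
    go (suc k) x with s x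
    ... | nothing      = x
    ... | just (p , _) = go k p

  sameTree : Rooted L → V → V → Bool
  sameTree s u v = eqᵇ (rootOf s u) (rootOf s v)

  treeEdges : Rooted L → V → ℕ
  treeEdges s v = length (filterᵇ (λ y → sameTree s y v) vertices) ∸ 1

  update : Rooted L → V → Maybe (V × L) → Rooted L
  update s x m y = if eqᵇ y x then m else s y

  reroot : Rooted L → V → Rooted L
  reroot s v = go n v nothing s
    where
    go : ℕ → V → Maybe (V × L) → Rooted L → Rooted L
    go zero    x m t = update t x m
    go (suc k) x m t with t x
    ... | nothing      = update t x m
    ... | just (y , l) = go k y (just (x , l)) (update t x m)

  shape : Rooted L → Rooted ⊤
  shape s v = M.map (λ pl → (proj₁ pl , tt)) (s v)

module DistMaint (n Δ c : ℕ) where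

  open Forest n public

  κ : ℕ
  κ = Δ + c

  Col : Set
  Col = Fin κ

  State : Set
  State = Rooted Col

  colorOf : State → V → Maybe Col
  colorOf s w = M.map proj₂ (s w)

  maybeToList : Maybe A → List A
  maybeToList nothing  = []
  maybeToList (just x) = x ∷ []

  usedAt : State → V → List Col
  usedAt s x = maybeToList (colorOf s x) ++ concatMap (λ w → maybeToList (colorOf s w)) (children s x)

  avail : State → V → List Col
  avail s x = filterᵇ (λ a → not (memᵇ a (usedAt s x))) (allFin κ)

  hasColor : State → V → Col → Bool
  hasColor s w β with colorOf s w
  ... | just a  = eqᵇ a β
  ... | nothing = false

  childWithColor : State → V → Col → Maybe V
  childWithColor s v β = head (filterᵇ (λ w → isChildOf s v w ∧ hasColor s w β) vertices)

  recolor : State → V → Col → State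
  recolor s w α = update s w (M.map (λ pl → (proj₁ pl , α)) (s w))

  -- FixForbidden(v, α, β)  (with fuel; n steps suffice since paths in a
  -- forest have fewer than n edges)
  fixForbidden : ℕ → V → Col → Col → State → State
  fixForbidden zero    v α β s = s
  fixForbidden (suc k) v α β s with childWithColor s v β
  ... | nothing = s
  ... | just w  = fixForbidden k w β α (recolor s w α)

  FixForbidden : V → Col → Col → State → State
  FixForbidden = fixForbidden n

  insertR : State → V → V → Dist State
  insertR s p r = bindD (uniform (avail s p)) step₁
    where
    step₁ : Col → Dist State
    step₁ β with update s r (just (p , β))
    ... | s₁ with childWithColor s₁ r β
    ...   | nothing = returnD s₁
    ...   | just w  = bindD (uniform (avail s₁ r))
                        (λ α → returnD (FixForbidden w β α (recolor s₁ w α)))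

  deleteR : State → V → V → Dist State
  deleteR s p r with s r
  ... | nothing      = returnD s
  ... | just (_ , α) =
        (frac (κ ∸ length (children s₁ r)) κ , s₁)
        ∷ scaleD (frac (length (children s₁ r)) κ)
                 (bindD (uniform (children s₁ r)) branch)
    where
    s₁ : State
    s₁ = update s r nothing
    branch : V → Dist State
    branch w with colorOf s₁ w
    ... | nothing = returnD s₁
    ... | just β  = returnD (FixForbidden w β α (recolor s₁ w α))

  edgeColor : State → V → V → Maybe Col
  edgeColor s u v with s u | s v
  ... | just (p , a) | just (q , b) = if eqᵇ p v then just a else (if eqᵇ q u then just b else nothing)
  ... | just (p , a) | nothing      = if eqᵇ p v then just a else nothing
  ... | nothing      | just (q , b) = if eqᵇ q u then just b else nothing
  ... | nothing      | nothing      = nothing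

  changed : State → State → V → V → Bool
  changed s s' u v with edgeColor s u v | edgeColor s' u v
  ... | just a | just b = not (eqᵇ a b)
  ... | _      | _      = false

  recourse : State → State → ℕ
  recourse s s' = length (filterᵇ (λ uv → (F.toℕ (proj₁ uv) <ᵇ F.toℕ (proj₂ uv)) ∧ changed s s' (proj₁ uv) (proj₂ uv))
                                   (cartesianProduct vertices vertices))

  data RUpdate : Set where
    rins : V → V → RUpdate
    rdel : V → V → RUpdate

  stepShapeR : Rooted ⊤ → RUpdate → Rooted ⊤
  stepShapeR f (rins p r) = update f r (just (p , tt))
  stepShapeR f (rdel p r) = update f r nothing

  ValidR : Rooted ⊤ → RUpdate → Set
  ValidR f (rins p r) = (f r ≡ nothing) × (rootOf f p ≢ r) × (degree f p < Δ) × (degree f r < Δ)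
  ValidR f (rdel p r) = f r ≡ just (p , tt)

  ValidSeqR : Rooted ⊤ → List RUpdate → Set
  ValidSeqR f []       = ⊤
  ValidSeqR f (u ∷ us) = ValidR f u × ValidSeqR (stepShapeR f u) us

  stepR : State → RUpdate → Dist State
  stepR s (rins p r) = insertR s p r
  stepR s (rdel p r) = deleteR s p r

  runR : List RUpdate → Dist State
  runR = foldl (λ d u → bindD d (λ s → stepR s u)) (returnD emptyForest)

  expRecR : List RUpdate → RUpdate → ℚ
  expRecR us u = expect (runR us) (λ s → expect (stepR s u) (λ s' → ℕtoℚ (recourse s s')))

  totalRecR : List RUpdate → List RUpdate → ℚ
  totalRecR pre []       = 0ℚ
  totalRecR pre (u ∷ us) = expRecR pre u ℚ.+ totalRecR (pre ∷ʳ u) us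

  amortRecR : List RUpdate → ℚ
  amortRecR us = totalRecR [] us ℚ.* frac 1 (length us)

  -- General (unrooted) model; the algorithm keeps a rooting

  data GUpdate : Set where
    gins : V → V → GUpdate
    gdel : V → V → GUpdate

  -- name the endpoints (u , v) of an insertion: returns (u , v) where v's
  -- tree will be rerooted at v and attached below u
  orient : Rooted L → V → V → V × V
  orient f u v =
    if (treeEdges f u ≤ᵇ Δ) ∧ (treeEdges f v ≤ᵇ Δ)
    then (if degree f v ≤ᵇ degree f u then (u , v) else (v , u))
    else (if treeEdges f v ≤ᵇ treeEdges f u then (u , v) else (v , u))

  stepShapeG : Rooted ⊤ → GUpdate → Rooted ⊤
  stepShapeG f (gins u v) with orient f u v
  ... | (a , b) = update (reroot f b) b (just (a , tt))
  stepShapeG f (gdel u v) = if isChildOf f u v then update f v nothing else update f u nothing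

  ValidG : Rooted ⊤ → GUpdate → Set
  ValidG f (gins u v) = (rootOf f u ≢ rootOf f v) × (degree f u < Δ) × (degree f v < Δ)
  ValidG f (gdel u v) = (f v ≡ just (u , tt)) ⊎ (f u ≡ just (v , tt))

  ValidSeqG : Rooted ⊤ → List GUpdate → Set
  ValidSeqG f []       = ⊤
  ValidSeqG f (u ∷ us) = ValidG f u × ValidSeqG (stepShapeG f u) us

  stepG : State → GUpdate → Dist State
  stepG s (gins u v) with orient s u v
  ... | (a , b) = insertR (reroot s b) a b
  stepG s (gdel u v) = if isChildOf s u v then deleteR s u v else deleteR s v u

  runG : List GUpdate → Dist State
  runG = foldl (λ d u → bindD d (λ s → stepG s u)) (returnD emptyForest)

  expRecG : List GUpdate → GUpdate → ℚ
  expRecG us u = expect (runG us) (λ s → expect (stepG s u) (λ s' → ℕtoℚ (recourse s s')))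

  totalRecG : List GUpdate → List GUpdate → ℚ
  totalRecG pre []       = 0ℚ
  totalRecG pre (u ∷ us) = expRecG pre u ℚ.+ totalRecG (pre ∷ʳ u) us

  amortRecG : List GUpdate → ℚ
  amortRecG us = totalRecG [] us ℚ.* frac 1 (length us)

{-# OPTIONS --safe #-}
-- The algorithm keeps the colouring uniformly distributed over all proper edge colourings of the
-- current forest.  Both an insertion and a deletion of an edge (p , r) recolour a two-coloured path
-- hanging from r, and exchanging the two colours on a Kempe component below r is an involution that
-- matches the colourings before and after the update, so uniformity is preserved.  In a uniform
-- colouring a vertex at depth d below r lies on the recoloured path with probability
-- 1 / (κ (κ-1)^(d-1)); hence the expected recourse of the update is the sum of these weights over the
-- subtree of r, in the forest that contains the edge (p , r).
-- Upper bound: a vertex below r has at most Δ-1 children, so the weights of consecutive levels shrink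
-- by the factor (Δ-1)/(κ-1), and the levels beyond log_{κ-1} n contribute at most 1 altogether.
-- Lower bound: build two (Δ-1)-ary heaps and repeatedly insert and delete the edge joining their roots.
module Submission where

open import Defs
open import Data.Nat as ℕ using (ℕ; zero; suc; _+_; _*_; _∸_; _^_; _≤_; _<_; z≤n; s≤s; NonZero)
import Data.Nat.Properties as ℕₚ
import Data.Nat.DivMod as ℕD
open import Data.Integer as ℤ using (+_; -[1+_])
import Data.Integer.Properties as ℤₚ
open import Data.Rational as ℚ using (ℚ; 0ℚ; 1ℚ) renaming (_+_ to _+ℚ_; _*_ to _*ℚ_; _≤_ to _≤ℚ_; -_ to -ℚ_)
import Data.Rational.Properties as ℚₚ
import Data.Rational.Unnormalised as ℚᵘ
import Data.Rational.Unnormalised.Properties as ℚᵘₚ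
open import Data.Rational.Solver using (module +-*-Solver)
open import Data.Fin using (Fin; zero; suc; toℕ; fromℕ<)
open import Data.Fin.Properties as Fₚ using (toℕ<n; all?; any?) renaming (_≟_ to _≟F_)
open import Data.Vec as Vec using (Vec; []; _∷_; lookup; tabulate; _[_]≔_)
import Data.Vec.Properties as Vecₚ
open import Data.Maybe as M using (Maybe; just; nothing)
open import Data.Maybe.Properties using (just-injective)
open import Data.Product using (_×_; _,_; proj₁; proj₂; ∃)
open import Data.Sum using (_⊎_; inj₁; inj₂)
open import Data.List as List using (List; []; _∷_; _++_; length; map; concatMap; foldl; filterᵇ; head; allFin; cartesianProduct; _∷ʳ_)
import Data.List.Properties as Listₚ
open import Data.Bool using (Bool; true; false; if_then_else_; _∧_; not)
open import Data.Unit using (⊤; tt)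
open import Data.Empty using (⊥; ⊥-elim)
open import Function using (_∘_; id; case_of_)
open import Relation.Nullary using (Dec; yes; no; does; ¬_; contradiction)
open import Relation.Nullary.Decidable using (_×-dec_; _⊎-dec_; _→-dec_; ¬?; dec-true; dec-false; map′; toWitness)
open import Relation.Binary.PropositionalEquality using (_≡_; _≢_; refl; sym; trans; cong; cong₂; subst; subst₂; _≗_; module ≡-Reasoning)
open import Data.List.Membership.Propositional using (_∈_)
open import Data.List.Membership.Propositional.Properties using (∈-allFin)
import Data.List.Relation.Unary.Any as Any
open import Algebra.Properties.Group ℚₚ.+-0-group using () renaming (∙-cancelʳ to +ℚ-cancelʳ)
open import Relation.Binary.Definitions as Tri using (Tri)
open import Data.Nat.Solver using () renaming (module +-*-Solver to ℕSolver)

-- The obstacle is that an update changes the set of edges that are coloured. A colouring is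
-- therefore a vector with one entry per vertex, the colour of the edge to its parent, and the entry
-- at a root is spare. The colour drawn for a new edge is exchanged with the spare entry at its
-- lower end, so the colourings before and after an update live in one type and every random choice
-- becomes a change of variables in a finite sum. Spare entries only multiply all counts on a given
-- forest by the same factor.
--
-- The stopping probability of a deletion makes it weigh staying against each swap exactly as an
-- insertion does. Hence one identity, `link-sum`, yields uniformity for both updates and, applied
-- to the number of differing entries, their recourse.
--
-- Logarithms occur only as inequalities between powers. The constant 2 comes from `D + 1 ≤ 2 * D`,
-- where `D` is the integer part of the logarithm. The constant 96 is `8 * 3 * 4`: 8 compares
-- `κ * D` with the weight of `D` levels, 3 spreads the costly insertions over the deletions and the
-- building phase, 4 covers the rounding to whole levels.

private
  variable
    Elem Elem′ : Set

-- Finite sums of rationals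

infixr 5 _▸_

-- Multiplication by an indicator, kept as a conditional so that the guard becomes a hypothesis for
-- the guarded term in `▸-cong?` and `▸-zero?`. All probabilities below are sums with such guards.
_▸_ : Bool → ℚ → ℚ
b ▸ x = if b then x else 0ℚ

∑ : List Elem → (Elem → ℚ) → ℚ
∑ []       h = 0ℚ
∑ (x ∷ xs) h = h x +ℚ ∑ xs h

▸-*ˡ : ∀ b x y → x *ℚ (b ▸ y) ≡ b ▸ x *ℚ y
▸-*ˡ true  x y = refl
▸-*ˡ false x y = ℚₚ.*-zeroʳ x

▸-*ʳ : ∀ b x y → (b ▸ x) *ℚ y ≡ b ▸ x *ℚ y
▸-*ʳ true  x y = refl
▸-*ʳ false x y = ℚₚ.*-zeroˡ y

▸-+ : ∀ b x y → b ▸ (x +ℚ y) ≡ (b ▸ x) +ℚ (b ▸ y)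
▸-+ true  x y = refl
▸-+ false x y = refl

▸-comm : ∀ b b' x → b ▸ b' ▸ x ≡ b' ▸ b ▸ x
▸-comm true  b'    x = refl
▸-comm false true  x = refl
▸-comm false false x = refl

▸-cong : ∀ b {x y} → (b ≡ true → x ≡ y) → b ▸ x ≡ b ▸ y
▸-cong true  e = e refl
▸-cong false e = refl

witness : ∀ {P : Set} (d : Dec P) → does d ≡ true → P
witness (yes p) _ = p

▸-cong? : ∀ {P : Set} (d : Dec P) {x y} → (P → x ≡ y) → does d ▸ x ≡ does d ▸ y
▸-cong? d e = ▸-cong (does d) (λ t → e (witness d t))

▸-yes : ∀ {P : Set} (d : Dec P) x → P → does d ▸ x ≡ x
▸-yes d x p = cong (_▸ x) (dec-true d p)

▸-no : ∀ {P : Set} (d : Dec P) x → ¬ P → does d ▸ x ≡ 0ℚ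
▸-no d x ¬p = cong (_▸ x) (dec-false d ¬p)

does-iff : ∀ {P Q : Set} (d : Dec P) (e : Dec Q) → (P → Q) → (Q → P) → does d ≡ does e
does-iff (yes p) e f g = sym (dec-true e (f p))
does-iff (no ¬p) e f g = sym (dec-false e (λ q → ¬p (g q)))

▸-nonneg : ∀ b {x} → 0ℚ ≤ℚ x → 0ℚ ≤ℚ b ▸ x
▸-nonneg true  p = p
▸-nonneg false p = ℚₚ.≤-refl

▸-≤ : ∀ b {x} → 0ℚ ≤ℚ x → b ▸ x ≤ℚ x
▸-≤ true  p = ℚₚ.≤-refl
▸-≤ false p = p

+-interchange : ∀ a b c d → (a +ℚ b) +ℚ (c +ℚ d) ≡ (a +ℚ c) +ℚ (b +ℚ d)
+-interchange = solve 4 (λ a b c d → (a :+ b) :+ (c :+ d) := (a :+ c) :+ (b :+ d)) refl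
  where open +-*-Solver

∑-cong : ∀ (xs : List Elem) {h k} → (∀ x → h x ≡ k x) → ∑ xs h ≡ ∑ xs k
∑-cong []       e = refl
∑-cong (x ∷ xs) e = cong₂ _+ℚ_ (e x) (∑-cong xs e)

∑-0 : ∀ (xs : List Elem) → ∑ xs (λ _ → 0ℚ) ≡ 0ℚ
∑-0 []       = refl
∑-0 (x ∷ xs) = trans (ℚₚ.+-identityˡ _) (∑-0 xs)

∑-+ : ∀ (xs : List Elem) h k → ∑ xs (λ x → h x +ℚ k x) ≡ ∑ xs h +ℚ ∑ xs k
∑-+ []       h k = refl
∑-+ (x ∷ xs) h k = trans (cong (h x +ℚ k x +ℚ_) (∑-+ xs h k)) (+-interchange (h x) (k x) (∑ xs h) (∑ xs k))

∑-*ˡ : ∀ (xs : List Elem) c h → ∑ xs (λ x → c *ℚ h x) ≡ c *ℚ ∑ xs h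
∑-*ˡ []       c h = sym (ℚₚ.*-zeroʳ c)
∑-*ˡ (x ∷ xs) c h = trans (cong (c *ℚ h x +ℚ_) (∑-*ˡ xs c h)) (sym (ℚₚ.*-distribˡ-+ c (h x) (∑ xs h)))

∑-*ʳ : ∀ (xs : List Elem) c h → ∑ xs (λ x → h x *ℚ c) ≡ ∑ xs h *ℚ c
∑-*ʳ xs c h = trans (∑-cong xs (λ x → ℚₚ.*-comm (h x) c)) (trans (∑-*ˡ xs c h) (ℚₚ.*-comm c (∑ xs h)))

∑-▸ : ∀ (xs : List Elem) b h → ∑ xs (λ x → b ▸ h x) ≡ b ▸ ∑ xs h
∑-▸ xs true  h = refl
∑-▸ xs false h = ∑-0 xs

∑-swap : ∀ (xs : List Elem) (ys : List Elem′) (h : Elem → Elem′ → ℚ) → ∑ xs (λ x → ∑ ys (h x)) ≡ ∑ ys (λ y → ∑ xs (λ x → h x y))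
∑-swap []       ys h = sym (∑-0 ys)
∑-swap (x ∷ xs) ys h = trans (cong (∑ ys (h x) +ℚ_) (∑-swap xs ys h)) (sym (∑-+ ys (h x) (λ y → ∑ xs (λ z → h z y))))

∑-++ : ∀ (xs ys : List Elem) h → ∑ (xs ++ ys) h ≡ ∑ xs h +ℚ ∑ ys h
∑-++ []       ys h = sym (ℚₚ.+-identityˡ _)
∑-++ (x ∷ xs) ys h = trans (cong (h x +ℚ_) (∑-++ xs ys h)) (sym (ℚₚ.+-assoc (h x) (∑ xs h) (∑ ys h)))

∑-map : ∀ (f : Elem → Elem′) xs h → ∑ (map f xs) h ≡ ∑ xs (h ∘ f)
∑-map f []       h = refl
∑-map f (x ∷ xs) h = cong (h (f x) +ℚ_) (∑-map f xs h)

∑-filter : ∀ (p : Elem → Bool) xs h → ∑ (filterᵇ p xs) h ≡ ∑ xs (λ x → p x ▸ h x)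
∑-filter p []       h = refl
∑-filter p (x ∷ xs) h with p x
... | true  = cong (h x +ℚ_) (∑-filter p xs h)
... | false = trans (∑-filter p xs h) (sym (ℚₚ.+-identityˡ _))

∑-concatMap : ∀ (f : Elem → List Elem′) xs h → ∑ (concatMap f xs) h ≡ ∑ xs (λ x → ∑ (f x) h)
∑-concatMap f []       h = refl
∑-concatMap f (x ∷ xs) h = trans (∑-++ (f x) (concatMap f xs) h) (cong (∑ (f x) h +ℚ_) (∑-concatMap f xs h))

∑-cartesian : ∀ (xs : List Elem) (ys : List Elem′) h →
  ∑ (cartesianProduct xs ys) h ≡ ∑ xs (λ x → ∑ ys (λ y → h (x , y)))
∑-cartesian []       ys h = refl
∑-cartesian (x ∷ xs) ys h = trans (∑-++ (map (x ,_) ys) (cartesianProduct xs ys) h)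
  (cong₂ _+ℚ_ (∑-map (x ,_) ys h) (∑-cartesian xs ys h))

∑-mono : ∀ (xs : List Elem) {h k} → (∀ x → h x ≤ℚ k x) → ∑ xs h ≤ℚ ∑ xs k
∑-mono []       e = ℚₚ.≤-refl
∑-mono (x ∷ xs) e = ℚₚ.+-mono-≤ (e x) (∑-mono xs e)

∑-nonneg : ∀ (xs : List Elem) {h} → (∀ x → 0ℚ ≤ℚ h x) → 0ℚ ≤ℚ ∑ xs h
∑-nonneg xs e = ℚₚ.≤-trans (ℚₚ.≤-reflexive (sym (∑-0 xs))) (∑-mono xs e)

filterᵇ-cong : ∀ {p q : Elem → Bool} xs → (∀ x → p x ≡ q x) → filterᵇ p xs ≡ filterᵇ q xs
filterᵇ-cong [] e = refl
filterᵇ-cong {p = p} {q} (x ∷ xs) e with p x | q x | e x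
... | true  | .true  | refl = cong (x ∷_) (filterᵇ-cong xs e)
... | false | .false | refl = filterᵇ-cong xs e

-- Enumerations

-- Every element occurs exactly once, phrased through the sums it is used in.
IsEnum : List Elem → Set
IsEnum {Elem} xs = ∀ (x : Elem) h → (∀ y → y ≢ x → h y ≡ 0ℚ) → ∑ xs h ≡ h x

enum-allFin : ∀ k → IsEnum (allFin k)
enum-allFin (suc k) x h z = trans (cong (h zero +ℚ_) tail) (pick x z)
  where
  tail : ∑ (List.tabulate suc) h ≡ ∑ (allFin k) (h ∘ suc)
  tail = trans (cong (λ l → ∑ l h) (sym (Listₚ.map-tabulate id suc))) (∑-map suc (allFin k) h)
  pick : ∀ x → (∀ y → y ≢ x → h y ≡ 0ℚ) → h zero +ℚ ∑ (allFin k) (h ∘ suc) ≡ h x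
  pick zero    z = trans (cong (h zero +ℚ_) (trans (∑-cong (allFin k) (λ y → z (suc y) λ ())) (∑-0 (allFin k)))) (ℚₚ.+-identityʳ _)
  pick (suc x) z = trans (cong₂ _+ℚ_ (z zero λ ()) (enum-allFin k x (h ∘ suc) (λ y y≢x → z (suc y) (λ e → y≢x (Fₚ.suc-injective e)))))
                         (ℚₚ.+-identityˡ _)

allVecs : ∀ k n → List (Vec (Fin k) n)
allVecs k zero    = [] ∷ []
allVecs k (suc n) = concatMap (λ a → map (a ∷_) (allVecs k n)) (allFin k)

enum-allVecs : ∀ k n → IsEnum (allVecs k n)
enum-allVecs k zero    []      h z = ℚₚ.+-identityʳ _
enum-allVecs k (suc n) (a ∷ v) h z = begin
  ∑ (allVecs k (suc n)) h
    ≡⟨ ∑-concatMap (λ b → map (b ∷_) (allVecs k n)) (allFin k) h ⟩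
  ∑ (allFin k) (λ b → ∑ (map (b ∷_) (allVecs k n)) h)
    ≡⟨ ∑-cong (allFin k) (λ b → ∑-map (b ∷_) (allVecs k n) h) ⟩
  ∑ (allFin k) (λ b → ∑ (allVecs k n) (λ w → h (b ∷ w)))
    ≡⟨ enum-allFin k a _ (λ b b≢a → trans (∑-cong (allVecs k n) (λ w → z (b ∷ w) (λ e → b≢a (Vecₚ.∷-injectiveˡ e)))) (∑-0 (allVecs k n))) ⟩
  ∑ (allVecs k n) (λ w → h (a ∷ w))
    ≡⟨ enum-allVecs k n v (λ w → h (a ∷ w)) (λ w w≢v → z (a ∷ w) (λ e → w≢v (Vecₚ.∷-injectiveʳ e))) ⟩
  h (a ∷ v) ∎
  where open ≡-Reasoning

enum-× : ∀ (xs : List Elem) (ys : List Elem′) → IsEnum xs → IsEnum ys → IsEnum (cartesianProduct xs ys)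
enum-× xs ys ex ey (x , y) h z = begin
  ∑ (cartesianProduct xs ys) h
    ≡⟨ ∑-cartesian xs ys h ⟩
  ∑ xs (λ x' → ∑ ys (λ y' → h (x' , y')))
    ≡⟨ ex x _ (λ x' x'≢x → trans (∑-cong ys (λ y' → z (x' , y') (λ e → x'≢x (cong proj₁ e)))) (∑-0 ys)) ⟩
  ∑ ys (λ y' → h (x , y'))
    ≡⟨ ey y _ (λ y' y'≢y → z (x , y') (λ e → y'≢y (cong proj₂ e))) ⟩
  h (x , y) ∎
  where open ≡-Reasoning

-- Write `h (φ x)` as a sum over `y` guarded by `y ≡ φ x`, exchange the two sums, and read the guard
-- as `x ≡ φ y`. Every bijective count below is brought to this form.
∑-involution : ∀ (xs : List Elem) → ((x y : Elem) → Dec (x ≡ y)) → IsEnum xs →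
  ∀ (φ : Elem → Elem) → (∀ x → φ (φ x) ≡ x) → ∀ h → ∑ xs (h ∘ φ) ≡ ∑ xs h
∑-involution xs _≟_ enum φ inv h = begin
  ∑ xs (h ∘ φ)
    ≡⟨ ∑-cong xs (λ x → sym (trans (enum (φ x) (λ y → does (y ≟ φ x) ▸ h y) (λ y → ▸-no (y ≟ φ x) (h y)))
                                   (▸-yes (φ x ≟ φ x) (h (φ x)) refl))) ⟩
  ∑ xs (λ x → ∑ xs (λ y → does (y ≟ φ x) ▸ h y))
    ≡⟨ ∑-swap xs xs (λ x y → does (y ≟ φ x) ▸ h y) ⟩
  ∑ xs (λ y → ∑ xs (λ x → does (y ≟ φ x) ▸ h y))
    ≡⟨ ∑-cong xs (λ y → trans (enum (φ y) (λ x → does (y ≟ φ x) ▸ h y)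
                                  (λ x x≢ → ▸-no (y ≟ φ x) (h y) (λ e → x≢ (trans (sym (inv x)) (cong φ (sym e))))))
                              (▸-yes (y ≟ φ (φ y)) (h y) (sym (inv y)))) ⟩
  ∑ xs h ∎
  where open ≡-Reasoning

∑-δ : ∀ k (x : Fin k) (h : Fin k → ℚ) → ∑ (allFin k) (λ y → does (x ≟F y) ▸ h y) ≡ h x
∑-δ k x h = trans (enum-allFin k x (λ y → does (x ≟F y) ▸ h y) (λ y y≢x → ▸-no (x ≟F y) (h y) (λ e → y≢x (sym e))))
                  (▸-yes (x ≟F x) (h x) refl)

-- The numerals ℕtoℚ and frac

ℕtoℚ-+ : ∀ a b → ℕtoℚ (a + b) ≡ ℕtoℚ a +ℚ ℕtoℚ b
ℕtoℚ-+ a b = ℚₚ.toℚᵘ-injective (begin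
  ℚ.toℚᵘ (ℕtoℚ (a + b))                     ≈⟨ ℚₚ.toℚᵘ-fromℚᵘ (ℚᵘ.mkℚᵘ (+ (a + b)) 0) ⟩
  ℚᵘ.mkℚᵘ (+ (a + b)) 0                     ≈⟨ ℚᵘ.*≡* (cong₂ ℤ._*_ (cong₂ ℤ._+_ (sym (ℤₚ.*-identityʳ (+ a))) (sym (ℤₚ.*-identityʳ (+ b)))) refl) ⟩
  ℚᵘ.mkℚᵘ (+ a) 0 ℚᵘ.+ ℚᵘ.mkℚᵘ (+ b) 0      ≈⟨ ℚᵘₚ.+-cong (ℚᵘₚ.≃-sym (ℚₚ.toℚᵘ-fromℚᵘ (ℚᵘ.mkℚᵘ (+ a) 0))) (ℚᵘₚ.≃-sym (ℚₚ.toℚᵘ-fromℚᵘ (ℚᵘ.mkℚᵘ (+ b) 0))) ⟩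
  ℚ.toℚᵘ (ℕtoℚ a) ℚᵘ.+ ℚ.toℚᵘ (ℕtoℚ b)      ≈⟨ ℚᵘₚ.≃-sym (ℚₚ.toℚᵘ-homo-+ (ℕtoℚ a) (ℕtoℚ b)) ⟩
  ℚ.toℚᵘ (ℕtoℚ a +ℚ ℕtoℚ b)                 ∎)
  where open import Relation.Binary.Reasoning.Setoid ℚᵘₚ.≃-setoid

ℕtoℚ-* : ∀ a b → ℕtoℚ (a * b) ≡ ℕtoℚ a *ℚ ℕtoℚ b
ℕtoℚ-* a b = ℚₚ.toℚᵘ-injective (begin
  ℚ.toℚᵘ (ℕtoℚ (a * b))                     ≈⟨ ℚₚ.toℚᵘ-fromℚᵘ (ℚᵘ.mkℚᵘ (+ (a * b)) 0) ⟩
  ℚᵘ.mkℚᵘ (+ (a * b)) 0                     ≈⟨ ℚᵘ.*≡* (cong (ℤ._* + 1) (ℤₚ.pos-* a b)) ⟩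
  ℚᵘ.mkℚᵘ (+ a) 0 ℚᵘ.* ℚᵘ.mkℚᵘ (+ b) 0      ≈⟨ ℚᵘₚ.*-cong (ℚᵘₚ.≃-sym (ℚₚ.toℚᵘ-fromℚᵘ (ℚᵘ.mkℚᵘ (+ a) 0))) (ℚᵘₚ.≃-sym (ℚₚ.toℚᵘ-fromℚᵘ (ℚᵘ.mkℚᵘ (+ b) 0))) ⟩
  ℚ.toℚᵘ (ℕtoℚ a) ℚᵘ.* ℚ.toℚᵘ (ℕtoℚ b)      ≈⟨ ℚᵘₚ.≃-sym (ℚₚ.toℚᵘ-homo-* (ℕtoℚ a) (ℕtoℚ b)) ⟩
  ℚ.toℚᵘ (ℕtoℚ a *ℚ ℕtoℚ b)                 ∎)
  where open import Relation.Binary.Reasoning.Setoid ℚᵘₚ.≃-setoid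

frac-* : ∀ a k → .{{_ : NonZero k}} → frac a k *ℚ ℕtoℚ k ≡ ℕtoℚ a
frac-* a (suc k) = ℚₚ.toℚᵘ-injective (begin
  ℚ.toℚᵘ (frac a (suc k) *ℚ ℕtoℚ (suc k))
    ≈⟨ ℚₚ.toℚᵘ-homo-* (frac a (suc k)) (ℕtoℚ (suc k)) ⟩
  ℚ.toℚᵘ (frac a (suc k)) ℚᵘ.* ℚ.toℚᵘ (ℕtoℚ (suc k))
    ≈⟨ ℚᵘₚ.*-cong (ℚₚ.toℚᵘ-fromℚᵘ (ℚᵘ.mkℚᵘ (+ a) k)) (ℚₚ.toℚᵘ-fromℚᵘ (ℚᵘ.mkℚᵘ (+ suc k) 0)) ⟩
  ℚᵘ.mkℚᵘ (+ a) k ℚᵘ.* ℚᵘ.mkℚᵘ (+ suc k) 0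
    ≈⟨ ℚᵘ.*≡* (trans (ℤₚ.*-identityʳ (+ a ℤ.* + suc k)) (cong (λ z → + a ℤ.* + suc z) (sym (ℕₚ.*-identityʳ k)))) ⟩
  ℚᵘ.mkℚᵘ (+ a) 0
    ≈⟨ ℚᵘₚ.≃-sym (ℚₚ.toℚᵘ-fromℚᵘ (ℚᵘ.mkℚᵘ (+ a) 0)) ⟩
  ℚ.toℚᵘ (ℕtoℚ a) ∎)
  where open import Relation.Binary.Reasoning.Setoid ℚᵘₚ.≃-setoid

ℕtoℚ-mono : ∀ {a b} → a ≤ b → ℕtoℚ a ≤ℚ ℕtoℚ b
ℕtoℚ-mono {a} {b} a≤b = ℚₚ.toℚᵘ-cancel-≤
  (ℚᵘₚ.≤-trans (ℚᵘₚ.≤-reflexive (ℚₚ.toℚᵘ-fromℚᵘ (ℚᵘ.mkℚᵘ (+ a) 0)))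
  (ℚᵘₚ.≤-trans (ℚᵘ.*≤* (ℤₚ.*-monoʳ-≤-nonNeg (+ 1) (ℤ.+≤+ a≤b)))
               (ℚᵘₚ.≤-reflexive (ℚᵘₚ.≃-sym (ℚₚ.toℚᵘ-fromℚᵘ (ℚᵘ.mkℚᵘ (+ b) 0))))))

ℕtoℚ-nonneg : ∀ a → 0ℚ ≤ℚ ℕtoℚ a
ℕtoℚ-nonneg a = ℕtoℚ-mono {0} {a} z≤n

frac1-nonneg : ∀ k → 0ℚ ≤ℚ frac 1 k
frac1-nonneg zero    = ℚₚ.≤-refl
frac1-nonneg (suc k) = ℚₚ.nonNegative⁻¹ _ {{ℚₚ.normalize-nonNeg 1 (suc k)}}

*-nonneg : ∀ {x y} → 0ℚ ≤ℚ x → 0ℚ ≤ℚ y → 0ℚ ≤ℚ x *ℚ y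
*-nonneg {x} {y} p q = ℚₚ.≤-trans (ℚₚ.≤-reflexive (sym (ℚₚ.*-zeroʳ x))) (ℚₚ.*-monoˡ-≤-nonNeg x {{ℚ.nonNegative p}} q)

*-monoʳ : ∀ {x y z} → 0ℚ ≤ℚ x → y ≤ℚ z → x *ℚ y ≤ℚ x *ℚ z
*-monoʳ {x} p q = ℚₚ.*-monoˡ-≤-nonNeg x {{ℚ.nonNegative p}} q

*-monoˡ : ∀ {x y z} → 0ℚ ≤ℚ x → y ≤ℚ z → y *ℚ x ≤ℚ z *ℚ x
*-monoˡ {x} p q = ℚₚ.*-monoʳ-≤-nonNeg x {{ℚ.nonNegative p}} q

∑-length : ∀ (xs : List Elem) → ∑ xs (λ _ → 1ℚ) ≡ ℕtoℚ (length xs)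
∑-length []       = refl
∑-length (x ∷ xs) = trans (cong (1ℚ +ℚ_) (∑-length xs)) (sym (ℕtoℚ-+ 1 (length xs)))

∑-const : ∀ (xs : List Elem) c → ∑ xs (λ _ → c) ≡ ℕtoℚ (length xs) *ℚ c
∑-const xs c = trans (∑-cong xs (λ _ → sym (ℚₚ.*-identityˡ c))) (trans (∑-*ʳ xs c (λ _ → 1ℚ)) (cong (_*ℚ c) (∑-length xs)))

length-filterᵇ : ∀ (p : Elem → Bool) xs → ℕtoℚ (length (filterᵇ p xs)) ≡ ∑ xs (λ x → p x ▸ 1ℚ)
length-filterᵇ p xs = trans (sym (∑-length (filterᵇ p xs))) (∑-filter p xs (λ _ → 1ℚ))

length-allFin : ∀ k → length (allFin k) ≡ k
length-allFin k = Listₚ.length-tabulate id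

-- Expectations

expect-∑ : ∀ (d : Dist Elem) g → expect d g ≡ ∑ d (λ px → proj₁ px *ℚ g (proj₂ px))
expect-∑ []       g = refl
expect-∑ (x ∷ d)  g = cong (proj₁ x *ℚ g (proj₂ x) +ℚ_) (expect-∑ d g)

expect-cong : ∀ (d : Dist Elem) {g h} → (∀ x → g x ≡ h x) → expect d g ≡ expect d h
expect-cong []      e = refl
expect-cong (x ∷ d) e = cong₂ _+ℚ_ (cong (proj₁ x *ℚ_) (e (proj₂ x))) (expect-cong d e)

expect-++ : ∀ (d e : Dist Elem) g → expect (d ++ e) g ≡ expect d g +ℚ expect e g
expect-++ []      e g = sym (ℚₚ.+-identityˡ _)
expect-++ (x ∷ d) e g = trans (cong (proj₁ x *ℚ g (proj₂ x) +ℚ_) (expect-++ d e g)) (sym (ℚₚ.+-assoc (proj₁ x *ℚ g (proj₂ x)) (expect d g) (expect e g)))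

expect-return : ∀ (x : Elem) g → expect (returnD x) g ≡ g x
expect-return x g = trans (ℚₚ.+-identityʳ _) (ℚₚ.*-identityˡ (g x))

expect-scale : ∀ p (d : Dist Elem) g → expect (scaleD p d) g ≡ p *ℚ expect d g
expect-scale p []      g = sym (ℚₚ.*-zeroʳ p)
expect-scale p (x ∷ d) g = trans (cong₂ _+ℚ_ (ℚₚ.*-assoc p (proj₁ x) _) (expect-scale p d g)) (sym (ℚₚ.*-distribˡ-+ p _ (expect d g)))

expect-bind : ∀ (d : Dist Elem) (k : Elem → Dist Elem′) g → expect (bindD d k) g ≡ expect d (λ x → expect (k x) g)
expect-bind []      k g = refl
expect-bind (x ∷ d) k g = trans (expect-++ (scaleD (proj₁ x) (k (proj₂ x))) (bindD d k) g)
  (cong₂ _+ℚ_ (expect-scale (proj₁ x) (k (proj₂ x)) g) (expect-bind d k g))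

expect-uniform : ∀ (xs : List Elem) g → expect (uniform xs) g ≡ frac 1 (length xs) *ℚ ∑ xs g
expect-uniform xs g = begin
  expect (uniform xs) g                                      ≡⟨ expect-∑ (uniform xs) g ⟩
  ∑ (uniform xs) (λ px → proj₁ px *ℚ g (proj₂ px))           ≡⟨ ∑-map (λ x → frac 1 (length xs) , x) xs _ ⟩
  ∑ xs (λ x → frac 1 (length xs) *ℚ g x)                     ≡⟨ ∑-*ˡ xs (frac 1 (length xs)) g ⟩
  frac 1 (length xs) *ℚ ∑ xs g                               ∎
  where open ≡-Reasoning

-- Transpositions of two colours

InPair : ∀ {k} → Fin k → Fin k → Fin k → Set
InPair a b x = x ≡ a ⊎ x ≡ b

inPair? : ∀ {k} (a b x : Fin k) → Dec (InPair a b x)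
inPair? a b x = (x ≟F a) ⊎-dec (x ≟F b)

tr : ∀ {k} → Fin k → Fin k → Fin k → Fin k
tr a b x with x ≟F a
... | yes _ = b
... | no _ with x ≟F b
...   | yes _ = a
...   | no _  = x

module _ {k : ℕ} where

  tr-fst : ∀ (a b : Fin k) → tr a b a ≡ b
  tr-fst a b with a ≟F a
  ... | yes _  = refl
  ... | no a≢a = contradiction refl a≢a

  tr-snd : ∀ (a b : Fin k) → tr a b b ≡ a
  tr-snd a b with b ≟F a
  ... | yes b≡a = b≡a
  ... | no _ with b ≟F b
  ...   | yes _  = refl
  ...   | no b≢b = contradiction refl b≢b

  tr-other : ∀ {a b x : Fin k} → ¬ InPair a b x → tr a b x ≡ x
  tr-other {a} {b} {x} ¬p with x ≟F a
  ... | yes x≡a = contradiction (inj₁ x≡a) ¬p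
  ... | no _ with x ≟F b
  ...   | yes x≡b = contradiction (inj₂ x≡b) ¬p
  ...   | no _    = refl

  tr-pair : ∀ {a b x : Fin k} → InPair a b x → InPair a b (tr a b x)
  tr-pair {a} {b} (inj₁ refl) = inj₂ (tr-fst a b)
  tr-pair {a} {b} (inj₂ refl) = inj₁ (tr-snd a b)

  tr-involutive : ∀ (a b x : Fin k) → tr a b (tr a b x) ≡ x
  tr-involutive a b x with inPair? a b x
  ... | yes (inj₁ refl) = trans (cong (tr a b) (tr-fst a b)) (tr-snd a b)
  ... | yes (inj₂ refl) = trans (cong (tr a b) (tr-snd a b)) (tr-fst a b)
  ... | no ¬q = trans (cong (tr a b) (tr-other ¬q)) (tr-other ¬q)

  tr-injective : ∀ (a b : Fin k) {x y} → tr a b x ≡ tr a b y → x ≡ y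
  tr-injective a b {x} {y} e = trans (sym (tr-involutive a b x)) (trans (cong (tr a b) e) (tr-involutive a b y))

  tr-comm : ∀ (a b x : Fin k) → tr a b x ≡ tr b a x
  tr-comm a b x with inPair? a b x
  ... | yes (inj₁ refl) = trans (tr-fst a b) (sym (tr-snd b a))
  ... | yes (inj₂ refl) = trans (tr-snd a b) (sym (tr-fst b a))
  ... | no ¬q = trans (tr-other ¬q) (sym (tr-other λ { (inj₁ e) → ¬q (inj₂ e) ; (inj₂ e) → ¬q (inj₁ e) }))

  tr-moves : ∀ {a b x : Fin k} → a ≢ b → InPair a b x → tr a b x ≢ x
  tr-moves {a} {b} a≢b (inj₁ refl) e = a≢b (sym (trans (sym (tr-fst a b)) e))
  tr-moves {a} {b} a≢b (inj₂ refl) e = a≢b (trans (sym (tr-snd a b)) e)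

lookup-ext : ∀ {n} {A : Set} {xs ys : Vec A n} → (∀ i → lookup xs i ≡ lookup ys i) → xs ≡ ys
lookup-ext {xs = xs} {ys} e = trans (sym (Vecₚ.tabulate∘lookup xs)) (trans (Vecₚ.tabulate-cong e) (Vecₚ.tabulate∘lookup ys))

-- Ranked forests, their proper edge colourings, and Kempe components

module Kempe (n κ : ℕ) where
  open Forest n

  Shape : Set
  Shape = Rooted ⊤

  Colouring : Set
  Colouring = Vec (Fin κ) n

  module _ {L : Set} where

    upd-same : ∀ (s : Rooted L) {x y} m → y ≡ x → update s x m y ≡ m
    upd-same s {x} m refl with x ≟F x
    ... | yes _  = refl
    ... | no x≢x = contradiction refl x≢x

    upd-diff : ∀ (s : Rooted L) {x y} m → y ≢ x → update s x m y ≡ s y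
    upd-diff s {x} {y} m y≢x with y ≟F x
    ... | yes y≡x = contradiction y≡x y≢x
    ... | no _    = refl

    upd-cong : ∀ {s t : Rooted L} {x m} → s ≗ t → update s x m ≗ update t x m
    upd-cong {x = x} e z with z ≟F x
    ... | yes _ = refl
    ... | no _  = e z

  -- A parent map may contain cycles; a rank that grows away from the roots excludes them and makes
  -- climbing well founded. The bound by `n` is what lets `n` units of fuel suffice in the loops of
  -- the algorithm.
  record Ranked (f : Shape) : Set where
    field
      rank       : V → ℕ
      rank-par   : ∀ {v q} → f v ≡ just (q , tt) → rank q < rank v
      rank-bound : ∀ v → rank v < n

  -- K f u Q v: v lies strictly below u, and Q holds on the whole path from v up to, but excluding, u.
  data K (f : Shape) (u : V) (Q : V → Set) (v : V) : Set where
    here  : f v ≡ just (u , tt) → Q v → K f u Q v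
    there : ∀ {q} → f v ≡ just (q , tt) → Q v → K f u Q q → K f u Q v

  par-unique : ∀ {L : Set} {m : Maybe (V × L)} {q q' : V} {l l' : L} → m ≡ just (q , l) → m ≡ just (q' , l') → q ≡ q'
  par-unique refl refl = refl

  module _ {f : Shape} where

    K-holds : ∀ {u Q v} → K f u Q v → Q v
    K-holds (here _ q)    = q
    K-holds (there _ q _) = q

    K-map : ∀ {u Q Q' v} → (∀ x → Q x → Q' x) → K f u Q v → K f u Q' v
    K-map i (here e q)    = here e (i _ q)
    K-map i (there e q k) = there e (i _ q) (K-map i k)

    K-intro : ∀ {u Q v q} → f v ≡ just (q , tt) → Q v → q ≡ u ⊎ K f u Q q → K f u Q v
    K-intro e h (inj₁ refl) = here e h
    K-intro e h (inj₂ k)    = there e h k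

    K-elim : ∀ {u Q v q} → f v ≡ just (q , tt) → K f u Q v → q ≡ u ⊎ K f u Q q
    K-elim e (here e' _)    = inj₁ (par-unique e e')
    K-elim e (there e' _ k) = inj₂ (subst (K f _ _) (par-unique e' e) k)

    K-edge : ∀ {u Q v} → K f u Q v → ∃ λ q → f v ≡ just q
    K-edge (here e _)    = _ , e
    K-edge (there e _ _) = _ , e

    module _ (rk : Ranked f) where
      open Ranked rk

      par-irrefl : ∀ {v} → f v ≢ just (v , tt)
      par-irrefl e = ℕₚ.<-irrefl refl (rank-par e)

      K-rank : ∀ {u Q v} → K f u Q v → rank u < rank v
      K-rank (here e _)    = rank-par e
      K-rank (there e _ k) = ℕₚ.<-trans (K-rank k) (rank-par e)

      K-irrefl : ∀ {u Q} → ¬ K f u Q u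
      K-irrefl k = ℕₚ.<-irrefl refl (K-rank k)

      abstract
        K-dec : ∀ {u Q} → (∀ x → Dec (Q x)) → ∀ k v → rank v < k → Dec (K f u Q v)
        K-dec {u} {Q} Q? (suc k) v (s≤s r) with f v in eq
        ... | nothing = no λ { (here e _) → case trans (sym eq) e of λ () ; (there e _ _) → case trans (sym eq) e of λ () }
        ... | just (q , tt) with Q? v
        ...   | no ¬q = no (¬q ∘ K-holds)
        ...   | yes h = map′ (K-intro eq h) (K-elim eq) ((q ≟F u) ⊎-dec K-dec Q? k q (ℕₚ.<-≤-trans (rank-par eq) r))

        K? : ∀ {u Q} → (∀ x → Dec (Q x)) → ∀ v → Dec (K f u Q v)
        K? Q? v = K-dec Q? n v (rank-bound v)

  Ab : Colouring → Fin κ → Fin κ → V → Set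
  Ab χ a b v = InPair a b (lookup χ v)

  ab? : ∀ χ a b v → Dec (Ab χ a b v)
  ab? χ a b v = inPair? a b (lookup χ v)

  Ab-comm : ∀ χ a b v → Ab χ a b v → Ab χ b a v
  Ab-comm χ a b v (inj₁ e) = inj₂ e
  Ab-comm χ a b v (inj₂ e) = inj₁ e

  -- The edge "e" joins e to its parent; Inc f p e says that it is incident to p.
  Inc : Shape → V → V → Set
  Inc f p e = (e ≡ p × ∃ λ q → f e ≡ just q) ⊎ f e ≡ just (p , tt)

  -- An edge is named by its lower endpoint, so a conflict is a pair of distinct vertices. Entries
  -- at roots are not incident to anything and stay unconstrained; they are the spare entries that
  -- an insertion fills.
  Proper : Shape → Colouring → Set
  Proper f χ = ∀ p e e' → Inc f p e → Inc f p e' → lookup χ e ≡ lookup χ e' → e ≡ e'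

  Used : Shape → Colouring → V → Fin κ → Set
  Used f χ x a = ∃ λ e → Inc f x e × lookup χ e ≡ a

  abstract
    child? : ∀ (f : Shape) v w → Dec (f w ≡ just (v , tt))
    child? f v w with f w
    ... | nothing = no λ ()
    ... | just (q , tt) with q ≟F v
    ...   | yes refl = yes refl
    ...   | no q≢v   = no λ { refl → q≢v refl }

    nonRoot? : ∀ (f : Shape) v → Dec (∃ λ q → f v ≡ just q)
    nonRoot? f v with f v
    ... | nothing = no λ ()
    ... | just q  = yes (q , refl)

    inc? : ∀ f p e → Dec (Inc f p e)
    inc? f p e = ((e ≟F p) ×-dec nonRoot? f e) ⊎-dec child? f p e

    proper? : ∀ f χ → Dec (Proper f χ)
    proper? f χ = all? λ p → all? λ e → all? λ e' →
      inc? f p e →-dec (inc? f p e' →-dec ((lookup χ e ≟F lookup χ e') →-dec (e ≟F e')))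

    used? : ∀ f χ x a → Dec (Used f χ x a)
    used? f χ x a = any? λ e → inc? f x e ×-dec (lookup χ e ≟F a)

  module Swap {f : Shape} (rk : Ranked f) (u : V) where

    kempe? : ∀ a b χ v → Dec (K f u (Ab χ a b) v)
    kempe? a b χ = K? rk (ab? χ a b)

    -- A Kempe exchange cut off at `u`: only edges joined to `u` by a descending path coloured `a`
    -- and `b` are touched. This is the whole Kempe component at `u` as long as the edge above `u`
    -- is absent or has a third colour, which is the side condition of `ψ-proper`.
    ψ : Fin κ → Fin κ → Colouring → Colouring
    ψ a b χ = tabulate λ v → if does (kempe? a b χ v) then tr a b (lookup χ v) else lookup χ v

    module _ (a b : Fin κ) (χ : Colouring) where

      ψ-in : ∀ {v} → K f u (Ab χ a b) v → lookup (ψ a b χ) v ≡ tr a b (lookup χ v)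
      ψ-in {v} k = trans (Vecₚ.lookup∘tabulate _ v)
        (cong (λ z → if z then tr a b (lookup χ v) else lookup χ v) (dec-true (kempe? a b χ v) k))

      ψ-out : ∀ {v} → ¬ K f u (Ab χ a b) v → lookup (ψ a b χ) v ≡ lookup χ v
      ψ-out {v} ¬k = trans (Vecₚ.lookup∘tabulate _ v)
        (cong (λ z → if z then tr a b (lookup χ v) else lookup χ v) (dec-false (kempe? a b χ v) ¬k))

      ψ-pair : ∀ v → Ab χ a b v → Ab (ψ a b χ) a b v
      ψ-pair v p with kempe? a b χ v
      ... | yes k = subst (InPair a b) (sym (ψ-in k)) (tr-pair p)
      ... | no ¬k = subst (InPair a b) (sym (ψ-out ¬k)) p

      ψ-pair⁻ : ∀ v → Ab (ψ a b χ) a b v → Ab χ a b v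
      ψ-pair⁻ v p with kempe? a b χ v
      ... | yes k = K-holds k
      ... | no ¬k = subst (InPair a b) (ψ-out ¬k) p

      ψ-K : ∀ {v} → K f u (Ab χ a b) v → K f u (Ab (ψ a b χ) a b) v
      ψ-K = K-map ψ-pair

      ψ-K⁻ : ∀ {v} → K f u (Ab (ψ a b χ) a b) v → K f u (Ab χ a b) v
      ψ-K⁻ = K-map ψ-pair⁻

      ψ-self : lookup (ψ a b χ) u ≡ lookup χ u
      ψ-self = ψ-out (K-irrefl rk)

      ψ-rank : ∀ {v} → Ranked.rank rk v ≤ Ranked.rank rk u → lookup (ψ a b χ) v ≡ lookup χ v
      ψ-rank r = ψ-out (λ k → ℕₚ.<⇒≱ (K-rank rk k) r)

      ψ-child : ∀ {w} → f w ≡ just (u , tt) → lookup (ψ a b χ) w ≡ tr a b (lookup χ w)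
      ψ-child {w} e with inPair? a b (lookup χ w)
      ... | yes p = ψ-in (here e p)
      ... | no ¬p = trans (ψ-out (λ k → ¬p (K-holds k))) (sym (tr-other ¬p))

    -- The exchange preserves which edges have a colour in the pair, hence the component itself, so
    -- the second exchange acts on the same edges.
    ψ-involutive : ∀ a b χ → ψ a b (ψ a b χ) ≡ χ
    ψ-involutive a b χ = lookup-ext at
      where
      at : ∀ v → lookup (ψ a b (ψ a b χ)) v ≡ lookup χ v
      at v with kempe? a b χ v
      ... | yes k = trans (ψ-in a b (ψ a b χ) (ψ-K a b χ k)) (trans (cong (tr a b) (ψ-in a b χ k)) (tr-involutive a b _))
      ... | no ¬k = trans (ψ-out a b (ψ a b χ) (¬k ∘ ψ-K⁻ a b χ)) (ψ-out a b χ ¬k)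

    ψ-comm : ∀ a b χ → ψ a b χ ≡ ψ b a χ
    ψ-comm a b χ = lookup-ext at
      where
      at : ∀ v → lookup (ψ a b χ) v ≡ lookup (ψ b a χ) v
      at v with kempe? a b χ v
      ... | yes k = trans (ψ-in a b χ k) (trans (tr-comm a b (lookup χ v)) (sym (ψ-in b a χ (K-map (Ab-comm χ a b) k))))
      ... | no ¬k = trans (ψ-out a b χ ¬k) (sym (ψ-out b a χ (¬k ∘ K-map (Ab-comm χ b a))))

    -- An edge of the two colours that touches the component is connected to `u` through it, hence
    -- belongs to it. The only edge that could touch it from outside is the one above `u`, and `hu`
    -- rules that out.
    boundary : ∀ a b χ → f u ≡ nothing ⊎ ¬ Ab χ a b u → ∀ {p e e'} → Inc f p e → Inc f p e' →
      K f u (Ab χ a b) e → ¬ K f u (Ab χ a b) e' → ¬ Ab χ a b e'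
    boundary a b χ hu (inj₁ (refl , _)) (inj₁ (refl , _)) k ¬k' _ = ¬k' k
    boundary a b χ hu (inj₁ (refl , _)) (inj₂ e') k ¬k' h = ¬k' (there e' h k)
    boundary a b χ hu (inj₂ e) i' k ¬k' h with K-elim e k
    boundary a b χ (inj₁ r) (inj₂ e) (inj₁ (refl , q , e')) k ¬k' h | inj₁ refl = case trans (sym r) e' of λ ()
    boundary a b χ (inj₂ ¬h) (inj₂ e) (inj₁ (refl , q , e')) k ¬k' h | inj₁ refl = ¬h h
    boundary a b χ hu (inj₂ e) (inj₁ (refl , q , e')) k ¬k' h | inj₂ kp = ¬k' kp
    boundary a b χ hu (inj₂ e) (inj₂ e') k ¬k' h | c = ¬k' (K-intro e' h c)

    ψ-proper : ∀ a b χ → f u ≡ nothing ⊎ ¬ Ab χ a b u → Proper f χ → Proper f (ψ a b χ)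
    ψ-proper a b χ hu pr p e e' i i' eq with kempe? a b χ e | kempe? a b χ e'
    ... | yes k | yes k' = pr p e e' i i' (tr-injective a b (trans (sym (ψ-in a b χ k)) (trans eq (ψ-in a b χ k'))))
    ... | no ¬k | no ¬k' = pr p e e' i i' (trans (sym (ψ-out a b χ ¬k)) (trans eq (ψ-out a b χ ¬k')))
    ... | yes k | no ¬k' = contradiction
      (subst (InPair a b) (trans (sym (ψ-in a b χ k)) (trans eq (ψ-out a b χ ¬k'))) (tr-pair (K-holds k)))
      (boundary a b χ hu i i' k ¬k')
    ... | no ¬k | yes k' = contradiction
      (subst (InPair a b) (trans (sym (ψ-in a b χ k')) (trans (sym eq) (ψ-out a b χ ¬k))) (tr-pair (K-holds k')))
      (boundary a b χ hu i' i k' ¬k)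

    ψ-proper⁻ : ∀ a b χ → f u ≡ nothing ⊎ ¬ Ab χ a b u → Proper f (ψ a b χ) → Proper f χ
    ψ-proper⁻ a b χ hu pr = subst (Proper f) (ψ-involutive a b χ) (ψ-proper a b (ψ a b χ) (flip hu) pr)
      where
      flip : f u ≡ nothing ⊎ ¬ Ab χ a b u → f u ≡ nothing ⊎ ¬ Ab (ψ a b χ) a b u
      flip (inj₁ r)  = inj₁ r
      flip (inj₂ ¬h) = inj₂ (¬h ∘ ψ-pair⁻ a b χ u)

▸-∧ : ∀ b b' x → (b ∧ b') ▸ x ≡ b ▸ b' ▸ x
▸-∧ true  b' x = refl
▸-∧ false b' x = refl

▸-iff : ∀ {P Q : Set} (d : Dec P) (e : Dec Q) {x y} → (P → Q) → (Q → P) → (P → x ≡ y) → does d ▸ x ≡ does e ▸ y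
▸-iff d e {x} {y} f g h = trans (▸-cong? d h) (cong (_▸ y) (does-iff d e f g))

▸-zero? : ∀ {P : Set} (d : Dec P) {x} → (P → x ≡ 0ℚ) → does d ▸ x ≡ 0ℚ
▸-zero? (yes p) e = e p
▸-zero? (no _)  e = refl

-- Counting proper colourings, and the effect of linking two trees

module Colourings (n κ : ℕ) where
  open Forest n
  open Kempe n κ

  colourings : List Colouring
  colourings = allVecs κ n

  colours : List (Fin κ)
  colours = allFin κ

  free? : ∀ f χ x a → Dec (¬ Used f χ x a)
  free? f χ x a = ¬? (used? f χ x a)

  degℚ : Shape → V → ℚ
  degℚ f x = ∑ vertices λ e → does (inc? f x e) ▸ 1ℚ

  freeℚ : Shape → Colouring → V → ℚ
  freeℚ f χ x = ∑ colours λ a → does (free? f χ x a) ▸ 1ℚ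

  -- A used colour sits on exactly one incident edge, by properness. Summed over the colours this
  -- gives the number of free ones; for the single colour at `r` it is the case distinction of an
  -- insertion.
  partition : ∀ f χ → Proper f χ → ∀ x a →
    (does (free? f χ x a) ▸ 1ℚ) +ℚ ∑ vertices (λ e → does (inc? f x e) ▸ does (lookup χ e ≟F a) ▸ 1ℚ) ≡ 1ℚ
  partition f χ pr x a with used? f χ x a
  ... | no ¬u = trans (cong (1ℚ +ℚ_) (trans (∑-cong vertices zeros) (∑-0 vertices))) (ℚₚ.+-identityʳ 1ℚ)
    where
    zeros : ∀ e → does (inc? f x e) ▸ does (lookup χ e ≟F a) ▸ 1ℚ ≡ 0ℚ
    zeros e = ▸-zero? (inc? f x e) λ i → ▸-no (lookup χ e ≟F a) 1ℚ (λ eq → ¬u (e , i , eq))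
  ... | yes (e₀ , i₀ , eq₀) = trans (ℚₚ.+-identityˡ _) (trans (enum-allFin n e₀ _ others)
      (trans (▸-yes (inc? f x e₀) _ i₀) (▸-yes (lookup χ e₀ ≟F a) 1ℚ eq₀)))
    where
    others : ∀ e → e ≢ e₀ → does (inc? f x e) ▸ does (lookup χ e ≟F a) ▸ 1ℚ ≡ 0ℚ
    others e e≢ = ▸-zero? (inc? f x e) λ i → ▸-no (lookup χ e ≟F a) 1ℚ (λ eq → e≢ (pr x e e₀ i i₀ (trans eq (sym eq₀))))

  freeℚ+degℚ : ∀ f χ → Proper f χ → ∀ x → freeℚ f χ x +ℚ degℚ f x ≡ ℕtoℚ κ
  freeℚ+degℚ f χ pr x = begin
    freeℚ f χ x +ℚ degℚ f x
      ≡⟨ cong (freeℚ f χ x +ℚ_) (∑-cong vertices λ e → trans (cong (does (inc? f x e) ▸_) (sym (∑-δ κ (lookup χ e) (λ _ → 1ℚ))))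
              (sym (∑-▸ colours (does (inc? f x e)) _))) ⟩
    freeℚ f χ x +ℚ ∑ vertices (λ e → ∑ colours λ a → does (inc? f x e) ▸ does (lookup χ e ≟F a) ▸ 1ℚ)
      ≡⟨ cong (freeℚ f χ x +ℚ_) (∑-swap vertices colours _) ⟩
    freeℚ f χ x +ℚ ∑ colours (λ a → ∑ vertices λ e → does (inc? f x e) ▸ does (lookup χ e ≟F a) ▸ 1ℚ)
      ≡⟨ sym (∑-+ colours _ _) ⟩
    ∑ colours (λ a → (does (free? f χ x a) ▸ 1ℚ) +ℚ ∑ vertices (λ e → does (inc? f x e) ▸ does (lookup χ e ≟F a) ▸ 1ℚ))
      ≡⟨ ∑-cong colours (partition f χ pr x) ⟩
    ∑ colours (λ _ → 1ℚ)
      ≡⟨ trans (∑-length colours) (cong ℕtoℚ (length-allFin κ)) ⟩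
    ℕtoℚ κ ∎
    where open ≡-Reasoning

  -- Exchanging the value at r with an independent colour is an involution on pairs.
  ∑-resample : ∀ r (F : Colouring → Fin κ → ℚ) →
    ∑ colourings (λ χ → ∑ colours (F χ)) ≡ ∑ colourings (λ χ → ∑ colours λ β → F (χ [ r ]≔ β) (lookup χ r))
  ∑-resample r F = begin
    ∑ colourings (λ χ → ∑ colours (F χ))
      ≡⟨ sym (∑-cartesian colourings colours (λ z → F (proj₁ z) (proj₂ z))) ⟩
    ∑ pairs (λ z → F (proj₁ z) (proj₂ z))
      ≡⟨ sym (∑-involution pairs _≟P_ (enum-× colourings colours (enum-allVecs κ n) (enum-allFin κ)) exchange exchange-involutive _) ⟩
    ∑ pairs (λ z → F (proj₁ z [ r ]≔ proj₂ z) (lookup (proj₁ z) r))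
      ≡⟨ ∑-cartesian colourings colours _ ⟩
    ∑ colourings (λ χ → ∑ colours λ β → F (χ [ r ]≔ β) (lookup χ r)) ∎
    where
    open ≡-Reasoning
    pairs = cartesianProduct colourings colours
    exchange : Colouring × Fin κ → Colouring × Fin κ
    exchange z = (proj₁ z [ r ]≔ proj₂ z) , lookup (proj₁ z) r
    exchange-involutive : ∀ z → exchange (exchange z) ≡ z
    exchange-involutive (χ , β) = cong₂ _,_
      (trans (Vecₚ.[]≔-idempotent χ r) (Vecₚ.[]≔-lookup χ r)) (Vecₚ.lookup∘update r χ β)
    _≟P_ : (x y : Colouring × Fin κ) → Dec (x ≡ y)
    (χ , β) ≟P (χ' , β') = map′ (λ (e , e') → cong₂ _,_ e e') (λ e → cong proj₁ e , cong proj₂ e)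
      (Vecₚ.≡-dec _≟F_ χ χ' ×-dec (β ≟F β'))

  ∑-colourings-involution : ∀ (φ : Colouring → Colouring) → (∀ χ → φ (φ χ) ≡ χ) → ∀ h →
    ∑ colourings (h ∘ φ) ≡ ∑ colourings h
  ∑-colourings-involution = ∑-involution colourings (Vecₚ.≡-dec _≟F_) (enum-allVecs κ n)

  Below : Shape → V → V → Set
  Below f r v = K f r (λ _ → ⊤) v

  module Link {f : Shape} (rk : Ranked f) (p r : V) (fr : f r ≡ nothing) (p≢r : p ≢ r) (¬below : ¬ Below f r p) where
    open Swap rk r

    f' : Shape
    f' = update f r (just (p , tt))

    f'-r : f' r ≡ just (p , tt)
    f'-r = upd-same f {r} (just (p , tt)) refl

    f'-other : ∀ {v} → v ≢ r → f' v ≡ f v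
    f'-other = upd-diff f (just (p , tt))

    nonRoot-≢ : ∀ {v q} → f v ≡ just q → v ≢ r
    nonRoot-≢ e refl = case trans (sym fr) e of λ ()

    Inc-lift : ∀ {x e} → Inc f x e → Inc f' x e
    Inc-lift (inj₁ (refl , q , eq)) = inj₁ (refl , q , trans (f'-other (nonRoot-≢ eq)) eq)
    Inc-lift (inj₂ eq)              = inj₂ (trans (f'-other (nonRoot-≢ eq)) eq)

    Inc-lower : ∀ {x e} → e ≢ r → Inc f' x e → Inc f x e
    Inc-lower e≢r (inj₁ (refl , q , eq)) = inj₁ (refl , q , trans (sym (f'-other e≢r)) eq)
    Inc-lower e≢r (inj₂ eq)              = inj₂ (trans (sym (f'-other e≢r)) eq)

    Inc-≢ : ∀ {x e} → Inc f x e → e ≢ r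
    Inc-≢ (inj₁ (refl , q , eq)) = nonRoot-≢ eq
    Inc-≢ (inj₂ eq)              = nonRoot-≢ eq

    Inc-r : ∀ {x} → Inc f' x r → x ≡ r ⊎ x ≡ p
    Inc-r (inj₁ (refl , _)) = inj₁ refl
    Inc-r (inj₂ eq)         = inj₂ (par-unique eq f'-r)

    Inc-p-¬K : ∀ {Q e} → Inc f p e → ¬ K f r Q e
    Inc-p-¬K (inj₁ (refl , _)) k = ¬below (K-map (λ _ _ → tt) k)
    Inc-p-¬K (inj₂ eq) k with K-elim eq k
    ... | inj₁ p≡r = p≢r p≡r
    ... | inj₂ k'  = ¬below (K-map (λ _ _ → tt) k')

    Inc-root : ∀ {e} → Inc f r e → f e ≡ just (r , tt)
    Inc-root (inj₁ (refl , q , eq)) = case trans (sym fr) eq of λ ()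
    Inc-root (inj₂ eq)              = eq

    -- Properness of the linked forest expressed in the unlinked one: the spare entry at `r` turns
    -- into the colour of the new edge and has to be free at both of its ends.
    ProperLink : Colouring → Set
    ProperLink χ = Proper f χ × ¬ Used f χ p (lookup χ r) × ¬ Used f χ r (lookup χ r)

    Proper-lower : ∀ χ → Proper f' χ → ProperLink χ
    Proper-lower χ pr =
      (λ x e e' i i' → pr x e e' (Inc-lift i) (Inc-lift i')) ,
      (λ (e , i , eq) → Inc-≢ i (pr p e r (Inc-lift i) (inj₂ f'-r) eq)) ,
      (λ (e , i , eq) → Inc-≢ i (pr r e r (Inc-lift i) (inj₁ (refl , _ , f'-r)) eq))

    Proper-lift : ∀ χ → ProperLink χ → Proper f' χ
    Proper-lift χ (pr , ¬up , ¬ur) x e e' i i' eq = cases (e ≟F r) (e' ≟F r)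
      where
      atRoot : ∀ {x e e'} → e ≡ r → e' ≢ r → Inc f' x e → Inc f' x e' → lookup χ e ≡ lookup χ e' → ⊥
      atRoot refl e'≢r i i' eq with Inc-r i
      ... | inj₁ refl = ¬ur (_ , Inc-lower e'≢r i' , sym eq)
      ... | inj₂ refl = ¬up (_ , Inc-lower e'≢r i' , sym eq)
      cases : Dec (e ≡ r) → Dec (e' ≡ r) → e ≡ e'
      cases (yes e≡r) (yes e'≡r) = trans e≡r (sym e'≡r)
      cases (no e≢r)  (no e'≢r)  = pr x e e' (Inc-lower e≢r i) (Inc-lower e'≢r i') eq
      cases (yes e≡r) (no e'≢r)  = ⊥-elim (atRoot e≡r e'≢r i i' eq)
      cases (no e≢r)  (yes e'≡r) = ⊥-elim (atRoot e'≡r e≢r i' i (sym eq))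

    properLink? : ∀ χ → Dec (ProperLink χ)
    properLink? χ = proper? f χ ×-dec (free? f χ p (lookup χ r) ×-dec free? f χ r (lookup χ r))

    Used-resp : ∀ χ χ' {x a} → (∀ e → Inc f x e → lookup χ' e ≡ lookup χ e) → Used f χ x a → Used f χ' x a
    Used-resp χ χ' h (e , i , eq) = e , i , trans (h e i) eq

    ψ-Used-p : ∀ α β χ {a} → Used f χ p a → Used f (ψ α β χ) p a
    ψ-Used-p α β χ = Used-resp χ (ψ α β χ) (λ e i → ψ-out α β χ (Inc-p-¬K i))

    ψ-Used-p⁻ : ∀ α β χ {a} → Used f (ψ α β χ) p a → Used f χ p a
    ψ-Used-p⁻ α β χ = Used-resp (ψ α β χ) χ (λ e i → sym (ψ-out α β χ (Inc-p-¬K i)))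

    ψ-Used-r : ∀ α β χ → Used f χ r β → Used f (ψ α β χ) r α
    ψ-Used-r α β χ (e , i , eq) = e , i , trans (ψ-child α β χ (Inc-root i)) (trans (cong (tr α β) eq) (tr-snd α β))

    ψ-Used-r⁻ : ∀ α β χ → Used f (ψ α β χ) r α → Used f χ r β
    ψ-Used-r⁻ α β χ (e , i , eq) = e , i ,
      tr-injective α β (trans (trans (sym (ψ-child α β χ (Inc-root i))) eq) (sym (tr-snd α β)))

    module _ (w : V) (wr : f w ≡ just (r , tt)) (α β : Fin κ) (χ : Colouring) where

      -- `Before` speaks about `ψ α β χ`: the colour `β` was drawn for the new edge, the child `w`
      -- blocks it, and `α` is free at `r`. Undoing the exchange gives `χ`, in which the new edge
      -- keeps `β` and `w` carries `α`. The exchange reaches neither the entry at `r` nor an edge at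
      -- `p`, since `r` is a root and `p` is not below it.
      Before After : Set
      Before = lookup (ψ α β χ) r ≡ β × Proper f (ψ α β χ) × ¬ Used f (ψ α β χ) p β × lookup (ψ α β χ) w ≡ β × ¬ Used f (ψ α β χ) r α
      After  = lookup χ r ≡ β × lookup χ w ≡ α × Proper f' χ

      swap⇒ : Before → After
      swap⇒ (er , pr , ¬up , ew , ¬ur) = er' ,
        tr-injective α β (trans (trans (sym (ψ-child α β χ wr)) ew) (sym (tr-fst α β))) ,
        Proper-lift χ (ψ-proper⁻ α β χ (inj₁ fr) pr ,
                     subst (λ z → ¬ Used f χ p z) (sym er') (¬up ∘ ψ-Used-p α β χ) ,
                     subst (λ z → ¬ Used f χ r z) (sym er') (¬ur ∘ ψ-Used-r α β χ))
        where
        er' : lookup χ r ≡ β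
        er' = trans (sym (ψ-self α β χ)) er

      swap⇐ : After → Before
      swap⇐ (er , ew , pr') with Proper-lower χ pr'
      ... | pr , ¬up , ¬ur =
        trans (ψ-self α β χ) er , ψ-proper α β χ (inj₁ fr) pr ,
        subst (λ z → ¬ Used f χ p z) er ¬up ∘ ψ-Used-p⁻ α β χ ,
        trans (ψ-child α β χ wr) (trans (cong (tr α β) ew) (tr-fst α β)) ,
        subst (λ z → ¬ Used f χ r z) er ¬ur ∘ ψ-Used-r⁻ α β χ

    -- The Kempe swap matches the colourings with χ w = χ r and a fresh α at r with the proper
    -- colourings of the linked forest.
    swap-sum : ∀ w → f w ≡ just (r , tt) → ∀ (H : Colouring → Colouring → ℚ) →
      ∑ colourings (λ χ → does (proper? f χ) ▸ does (free? f χ p (lookup χ r)) ▸ does (lookup χ w ≟F lookup χ r) ▸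
        ∑ colours λ α → does (free? f χ r α) ▸ H χ (ψ α (lookup χ r) χ))
      ≡ ∑ colourings (λ χ → does (proper? f' χ) ▸ H (ψ (lookup χ w) (lookup χ r) χ) χ)
    swap-sum w wr H = begin
      ∑ colourings (λ χ → does (proper? f χ) ▸ does (free? f χ p (lookup χ r)) ▸ does (lookup χ w ≟F lookup χ r) ▸
        ∑ colours λ α → does (free? f χ r α) ▸ H χ (ψ α (lookup χ r) χ))
        -- The colour exchanged with `α` is an entry of `χ` itself. Making it a variable `β`, tied
        -- to `χ` by a guard, leaves for fixed `α` and `β` an honest involution of all colourings.
        ≡⟨ ∑-cong colourings (λ χ → sym (trans
             (∑-cong colours λ α → ∑-δ κ (lookup χ r) (G χ α))
             (trans (∑-▸ colours _ _) (cong (does (proper? f χ) ▸_)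
             (trans (∑-▸ colours _ _) (cong (does (free? f χ p (lookup χ r)) ▸_) (∑-▸ colours _ _))))))) ⟩
      ∑ colourings (λ χ → ∑ colours λ α → ∑ colours λ β → does (lookup χ r ≟F β) ▸ G χ α β)
        ≡⟨ ∑-swap colourings colours _ ⟩
      ∑ colours (λ α → ∑ colourings λ χ → ∑ colours λ β → does (lookup χ r ≟F β) ▸ G χ α β)
        ≡⟨ ∑-cong colours (λ α → ∑-swap colourings colours _) ⟩
      ∑ colours (λ α → ∑ colours λ β → ∑ colourings λ χ → does (lookup χ r ≟F β) ▸ G χ α β)
        ≡⟨ ∑-cong colours (λ α → ∑-cong colours λ β → trans
             (sym (∑-colourings-involution (ψ α β) (ψ-involutive α β) _)) (∑-cong colourings (exchange α β))) ⟩
      ∑ colours (λ α → ∑ colours λ β → ∑ colourings λ χ → does (lookup χ r ≟F β) ▸ G' χ α β)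
        ≡⟨ ∑-cong colours (λ α → ∑-swap colours colourings _) ⟩
      ∑ colours (λ α → ∑ colourings λ χ → ∑ colours λ β → does (lookup χ r ≟F β) ▸ G' χ α β)
        ≡⟨ ∑-swap colours colourings _ ⟩
      ∑ colourings (λ χ → ∑ colours λ α → ∑ colours λ β → does (lookup χ r ≟F β) ▸ G' χ α β)
        ≡⟨ ∑-cong colourings (λ χ → trans (∑-cong colours λ α → ∑-δ κ (lookup χ r) (G' χ α))
             (∑-δ κ (lookup χ w) (λ α → does (proper? f' χ) ▸ H (ψ α (lookup χ r) χ) χ))) ⟩
      ∑ colourings (λ χ → does (proper? f' χ) ▸ H (ψ (lookup χ w) (lookup χ r) χ) χ) ∎
      where
      open ≡-Reasoning
      G G' : Colouring → Fin κ → Fin κ → ℚ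
      G χ α β = does (proper? f χ) ▸ does (free? f χ p β) ▸ does (lookup χ w ≟F β) ▸ does (free? f χ r α) ▸ H χ (ψ α β χ)
      G' χ α β = does (lookup χ w ≟F α) ▸ does (proper? f' χ) ▸ H (ψ α β χ) χ
      before? : ∀ α β χ → Dec (Before w wr α β χ)
      before? α β χ = (lookup (ψ α β χ) r ≟F β) ×-dec (proper? f (ψ α β χ) ×-dec (free? f (ψ α β χ) p β ×-dec
        ((lookup (ψ α β χ) w ≟F β) ×-dec free? f (ψ α β χ) r α)))
      after? : ∀ α β χ → Dec (After w wr α β χ)
      after? α β χ = (lookup χ r ≟F β) ×-dec ((lookup χ w ≟F α) ×-dec proper? f' χ)
      exchange : ∀ α β χ → does (lookup (ψ α β χ) r ≟F β) ▸ G (ψ α β χ) α β ≡ does (lookup χ r ≟F β) ▸ G' χ α β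
      exchange α β χ = trans
        (sym (trans (▸-∧ (does (lookup (ψ α β χ) r ≟F β)) _ _) (cong (does (lookup (ψ α β χ) r ≟F β) ▸_)
          (trans (▸-∧ (does (proper? f (ψ α β χ))) _ _) (cong (does (proper? f (ψ α β χ)) ▸_)
          (trans (▸-∧ (does (free? f (ψ α β χ) p β)) _ _) (cong (does (free? f (ψ α β χ) p β) ▸_)
          (▸-∧ (does (lookup (ψ α β χ) w ≟F β)) _ _))))))))
        (trans (▸-iff (before? α β χ) (after? α β χ) (swap⇒ w wr α β χ) (swap⇐ w wr α β χ)
                 (λ _ → cong (H (ψ α β χ)) (ψ-involutive α β χ)))
        (trans (▸-∧ (does (lookup χ r ≟F β)) _ _) (cong (does (lookup χ r ≟F β) ▸_)
          (▸-∧ (does (lookup χ w ≟F α)) _ _))))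

    -- A colouring of the linked forest arises from itself, when the entry at `r` is free there, and
    -- by one exchange for each child `w` of `r`, when `w` had to give way; the latter is
    -- `swap-sum`. `H` receives the colourings on both sides, so that the identity covers functions
    -- of the new state as well as the recourse. The parameter `t` becomes the probability of one
    -- choice of `α`.
    link-sum : ∀ (t : ℚ) (H : Colouring → Colouring → ℚ) →
      ∑ colourings (λ χ → does (proper? f χ) ▸ does (free? f χ p (lookup χ r)) ▸
        ((does (free? f χ r (lookup χ r)) ▸ H χ χ) +ℚ
         t *ℚ ∑ vertices λ w → does (child? f r w) ▸ does (lookup χ w ≟F lookup χ r) ▸
           ∑ colours λ α → does (free? f χ r α) ▸ H χ (ψ α (lookup χ r) χ)))
      ≡ ∑ colourings (λ χ → does (proper? f' χ) ▸
          (H χ χ +ℚ t *ℚ ∑ vertices λ w → does (child? f r w) ▸ H (ψ (lookup χ w) (lookup χ r) χ) χ))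
    link-sum t H = begin
      ∑ colourings (λ χ → P χ ▸ Fp χ ▸ ((Fr χ ▸ H χ χ) +ℚ t *ℚ ∑ vertices λ w → ch w ▸ I χ w))
        ≡⟨ ∑-cong colourings (λ χ → trans (cong (P χ ▸_) (▸-+ (Fp χ) _ _)) (▸-+ (P χ) _ _)) ⟩
      ∑ colourings (λ χ → (P χ ▸ Fp χ ▸ Fr χ ▸ H χ χ) +ℚ (P χ ▸ Fp χ ▸ t *ℚ ∑ vertices λ w → ch w ▸ I χ w))
        ≡⟨ ∑-+ colourings _ _ ⟩
      ∑ colourings (λ χ → P χ ▸ Fp χ ▸ Fr χ ▸ H χ χ) +ℚ ∑ colourings (λ χ → P χ ▸ Fp χ ▸ t *ℚ ∑ vertices λ w → ch w ▸ I χ w)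
        ≡⟨ cong₂ _+ℚ_ (∑-cong colourings λ χ → first χ) second ⟩
      ∑ colourings (λ χ → P' χ ▸ H χ χ) +ℚ ∑ colourings (λ χ → P' χ ▸ t *ℚ ∑ vertices λ w → ch w ▸ J χ w)
        ≡⟨ sym (∑-+ colourings _ _) ⟩
      ∑ colourings (λ χ → (P' χ ▸ H χ χ) +ℚ (P' χ ▸ t *ℚ ∑ vertices λ w → ch w ▸ J χ w))
        ≡⟨ ∑-cong colourings (λ χ → sym (▸-+ (P' χ) _ _)) ⟩
      ∑ colourings (λ χ → P' χ ▸ (H χ χ +ℚ t *ℚ ∑ vertices λ w → ch w ▸ J χ w)) ∎
      where
      open ≡-Reasoning
      P P' Fp Fr : Colouring → Bool
      P χ = does (proper? f χ)
      P' χ = does (proper? f' χ)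
      Fp χ = does (free? f χ p (lookup χ r))
      Fr χ = does (free? f χ r (lookup χ r))
      ch : V → Bool
      ch w = does (child? f r w)
      I J : Colouring → V → ℚ
      I χ w = does (lookup χ w ≟F lookup χ r) ▸ ∑ colours λ α → does (free? f χ r α) ▸ H χ (ψ α (lookup χ r) χ)
      J χ w = H (ψ (lookup χ w) (lookup χ r) χ) χ
      first : ∀ χ → P χ ▸ Fp χ ▸ Fr χ ▸ H χ χ ≡ P' χ ▸ H χ χ
      first χ = trans (sym (trans (▸-∧ (P χ) _ _) (cong (P χ ▸_) (▸-∧ (Fp χ) (Fr χ) _))))
        (▸-iff (properLink? χ) (proper? f' χ) (Proper-lift χ) (Proper-lower χ) (λ _ → refl))
      pull : ∀ (b : Colouring → Bool) (X : Colouring → V → ℚ) →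
        ∑ colourings (λ χ → b χ ▸ t *ℚ ∑ vertices λ w → ch w ▸ X χ w)
        ≡ t *ℚ ∑ vertices (λ w → ch w ▸ ∑ colourings λ χ → b χ ▸ X χ w)
      pull b X = begin
        ∑ colourings (λ χ → b χ ▸ t *ℚ ∑ vertices λ w → ch w ▸ X χ w)
          ≡⟨ ∑-cong colourings (λ χ → trans (sym (▸-*ˡ (b χ) t _)) (cong (t *ℚ_) (sym (∑-▸ vertices (b χ) _)))) ⟩
        ∑ colourings (λ χ → t *ℚ ∑ vertices λ w → b χ ▸ ch w ▸ X χ w)
          ≡⟨ ∑-*ˡ colourings t _ ⟩
        t *ℚ ∑ colourings (λ χ → ∑ vertices λ w → b χ ▸ ch w ▸ X χ w)
          ≡⟨ cong (t *ℚ_) (∑-swap colourings vertices _) ⟩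
        t *ℚ ∑ vertices (λ w → ∑ colourings λ χ → b χ ▸ ch w ▸ X χ w)
          ≡⟨ cong (t *ℚ_) (∑-cong vertices λ w → trans (∑-cong colourings λ χ → ▸-comm (b χ) (ch w) _) (∑-▸ colourings (ch w) _)) ⟩
        t *ℚ ∑ vertices (λ w → ch w ▸ ∑ colourings λ χ → b χ ▸ X χ w) ∎
      second : ∑ colourings (λ χ → P χ ▸ Fp χ ▸ t *ℚ ∑ vertices λ w → ch w ▸ I χ w)
             ≡ ∑ colourings (λ χ → P' χ ▸ t *ℚ ∑ vertices λ w → ch w ▸ J χ w)
      second = begin
        ∑ colourings (λ χ → P χ ▸ Fp χ ▸ t *ℚ ∑ vertices λ w → ch w ▸ I χ w)
          ≡⟨ ∑-cong colourings (λ χ → sym (▸-∧ (P χ) (Fp χ) _)) ⟩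
        ∑ colourings (λ χ → (P χ ∧ Fp χ) ▸ t *ℚ ∑ vertices λ w → ch w ▸ I χ w)
          ≡⟨ pull (λ χ → P χ ∧ Fp χ) I ⟩
        t *ℚ ∑ vertices (λ w → ch w ▸ ∑ colourings λ χ → (P χ ∧ Fp χ) ▸ I χ w)
          ≡⟨ cong (t *ℚ_) (∑-cong vertices λ w → ▸-cong? (child? f r w) λ wr →
               trans (∑-cong colourings λ χ → ▸-∧ (P χ) (Fp χ) _) (swap-sum w wr H)) ⟩
        t *ℚ ∑ vertices (λ w → ch w ▸ ∑ colourings λ χ → P' χ ▸ J χ w)
          ≡⟨ sym (pull P' J) ⟩
        ∑ colourings (λ χ → P' χ ▸ t *ℚ ∑ vertices λ w → ch w ▸ J χ w) ∎

-- Resampling the spare entry: the sums behind an insertion and a deletion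

module LinkSums (n κ : ℕ) {f : Forest.Rooted n ⊤} (rk : Kempe.Ranked n κ f) (p r : Fin n) (fr : f r ≡ nothing)
    (p≢r : p ≢ r) (¬below : ¬ Colourings.Below n κ f r p) where
  open Forest n
  open Kempe n κ
  open Colourings n κ
  open Link rk p r fr p≢r ¬below
  open Swap rk r

  module _ (χ : Colouring) (β : Fin κ) where

    resample-inc : ∀ {x e} → Inc f x e → lookup (χ [ r ]≔ β) e ≡ lookup χ e
    resample-inc i = Vecₚ.lookup∘update′ (Inc-≢ i) χ β

    resample-proper : Proper f χ → Proper f (χ [ r ]≔ β)
    resample-proper pr x e e' i i' eq = pr x e e' i i' (trans (sym (resample-inc i)) (trans eq (resample-inc i')))

    resample-proper⁻ : Proper f (χ [ r ]≔ β) → Proper f χ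
    resample-proper⁻ pr x e e' i i' eq = pr x e e' i i' (trans (resample-inc i) (trans eq (sym (resample-inc i'))))

    resample-proper? : does (proper? f (χ [ r ]≔ β)) ≡ does (proper? f χ)
    resample-proper? = does-iff (proper? f (χ [ r ]≔ β)) (proper? f χ) resample-proper⁻ resample-proper

    resample-free? : ∀ x a → does (free? f (χ [ r ]≔ β) x a) ≡ does (free? f χ x a)
    resample-free? x a = does-iff (free? f (χ [ r ]≔ β) x a) (free? f χ x a)
      (_∘ Used-resp χ (χ [ r ]≔ β) (λ e i → resample-inc i))
      (_∘ Used-resp (χ [ r ]≔ β) χ (λ e i → sym (resample-inc i)))

    resample-back : (χ [ r ]≔ β) [ r ]≔ lookup χ r ≡ χ
    resample-back = trans (Vecₚ.[]≔-idempotent χ r) (Vecₚ.[]≔-lookup χ r)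

  -- The algorithm draws `β` independently of `χ`, while `link-sum` reads it from the entry at `r`.
  -- Exchanging the two by `∑-resample` is harmless because nothing else depends on the spare entry;
  -- the entry thrown out is then summed over freely, which is the factor `κ`.
  ins-sum : ∀ (t : ℚ) (H : Colouring → Colouring → ℚ) →
    (∀ χ β χ' → Proper f χ → H (χ [ r ]≔ β) χ' ≡ H χ χ') →
    ∑ colourings (λ χ → does (proper? f χ) ▸ ∑ colours λ β → does (free? f χ p β) ▸
      ((does (free? f χ r β) ▸ H χ (χ [ r ]≔ β)) +ℚ
       t *ℚ ∑ vertices λ w → does (child? f r w) ▸ does (lookup χ w ≟F β) ▸
         ∑ colours λ α → does (free? f χ r α) ▸ H χ (ψ α β (χ [ r ]≔ β))))
    ≡ ℕtoℚ κ *ℚ ∑ colourings (λ χ → does (proper? f' χ) ▸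
        (H χ χ +ℚ t *ℚ ∑ vertices λ w → does (child? f r w) ▸ H (ψ (lookup χ w) (lookup χ r) χ) χ))
  ins-sum t H H-inv = begin
    ∑ colourings (λ χ → does (proper? f χ) ▸ ∑ colours λ β → body χ χ β (χ [ r ]≔ β))
      ≡⟨ ∑-cong colourings (λ χ → sym (∑-▸ colours (does (proper? f χ)) _)) ⟩
    ∑ colourings (λ χ → ∑ colours λ β → does (proper? f χ) ▸ body χ χ β (χ [ r ]≔ β))
      ≡⟨ ∑-resample r _ ⟩
    ∑ colourings (λ χ → ∑ colours λ β → does (proper? f (χ [ r ]≔ β)) ▸
      body (χ [ r ]≔ β) (χ [ r ]≔ β) (lookup χ r) ((χ [ r ]≔ β) [ r ]≔ lookup χ r))
      ≡⟨ ∑-cong colourings (λ χ → ∑-cong colours λ β → trans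
           (cong (_▸ body (χ [ r ]≔ β) (χ [ r ]≔ β) (lookup χ r) ((χ [ r ]≔ β) [ r ]≔ lookup χ r)) (resample-proper? χ β))
           (▸-cong? (proper? f χ) λ pr → trans
             (cong (body (χ [ r ]≔ β) (χ [ r ]≔ β) (lookup χ r)) (resample-back χ β)) (body-inv χ β pr))) ⟩
    ∑ colourings (λ χ → ∑ colours λ β → does (proper? f χ) ▸ body χ χ (lookup χ r) χ)
      ≡⟨ ∑-swap colourings colours _ ⟩
    ∑ colours (λ _ → ∑ colourings λ χ → does (proper? f χ) ▸ body χ χ (lookup χ r) χ)
      ≡⟨ ∑-const colours _ ⟩
    ℕtoℚ (length colours) *ℚ ∑ colourings (λ χ → does (proper? f χ) ▸ body χ χ (lookup χ r) χ)
      ≡⟨ cong₂ _*ℚ_ (cong ℕtoℚ (length-allFin κ)) (link-sum t H) ⟩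
    ℕtoℚ κ *ℚ ∑ colourings (λ χ → does (proper? f' χ) ▸
        (H χ χ +ℚ t *ℚ ∑ vertices λ w → does (child? f r w) ▸ H (ψ (lookup χ w) (lookup χ r) χ) χ)) ∎
    where
    open ≡-Reasoning
    body : Colouring → Colouring → Fin κ → Colouring → ℚ
    body χ χ₀ β χ₁ = does (free? f χ p β) ▸ ((does (free? f χ r β) ▸ H χ₀ χ₁) +ℚ
       t *ℚ ∑ vertices λ w → does (child? f r w) ▸ does (lookup χ w ≟F β) ▸
         ∑ colours λ α → does (free? f χ r α) ▸ H χ₀ (ψ α β χ₁))
    body-inv : ∀ χ β → Proper f χ → body (χ [ r ]≔ β) (χ [ r ]≔ β) (lookup χ r) χ ≡ body χ χ (lookup χ r) χ
    body-inv χ β pr = cong₂ _▸_ (resample-free? χ β p (lookup χ r)) (cong₂ _+ℚ_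
      (cong₂ _▸_ (resample-free? χ β r (lookup χ r)) (H-inv χ β χ pr))
      (cong (t *ℚ_) (∑-cong vertices λ w → ▸-cong? (child? f r w) λ wr → cong₂ _▸_
        (cong (λ z → does (z ≟F lookup χ r)) (resample-inc χ β (inj₂ wr)))
        (∑-cong colours λ α → cong₂ _▸_ (resample-free? χ β r α) (H-inv χ β (ψ α (lookup χ r) χ) pr)))))

  inc-root? : ∀ w → does (inc? f r w) ≡ does (child? f r w)
  inc-root? w = does-iff (inc? f r w) (child? f r w) Inc-root inj₂

  -- `link-sum` used from right to left, with a function of the unlinked colouring alone. What
  -- remains is the guard that the spare entry at `r` is free at `p`; resampling that entry replaces
  -- the guard by the number `aₚ` of free colours at `p`.
  del-sum : ∀ (t aₚ : ℚ) (h : Colouring → ℚ) →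
    (∀ χ → Proper f χ → t *ℚ freeℚ f χ r ≡ 1ℚ) → (∀ χ → Proper f χ → freeℚ f χ p ≡ aₚ) →
    (∀ χ β → Proper f χ → h (χ [ r ]≔ β) ≡ h χ) →
    ℕtoℚ κ *ℚ ∑ colourings (λ χ → does (proper? f' χ) ▸
      (h χ +ℚ t *ℚ ∑ vertices λ w → does (child? f r w) ▸ h (ψ (lookup χ w) (lookup χ r) χ)))
    ≡ aₚ *ℚ ∑ colourings (λ χ → does (proper? f χ) ▸ h χ)
  del-sum t aₚ h tᵣ eₚ h-inv = begin
    ℕtoℚ κ *ℚ ∑ colourings (λ χ → does (proper? f' χ) ▸
      (h χ +ℚ t *ℚ ∑ vertices λ w → does (child? f r w) ▸ h (ψ (lookup χ w) (lookup χ r) χ)))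
      ≡⟨ cong (ℕtoℚ κ *ℚ_) (sym (link-sum t (λ χ _ → h χ))) ⟩
    ℕtoℚ κ *ℚ ∑ colourings (λ χ → does (proper? f χ) ▸ does (free? f χ p (lookup χ r)) ▸ inner χ)
      ≡⟨ cong (ℕtoℚ κ *ℚ_) (∑-cong colourings λ χ → ▸-cong? (proper? f χ) λ pr →
           cong (does (free? f χ p (lookup χ r)) ▸_) (inner-h χ pr)) ⟩
    ℕtoℚ κ *ℚ ∑ colourings (λ χ → does (proper? f χ) ▸ does (free? f χ p (lookup χ r)) ▸ h χ)
      ≡⟨ cong₂ _*ℚ_ (cong ℕtoℚ (sym (length-allFin κ))) refl ⟩
    ℕtoℚ (length colours) *ℚ ∑ colourings (λ χ → does (proper? f χ) ▸ does (free? f χ p (lookup χ r)) ▸ h χ)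
      ≡⟨ sym (∑-const colours _) ⟩
    ∑ colours (λ β → ∑ colourings λ χ → does (proper? f χ) ▸ does (free? f χ p (lookup χ r)) ▸ h χ)
      ≡⟨ ∑-swap colours colourings _ ⟩
    ∑ colourings (λ χ → ∑ colours λ β → does (proper? f χ) ▸ does (free? f χ p (lookup χ r)) ▸ h χ)
      ≡⟨ ∑-cong colourings (λ χ → ∑-cong colours λ β → sym (trans
           (cong (_▸ does (free? f (χ [ r ]≔ β) p (lookup χ r)) ▸ h (χ [ r ]≔ β)) (resample-proper? χ β))
           (▸-cong? (proper? f χ) λ pr → cong₂ _▸_ (resample-free? χ β p (lookup χ r)) (h-inv χ β pr)))) ⟩
    ∑ colourings (λ χ → ∑ colours λ β → does (proper? f (χ [ r ]≔ β)) ▸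
      does (free? f (χ [ r ]≔ β) p (lookup χ r)) ▸ h (χ [ r ]≔ β))
      ≡⟨ sym (∑-resample r (λ χ β → does (proper? f χ) ▸ does (free? f χ p β) ▸ h χ)) ⟩
    ∑ colourings (λ χ → ∑ colours λ β → does (proper? f χ) ▸ does (free? f χ p β) ▸ h χ)
      ≡⟨ ∑-cong colourings (λ χ → trans (∑-▸ colours (does (proper? f χ)) _) (▸-cong? (proper? f χ) λ pr →
           trans (free-const χ p (h χ)) (cong (_*ℚ h χ) (eₚ χ pr)))) ⟩
    ∑ colourings (λ χ → does (proper? f χ) ▸ aₚ *ℚ h χ)
      ≡⟨ ∑-cong colourings (λ χ → sym (▸-*ˡ (does (proper? f χ)) aₚ (h χ))) ⟩
    ∑ colourings (λ χ → aₚ *ℚ (does (proper? f χ) ▸ h χ))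
      ≡⟨ ∑-*ˡ colourings aₚ _ ⟩
    aₚ *ℚ ∑ colourings (λ χ → does (proper? f χ) ▸ h χ) ∎
    where
    open ≡-Reasoning
    free-const : ∀ χ x y → ∑ colours (λ α → does (free? f χ x α) ▸ y) ≡ freeℚ f χ x *ℚ y
    free-const χ x y = trans (∑-cong colours λ α → trans (cong (does (free? f χ x α) ▸_) (sym (ℚₚ.*-identityˡ y)))
      (sym (▸-*ʳ (does (free? f χ x α)) 1ℚ y))) (∑-*ʳ colours y _)
    inner : Colouring → ℚ
    inner χ = (does (free? f χ r (lookup χ r)) ▸ h χ) +ℚ
         t *ℚ ∑ vertices (λ w → does (child? f r w) ▸ does (lookup χ w ≟F lookup χ r) ▸
           ∑ colours λ α → does (free? f χ r α) ▸ h χ)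
    scalar : ∀ b x → b ▸ x ≡ (b ▸ 1ℚ) *ℚ x
    scalar b x = sym (trans (▸-*ʳ b 1ℚ x) (cong (b ▸_) (ℚₚ.*-identityˡ x)))
    -- Either the entry at `r` is free there, or exactly one child blocks it and the choices of `α`
    -- have total weight `t *ℚ freeℚ f χ r`, which is one. By `partition` the two cases together
    -- have weight one.
    inner-h : ∀ χ → Proper f χ → inner χ ≡ h χ
    inner-h χ pr = begin
      inner χ
        ≡⟨ cong₂ _+ℚ_ (scalar (does (free? f χ r (lookup χ r))) (h χ)) (cong (t *ℚ_) (trans
             (∑-cong vertices λ w → trans (sym (▸-∧ (does (child? f r w)) _ _)) (trans (scalar (does (child? f r w) ∧ does (lookup χ w ≟F lookup χ r)) _)
               (cong₂ _*ℚ_ (trans (▸-∧ (does (child? f r w)) _ _) (cong (_▸ does (lookup χ w ≟F lookup χ r) ▸ 1ℚ) (sym (inc-root? w)))) (free-const χ r (h χ)))))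
             (∑-*ʳ vertices _ _))) ⟩
      φ *ℚ h χ +ℚ t *ℚ (σ *ℚ (freeℚ f χ r *ℚ h χ))
        ≡⟨ rearrange φ (h χ) t σ (freeℚ f χ r) ⟩
      φ *ℚ h χ +ℚ (t *ℚ freeℚ f χ r) *ℚ (σ *ℚ h χ)
        ≡⟨ cong (φ *ℚ h χ +ℚ_) (trans (cong (_*ℚ (σ *ℚ h χ)) (tᵣ χ pr)) (ℚₚ.*-identityˡ _)) ⟩
      φ *ℚ h χ +ℚ σ *ℚ h χ
        ≡⟨ sym (ℚₚ.*-distribʳ-+ (h χ) φ σ) ⟩
      (φ +ℚ σ) *ℚ h χ
        ≡⟨ trans (cong (_*ℚ h χ) (partition f χ pr r (lookup χ r))) (ℚₚ.*-identityˡ (h χ)) ⟩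
      h χ ∎
      where
      φ σ : ℚ
      φ = does (free? f χ r (lookup χ r)) ▸ 1ℚ
      σ = ∑ vertices (λ w → does (inc? f r w) ▸ does (lookup χ w ≟F lookup χ r) ▸ 1ℚ)
      rearrange : ∀ φ h t σ a → φ *ℚ h +ℚ t *ℚ (σ *ℚ (a *ℚ h)) ≡ φ *ℚ h +ℚ (t *ℚ a) *ℚ (σ *ℚ h)
      rearrange = solve 5 (λ φ h t σ a → φ :* h :+ t :* (σ :* (a :* h)) := φ :* h :+ (t :* a) :* (σ :* h)) refl
        where open +-*-Solver

-- The algorithm on painted forests

bool-iff : ∀ {P : Set} (b : Bool) (d : Dec P) → (b ≡ true → P) → (P → b ≡ true) → b ≡ does d
bool-iff true  d to from = sym (dec-true d (to refl))
bool-iff false d to from = sym (dec-false d (λ p → case from p of λ ()))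

∧-true : ∀ {a b} → a ∧ b ≡ true → a ≡ true × b ≡ true
∧-true {true} {true} refl = refl , refl

memᵇ-++⁻ : ∀ {k} (a : Fin k) xs ys → memᵇ a (xs ++ ys) ≡ true → memᵇ a xs ≡ true ⊎ memᵇ a ys ≡ true
memᵇ-++⁻ a []       ys m = inj₂ m
memᵇ-++⁻ a (x ∷ xs) ys m with a ≟F x
... | yes _ = inj₁ refl
... | no _  = memᵇ-++⁻ a xs ys m

memᵇ-++ˡ : ∀ {k} (a : Fin k) xs ys → memᵇ a xs ≡ true → memᵇ a (xs ++ ys) ≡ true
memᵇ-++ˡ a (x ∷ xs) ys m with a ≟F x
... | yes _ = refl
... | no _  = memᵇ-++ˡ a xs ys m

memᵇ-++ʳ : ∀ {k} (a : Fin k) xs ys → memᵇ a ys ≡ true → memᵇ a (xs ++ ys) ≡ true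
memᵇ-++ʳ a []       ys m = m
memᵇ-++ʳ a (x ∷ xs) ys m with a ≟F x
... | yes _ = refl
... | no _  = memᵇ-++ʳ a xs ys m

module _ {k : ℕ} {B : Set} (a : Fin k) (g : B → List (Fin k)) (p : B → Bool) where

  memᵇ-concatMap⁻ : ∀ xs → memᵇ a (concatMap g (filterᵇ p xs)) ≡ true → ∃ λ w → p w ≡ true × memᵇ a (g w) ≡ true
  memᵇ-concatMap⁻ (x ∷ xs) m with p x in px
  ... | false = memᵇ-concatMap⁻ xs m
  ... | true with memᵇ-++⁻ a (g x) _ m
  ...   | inj₁ m' = x , px , m'
  ...   | inj₂ m' = memᵇ-concatMap⁻ xs m'

  memᵇ-concatMap⁺ : ∀ {xs w} → w ∈ xs → p w ≡ true → memᵇ a (g w) ≡ true → memᵇ a (concatMap g (filterᵇ p xs)) ≡ true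
  memᵇ-concatMap⁺ {x ∷ xs} (Any.here refl) pw m rewrite pw = memᵇ-++ˡ a (g x) _ m
  memᵇ-concatMap⁺ {x ∷ xs} (Any.there i) pw m with p x
  ... | false = memᵇ-concatMap⁺ i pw m
  ... | true  = memᵇ-++ʳ a (g x) _ (memᵇ-concatMap⁺ i pw m)

module _ {B : Set} (p : B → Bool) where

  head-filterᵇ-just : ∀ xs {w} → head (filterᵇ p xs) ≡ just w → p w ≡ true
  head-filterᵇ-just (x ∷ xs) e with p x in px
  ... | true with refl ← e = px
  ... | false = head-filterᵇ-just xs e

  head-filterᵇ-nothing : ∀ {xs w} → w ∈ xs → head (filterᵇ p xs) ≡ nothing → p w ≡ true → ⊥
  head-filterᵇ-nothing {x ∷ xs} (Any.here refl) e pw rewrite pw with () ← e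
  head-filterᵇ-nothing {x ∷ xs} (Any.there i) e pw with p x
  ... | false = head-filterᵇ-nothing i e pw

module Painting (n Δ c : ℕ) where
  open DistMaint n Δ c
  open Kempe n κ
  open Colourings n κ

  -- Every state reached by the algorithm is pointwise equal to a painted shape. Spare entries leave
  -- no trace in it, so several vectors paint the same state.
  paint : Shape → Colouring → State
  paint f χ v = M.map (λ q → proj₁ q , lookup χ v) (f v)

  paint-just : ∀ f χ {v q} → f v ≡ just (q , tt) → paint f χ v ≡ just (q , lookup χ v)
  paint-just f χ {v} e = cong (M.map (λ q → proj₁ q , lookup χ v)) e

  paint-nothing : ∀ f χ {v} → f v ≡ nothing → paint f χ v ≡ nothing
  paint-nothing f χ {v} e = cong (M.map (λ q → proj₁ q , lookup χ v)) e

  paint-cong : ∀ {f g : Shape} {χ χ'} → f ≗ g → (∀ v → lookup χ v ≡ lookup χ' v) → paint f χ ≗ paint g χ'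
  paint-cong f≗g e v = cong₂ (λ l m → M.map (λ q → proj₁ q , l) m) (e v) (f≗g v)

  paint-resp : ∀ {f : Shape} {χ χ'} → (∀ v → (∃ λ q → f v ≡ just q) → lookup χ v ≡ lookup χ' v) → paint f χ ≗ paint f χ'
  paint-resp {f} e v with f v in eq
  ... | nothing = refl
  ... | just q  = cong (λ l → just (proj₁ q , l)) (e v (q , eq))

  isChildOf-just : ∀ {L : Set} (s : Rooted L) v w {q l} → s w ≡ just (q , l) → isChildOf s v w ≡ eqᵇ q v
  isChildOf-just s v w e rewrite e = refl

  isChildOf-nothing : ∀ {L : Set} (s : Rooted L) v w → s w ≡ nothing → isChildOf s v w ≡ false
  isChildOf-nothing s v w e rewrite e = refl

  isChildOf-child? : ∀ (f : Shape) v w → isChildOf f v w ≡ does (child? f v w)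
  isChildOf-child? f v w = go (f w) refl
    where
    go : ∀ m → f w ≡ m → isChildOf f v w ≡ does (child? f v w)
    go nothing         e = trans (isChildOf-nothing f v w e) (sym (dec-false (child? f v w) (λ e' → case trans (sym e) e' of λ ())))
    go (just (q , tt)) e = trans (isChildOf-just f v w e)
      (does-iff (q ≟F v) (child? f v w) (λ { refl → e }) (λ e' → par-unique e e'))

  module Reading {f : Shape} {χ : Colouring} {s : State} (e : s ≗ paint f χ) where

    read-just : ∀ {v q} → f v ≡ just (q , tt) → s v ≡ just (q , lookup χ v)
    read-just h = trans (e _) (paint-just f χ h)

    read-nothing : ∀ {v} → f v ≡ nothing → s v ≡ nothing
    read-nothing h = trans (e _) (paint-nothing f χ h)

    isChildOf-shape : ∀ v w → isChildOf s v w ≡ isChildOf f v w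
    isChildOf-shape v w = go (f w) refl
      where
      go : ∀ m → f w ≡ m → isChildOf s v w ≡ isChildOf f v w
      go nothing         h = trans (isChildOf-nothing s v w (read-nothing h)) (sym (isChildOf-nothing f v w h))
      go (just (q , tt)) h = trans (isChildOf-just s v w (read-just h)) (sym (isChildOf-just f v w h))

    isChildOf-paint : ∀ v w → isChildOf s v w ≡ does (child? f v w)
    isChildOf-paint v w = trans (isChildOf-shape v w) (isChildOf-child? f v w)

    children-paint : ∀ v → children s v ≡ children f v
    children-paint v = filterᵇ-cong vertices (isChildOf-shape v)

    ∑-children : ∀ v h → ∑ (children s v) h ≡ ∑ vertices (λ w → does (child? f v w) ▸ h w)
    ∑-children v h = trans (∑-filter (isChildOf s v) vertices h) (∑-cong vertices λ w → cong (_▸ h w) (isChildOf-paint v w))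

    child-read : ∀ {v w} → isChildOf s v w ≡ true → f w ≡ just (v , tt)
    child-read {v} {w} h = witness (child? f v w) (trans (sym (isChildOf-paint v w)) h)

    child-write : ∀ {v w} → f w ≡ just (v , tt) → isChildOf s v w ≡ true
    child-write {v} {w} h = trans (isChildOf-paint v w) (dec-true (child? f v w) h)

    colorOf-just : ∀ {v q} → f v ≡ just (q , tt) → colorOf s v ≡ just (lookup χ v)
    colorOf-just h = cong (M.map proj₂) (read-just h)

    memᵇ-colorOf : ∀ {v q a} → f v ≡ just (q , tt) → memᵇ a (maybeToList (colorOf s v)) ≡ true → lookup χ v ≡ a
    memᵇ-colorOf {v} {q} {a} h m rewrite colorOf-just h with a ≟F lookup χ v
    ... | yes a≡ = sym a≡

    memᵇ-colorOf⁺ : ∀ {v q} → f v ≡ just (q , tt) → memᵇ (lookup χ v) (maybeToList (colorOf s v)) ≡ true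
    memᵇ-colorOf⁺ {v} h rewrite colorOf-just h with lookup χ v ≟F lookup χ v
    ... | yes _ = refl
    ... | no ¬r = contradiction refl ¬r

    used-paint : ∀ x a → memᵇ a (usedAt s x) ≡ does (used? f χ x a)
    used-paint x a = bool-iff (memᵇ a (usedAt s x)) (used? f χ x a) to from
      where
      own : ∀ m → f x ≡ m → memᵇ a (maybeToList (colorOf s x)) ≡ true → Used f χ x a
      own nothing         h m rewrite read-nothing h with () ← m
      own (just (q , tt)) h m = x , inj₁ (refl , _ , h) , memᵇ-colorOf h m
      to : memᵇ a (usedAt s x) ≡ true → Used f χ x a
      to m with memᵇ-++⁻ a (maybeToList (colorOf s x)) _ m
      ... | inj₁ m' = own (f x) refl m'
      ... | inj₂ m' with w , c , m'' ← memᵇ-concatMap⁻ a (λ w → maybeToList (colorOf s w)) (isChildOf s x) vertices m' =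
        w , inj₂ (child-read c) , memᵇ-colorOf (child-read c) m''
      from : Used f χ x a → memᵇ a (usedAt s x) ≡ true
      from (w , inj₁ (refl , q , h) , refl) = memᵇ-++ˡ a (maybeToList (colorOf s x)) _ (memᵇ-colorOf⁺ h)
      from (w , inj₂ h , refl) = memᵇ-++ʳ a (maybeToList (colorOf s x)) _
        (memᵇ-concatMap⁺ a (λ w → maybeToList (colorOf s w)) (isChildOf s x) (∈-allFin w) (child-write h) (memᵇ-colorOf⁺ h))

    ∑-avail : ∀ x h → ∑ (avail s x) h ≡ ∑ colours (λ a → does (free? f χ x a) ▸ h a)
    ∑-avail x h = trans (∑-filter (λ a → not (memᵇ a (usedAt s x))) colours h)
      (∑-cong colours λ a → cong (λ b → not b ▸ h a) (used-paint x a))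

    hasColor-just : ∀ {v q} β → f v ≡ just (q , tt) → hasColor s v β ≡ eqᵇ (lookup χ v) β
    hasColor-just β h rewrite colorOf-just h = refl

    childWithColor-just : ∀ {v β w} → childWithColor s v β ≡ just w → f w ≡ just (v , tt) × lookup χ w ≡ β
    childWithColor-just {v} {β} {w} h with ∧-true {isChildOf s v w} (head-filterᵇ-just (λ w → isChildOf s v w ∧ hasColor s w β) vertices h)
    ... | i , j = child-read i , witness (lookup χ w ≟F β) (trans (sym (hasColor-just β (child-read i))) j)

    childWithColor-nothing : ∀ {v β} → childWithColor s v β ≡ nothing → ∀ {w} → f w ≡ just (v , tt) → lookup χ w ≢ β
    childWithColor-nothing {v} {β} h {w} i refl = head-filterᵇ-nothing (λ w → isChildOf s v w ∧ hasColor s w β) (∈-allFin w) h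
      (cong₂ _∧_ (child-write i) (trans (hasColor-just β i) (dec-true (lookup χ w ≟F β) refl)))

    recolor-paint : ∀ w α → recolor s w α ≗ paint f (χ [ w ]≔ α)
    recolor-paint w α v with v ≟F w
    ... | no v≢w = trans (e v) (cong (λ l → M.map (λ q → proj₁ q , l) (f v)) (sym (Vecₚ.lookup∘update′ v≢w χ α)))
    ... | yes refl rewrite e v | Vecₚ.lookup∘update v χ α with f v
    ...   | nothing = refl
    ...   | just q  = refl

  -- χ is the colouring before the walk started; χ₁ the current one, which may differ from it
  -- on the part of the forest that the walk has left behind.
  fixForbidden-paint : ∀ {f : Shape} (rk : Ranked f) → let open Ranked rk in ∀ χ k w a b χ₁ χ₂ t →
    n ≤ k + rank w → t ≗ paint f χ₁ →
    (∀ p e e' → rank w ≤ rank p → Inc f p e → Inc f p e' → lookup χ e ≡ lookup χ e' → e ≡ e') →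
    (∀ v → rank w < rank v → lookup χ₁ v ≡ lookup χ v) →
    (∀ {x} → f x ≡ just (w , tt) → lookup χ x ≢ a) →
    (∀ {v} → K f w (Ab χ a b) v → lookup χ₂ v ≡ tr a b (lookup χ v)) →
    (∀ {v} → ¬ K f w (Ab χ a b) v → lookup χ₂ v ≡ lookup χ₁ v) →
    fixForbidden k w a b t ≗ paint f χ₂
  -- The invariant `n ≤ k + rank w` survives each step because the rank grows; since ranks stay
  -- below `n`, the walk never runs out of fuel.
  fixForbidden-paint rk χ zero w a b χ₁ χ₂ t fuel t≗ pr ag na inK outK = ⊥-elim (ℕₚ.<⇒≱ (Ranked.rank-bound rk w) fuel)
  fixForbidden-paint {f} rk χ (suc k) w a b χ₁ χ₂ t fuel t≗ pr ag na inK outK with childWithColor t w b in cw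
  ... | nothing = λ v → trans (t≗ v) (paint-cong {f} {f} {χ₁} {χ₂} (λ _ → refl) (λ v → sym (outK empty)) v)
    where
    open Ranked rk
    empty : ∀ {v} → ¬ K f w (Ab χ a b) v
    empty (here e (inj₁ h)) = na e h
    empty (here e (inj₂ h)) = Reading.childWithColor-nothing {f} {χ₁} {t} t≗ cw e (trans (ag _ (rank-par e)) h)
    empty (there _ _ k)     = empty k
  ... | just x with fx , χx ← Reading.childWithColor-just {f} {χ₁} {t} t≗ cw =
    fixForbidden-paint rk χ k x b a (χ₁ [ x ]≔ a) χ₂ (recolor t x a) fuel'
      (Reading.recolor-paint {f} {χ₁} {t} t≗ x a)
      (λ p e e' r → pr p e e' (ℕₚ.≤-trans (ℕₚ.<⇒≤ (rank-par fx)) r))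
      (λ v r → trans (Vecₚ.lookup∘update′ {i = v} {j = x} (λ { refl → ℕₚ.<-irrefl refl r }) χ₁ a) (ag v (ℕₚ.<-trans (rank-par fx) r)))
      -- The edge above `x` was coloured `b` in `χ`, so by properness no child of `x` is: this is
      -- the hypothesis `na` of the next call, in which `a` and `b` have changed roles.
      (λ {y} fy e → par-irrefl rk (subst (λ z → f z ≡ just (x , tt))
        (pr x y x (ℕₚ.<⇒≤ (rank-par fx)) (inj₂ fy) (inj₁ (refl , _ , fx)) (trans e (sym xb))) fy))
      (λ {v} k → trans (inK (up k)) (tr-comm a b (lookup χ v)))
      outK'
    where
    open Ranked rk
    fuel' : n ≤ k + rank x
    fuel' = ℕₚ.≤-trans fuel (ℕₚ.≤-trans (ℕₚ.≤-reflexive (sym (ℕₚ.+-suc k (rank w)))) (ℕₚ.+-monoʳ-≤ k (rank-par fx)))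
    xb : lookup χ x ≡ b
    xb = trans (sym (ag x (rank-par fx))) χx
    kx : K f w (Ab χ a b) x
    kx = here fx (inj₂ xb)
    up : ∀ {v} → K f x (Ab χ b a) v → K f w (Ab χ a b) v
    up (here e h)     = there e (Ab-comm χ b a _ h) kx
    up (there e h k)  = there e (Ab-comm χ b a _ h) (up k)
    down : ∀ {v} → K f w (Ab χ a b) v → v ≡ x ⊎ K f x (Ab χ b a) v
    down (here e (inj₁ h)) = contradiction h (na e)
    down (here e (inj₂ h)) = inj₁ (pr w _ x ℕₚ.≤-refl (inj₂ e) (inj₂ fx) (trans h (sym xb)))
    down (there e h k) with down k
    ... | inj₁ refl = inj₂ (here e (Ab-comm χ a b _ h))
    ... | inj₂ k'   = inj₂ (there e (Ab-comm χ a b _ h) k')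
    outK' : ∀ {v} → ¬ K f x (Ab χ b a) v → lookup χ₂ v ≡ lookup (χ₁ [ x ]≔ a) v
    outK' {v} ¬k with v ≟F x
    ... | yes refl = trans (inK kx) (trans (cong (tr a b) xb) (trans (tr-snd a b) (sym (Vecₚ.lookup∘update x χ₁ a))))
    ... | no v≢x = trans (outK (λ k → case down k of λ { (inj₁ e) → v≢x e ; (inj₂ k') → ¬k k' }))
                         (sym (Vecₚ.lookup∘update′ v≢x χ₁ a))

  -- g is f, possibly with the root r of f attached to a parent.
  kempe-walk : ∀ {f g : Shape} (rk : Ranked f) (rkg : Ranked g) r → f r ≡ nothing → (∀ {v} → v ≢ r → g v ≡ f v) →
    ∀ χ t w a b → t ≗ paint g χ → Proper f χ → f w ≡ just (r , tt) → lookup χ w ≡ b →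
    (∀ {x} → f x ≡ just (r , tt) → lookup χ x ≢ a) →
    (∀ x e → Ranked.rank rkg w ≤ Ranked.rank rkg x → Inc g x e → Inc f x e) →
    FixForbidden w b a (recolor t w a) ≗ paint g (Swap.ψ rk r a b χ)
  kempe-walk {f} {g} rk rkg r fr agree χ t w a b t≗ pr wr wb na inc =
    fixForbidden-paint rkg χ n w b a (χ [ w ]≔ a) (ψ a b χ) (recolor t w a) (ℕₚ.m≤m+n n _)
      (Reading.recolor-paint {g} {χ} {t} t≗ w a)
      (λ p e e' h i i' → pr p e e' (inc p e h i) (inc p e' h i'))
      (λ v h → Vecₚ.lookup∘update′ {i = v} {j = w} (λ { refl → ℕₚ.<-irrefl refl h }) χ a)
      (λ {y} gy e → par-irrefl rkg (subst (λ z → g z ≡ just (w , tt))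
        (pr w y w (inc w y ℕₚ.≤-refl (inj₂ gy)) (inj₁ (refl , _ , wr)) (trans e (sym wb))) gy))
      (λ {v} k → trans (ψ-in a b χ (up k)) (tr-comm a b (lookup χ v)))
      out
    where
    open Swap rk r
    nr : ∀ {v q} → f v ≡ just q → v ≢ r
    nr e refl = case trans (sym fr) e of λ ()
    gw : g w ≡ just (r , tt)
    gw = trans (agree (nr wr)) wr
    below-≢ : ∀ {Q v} → K g w Q v → v ≢ r
    below-≢ k refl = ℕₚ.<-asym (K-rank rkg k) (Ranked.rank-par rkg gw)
    kw : K f r (Ab χ a b) w
    kw = here wr (inj₂ wb)
    up : ∀ {v} → K g w (Ab χ b a) v → K f r (Ab χ a b) v
    up k@(here e h)     = there (trans (sym (agree (below-≢ k))) e) (Ab-comm χ b a _ h) kw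
    up k@(there e h k') = there (trans (sym (agree (below-≢ k))) e) (Ab-comm χ b a _ h) (up k')
    down : ∀ {v} → K f r (Ab χ a b) v → v ≡ w ⊎ K g w (Ab χ b a) v
    down (here e (inj₁ h)) = contradiction h (na e)
    down (here e (inj₂ h)) = inj₁ (pr r _ w (inj₂ e) (inj₂ wr) (trans h (sym wb)))
    down (there e h k) with down k
    ... | inj₁ refl = inj₂ (here (trans (agree (nr e)) e) (Ab-comm χ a b _ h))
    ... | inj₂ k'   = inj₂ (there (trans (agree (nr e)) e) (Ab-comm χ a b _ h) k')
    out : ∀ {v} → ¬ K g w (Ab χ b a) v → lookup (ψ a b χ) v ≡ lookup (χ [ w ]≔ a) v
    out {v} ¬k with v ≟F w
    ... | yes refl = trans (ψ-child a b χ wr) (trans (cong (tr a b) wb) (trans (tr-snd a b) (sym (Vecₚ.lookup∘update w χ a))))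
    ... | no v≢w = trans (ψ-out a b χ (λ k → case down k of λ { (inj₁ e) → v≢w e ; (inj₂ k') → ¬k k' }))
                         (sym (Vecₚ.lookup∘update′ v≢w χ a))

ℕtoℚ-cancel : ∀ {a b} → ℕtoℚ a ≤ℚ ℕtoℚ b → a ≤ b
ℕtoℚ-cancel {a} {b} h = ℤₚ.drop‿+≤+ (subst₂ ℤ._≤_ (ℤₚ.*-identityʳ (+ a)) (ℤₚ.*-identityʳ (+ b)) (ℚᵘₚ.drop-*≤* h'))
  where
  h' : ℚᵘ.mkℚᵘ (+ a) 0 ℚᵘ.≤ ℚᵘ.mkℚᵘ (+ b) 0
  h' = ℚᵘₚ.≤-trans (ℚᵘₚ.≤-reflexive (ℚᵘₚ.≃-sym (ℚₚ.toℚᵘ-fromℚᵘ (ℚᵘ.mkℚᵘ (+ a) 0))))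
      (ℚᵘₚ.≤-trans (ℚₚ.toℚᵘ-mono-≤ h) (ℚᵘₚ.≤-reflexive (ℚₚ.toℚᵘ-fromℚᵘ (ℚᵘ.mkℚᵘ (+ b) 0))))

ℕtoℚ-injective : ∀ {a b} → ℕtoℚ a ≡ ℕtoℚ b → a ≡ b
ℕtoℚ-injective {a} {b} e = ℕₚ.≤-antisym (ℕtoℚ-cancel (ℚₚ.≤-reflexive e)) (ℕtoℚ-cancel (ℚₚ.≤-reflexive (sym e)))

bindD-cong : ∀ {A B : Set} (d : Dist A) {k k' : A → Dist B} → (∀ x → k x ≡ k' x) → bindD d k ≡ bindD d k'
bindD-cong []      e = refl
bindD-cong (x ∷ d) e = cong₂ _++_ (cong (scaleD (proj₁ x)) (e (proj₂ x))) (bindD-cong d e)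

-- One insertion or deletion evaluated on a painted forest

module Steps (n Δ c : ℕ) where
  open DistMaint n Δ c
  open Kempe n κ
  open Colourings n κ
  open Painting n Δ c

  colourChild : State → V → Col → Dist State
  colourChild s₁ r β with childWithColor s₁ r β
  ... | nothing = returnD s₁
  ... | just w  = bindD (uniform (avail s₁ r)) (λ α → returnD (FixForbidden w β α (recolor s₁ w α)))

  swapChild : State → Col → V → Dist State
  swapChild s₁ α w with colorOf s₁ w
  ... | nothing = returnD s₁
  ... | just β  = returnD (FixForbidden w β α (recolor s₁ w α))

  -- The local functions of insertR and deleteR cannot be named here; the underscores below
  -- stand for them and are solved by unification.
  mutual
    insertR≡ : ∀ s p r → insertR s p r ≡ bindD (uniform (avail s p)) (λ β → colourChild (update s r (just (p , β))) r β)
    insertR≡ s p r = bindD-cong (uniform (avail s p)) (λ β → step₁≡ s p r β)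

    step₁≡ : ∀ s p r β → _ ≡ colourChild (update s r (just (p , β))) r β
    step₁≡ s p r β with childWithColor (update s r (just (p , β))) r β
    ... | nothing = refl
    ... | just w  = refl

  mutual
    deleteR≡ : ∀ s p r {q α} → s r ≡ just (q , α) → let s₁ = update s r nothing in
      deleteR s p r ≡ (frac (κ ∸ length (children s₁ r)) κ , s₁) ∷
        scaleD (frac (length (children s₁ r)) κ) (bindD (uniform (children s₁ r)) (swapChild s₁ α))
    deleteR≡ s p r {q} {α} e with s r
    deleteR≡ s p r {q} {α} refl | just _ =
      cong (λ d → (frac (κ ∸ length (children (update s r nothing) r)) κ , update s r nothing)
                  ∷ scaleD (frac (length (children (update s r nothing) r)) κ) d)
        (bindD-cong (uniform (children (update s r nothing) r)) (λ w → branch≡ s p r q α w))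

    branch≡ : ∀ s p r q α w → _ ≡ swapChild (update s r nothing) α w
    branch≡ s p r q α w with colorOf (update s r nothing) w
    ... | nothing = refl
    ... | just β  = refl

  ∑-children-shape : ∀ (f : Shape) v h → ∑ (children f v) h ≡ ∑ vertices (λ w → does (child? f v w) ▸ h w)
  ∑-children-shape f v h = trans (∑-filter (isChildOf f v) vertices h)
    (∑-cong vertices λ w → cong (_▸ h w) (isChildOf-child? f v w))

  degree-degℚ : ∀ {f : Shape} → Ranked f → ∀ v → ℕtoℚ (degree f v) ≡ degℚ f v
  degree-degℚ {f} rk v = trans (split (f v) refl) (sym (trans (∑-cong vertices pointwise) (trans (∑-+ vertices _ _)
      (cong (_+ℚ childSum) (∑-δ n v (λ e → does (nonRoot? f e) ▸ 1ℚ))))))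
    where
    childSum = ∑ vertices λ e → does (child? f v e) ▸ 1ℚ
    kids : ℕtoℚ (length (children f v)) ≡ childSum
    kids = trans (sym (∑-length (children f v))) (∑-children-shape f v (λ _ → 1ℚ))
    split : ∀ m → f v ≡ m → ℕtoℚ (degree f v) ≡ (does (nonRoot? f v) ▸ 1ℚ) +ℚ childSum
    split nothing e = trans (trans (cong ℕtoℚ deg) kids) (sym (trans (cong (_+ℚ childSum)
        (▸-no (nonRoot? f v) 1ℚ (λ (q , e') → case trans (sym e) e' of λ ()))) (ℚₚ.+-identityˡ _)))
      where
      deg : degree f v ≡ length (children f v)
      deg rewrite e = refl
    split (just q) e = trans (cong ℕtoℚ deg) (trans (ℕtoℚ-+ 1 (length (children f v)))
        (cong₂ _+ℚ_ (sym (▸-yes (nonRoot? f v) 1ℚ (q , e))) kids))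
      where
      deg : degree f v ≡ suc (length (children f v))
      deg rewrite e = refl
    pointwise : ∀ e → does (inc? f v e) ▸ 1ℚ ≡ (does (v ≟F e) ▸ does (nonRoot? f e) ▸ 1ℚ) +ℚ (does (child? f v e) ▸ 1ℚ)
    pointwise e = cases (v ≟F e) (nonRoot? f e) (child? f v e)
      where
      rhs : ∀ {x y x' y'} → x ≡ x' → y ≡ y' → does (inc? f v e) ▸ 1ℚ ≡ x' +ℚ y' → does (inc? f v e) ▸ 1ℚ ≡ x +ℚ y
      rhs ex ey h = trans h (sym (cong₂ _+ℚ_ ex ey))
      cases : Dec (v ≡ e) → Dec (∃ λ q → f e ≡ just q) → Dec (f e ≡ just (v , tt)) →
        does (inc? f v e) ▸ 1ℚ ≡ (does (v ≟F e) ▸ does (nonRoot? f e) ▸ 1ℚ) +ℚ (does (child? f v e) ▸ 1ℚ)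
      cases (yes refl) (yes nr) _ = rhs (trans (▸-yes (v ≟F v) _ refl) (▸-yes (nonRoot? f v) 1ℚ nr))
        (▸-no (child? f v v) 1ℚ (par-irrefl rk)) (trans (▸-yes (inc? f v v) 1ℚ (inj₁ (refl , nr))) (sym (ℚₚ.+-identityʳ 1ℚ)))
      cases (yes refl) (no ¬nr) _ = rhs (trans (▸-yes (v ≟F v) _ refl) (▸-no (nonRoot? f v) 1ℚ ¬nr))
        (▸-no (child? f v v) 1ℚ (par-irrefl rk)) (▸-no (inc? f v v) 1ℚ λ { (inj₁ (_ , nr)) → ¬nr nr ; (inj₂ h) → ¬nr (_ , h) })
      cases (no v≢e) _ (yes h) = rhs (▸-no (v ≟F e) _ v≢e) (▸-yes (child? f v e) 1ℚ h)
        (trans (▸-yes (inc? f v e) 1ℚ (inj₂ h)) (sym (ℚₚ.+-identityˡ 1ℚ)))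
      cases (no v≢e) _ (no ¬h) = rhs (▸-no (v ≟F e) _ v≢e) (▸-no (child? f v e) 1ℚ ¬h)
        (▸-no (inc? f v e) 1ℚ λ { (inj₁ (e≡v , _)) → v≢e (sym e≡v) ; (inj₂ h) → ¬h h })

  -- The number of free colours at a vertex is independent of the colouring. Uniform draws from
  -- `A(p)` and `A(r)` therefore have constant weights, which can be pulled out of sums over
  -- colourings.
  degree-free : ∀ {f : Shape} → Ranked f → ∀ χ → Proper f χ → ∀ x m → ℕtoℚ m ≡ freeℚ f χ x → m ≡ κ ∸ degree f x
  degree-free {f} rk χ pr x m e = sym (trans (cong (_∸ degree f x) (sym total)) (ℕₚ.m+n∸n≡m m (degree f x)))
    where
    total : m + degree f x ≡ κ
    total = ℕtoℚ-injective (trans (ℕtoℚ-+ m (degree f x))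
      (trans (cong₂ _+ℚ_ e (degree-degℚ rk x)) (freeℚ+degℚ f χ pr x)))

  free-degree : ∀ {f : Shape} → Ranked f → ∀ χ → Proper f χ → ∀ x → degree f x ≤ κ → freeℚ f χ x ≡ ℕtoℚ (κ ∸ degree f x)
  free-degree {f} rk χ pr x d≤κ = +ℚ-cancelʳ (degℚ f x) _ _ (trans (freeℚ+degℚ f χ pr x)
    (trans (cong ℕtoℚ (sym (ℕₚ.m∸n+n≡m d≤κ))) (trans (ℕtoℚ-+ (κ ∸ degree f x) (degree f x)) (cong (ℕtoℚ (κ ∸ degree f x) +ℚ_) (degree-degℚ rk x)))))

  module Evaluate {f : Shape} (rk : Ranked f) (p r : V) (fr : f r ≡ nothing) (p≢r : p ≢ r) (¬below : ¬ Below f r p)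
      (rk' : Ranked (update f r (just (p , tt)))) where
    open Link rk p r fr p≢r ¬below
    open LinkSums n κ rk p r fr p≢r ¬below
    open Swap rk r

    Spec : Shape → (State → ℚ) → (Colouring → ℚ) → Set
    Spec g G H = ∀ t χ → Proper g χ → t ≗ paint g χ → G t ≡ H χ

    link-state : ∀ s χ β → s ≗ paint f χ → update s r (just (p , β)) ≗ paint f' (χ [ r ]≔ β)
    link-state s χ β s≗ v with v ≟F r
    ... | yes refl = cong (λ l → just (p , l)) (sym (Vecₚ.lookup∘update r χ β))
    ... | no v≢r   = trans (s≗ v) (cong (λ l → M.map (λ q → proj₁ q , l) (f v)) (sym (Vecₚ.lookup∘update′ v≢r χ β)))

    inc-below : ∀ {w} → f w ≡ just (r , tt) → ∀ x e → Ranked.rank rk' w ≤ Ranked.rank rk' x → Inc f' x e → Inc f x e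
    inc-below {w} wr x e h i = Inc-lower e≢r i
      where
      r<w : Ranked.rank rk' r < Ranked.rank rk' w
      r<w = Ranked.rank-par rk' (trans (f'-other (nonRoot-≢ wr)) wr)
      e≢r : e ≢ r
      e≢r refl with Inc-r i
      ... | inj₁ refl = ℕₚ.<⇒≱ r<w h
      ... | inj₂ refl = ℕₚ.<⇒≱ (ℕₚ.<-trans (Ranked.rank-par rk' f'-r) r<w) h

    -- The two branches fill complementary summands. Without a blocking child all terms of the
    -- second sum vanish; with one, the first summand vanishes and properness leaves a single `w` in
    -- the second. Thus one formula without cases enters `ins-sum`.
    colourChild-eval : ∀ G H → Spec f' G H → ∀ s χ → Proper f χ → s ≗ paint f χ → ∀ β → ¬ Used f χ p β →
      expect (colourChild (update s r (just (p , β))) r β) G ≡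
      (does (free? f χ r β) ▸ H (χ [ r ]≔ β)) +ℚ
       frac 1 (κ ∸ degree f r) *ℚ ∑ vertices (λ w → does (child? f r w) ▸ does (lookup χ w ≟F β) ▸
         ∑ colours λ α → does (free? f χ r α) ▸ H (ψ α β (χ [ r ]≔ β)))
    colourChild-eval G H spec s χ pr s≗ β ¬up with childWithColor (update s r (just (p , β))) r β in cw
    ... | nothing = begin
      expect (returnD s₁) G
        ≡⟨ expect-return s₁ G ⟩
      G s₁
        ≡⟨ spec s₁ χ₁ pr' s₁≗ ⟩
      H χ₁
        ≡⟨ sym (trans (cong₂ _+ℚ_ (▸-yes (free? f χ r β) (H χ₁) ¬ur)
             (trans (cong (t *ℚ_) (trans (∑-cong vertices λ w → ▸-zero? (child? f r w) λ wr →
                ▸-no (lookup χ w ≟F β) _ (none wr)) (∑-0 vertices))) (ℚₚ.*-zeroʳ t))) (ℚₚ.+-identityʳ _)) ⟩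
      _ ∎
      where
      open ≡-Reasoning
      t = frac 1 (κ ∸ degree f r)
      s₁ = update s r (just (p , β))
      χ₁ = χ [ r ]≔ β
      s₁≗ : s₁ ≗ paint f' χ₁
      s₁≗ = link-state s χ β s≗
      none : ∀ {w} → f w ≡ just (r , tt) → lookup χ w ≢ β
      none wr e = Reading.childWithColor-nothing {f'} {χ₁} {s₁} s₁≗ cw (trans (f'-other (nonRoot-≢ wr)) wr)
        (trans (resample-inc χ β (inj₂ wr)) e)
      ¬ur : ¬ Used f χ r β
      ¬ur (e , i , eq) = none (Inc-root i) eq
      χ₁r : lookup χ₁ r ≡ β
      χ₁r = Vecₚ.lookup∘update r χ β
      pr' : Proper f' χ₁
      pr' = Proper-lift χ₁ (resample-proper χ β pr ,
        subst (λ z → ¬ Used f χ₁ p z) (sym χ₁r) (¬up ∘ Used-resp χ₁ χ (λ e i → sym (resample-inc χ β i))) ,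
        subst (λ z → ¬ Used f χ₁ r z) (sym χ₁r) (¬ur ∘ Used-resp χ₁ χ (λ e i → sym (resample-inc χ β i))))
    ... | just w = begin
      expect (bindD (uniform (avail s₁ r)) (λ α → returnD (next α))) G
        ≡⟨ expect-bind (uniform (avail s₁ r)) (λ α → returnD (next α)) G ⟩
      expect (uniform (avail s₁ r)) (λ α → expect (returnD (next α)) G)
        ≡⟨ expect-uniform (avail s₁ r) _ ⟩
      frac 1 (length (avail s₁ r)) *ℚ ∑ (avail s₁ r) (λ α → expect (returnD (next α)) G)
        ≡⟨ cong₂ _*ℚ_ (cong (frac 1) len) (availSum _) ⟩
      t *ℚ ∑ colours (λ α → does (free? f χ r α) ▸ expect (returnD (next α)) G)
        ≡⟨ cong (t *ℚ_) (∑-cong colours λ α → ▸-cong? (free? f χ r α) λ ¬ua → trans (expect-return (next α) G) (G-next α ¬ua)) ⟩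
      t *ℚ inner
        ≡⟨ sym (trans (cong₂ _+ℚ_ (▸-no (free? f χ r β) (H χ₁) (λ ¬ur → ¬ur (w , inj₂ wr , wβ)))
             (cong (t *ℚ_) (trans (enum-allFin n w _ others) (trans (▸-yes (child? f r w) _ wr) (▸-yes (lookup χ w ≟F β) _ wβ)))))
             (ℚₚ.+-identityˡ _)) ⟩
      _ ∎
      where
      open ≡-Reasoning
      t = frac 1 (κ ∸ degree f r)
      s₁ = update s r (just (p , β))
      χ₁ = χ [ r ]≔ β
      next : Col → State
      next α = FixForbidden w β α (recolor s₁ w α)
      inner = ∑ colours λ α → does (free? f χ r α) ▸ H (ψ α β χ₁)
      s₁≗ : s₁ ≗ paint f' χ₁
      s₁≗ = link-state s χ β s≗
      wr' : f' w ≡ just (r , tt)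
      wr' = proj₁ (Reading.childWithColor-just {f'} {χ₁} {s₁} s₁≗ cw)
      w≢r : w ≢ r
      w≢r w≡r = p≢r (par-unique f'-r (subst (λ z → f' z ≡ just (r , tt)) w≡r wr'))
      wr : f w ≡ just (r , tt)
      wr = trans (sym (f'-other w≢r)) wr'
      wβ₁ : lookup χ₁ w ≡ β
      wβ₁ = proj₂ (Reading.childWithColor-just {f'} {χ₁} {s₁} s₁≗ cw)
      wβ : lookup χ w ≡ β
      wβ = trans (sym (resample-inc χ β (inj₂ wr))) wβ₁
      others : ∀ x → x ≢ w → does (child? f r x) ▸ does (lookup χ x ≟F β) ▸ inner ≡ 0ℚ
      others x x≢w = ▸-zero? (child? f r x) λ xr → ▸-no (lookup χ x ≟F β) inner
        (λ xβ → x≢w (pr r x w (inj₂ xr) (inj₂ wr) (trans xβ (sym wβ))))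
      used⇒ : ∀ {α} → Used f χ r α → Used f' χ₁ r α
      used⇒ (e , i , eq) = e , Inc-lift i , trans (resample-inc χ β i) eq
      -- At this moment the new edge and the edge to `w` both have colour `β`, so the new edge adds
      -- no used colour at `r` and `α` is drawn from as many colours as before the insertion.
      used⇐ : ∀ {α} → Used f' χ₁ r α → Used f χ r α
      used⇐ (e , i , eq) = cases (e ≟F r)
        where
        cases : Dec (e ≡ r) → Used f χ r _
        cases (yes refl) = w , inj₂ wr , trans wβ (trans (sym (Vecₚ.lookup∘update r χ β)) eq)
        cases (no e≢r)   = e , Inc-lower e≢r i , trans (sym (resample-inc χ β (Inc-lower e≢r i))) eq
      availSum : ∀ h → ∑ (avail s₁ r) h ≡ ∑ colours (λ α → does (free? f χ r α) ▸ h α)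
      availSum h = trans (Reading.∑-avail {f'} {χ₁} {s₁} s₁≗ r h) (∑-cong colours λ α → cong (_▸ h α)
        (does-iff (free? f' χ₁ r α) (free? f χ r α) (_∘ used⇒) (_∘ used⇐)))
      len : length (avail s₁ r) ≡ κ ∸ degree f r
      len = degree-free rk χ pr r (length (avail s₁ r)) (trans (sym (∑-length (avail s₁ r))) (availSum (λ _ → 1ℚ)))
      G-next : ∀ α → ¬ Used f χ r α → G (next α) ≡ H (ψ α β χ₁)
      G-next α ¬ua = spec (next α) (ψ α β χ₁) pr*
        (kempe-walk rk rk' r fr f'-other χ₁ s₁ w α β s₁≗ (resample-proper χ β pr) wr wβ₁
          (λ xr e → ¬ua (_ , inj₂ xr , trans (sym (resample-inc χ β (inj₂ xr))) e)) (inc-below wr))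
        where
        back : ∀ {P : Colouring → Set} → P χ₁ → P (ψ α β (ψ α β χ₁))
        back {P} = subst P (sym (ψ-involutive α β χ₁))
        pr* : Proper f' (ψ α β χ₁)
        -- `swap⇒` takes its hypotheses at `ψ α β` of its argument. With argument `ψ α β χ₁` they
        -- concern the double exchange, that is `χ₁`.
        pr* = proj₂ (proj₂ (swap⇒ w wr α β (ψ α β χ₁)
          ( back {λ z → lookup z r ≡ β} (Vecₚ.lookup∘update r χ β)
          , back {Proper f} (resample-proper χ β pr)
          , back {λ z → ¬ Used f z p β} (¬up ∘ Used-resp χ₁ χ (λ e i → sym (resample-inc χ β i)))
          , back {λ z → lookup z w ≡ β} wβ₁
          , back {λ z → ¬ Used f z r α} (¬ua ∘ Used-resp χ₁ χ (λ e i → sym (resample-inc χ β i))))))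

    insertR-eval : ∀ G H → Spec f' G H → ∀ s χ → Proper f χ → s ≗ paint f χ →
      expect (insertR s p r) G ≡ frac 1 (κ ∸ degree f p) *ℚ ∑ colours λ β → does (free? f χ p β) ▸
        ((does (free? f χ r β) ▸ H (χ [ r ]≔ β)) +ℚ
         frac 1 (κ ∸ degree f r) *ℚ ∑ vertices (λ w → does (child? f r w) ▸ does (lookup χ w ≟F β) ▸
           ∑ colours λ α → does (free? f χ r α) ▸ H (ψ α β (χ [ r ]≔ β))))
    insertR-eval G H spec s χ pr s≗ = begin
      expect (insertR s p r) G
        ≡⟨ cong (λ d → expect d G) (insertR≡ s p r) ⟩
      expect (bindD (uniform (avail s p)) k) G
        ≡⟨ expect-bind (uniform (avail s p)) k G ⟩
      expect (uniform (avail s p)) (λ β → expect (k β) G)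
        ≡⟨ expect-uniform (avail s p) _ ⟩
      frac 1 (length (avail s p)) *ℚ ∑ (avail s p) (λ β → expect (k β) G)
        ≡⟨ cong₂ _*ℚ_ (cong (frac 1) (degree-free rk χ pr p (length (avail s p))
             (trans (sym (∑-length (avail s p))) (Reading.∑-avail {f} {χ} {s} s≗ p (λ _ → 1ℚ)))))
             (Reading.∑-avail {f} {χ} {s} s≗ p _) ⟩
      frac 1 (κ ∸ degree f p) *ℚ ∑ colours (λ β → does (free? f χ p β) ▸ expect (k β) G)
        ≡⟨ cong (frac 1 (κ ∸ degree f p) *ℚ_) (∑-cong colours λ β → ▸-cong? (free? f χ p β) (colourChild-eval G H spec s χ pr s≗ β)) ⟩
      _ ∎
      where
      open ≡-Reasoning
      k : Col → Dist State
      k β = colourChild (update s r (just (p , β))) r β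

    unlink-state : ∀ s χ → s ≗ paint f' χ → update s r nothing ≗ paint f χ
    unlink-state s χ s≗ v with v ≟F r
    ... | yes refl = sym (paint-nothing f χ fr)
    ... | no v≢r   = trans (s≗ v) (cong (M.map (λ q → proj₁ q , lookup χ v)) (f'-other v≢r))

    deleteR-eval : ∀ G H → Spec f G H → ∀ s χ → Proper f' χ → s ≗ paint f' χ → ∀ q →
      expect (deleteR s q r) G ≡ frac (κ ∸ length (children f r)) κ *ℚ H χ +ℚ
        frac (length (children f r)) κ *ℚ (frac 1 (length (children f r)) *ℚ
          ∑ vertices (λ w → does (child? f r w) ▸ H (ψ (lookup χ w) (lookup χ r) χ)))
    deleteR-eval G H spec s χ pr' s≗ q = begin
      expect (deleteR s q r) G
        ≡⟨ cong (λ d → expect d G) (deleteR≡ s q r (Reading.read-just {f'} {χ} {s} s≗ f'-r)) ⟩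
      frac (κ ∸ length (children s₁ r)) κ *ℚ G s₁ +ℚ expect (scaleD (frac (length (children s₁ r)) κ) (bindD (uniform (children s₁ r)) (swapChild s₁ α))) G
        ≡⟨ cong₂ _+ℚ_ (cong₂ _*ℚ_ (cong (λ z → frac (κ ∸ length z) κ) kids) (spec s₁ χ pr s₁≗))
             (trans (expect-scale (frac (length (children s₁ r)) κ) (bindD (uniform (children s₁ r)) (swapChild s₁ α)) G)
               (cong₂ _*ℚ_ (cong (λ z → frac (length z) κ) kids) (trans (expect-bind (uniform (children s₁ r)) (swapChild s₁ α) G)
                 (expect-uniform (children s₁ r) _)))) ⟩
      frac (κ ∸ length (children f r)) κ *ℚ H χ +ℚ frac (length (children f r)) κ *ℚ
        (frac 1 (length (children s₁ r)) *ℚ ∑ (children s₁ r) (λ w → expect (swapChild s₁ α w) G))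
        ≡⟨ cong (λ z → frac (κ ∸ length (children f r)) κ *ℚ H χ +ℚ frac (length (children f r)) κ *ℚ z)
             (cong₂ _*ℚ_ (cong (λ z → frac 1 (length z)) kids) (trans (Reading.∑-children {f} {χ} {s₁} s₁≗ r _)
               (∑-cong vertices λ w → ▸-cong? (child? f r w) (branch w)))) ⟩
      _ ∎
      where
      open ≡-Reasoning
      s₁ = update s r nothing
      α = lookup χ r
      s₁≗ : s₁ ≗ paint f χ
      s₁≗ = unlink-state s χ s≗
      pr : Proper f χ
      pr = proj₁ (Proper-lower χ pr')
      ¬ur : ¬ Used f χ r (lookup χ r)
      ¬ur = proj₂ (proj₂ (Proper-lower χ pr'))
      kids : children s₁ r ≡ children f r
      kids = Reading.children-paint {f} {χ} {s₁} s₁≗ r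
      branch : ∀ w → f w ≡ just (r , tt) → expect (swapChild s₁ α w) G ≡ H (ψ (lookup χ w) α χ)
      branch w wr rewrite Reading.colorOf-just {f} {χ} {s₁} s₁≗ wr = trans (expect-return _ G)
        (trans (spec _ (ψ α (lookup χ w) χ) (ψ-proper α (lookup χ w) χ (inj₁ fr) pr)
          (kempe-walk rk rk r fr (λ _ → refl) χ s₁ w α (lookup χ w) s₁≗ pr wr refl (λ xr e → ¬ur (_ , inj₂ xr , e)) (λ _ _ _ i → i)))
          (cong H (ψ-comm α (lookup χ w) χ)))

frac-split : ∀ a b → .{{_ : NonZero b}} → frac a b ≡ ℕtoℚ a *ℚ frac 1 b
frac-split a b = begin
  frac a b                               ≡⟨ sym (ℚₚ.*-identityʳ (frac a b)) ⟩
  frac a b *ℚ 1ℚ                         ≡⟨ cong (frac a b *ℚ_) (sym (trans (ℚₚ.*-comm (ℕtoℚ b) (frac 1 b)) (frac-* 1 b))) ⟩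
  frac a b *ℚ (ℕtoℚ b *ℚ frac 1 b)       ≡⟨ sym (ℚₚ.*-assoc (frac a b) (ℕtoℚ b) (frac 1 b)) ⟩
  frac a b *ℚ ℕtoℚ b *ℚ frac 1 b         ≡⟨ cong (_*ℚ frac 1 b) (frac-* a b) ⟩
  ℕtoℚ a *ℚ frac 1 b                     ∎
  where open ≡-Reasoning

frac-mul : ∀ a b → .{{_ : NonZero a}} → .{{_ : NonZero b}} → frac a b *ℚ frac 1 a ≡ frac 1 b
frac-mul a b = begin
  frac a b *ℚ frac 1 a               ≡⟨ cong (_*ℚ frac 1 a) (trans (frac-split a b) (ℚₚ.*-comm (ℕtoℚ a) (frac 1 b))) ⟩
  frac 1 b *ℚ ℕtoℚ a *ℚ frac 1 a     ≡⟨ ℚₚ.*-assoc (frac 1 b) (ℕtoℚ a) (frac 1 a) ⟩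
  frac 1 b *ℚ (ℕtoℚ a *ℚ frac 1 a)   ≡⟨ cong (frac 1 b *ℚ_) (trans (ℚₚ.*-comm (ℕtoℚ a) (frac 1 a)) (frac-* 1 a)) ⟩
  frac 1 b *ℚ 1ℚ                     ≡⟨ ℚₚ.*-identityʳ (frac 1 b) ⟩
  frac 1 b                           ∎
  where open ≡-Reasoning

module _ where
  open +-*-Solver

  assoc : ∀ w u k t x → w *ℚ (u *ℚ (k *ℚ (t *ℚ x))) ≡ w *ℚ (u *ℚ (k *ℚ t)) *ℚ x
  assoc = solve 5 (λ w u k t x → w :* (u :* (k :* (t :* x))) := w :* (u :* (k :* t)) :* x) refl

  factorʳ : ∀ x t l → x +ℚ t *ℚ (l *ℚ x) ≡ (1ℚ +ℚ t *ℚ l) *ℚ x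
  factorʳ = solve 3 (λ x t l → x :+ t :* (l :* x) := (con 1ℚ :+ t :* l) :* x) refl

  factorˡ : ∀ s t k x → s *ℚ x +ℚ s *ℚ t *ℚ k ≡ s *ℚ (x +ℚ t *ℚ k)
  factorˡ = solve 4 (λ s t k x → s :* x :+ s :* t :* k := s :* (x :+ t :* k)) refl

  exchange : ∀ w s m → w *ℚ (s *ℚ m) ≡ s *ℚ (w *ℚ m)
  exchange = solve 3 (λ w s m → w :* (s :* m) := s :* (w :* m)) refl

-- The state is uniform over the proper colourings of the current forest

module Uniformity (n Δ c : ℕ) where
  open DistMaint n Δ c
  open Kempe n κ
  open Colourings n κ
  open Painting n Δ c
  open Steps n Δ c

  -- An unnormalised sum: each colouring of the edges is counted once per choice of spare entries,
  -- so the scale changes with the number of trees. `Unif.weight` absorbs this.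
  N : Shape → (Colouring → ℚ) → ℚ
  N f h = ∑ colourings λ χ → does (proper? f χ) ▸ h χ

  N-* : ∀ f a h → N f (λ χ → a *ℚ h χ) ≡ a *ℚ N f h
  N-* f a h = trans (∑-cong colourings λ χ → sym (▸-*ˡ (does (proper? f χ)) a (h χ))) (∑-*ˡ colourings a _)

  N-cong : ∀ f {h k} → (∀ χ → Proper f χ → h χ ≡ k χ) → N f h ≡ N f k
  N-cong f e = ∑-cong colourings λ χ → ▸-cong? (proper? f χ) (e χ)

  N-0 : ∀ f {h} → (∀ χ → Proper f χ → h χ ≡ 0ℚ) → N f h ≡ 0ℚ
  N-0 f e = trans (∑-cong colourings λ χ → ▸-zero? (proper? f χ) (e χ)) (∑-0 colourings)

  N-∑ : ∀ {A : Set} f (xs : List A) (h : A → Colouring → ℚ) → N f (λ χ → ∑ xs λ x → h x χ) ≡ ∑ xs λ x → N f (h x)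
  N-∑ f xs h = trans (∑-cong colourings λ χ → sym (∑-▸ xs (does (proper? f χ)) _)) (∑-swap colourings xs _)

  N-▸ : ∀ f b h → N f (λ χ → b ▸ h χ) ≡ b ▸ N f h
  N-▸ f b h = trans (∑-cong colourings λ χ → ▸-comm (does (proper? f χ)) b (h χ)) (∑-▸ colourings b _)

  -- h is the value of g on painted forests, so g only has to be well behaved there.
  Spec : Shape → (State → ℚ) → (Colouring → ℚ) → Set
  Spec f g h = ∀ s χ → Proper f χ → s ≗ paint f χ → g s ≡ h χ

  -- A distribution is represented by its expectation functional `Φ`, which composes with update
  -- kernels and with rerooting and does not distinguish pointwise equal states in any way that
  -- matters here. `mass` determines `weight`, so the number of proper colourings is never computed.
  record Unif (Φ : (State → ℚ) → ℚ) (f : Shape) : Set where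
    field
      weight      : ℚ
      mass        : weight *ℚ N f (λ _ → 1ℚ) ≡ 1ℚ
      expectation : ∀ g h → Spec f g h → Φ g ≡ weight *ℚ N f h

  Proper-cong : ∀ {f g : Shape} → f ≗ g → ∀ χ → Proper f χ → Proper g χ
  Proper-cong {f} {g} f≗g χ pr p e e' i i' = pr p e e' (back i) (back i')
    where
    back : ∀ {e} → Inc g p e → Inc f p e
    back (inj₁ (eq , q , h)) = inj₁ (eq , q , trans (f≗g _) h)
    back (inj₂ h)            = inj₂ (trans (f≗g _) h)

  N-shape : ∀ {f g : Shape} → f ≗ g → ∀ h → N f h ≡ N g h
  N-shape {f} {g} f≗g h = ∑-cong colourings λ χ → cong (_▸ h χ)
    (does-iff (proper? f χ) (proper? g χ) (Proper-cong f≗g χ) (Proper-cong (λ v → sym (f≗g v)) χ))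

  Unif-cong : ∀ {Φ} {f g : Shape} → f ≗ g → Unif Φ f → Unif Φ g
  Unif-cong {Φ} {f} {g} f≗g U = record
    { weight = weight
    ; mass = trans (cong (weight *ℚ_) (N-shape (λ v → sym (f≗g v)) (λ _ → 1ℚ))) mass
    ; expectation = λ k h sp → trans (expectation k h (λ s χ pr s≗ → sp s χ (Proper-cong f≗g χ pr)
        (λ v → trans (s≗ v) (paint-cong {f} {g} {χ} {χ} f≗g (λ _ → refl) v)))) (cong (weight *ℚ_) (N-shape f≗g h))
    }
    where open Unif U

  degree-root : ∀ (f : Shape) v → f v ≡ nothing → degree f v ≡ length (children f v)
  degree-root f v e rewrite e = refl

  -- The value is `1 / (κ ∸ 1)^(d-1)` for a vertex `d` levels below `r`, provided `d ≤ k`, and zero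
  -- otherwise. Exhausted fuel gives zero, so a smaller `k` truncates the subtree at level `k`; both
  -- bounds exploit this.
  wt : Shape → V → ℕ → V → ℚ
  wt f r zero    v = 0ℚ
  wt f r (suc k) v with f v
  ... | nothing      = 0ℚ
  ... | just (q , _) = if does (q ≟F r) then 1ℚ else frac 1 (κ ∸ 1) *ℚ wt f r k q

  module UnifLink {f : Shape} (rk : Ranked f) (p r : V) (fr : f r ≡ nothing) (p≢r : p ≢ r) (¬below : ¬ Below f r p)
      (rk' : Ranked (update f r (just (p , tt)))) (dₚ : degree f p < κ) (dᵣ : degree f r < κ) where
    open Link rk p r fr p≢r ¬below
    open LinkSums n κ rk p r fr p≢r ¬below
    open Swap rk r
    open Evaluate rk p r fr p≢r ¬below rk' hiding (Spec)

    uₚ t K# : ℚ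
    uₚ = frac 1 (κ ∸ degree f p)
    t  = frac 1 (κ ∸ degree f r)
    K# = ℕtoℚ κ

    instance
      nzₚ : NonZero (κ ∸ degree f p)
      nzₚ = ℕ.>-nonZero (ℕₚ.m<n⇒0<n∸m dₚ)
      nzᵣ : NonZero (κ ∸ degree f r)
      nzᵣ = ℕ.>-nonZero (ℕₚ.m<n⇒0<n∸m dᵣ)
      nzκ : NonZero κ
      nzκ = ℕ.>-nonZero (ℕₚ.≤-<-trans z≤n dₚ)

    t-κ : t *ℚ K# ≡ 1ℚ +ℚ t *ℚ ℕtoℚ (degree f r)
    t-κ = trans (cong (λ z → t *ℚ ℕtoℚ z) (sym (ℕₚ.m∸n+n≡m (ℕₚ.<⇒≤ dᵣ)))) (trans (cong (t *ℚ_) (ℕtoℚ-+ (κ ∸ degree f r) (degree f r)))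
      (trans (ℚₚ.*-distribˡ-+ t _ _) (cong (_+ℚ t *ℚ ℕtoℚ (degree f r)) (frac-* 1 (κ ∸ degree f r)))))

    kids : ∀ x → ∑ vertices (λ w → does (child? f r w) ▸ x) ≡ ℕtoℚ (degree f r) *ℚ x
    kids x = trans (sym (∑-children-shape f r (λ _ → x))) (trans (∑-const (children f r) x)
      (cong (λ z → ℕtoℚ z *ℚ x) (sym (degree-root f r fr))))

    -- A linked colouring receives weight 1 from itself and `t` from each of the `degree f r`
    -- exchanges. As `t` is `1 / (κ ∸ degree f r)`, the total is `t *ℚ K#` for every colouring: this
    -- is why insertion preserves uniformity.
    link-const : ∀ x → x +ℚ t *ℚ ∑ vertices (λ w → does (child? f r w) ▸ x) ≡ (t *ℚ K#) *ℚ x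
    link-const x = trans (cong (λ z → x +ℚ t *ℚ z) (kids x)) (trans (factorʳ x t (ℕtoℚ (degree f r))) (cong (_*ℚ x) (sym t-κ)))

    t-free : ∀ χ → Proper f χ → t *ℚ freeℚ f χ r ≡ 1ℚ
    t-free χ pr = trans (cong (t *ℚ_) (free-degree rk χ pr r (ℕₚ.<⇒≤ dᵣ))) (frac-* 1 (κ ∸ degree f r))

    -- `del-sum` for the constant 1 compares the numbers of proper colourings of the two forests,
    -- which is what normalises the distribution after an insertion.
    count-link : uₚ *ℚ (K# *ℚ (t *ℚ K# *ℚ N f' (λ _ → 1ℚ))) ≡ N f (λ _ → 1ℚ)
    count-link = begin
      uₚ *ℚ (K# *ℚ (t *ℚ K# *ℚ N f' (λ _ → 1ℚ)))
        ≡⟨ cong (λ z → uₚ *ℚ (K# *ℚ z)) (trans (sym (N-* f' (t *ℚ K#) (λ _ → 1ℚ))) (N-cong f' (λ χ _ → sym (link-const 1ℚ)))) ⟩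
      uₚ *ℚ (K# *ℚ N f' (λ χ → 1ℚ +ℚ t *ℚ ∑ vertices λ w → does (child? f r w) ▸ 1ℚ))
        ≡⟨ cong (uₚ *ℚ_) (del-sum t (ℕtoℚ (κ ∸ degree f p)) (λ _ → 1ℚ) t-free
             (λ χ pr → free-degree rk χ pr p (ℕₚ.<⇒≤ dₚ)) (λ _ _ _ → refl)) ⟩
      uₚ *ℚ (ℕtoℚ (κ ∸ degree f p) *ℚ N f (λ _ → 1ℚ))
        ≡⟨ trans (sym (ℚₚ.*-assoc uₚ _ _)) (trans (cong (_*ℚ N f (λ _ → 1ℚ)) (frac-* 1 (κ ∸ degree f p))) (ℚₚ.*-identityˡ _)) ⟩
      N f (λ _ → 1ℚ) ∎
      where open ≡-Reasoning

    link-weight : ℚ → ℚ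
    link-weight w = w *ℚ (uₚ *ℚ (K# *ℚ (t *ℚ K#)))

    link-weight-* : ∀ w x → w *ℚ (uₚ *ℚ (K# *ℚ (t *ℚ K# *ℚ x))) ≡ link-weight w *ℚ x
    link-weight-* w x = assoc w uₚ K# (t *ℚ K#) x

    insertR-N : ∀ {Φ} (U : Unif Φ f) (G : State → State → ℚ) (H : Colouring → Colouring → ℚ) →
      (∀ s χ → Proper f χ → s ≗ paint f χ → Spec f' (G s) (H χ)) →
      (∀ χ β χ' → Proper f χ → H (χ [ r ]≔ β) χ' ≡ H χ χ') →
      Φ (λ s → expect (insertR s p r) (G s)) ≡
      Unif.weight U *ℚ (uₚ *ℚ (K# *ℚ N f' (λ χ → H χ χ +ℚ t *ℚ ∑ vertices λ w → does (child? f r w) ▸ H (ψ (lookup χ w) (lookup χ r) χ) χ)))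
    insertR-N U G H sp H-inv = trans
      (Unif.expectation U _ _ (λ s χ pr s≗ → insertR-eval (G s) (H χ) (sp s χ pr s≗) s χ pr s≗))
      (cong (Unif.weight U *ℚ_) (trans (N-* f uₚ _) (cong (uₚ *ℚ_) (ins-sum t H H-inv))))

    unif-insertR : ∀ {Φ} → Unif Φ f → Unif (λ G → Φ (λ s → expect (insertR s p r) G)) f'
    unif-insertR U = record
      { weight = link-weight weight
      ; mass = trans (sym (link-weight-* weight _)) (trans (cong (weight *ℚ_) count-link) mass)
      ; expectation = λ g h sp → trans (insertR-N U (λ _ → g) (λ _ → h) (λ _ _ _ _ → sp) (λ _ _ _ _ → refl))
          (trans (cong (λ z → weight *ℚ (uₚ *ℚ (K# *ℚ z))) (trans (N-cong f' (λ χ _ → link-const (h χ))) (N-* f' (t *ℚ K#) h)))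
                 (link-weight-* weight (N f' h)))
      }
      where open Unif U

    ℓ : ℕ
    ℓ = length (children f r)

    ℓ-degree : ℓ ≡ degree f r
    ℓ-degree = sym (degree-root f r fr)

    stay : ℚ
    stay = frac (κ ∸ ℓ) κ

    -- The stopping probability is designed for this. A deletion keeps the colouring with weight
    -- `(κ - ℓ) / κ` and recolours each given child with weight `1 / κ`; the ratio is `t`, the one
    -- that `link-sum` requires.
    stay-t : stay *ℚ t ≡ frac 1 κ
    stay-t = trans (cong (λ z → frac (κ ∸ z) κ *ℚ t) ℓ-degree) (frac-mul (κ ∸ degree f r) κ)

    frac-κ : frac 1 κ *ℚ K# ≡ 1ℚ
    frac-κ = frac-* 1 κ

    move-sum : ∀ (h : V → ℚ) → frac ℓ κ *ℚ (frac 1 ℓ *ℚ ∑ vertices (λ w → does (child? f r w) ▸ h w))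
      ≡ frac 1 κ *ℚ ∑ vertices (λ w → does (child? f r w) ▸ h w)
    move-sum h = go (children f r) refl
      where
      Σw = ∑ vertices (λ w → does (child? f r w) ▸ h w)
      go : ∀ l → children f r ≡ l → frac ℓ κ *ℚ (frac 1 ℓ *ℚ Σw) ≡ frac 1 κ *ℚ Σw
      -- Without children `frac 1 ℓ` takes its default value `0ℚ` rather than an inverse, but both
      -- sides vanish since the sum is empty.
      go [] e = trans (cong (λ z → frac ℓ κ *ℚ (frac 1 ℓ *ℚ z)) Σ0) (trans (trans (cong (frac ℓ κ *ℚ_) (ℚₚ.*-zeroʳ (frac 1 ℓ))) (ℚₚ.*-zeroʳ (frac ℓ κ)))
          (sym (trans (cong (frac 1 κ *ℚ_) Σ0) (ℚₚ.*-zeroʳ (frac 1 κ)))))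
        where
        Σ0 : Σw ≡ 0ℚ
        Σ0 = trans (sym (∑-children-shape f r h)) (cong (λ l → ∑ l h) e)
      go (x ∷ l) e = trans (sym (ℚₚ.*-assoc (frac ℓ κ) (frac 1 ℓ) Σw)) (cong (_*ℚ Σw)
          (trans (cong (λ z → frac z κ *ℚ frac 1 z) (cong length e)) (frac-mul (suc (length l)) κ)))

    deleteR-N : ∀ {Φ} (U : Unif Φ f') (G : State → State → ℚ) (H : Colouring → Colouring → ℚ) →
      (∀ s χ → Proper f' χ → s ≗ paint f' χ → Spec f (G s) (H χ)) → ∀ q →
      Φ (λ s → expect (deleteR s q r) (G s)) ≡ Unif.weight U *ℚ N f' (λ χ → stay *ℚ H χ χ +ℚ
        frac 1 κ *ℚ ∑ vertices λ w → does (child? f r w) ▸ H χ (ψ (lookup χ w) (lookup χ r) χ))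
    deleteR-N U G H sp q = Unif.expectation U _ _ (λ s χ pr s≗ → trans
      (deleteR-eval (G s) (H χ) (sp s χ pr s≗) s χ pr s≗ q)
      (cong (stay *ℚ H χ χ +ℚ_) (move-sum (λ w → H χ (ψ (lookup χ w) (lookup χ r) χ)))))

    -- Vectors that differ only in the spare entry at `r` paint the same state, so any `h` that
    -- describes a function of states must agree on them.
    spec-inv : ∀ {g h} → Spec f g h → ∀ χ β → Proper f χ → h (χ [ r ]≔ β) ≡ h χ
    spec-inv {g} {h} sp χ β pr = trans (sym (sp (paint f χ) (χ [ r ]≔ β) (resample-proper χ β pr)
      (paint-resp {f} {χ} {χ [ r ]≔ β} (λ v nr → sym (resample-inc χ β (inj₁ (refl , nr))))))) (sp (paint f χ) χ pr (λ _ → refl))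

    unif-deleteR : ∀ {Φ} → Unif Φ f' → ∀ q → Unif (λ G → Φ (λ s → expect (deleteR s q r) G)) f
    unif-deleteR {Φ} U q = record
      { weight = w₀
      -- The deletion kernel has total mass one. Evaluating the constant 1 through it in two ways
      -- normalises `w₀` without counting colourings.
      ; mass = trans (sym (trans (deleteR-N U (λ _ _ → 1ℚ) (λ _ _ → 1ℚ) (λ _ _ _ _ _ _ _ _ → refl) q) (unlinked (λ _ → 1ℚ) (λ _ _ _ → refl))))
          (trans (deleteR-N U (λ _ _ → 1ℚ) (λ _ _ → 1ℚ) (λ _ _ _ _ _ _ _ _ → refl) q)
            (trans (cong (weight *ℚ_) (N-cong f' (λ _ _ → total))) mass))
      ; expectation = λ g h sp → trans (deleteR-N U (λ _ → g) (λ _ → h) (λ _ _ _ _ → sp) q) (unlinked h (spec-inv sp))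
      }
      where
      open Unif U
      open ≡-Reasoning
      aₚ = ℕtoℚ (κ ∸ degree f p)
      w₀ = weight *ℚ (stay *ℚ (frac 1 κ *ℚ aₚ))
      total : stay *ℚ 1ℚ +ℚ frac 1 κ *ℚ ∑ vertices (λ w → does (child? f r w) ▸ 1ℚ) ≡ 1ℚ
      total = begin
        stay *ℚ 1ℚ +ℚ frac 1 κ *ℚ ∑ vertices (λ w → does (child? f r w) ▸ 1ℚ)
          ≡⟨ cong (λ z → stay *ℚ 1ℚ +ℚ z *ℚ ∑ vertices (λ w → does (child? f r w) ▸ 1ℚ)) (sym stay-t) ⟩
        stay *ℚ 1ℚ +ℚ stay *ℚ t *ℚ ∑ vertices (λ w → does (child? f r w) ▸ 1ℚ)
          ≡⟨ factorˡ stay t (∑ vertices (λ w → does (child? f r w) ▸ 1ℚ)) 1ℚ ⟩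
        stay *ℚ (1ℚ +ℚ t *ℚ ∑ vertices (λ w → does (child? f r w) ▸ 1ℚ))
          ≡⟨ cong (stay *ℚ_) (link-const 1ℚ) ⟩
        stay *ℚ (t *ℚ K# *ℚ 1ℚ)
          ≡⟨ trans (cong (stay *ℚ_) (ℚₚ.*-identityʳ (t *ℚ K#))) (sym (ℚₚ.*-assoc stay t K#)) ⟩
        stay *ℚ t *ℚ K#
          ≡⟨ trans (cong (_*ℚ K#) stay-t) frac-κ ⟩
        1ℚ ∎
      unlinked : ∀ h → (∀ χ β → Proper f χ → h (χ [ r ]≔ β) ≡ h χ) →
        weight *ℚ N f' (λ χ → stay *ℚ h χ +ℚ frac 1 κ *ℚ ∑ vertices λ w → does (child? f r w) ▸ h (ψ (lookup χ w) (lookup χ r) χ))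
        ≡ w₀ *ℚ N f h
      unlinked h h-inv = begin
        weight *ℚ N f' (λ χ → stay *ℚ h χ +ℚ frac 1 κ *ℚ S χ)
          ≡⟨ cong (weight *ℚ_) (trans (N-cong f' (λ χ _ → trans (cong (λ z → stay *ℚ h χ +ℚ z *ℚ S χ) (sym stay-t))
               (factorˡ stay t (S χ) (h χ)))) (N-* f' stay _)) ⟩
        weight *ℚ (stay *ℚ X)
          ≡⟨ cong (λ z → weight *ℚ (stay *ℚ z)) (sym (trans (sym (ℚₚ.*-assoc (frac 1 κ) K# X)) (trans (cong (_*ℚ X) frac-κ) (ℚₚ.*-identityˡ X)))) ⟩
        weight *ℚ (stay *ℚ (frac 1 κ *ℚ (K# *ℚ X)))
          ≡⟨ cong (λ z → weight *ℚ (stay *ℚ (frac 1 κ *ℚ z))) (del-sum t aₚ h t-free (λ χ pr → free-degree rk χ pr p (ℕₚ.<⇒≤ dₚ)) h-inv) ⟩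
        weight *ℚ (stay *ℚ (frac 1 κ *ℚ (aₚ *ℚ N f h)))
          ≡⟨ assoc weight stay (frac 1 κ) aₚ (N f h) ⟩
        w₀ *ℚ N f h ∎
        where
        S : Colouring → ℚ
        S χ = ∑ vertices λ w → does (child? f r w) ▸ h (ψ (lookup χ w) (lookup χ r) χ)
        X : ℚ
        X = N f' (λ χ → h χ +ℚ t *ℚ S χ)

    -- Probability that a vertex lies on the recoloured path

    module Prob where

      κ-1 : ∀ (x : Fin κ) → ∑ colours (λ a → does (¬? (x ≟F a)) ▸ 1ℚ) ≡ ℕtoℚ (κ ∸ 1)
      κ-1 x = +ℚ-cancelʳ 1ℚ _ _ (begin
        ∑ colours (λ a → does (¬? (x ≟F a)) ▸ 1ℚ) +ℚ 1ℚ
          ≡⟨ cong (∑ colours (λ a → does (¬? (x ≟F a)) ▸ 1ℚ) +ℚ_) (sym (∑-δ κ x (λ _ → 1ℚ))) ⟩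
        ∑ colours (λ a → does (¬? (x ≟F a)) ▸ 1ℚ) +ℚ ∑ colours (λ a → does (x ≟F a) ▸ 1ℚ)
          ≡⟨ sym (∑-+ colours _ _) ⟩
        ∑ colours (λ a → (does (¬? (x ≟F a)) ▸ 1ℚ) +ℚ (does (x ≟F a) ▸ 1ℚ))
          ≡⟨ ∑-cong colours (λ a → either (does (x ≟F a))) ⟩
        ∑ colours (λ _ → 1ℚ)
          ≡⟨ trans (∑-length colours) (cong ℕtoℚ (length-allFin κ)) ⟩
        ℕtoℚ κ
          ≡⟨ trans (cong ℕtoℚ (sym (ℕₚ.m∸n+n≡m (ℕ.>-nonZero⁻¹ κ)))) (ℕtoℚ-+ (κ ∸ 1) 1) ⟩
        ℕtoℚ (κ ∸ 1) +ℚ 1ℚ ∎)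
        where
        open ≡-Reasoning
        either : ∀ b → (not b ▸ 1ℚ) +ℚ (b ▸ 1ℚ) ≡ 1ℚ
        either true  = refl
        either false = refl

      -- In a proper colouring of the linked forest no child of `r` has the colour of the new edge,
      -- so this component starts with the single edge to `w` and is a path: the one recoloured when
      -- `w` is chosen.
      Path : V → Colouring → V → Set
      Path w χ v = K f r (Ab χ (lookup χ w) (lookup χ r)) v

      path? : ∀ w χ v → Dec (Path w χ v)
      path? w χ v = kempe? (lookup χ w) (lookup χ r) χ v

      module _ (χ : Colouring) (pr : Proper f' χ) where

        child-≢ : ∀ {w} → f w ≡ just (r , tt) → lookup χ w ≢ lookup χ r
        child-≢ wr e = nonRoot-≢ wr (pr r _ r (inj₂ (trans (f'-other (nonRoot-≢ wr)) wr)) (inj₁ (refl , _ , f'-r)) e)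

        path-top : ∀ {w v} → f w ≡ just (r , tt) → f v ≡ just (r , tt) → Path w χ v → w ≡ v
        path-top wr vr k with K-holds k
        ... | inj₁ e = sym (proj₁ (Proper-lower χ pr) r _ _ (inj₂ vr) (inj₂ wr) e)
        ... | inj₂ e = contradiction e (child-≢ vr)

        parent-≢ : ∀ {v q} → f v ≡ just (q , tt) → (∃ λ x → f q ≡ just x) → lookup χ v ≢ lookup χ q
        parent-≢ {v} {q} vq nr e = par-irrefl rk (subst (λ z → f z ≡ just (q , tt)) (proj₁ (Proper-lower χ pr) q v q (inj₂ vq) (inj₁ (refl , nr)) e) vq)

        module _ {w v q : V} (wr : f w ≡ just (r , tt)) (vq : f v ≡ just (q , tt)) (q≢r : q ≢ r) where

          path-up : Path w χ v → Path w χ q × lookup χ v ≡ tr (lookup χ w) (lookup χ r) (lookup χ q)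
          path-up k with K-elim vq k
          ... | inj₁ q≡r = contradiction q≡r q≢r
          ... | inj₂ kq = kq , other (K-holds k) (K-holds kq)
            where
            other : Ab χ (lookup χ w) (lookup χ r) v → Ab χ (lookup χ w) (lookup χ r) q → lookup χ v ≡ tr (lookup χ w) (lookup χ r) (lookup χ q)
            other (inj₁ a) (inj₁ b) = contradiction (trans a (sym b)) (parent-≢ vq (K-edge kq))
            other (inj₂ a) (inj₂ b) = contradiction (trans a (sym b)) (parent-≢ vq (K-edge kq))
            other (inj₁ a) (inj₂ b) = trans a (sym (trans (cong (tr (lookup χ w) (lookup χ r)) b) (tr-snd (lookup χ w) (lookup χ r))))
            other (inj₂ a) (inj₁ b) = trans a (sym (trans (cong (tr (lookup χ w) (lookup χ r)) b) (tr-fst (lookup χ w) (lookup χ r))))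

          path-down : Path w χ q × lookup χ v ≡ tr (lookup χ w) (lookup χ r) (lookup χ q) → Path w χ v
          path-down (kq , e) = there vq (subst (InPair (lookup χ w) (lookup χ r)) (sym e) (tr-pair (K-holds kq))) kq

      rank' : V → ℕ
      rank' = Ranked.rank rk'

      K-below : ∀ {Q v} → K f r Q v → Below f r v
      K-below = K-map (λ _ _ → tt)

      K-resp : ∀ {Q Q' : V → Set} {v} → (∀ x → rank' x ≤ rank' v → Q x → Q' x) → K f r Q v → K f r Q' v
      K-resp i (here e h) = here e (i _ ℕₚ.≤-refl h)
      K-resp i (there e h k) = there e (i _ ℕₚ.≤-refl h)
        (K-resp (λ x l → i x (ℕₚ.≤-trans l (ℕₚ.<⇒≤ (Ranked.rank-par rk' (trans (f'-other (nonRoot-≢ e)) e))))) k)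

      below-rank' : ∀ {v} → Below f r v → rank' r < rank' v
      below-rank' (here e _)    = Ranked.rank-par rk' (trans (f'-other (nonRoot-≢ e)) e)
      below-rank' (there e _ k) = ℕₚ.<-trans (below-rank' k) (Ranked.rank-par rk' (trans (f'-other (nonRoot-≢ e)) e))

      module Rotate {w v q : V} (wr : f w ≡ just (r , tt)) (vq : f v ≡ just (q , tt)) (q≢r : q ≢ r) (bq : Below f r q) where
        module S' = Swap rk' q

        -- Of the two colours on the path, the one that the edge above `q` does not have: a child of
        -- `q` continues the path exactly if it carries this colour.
        o : Colouring → Fin κ
        o χ = tr (lookup χ w) (lookup χ r) (lookup χ q)

        rot : Fin κ → Colouring → Colouring
        rot a χ = S'.ψ a (o χ) χ

        vq' : f' v ≡ just (q , tt)
        vq' = trans (f'-other (nonRoot-≢ vq)) vq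

        rot-q : ∀ a χ → lookup (rot a χ) q ≡ lookup χ q
        rot-q a χ = S'.ψ-self a (o χ) χ

        rot-above : ∀ a χ {x} → rank' x ≤ rank' q → lookup (rot a χ) x ≡ lookup χ x
        rot-above a χ = S'.ψ-rank a (o χ) χ

        rot-r : ∀ a χ → lookup (rot a χ) r ≡ lookup χ r
        rot-r a χ = rot-above a χ (ℕₚ.<⇒≤ (below-rank' bq))

        rot-w : ∀ a χ → lookup (rot a χ) w ≡ lookup χ w
        -- If the child `w` of `r` were below `q`, then `r` would be `q` or lie below `q`, against
        -- the ranks.
        rot-w a χ = S'.ψ-out a (o χ) χ λ k → case K-elim (trans (f'-other (nonRoot-≢ wr)) wr) k of
          λ { (inj₁ r≡q) → q≢r (sym r≡q) ; (inj₂ k') → ℕₚ.<-asym (K-rank rk' k') (below-rank' bq) }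

        rot-o : ∀ a χ → o (rot a χ) ≡ o χ
        rot-o a χ rewrite rot-w a χ | rot-r a χ | rot-q a χ = refl

        rot-involutive : ∀ a χ → rot a (rot a χ) ≡ χ
        rot-involutive a χ = trans (cong (λ z → S'.ψ a z (rot a χ)) (rot-o a χ)) (S'.ψ-involutive a (o χ) χ)

        Ab-eq : ∀ {a b a' b' x y : Fin κ} → a ≡ a' → b ≡ b' → x ≡ y → InPair a b x → InPair a' b' y
        Ab-eq refl refl refl p = p

        path-rot : ∀ a χ → Path w χ q → Path w (rot a χ) q
        path-rot a χ = K-resp (λ x l → Ab-eq (sym (rot-w a χ)) (sym (rot-r a χ)) (sym (rot-above a χ l)))

        path-rot⁻ : ∀ a χ → Path w (rot a χ) q → Path w χ q
        path-rot⁻ a χ = K-resp (λ x l → Ab-eq (rot-w a χ) (rot-r a χ) (rot-above a χ l))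

        A B : Fin κ → Colouring → Set
        A a χ = Proper f' χ × lookup χ q ≢ a × Path w χ q × lookup χ v ≡ o χ
        B a χ = Proper f' χ × lookup χ q ≢ a × Path w χ q × lookup χ v ≡ a

        a? : ∀ a χ → Dec (A a χ)
        a? a χ = proper? f' χ ×-dec (¬? (lookup χ q ≟F a) ×-dec (path? w χ q ×-dec (lookup χ v ≟F o χ)))

        b? : ∀ a χ → Dec (B a χ)
        b? a χ = proper? f' χ ×-dec (¬? (lookup χ q ≟F a) ×-dec (path? w χ q ×-dec (lookup χ v ≟F a)))

        avoids : ∀ a χ → Proper f' χ → lookup χ q ≢ a → Path w χ q → ¬ Ab χ a (o χ) q
        avoids a χ pr qa k (inj₁ e) = qa e
        avoids a χ pr qa k (inj₂ e) = tr-moves (child-≢ χ pr wr) (K-holds k) (sym e)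

        B⇒A : ∀ a χ → B a χ → A a (rot a χ)
        B⇒A a χ (pr , qa , k , va) =
          S'.ψ-proper a (o χ) χ (inj₂ (avoids a χ pr qa k)) pr , (λ e → qa (trans (sym (rot-q a χ)) e)) , path-rot a χ k ,
          trans (S'.ψ-child a (o χ) χ vq') (trans (cong (tr a (o χ)) va) (trans (tr-fst a (o χ)) (sym (rot-o a χ))))

        A⇒B : ∀ a χ → A a (rot a χ) → B a χ
        A⇒B a χ (pr , qa , k , vo) =
          subst (Proper f') (rot-involutive a χ) (S'.ψ-proper a (o (rot a χ)) (rot a χ) (inj₂ (avoids a (rot a χ) pr qa k)) pr) ,
          (λ e → qa (trans (rot-q a χ) e)) , path-rot⁻ a χ k ,
          tr-injective a (o χ) (trans (trans (sym (S'.ψ-child a (o χ) χ vq')) (trans vo (rot-o a χ))) (sym (tr-fst a (o χ))))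

        nested : ∀ a χ (b : Bool) → (does (proper? f' χ) ∧ (does (¬? (lookup χ q ≟F a)) ∧ (does (path? w χ q) ∧ b))) ▸ 1ℚ
          ≡ does (proper? f' χ) ▸ does (¬? (lookup χ q ≟F a)) ▸ does (path? w χ q) ▸ b ▸ 1ℚ
        nested a χ b = trans (▸-∧ (does (proper? f' χ)) _ 1ℚ) (cong (does (proper? f' χ) ▸_)
          (trans (▸-∧ (does (¬? (lookup χ q ≟F a))) _ 1ℚ) (cong (does (¬? (lookup χ q ≟F a)) ▸_) (▸-∧ (does (path? w χ q)) b 1ℚ))))

        -- Once the path has reached `q`, the edge above its child `v` is equally likely to have
        -- each of the `κ ∸ 1` colours other than that of `q`. For every such `a` the involution
        -- `rot a`, an exchange of `a` and `o χ` below `q`, matches the colourings in which `v` has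
        -- colour `o χ` with those in which it has colour `a`. The path down to `q` is not affected.
        step : ℕtoℚ (κ ∸ 1) *ℚ N f' (λ χ → does (path? w χ v) ▸ 1ℚ) ≡ N f' (λ χ → does (path? w χ q) ▸ 1ℚ)
        step = begin
          ℕtoℚ (κ ∸ 1) *ℚ N f' (λ χ → does (path? w χ v) ▸ 1ℚ)
            ≡⟨ sym (N-* f' (ℕtoℚ (κ ∸ 1)) _) ⟩
          N f' (λ χ → ℕtoℚ (κ ∸ 1) *ℚ (does (path? w χ v) ▸ 1ℚ))
            ≡⟨ N-cong f' (λ χ pr → trans (cong₂ _*ℚ_ (sym (κ-1 (lookup χ q)))
                 (trans (cong (_▸ 1ℚ) (does-iff (path? w χ v) (path? w χ q ×-dec (lookup χ v ≟F o χ)) (path-up χ pr wr vq q≢r) (path-down χ pr wr vq q≢r)))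
                        (▸-∧ (does (path? w χ q)) _ 1ℚ)))
                 (trans (sym (∑-*ʳ colours _ _)) (∑-cong colours λ a → trans (▸-*ʳ (does (¬? (lookup χ q ≟F a))) 1ℚ _)
                   (cong (does (¬? (lookup χ q ≟F a)) ▸_) (ℚₚ.*-identityˡ _))))) ⟩
          N f' (λ χ → ∑ colours λ a → does (¬? (lookup χ q ≟F a)) ▸ does (path? w χ q) ▸ does (lookup χ v ≟F o χ) ▸ 1ℚ)
            ≡⟨ N-∑ f' colours _ ⟩
          ∑ colours (λ a → ∑ colourings λ χ → does (proper? f' χ) ▸ does (¬? (lookup χ q ≟F a)) ▸ does (path? w χ q) ▸ does (lookup χ v ≟F o χ) ▸ 1ℚ)
            ≡⟨ ∑-cong colours (λ a → ∑-cong colourings λ χ → sym (nested a χ (does (lookup χ v ≟F o χ)))) ⟩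
          ∑ colours (λ a → ∑ colourings λ χ → does (a? a χ) ▸ 1ℚ)
            ≡⟨ ∑-cong colours (λ a → sym (∑-colourings-involution (rot a) (rot-involutive a) _)) ⟩
          ∑ colours (λ a → ∑ colourings λ χ → does (a? a (rot a χ)) ▸ 1ℚ)
            ≡⟨ ∑-cong colours (λ a → ∑-cong colourings λ χ → cong (_▸ 1ℚ) (does-iff (a? a (rot a χ)) (b? a χ) (A⇒B a χ) (B⇒A a χ))) ⟩
          ∑ colours (λ a → ∑ colourings λ χ → does (b? a χ) ▸ 1ℚ)
            ≡⟨ ∑-cong colours (λ a → ∑-cong colourings λ χ → nested a χ (does (lookup χ v ≟F a))) ⟩
          ∑ colours (λ a → N f' λ χ → does (¬? (lookup χ q ≟F a)) ▸ does (path? w χ q) ▸ does (lookup χ v ≟F a) ▸ 1ℚ)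
            ≡⟨ sym (N-∑ f' colours _) ⟩
          N f' (λ χ → ∑ colours λ a → does (¬? (lookup χ q ≟F a)) ▸ does (path? w χ q) ▸ does (lookup χ v ≟F a) ▸ 1ℚ)
            ≡⟨ N-cong f' (λ χ pr → trans (∑-cong colours λ a → trans (cong (does (¬? (lookup χ q ≟F a)) ▸_) (▸-comm (does (path? w χ q)) (does (lookup χ v ≟F a)) 1ℚ))
                   (▸-comm (does (¬? (lookup χ q ≟F a))) (does (lookup χ v ≟F a)) (does (path? w χ q) ▸ 1ℚ)))
                 (trans (∑-δ κ (lookup χ v) (λ a → does (¬? (lookup χ q ≟F a)) ▸ does (path? w χ q) ▸ 1ℚ))
                   (▸-yes (¬? (lookup χ q ≟F lookup χ v)) (does (path? w χ q) ▸ 1ℚ) (λ e → parent-≢ χ pr vq (K-edge bq) (sym e))))) ⟩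
          N f' (λ χ → does (path? w χ q) ▸ 1ℚ) ∎
          where open ≡-Reasoning

      hits : V → ℚ
      hits v = N f' λ χ → ∑ vertices λ w → does (child? f r w) ▸ does (path? w χ v) ▸ 1ℚ

      hits-∑ : ∀ v → hits v ≡ ∑ vertices (λ w → does (child? f r w) ▸ N f' λ χ → does (path? w χ v) ▸ 1ℚ)
      hits-∑ v = trans (N-∑ f' vertices _) (∑-cong vertices λ w → N-▸ f' (does (child? f r w)) _)

      hits-0 : ∀ {v} → ¬ Below f r v → hits v ≡ 0ℚ
      hits-0 {v} ¬b = N-0 f' (λ χ _ → trans (∑-cong vertices λ w → ▸-zero? (child? f r w) λ _ →
        ▸-no (path? w χ v) 1ℚ (¬b ∘ K-below)) (∑-0 vertices))

      hits-top : ∀ {v} → f v ≡ just (r , tt) → hits v ≡ N f' (λ _ → 1ℚ)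
      hits-top {v} vr = N-cong f' (λ χ pr → trans
        (enum-allFin n v _ (λ w w≢v → ▸-zero? (child? f r w) λ wr → ▸-no (path? w χ v) 1ℚ (λ k → w≢v (path-top χ pr wr vr k))))
        (trans (▸-yes (child? f r v) _ vr) (▸-yes (path? v χ v) 1ℚ (here vr (inj₁ refl)))))

      inv : ℚ
      inv = frac 1 (κ ∸ 1)

      hits-step : NonZero (κ ∸ 1) → ∀ {v q} → f v ≡ just (q , tt) → q ≢ r → hits v ≡ inv *ℚ hits q
      hits-step nz {v} {q} vq q≢r = cases (K? rk (λ _ → yes tt) q)
        where
        cases : Dec (Below f r q) → hits v ≡ inv *ℚ hits q
        cases (no ¬b) = trans (hits-0 λ b → case K-elim vq b of λ { (inj₁ e) → q≢r e ; (inj₂ b') → ¬b b' })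
          (sym (trans (cong (inv *ℚ_) (hits-0 ¬b)) (ℚₚ.*-zeroʳ inv)))
        cases (yes b) = trans (hits-∑ v) (trans (∑-cong vertices λ w → trans (▸-cong? (child? f r w) (λ wr → at w wr))
            (sym (▸-*ˡ (does (child? f r w)) inv _))) (trans (∑-*ˡ vertices inv _) (cong (inv *ℚ_) (sym (hits-∑ q)))))
          where
          at : ∀ w → f w ≡ just (r , tt) → N f' (λ χ → does (path? w χ v) ▸ 1ℚ) ≡ inv *ℚ N f' (λ χ → does (path? w χ q) ▸ 1ℚ)
          at w wr = sym (trans (cong (inv *ℚ_) (sym (Rotate.step wr vq q≢r b))) (trans (sym (ℚₚ.*-assoc inv _ _))
            (trans (cong (_*ℚ N f' (λ χ → does (path? w χ v) ▸ 1ℚ)) (frac-* 1 (κ ∸ 1) {{nz}})) (ℚₚ.*-identityˡ _))))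

      wt-nothing : ∀ {k v} → f' v ≡ nothing → wt f' r (suc k) v ≡ 0ℚ
      wt-nothing e rewrite e = refl

      wt-just : ∀ {k v q} → f' v ≡ just (q , tt) → wt f' r (suc k) v ≡ (if does (q ≟F r) then 1ℚ else inv *ℚ wt f' r k q)
      wt-just e rewrite e = refl

      hits-wt : NonZero (κ ∸ 1) → ∀ k v → rank' v < k → hits v ≡ wt f' r k v *ℚ N f' (λ _ → 1ℚ)
      hits-wt nz (suc k) v (s≤s l) = cases (f' v) refl
        where
        N₁ = N f' (λ _ → 1ℚ)
        deep : ∀ {q} → f' v ≡ just (q , tt) → q ≢ r → hits v ≡ inv *ℚ hits q → hits v ≡ wt f' r (suc k) v *ℚ N₁
        deep {q} e q≢r h = trans h (trans (cong (inv *ℚ_) (hits-wt nz k q (ℕₚ.<-≤-trans (Ranked.rank-par rk' e) l)))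
          (trans (sym (ℚₚ.*-assoc inv (wt f' r k q) N₁))
            (cong (_*ℚ N₁) (sym (trans (wt-just {k} e) (cong (λ b → if b then 1ℚ else inv *ℚ wt f' r k q) (dec-false (q ≟F r) q≢r)))))))
        cases : ∀ m → f' v ≡ m → hits v ≡ wt f' r (suc k) v *ℚ N₁
        cases nothing e = trans (hits-0 λ b → case trans (sym e) (trans (f'-other (λ { refl → K-irrefl rk b })) (proj₂ (K-edge b))) of λ ())
          (sym (trans (cong (_*ℚ N₁) (wt-nothing {k} e)) (ℚₚ.*-zeroˡ N₁)))
        cases (just (q , tt)) e = here? (v ≟F r) (q ≟F r)
          where
          here? : Dec (v ≡ r) → Dec (q ≡ r) → hits v ≡ wt f' r (suc k) v *ℚ N₁
          -- At `v = r` both sides vanish: the climb continues to `p`, which is not below `r`.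
          here? (yes refl) _ = deep e (λ q≡r → p≢r (trans (par-unique f'-r e) q≡r))
            (trans (hits-0 (K-irrefl rk)) (sym (trans (cong (inv *ℚ_) (hits-0 (subst (¬_ ∘ Below f r) (par-unique f'-r e) ¬below))) (ℚₚ.*-zeroʳ inv))))
          here? (no v≢r) (yes refl) = trans (hits-top (trans (sym (f'-other v≢r)) e)) (sym (trans (cong (_*ℚ N₁)
            (trans (wt-just {k} e) (cong (λ b → if b then 1ℚ else inv *ℚ wt f' r k q) (dec-true (q ≟F q) refl)))) (ℚₚ.*-identityˡ N₁)))
          here? (no v≢r) (no q≢r) = deep e q≢r (hits-step nz (trans (sym (f'-other v≢r)) e) q≢r)

      -- Exchanging the sums lets every vertex contribute its `hits`, and normalisation leaves its
      -- weight. The probability `1 / κ` that a given child is recoloured is supplied by the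
      -- callers.
      expected-path : NonZero (κ ∸ 1) → ∀ {Φ} (U : Unif Φ f') →
        Unif.weight U *ℚ N f' (λ χ → ∑ vertices λ w → does (child? f r w) ▸ ∑ vertices λ v → does (path? w χ v) ▸ 1ℚ)
        ≡ ∑ vertices (wt f' r n)
      expected-path nz U = trans (cong (weight *ℚ_) (trans rows sums)) (trans (exchange weight S (N f' (λ _ → 1ℚ)))
          (trans (cong (S *ℚ_) mass) (ℚₚ.*-identityʳ S)))
        where
        open Unif U
        S : ℚ
        S = ∑ vertices (wt f' r n)
        rows : N f' (λ χ → ∑ vertices λ w → does (child? f r w) ▸ ∑ vertices λ v → does (path? w χ v) ▸ 1ℚ) ≡ ∑ vertices hits
        rows = trans (N-cong f' λ χ _ → trans (∑-cong vertices λ w → sym (∑-▸ vertices (does (child? f r w)) (λ v → does (path? w χ v) ▸ 1ℚ)))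
            (∑-swap vertices vertices (λ w v → does (child? f r w) ▸ does (path? w χ v) ▸ 1ℚ)))
          (N-∑ f' vertices (λ v χ → ∑ vertices λ w → does (child? f r w) ▸ does (path? w χ v) ▸ 1ℚ))
        sums : ∑ vertices hits ≡ S *ℚ N f' (λ _ → 1ℚ)
        sums = trans (∑-cong vertices λ v → hits-wt nz n v (Ranked.rank-bound rk' v)) (∑-*ʳ vertices (N f' (λ _ → 1ℚ)) (wt f' r n))

-- Recourse

-- In an insertion the exchange at a given child has weight `t`, while the new uniform weight
-- contains `t * k`. The quotient, `1 / κ`, is the probability that this child was recoloured, the
-- same as in a deletion.
collect : ∀ k⁻¹ k w u t y → k⁻¹ *ℚ k ≡ 1ℚ → w *ℚ (u *ℚ (k *ℚ (t *ℚ y))) ≡ k⁻¹ *ℚ (w *ℚ (u *ℚ (k *ℚ (t *ℚ k))) *ℚ y)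
collect k⁻¹ k w u t y e = sym (trans (rearrange k⁻¹ k w u t y) (trans (cong (_*ℚ (w *ℚ (u *ℚ (k *ℚ (t *ℚ y))))) e) (ℚₚ.*-identityˡ _)))
  where
  rearrange : ∀ k⁻¹ k w u t y → k⁻¹ *ℚ (w *ℚ (u *ℚ (k *ℚ (t *ℚ k))) *ℚ y) ≡ k⁻¹ *ℚ k *ℚ (w *ℚ (u *ℚ (k *ℚ (t *ℚ y))))
  rearrange = solve 6 (λ i k w u t y → i :* (w :* (u :* (k :* (t :* k))) :* y) := i :* k :* (w :* (u :* (k :* (t :* y))))) refl
    where open +-*-Solver

module Recourse (n Δ c : ℕ) where
  open DistMaint n Δ c
  open Kempe n κ
  open Colourings n κ
  open Painting n Δ c
  open Steps n Δ c
  open Uniformity n Δ c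

  edgeColor-fst : ∀ s {u v a} → s u ≡ just (v , a) → edgeColor s u v ≡ just a
  edgeColor-fst s {u} {v} {a} e rewrite e with s v
  ... | nothing rewrite dec-true (v ≟F v) refl = refl
  ... | just _  rewrite dec-true (v ≟F v) refl = refl

  edgeColor-snd : ∀ s {u v b} → s v ≡ just (u , b) → (∀ a → s u ≢ just (v , a)) → edgeColor s u v ≡ just b
  edgeColor-snd s {u} {v} {b} e ne rewrite e with s u
  ... | nothing rewrite dec-true (u ≟F u) refl = refl
  ... | just (p , a) with p ≟F v
  ...   | yes refl = contradiction refl (ne a)
  ...   | no _ rewrite dec-true (u ≟F u) refl = refl

  edgeColor-none : ∀ s {u v} → (∀ a → s u ≢ just (v , a)) → (∀ b → s v ≢ just (u , b)) → edgeColor s u v ≡ nothing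
  edgeColor-none s {u} {v} nu nv with s u | s v
  ... | nothing      | nothing = refl
  ... | nothing      | just (q , b) with q ≟F u
  ...   | yes refl = contradiction refl (nv b)
  ...   | no _     = refl
  edgeColor-none s {u} {v} nu nv | just (p , a) | nothing with p ≟F v
  ...   | yes refl = contradiction refl (nu a)
  ...   | no _     = refl
  edgeColor-none s {u} {v} nu nv | just (p , a) | just (q , b) with p ≟F v
  ...   | yes refl = contradiction refl (nu a)
  ...   | no _ with q ≟F u
  ...     | yes refl = contradiction refl (nv b)
  ...     | no _     = refl

  changed-both : ∀ s t u v {a b} → edgeColor s u v ≡ just a → edgeColor t u v ≡ just b → changed s t u v ≡ not (eqᵇ a b)
  changed-both s t u v e e' rewrite e | e' = refl

  changed-none : ∀ s t u v → edgeColor s u v ≡ nothing ⊎ edgeColor t u v ≡ nothing → changed s t u v ≡ false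
  changed-none s t u v (inj₁ e) rewrite e = refl
  changed-none s t u v (inj₂ e) with edgeColor s u v
  ... | nothing = refl
  ... | just _ rewrite e = refl

  module Edges {f : Shape} (rk : Ranked f) {χ : Colouring} {s : State} (s≗ : s ≗ paint f χ) where

    read : ∀ {u v a} → s u ≡ just (v , a) → f u ≡ just (v , tt)
    read {u} e with f u in eq
    ... | nothing = case trans (sym e) (trans (s≗ u) (paint-nothing f χ eq)) of λ ()
    ... | just (q , tt) = cong (λ z → just (z , tt)) (par-unique (trans (s≗ u) (paint-just f χ eq)) e)

    antisym : ∀ {u v} → f u ≡ just (v , tt) → f v ≢ just (u , tt)
    antisym e e' = ℕₚ.<-asym (Ranked.rank-par rk e) (Ranked.rank-par rk e')

    edge-fst : ∀ {u v} → f u ≡ just (v , tt) → edgeColor s u v ≡ just (lookup χ u)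
    edge-fst e = edgeColor-fst s (trans (s≗ _) (paint-just f χ e))

    edge-snd : ∀ {u v} → f v ≡ just (u , tt) → edgeColor s u v ≡ just (lookup χ v)
    edge-snd e = edgeColor-snd s (trans (s≗ _) (paint-just f χ e)) (λ a e' → antisym e (read e'))

    edge-none : ∀ {u v} → f u ≢ just (v , tt) → f v ≢ just (u , tt) → edgeColor s u v ≡ nothing
    edge-none nu nv = edgeColor-none s (λ a e → nu (read e)) (λ b e → nv (read e))

  D : Shape → Colouring → Colouring → ℚ
  D f χ χ' = ∑ vertices λ v → does (nonRoot? f v) ▸ does (¬? (lookup χ v ≟F lookup χ' v)) ▸ 1ℚ

  <ᵇ-exclusive : ∀ (x y : V) → x ≢ y → ∀ z → ((toℕ x ℕ.<ᵇ toℕ y) ▸ z) +ℚ ((toℕ y ℕ.<ᵇ toℕ x) ▸ z) ≡ z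
  <ᵇ-exclusive x y x≢y z with ℕₚ.<-cmp (toℕ x) (toℕ y)
  ... | Tri.tri≈ _ e _ = contradiction (Fₚ.toℕ-injective e) x≢y
  ... | Tri.tri< l _ ¬g = trans (cong₂ _+ℚ_ (▸-yes (toℕ x ℕ.<? toℕ y) z l) (▸-no (toℕ y ℕ.<? toℕ x) z ¬g)) (ℚₚ.+-identityʳ z)
  ... | Tri.tri> ¬l _ g = trans (cong₂ _+ℚ_ (▸-no (toℕ x ℕ.<? toℕ y) z ¬l) (▸-yes (toℕ y ℕ.<? toℕ x) z g)) (ℚₚ.+-identityˡ z)

  module Count {f : Shape} (rk : Ranked f) (χ χ' : Colouring) (s t : State)
      (sf : ∀ {u v} → f u ≡ just (v , tt) → edgeColor s u v ≡ just (lookup χ u))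
      (ss : ∀ {u v} → f v ≡ just (u , tt) → edgeColor s u v ≡ just (lookup χ v))
      (tf : ∀ {u v} → f u ≡ just (v , tt) → edgeColor t u v ≡ just (lookup χ' u))
      (ts : ∀ {u v} → f v ≡ just (u , tt) → edgeColor t u v ≡ just (lookup χ' v))
      (none : ∀ {u v} → f u ≢ just (v , tt) → f v ≢ just (u , tt) → edgeColor s u v ≡ nothing ⊎ edgeColor t u v ≡ nothing) where

    d : V → ℚ
    d x = does (¬? (lookup χ x ≟F lookup χ' x)) ▸ 1ℚ

    changed-split : ∀ u v → changed s t u v ▸ 1ℚ ≡ (does (child? f v u) ▸ d u) +ℚ (does (child? f u v) ▸ d v)
    changed-split u v = cases (child? f v u) (child? f u v)
      where
      cases : Dec (f u ≡ just (v , tt)) → Dec (f v ≡ just (u , tt)) →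
        changed s t u v ▸ 1ℚ ≡ (does (child? f v u) ▸ d u) +ℚ (does (child? f u v) ▸ d v)
      cases (yes e) _ = trans (cong (_▸ 1ℚ) (changed-both s t u v (sf e) (tf e)))
        (sym (trans (cong₂ _+ℚ_ (▸-yes (child? f v u) (d u) e)
          (▸-no (child? f u v) (d v) (λ e' → ℕₚ.<-asym (Ranked.rank-par rk e) (Ranked.rank-par rk e')))) (ℚₚ.+-identityʳ (d u))))
      cases (no ¬e) (yes e) = trans (cong (_▸ 1ℚ) (changed-both s t u v (ss e) (ts e)))
        (sym (trans (cong₂ _+ℚ_ (▸-no (child? f v u) (d u) ¬e) (▸-yes (child? f u v) (d v) e)) (ℚₚ.+-identityˡ (d v))))
      cases (no ¬e) (no ¬e') = trans (cong (_▸ 1ℚ) (changed-none s t u v (none ¬e ¬e')))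
        (sym (trans (cong₂ _+ℚ_ (▸-no (child? f v u) (d u) ¬e) (▸-no (child? f u v) (d v) ¬e')) (ℚₚ.+-identityˡ 0ℚ)))

    parents : ∀ x y → ∑ vertices (λ q → does (child? f q x) ▸ y) ≡ does (nonRoot? f x) ▸ y
    parents x y = cases (nonRoot? f x)
      where
      cases : Dec (∃ λ q → f x ≡ just q) → ∑ vertices (λ q → does (child? f q x) ▸ y) ≡ does (nonRoot? f x) ▸ y
      cases (no ¬nr) = trans (trans (∑-cong vertices λ q → ▸-no (child? f q x) y (λ e → ¬nr (_ , e))) (∑-0 vertices)) (sym (▸-no (nonRoot? f x) y ¬nr))
      cases (yes ((q , tt) , e)) = trans (enum-allFin n q _ (λ q' q'≢q → ▸-no (child? f q' x) y (λ e' → q'≢q (par-unique e' e))))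
        (trans (▸-yes (child? f q x) y e) (sym (▸-yes (nonRoot? f x) y (_ , e))))

    -- `f` is the forest without `(p , r)`; that edge has a colour in only one of the two states and
    -- is never counted as changed. An edge of `f` occurs among the ordered pairs in either order,
    -- and exactly one order passes the test `<ᵇ`, so it is counted once, at its lower endpoint.
    recourse-D : ℕtoℚ (recourse s t) ≡ D f χ χ'
    recourse-D = begin
      ℕtoℚ (recourse s t)
        ≡⟨ length-filterᵇ _ (cartesianProduct vertices vertices) ⟩
      ∑ (cartesianProduct vertices vertices) (λ uv → ((toℕ (proj₁ uv) ℕ.<ᵇ toℕ (proj₂ uv)) ∧ changed s t (proj₁ uv) (proj₂ uv)) ▸ 1ℚ)
        ≡⟨ ∑-cartesian vertices vertices _ ⟩
      ∑ vertices (λ u → ∑ vertices λ v → ((toℕ u ℕ.<ᵇ toℕ v) ∧ changed s t u v) ▸ 1ℚ)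
        ≡⟨ ∑-cong vertices (λ u → trans (∑-cong vertices λ v → trans (▸-∧ (toℕ u ℕ.<ᵇ toℕ v) (changed s t u v) 1ℚ)
             (trans (cong ((toℕ u ℕ.<ᵇ toℕ v) ▸_) (changed-split u v)) (▸-+ (toℕ u ℕ.<ᵇ toℕ v) (does (child? f v u) ▸ d u) (does (child? f u v) ▸ d v))))
             (∑-+ vertices (λ v → X u v) (λ v → Y u v))) ⟩
      ∑ vertices (λ u → ∑ vertices (X u) +ℚ ∑ vertices (Y u))
        ≡⟨ ∑-+ vertices (λ u → ∑ vertices (X u)) (λ u → ∑ vertices (Y u)) ⟩
      ∑ vertices (λ u → ∑ vertices (X u)) +ℚ ∑ vertices (λ u → ∑ vertices (Y u))
        ≡⟨ cong (∑ vertices (λ u → ∑ vertices (X u)) +ℚ_) (∑-swap vertices vertices Y) ⟩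
      ∑ vertices (λ x → ∑ vertices (X x)) +ℚ ∑ vertices (λ x → ∑ vertices λ y → Y y x)
        ≡⟨ sym (∑-+ vertices (λ x → ∑ vertices (X x)) (λ x → ∑ vertices λ y → Y y x)) ⟩
      ∑ vertices (λ x → ∑ vertices (X x) +ℚ ∑ vertices λ y → Y y x)
        ≡⟨ ∑-cong vertices (λ x → trans (sym (∑-+ vertices (X x) (λ y → Y y x))) (∑-cong vertices (merge x))) ⟩
      ∑ vertices (λ x → ∑ vertices λ y → does (child? f y x) ▸ d x)
        ≡⟨ ∑-cong vertices (λ x → parents x (d x)) ⟩
      D f χ χ' ∎
      where
      open ≡-Reasoning
      X Y : V → V → ℚ
      X u v = (toℕ u ℕ.<ᵇ toℕ v) ▸ does (child? f v u) ▸ d u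
      Y u v = (toℕ u ℕ.<ᵇ toℕ v) ▸ does (child? f u v) ▸ d v
      merge : ∀ x y → X x y +ℚ Y y x ≡ does (child? f y x) ▸ d x
      merge x y = cases (child? f y x)
        where
        cases : Dec (f x ≡ just (y , tt)) → X x y +ℚ Y y x ≡ does (child? f y x) ▸ d x
        cases (yes e) = <ᵇ-exclusive x y (λ { refl → par-irrefl rk e }) (does (child? f y x) ▸ d x)
        cases (no ¬e) = trans (cong₂ _+ℚ_ (zero-▸ (toℕ x ℕ.<ᵇ toℕ y)) (zero-▸ (toℕ y ℕ.<ᵇ toℕ x)))
          (trans (ℚₚ.+-identityˡ 0ℚ) (sym (▸-no (child? f y x) (d x) ¬e)))
          where
          zero-▸ : ∀ b → b ▸ does (child? f y x) ▸ d x ≡ 0ℚ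
          zero-▸ true  = ▸-no (child? f y x) (d x) ¬e
          zero-▸ false = refl

  module RecourseLink {f : Shape} (rk : Ranked f) (p r : V) (fr : f r ≡ nothing) (p≢r : p ≢ r) (¬below : ¬ Below f r p)
      (rk' : Ranked (update f r (just (p , tt)))) (dₚ : degree f p < κ) (dᵣ : degree f r < κ) (nz : NonZero (κ ∸ 1)) where
    open Link rk p r fr p≢r ¬below
    open LinkSums n κ rk p r fr p≢r ¬below
    open Swap rk r
    open UnifLink rk p r fr p≢r ¬below rk' dₚ dᵣ
    open Prob

    recourse-link : ∀ {χ χ' s t} → s ≗ paint f χ → t ≗ paint f' χ' → ℕtoℚ (recourse s t) ≡ D f χ χ'
    recourse-link {χ} {χ'} {s} {t} s≗ t≗ = Count.recourse-D rk χ χ' s t Es.edge-fst Es.edge-snd (Et.edge-fst ∘ up) (Et.edge-snd ∘ up)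
        (λ nu nv → inj₁ (Es.edge-none nu nv))
      where
      module Es = Edges rk {χ} {s} s≗
      module Et = Edges rk' {χ'} {t} t≗
      up : ∀ {x q} → f x ≡ just (q , tt) → f' x ≡ just (q , tt)
      up e = trans (f'-other (nonRoot-≢ e)) e

    recourse-unlink : ∀ {χ χ' s t} → s ≗ paint f' χ → t ≗ paint f χ' → ℕtoℚ (recourse s t) ≡ D f χ χ'
    recourse-unlink {χ} {χ'} {s} {t} s≗ t≗ = Count.recourse-D rk χ χ' s t (Es.edge-fst ∘ up) (Es.edge-snd ∘ up) Et.edge-fst Et.edge-snd
        (λ nu nv → inj₂ (Et.edge-none nu nv))
      where
      module Es = Edges rk' {χ} {s} s≗
      module Et = Edges rk {χ'} {t} t≗
      up : ∀ {x q} → f x ≡ just (q , tt) → f' x ≡ just (q , tt)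
      up e = trans (f'-other (nonRoot-≢ e)) e

    D-refl : ∀ χ → D f χ χ ≡ 0ℚ
    D-refl χ = trans (∑-cong vertices λ v → ▸-zero? (nonRoot? f v) λ _ → ▸-no (¬? (lookup χ v ≟F lookup χ v)) 1ℚ (λ ne → ne refl)) (∑-0 vertices)

    D-sym : ∀ χ χ' → D f χ χ' ≡ D f χ' χ
    D-sym χ χ' = ∑-cong vertices λ v → cong (λ b → does (nonRoot? f v) ▸ b ▸ 1ℚ)
      (does-iff (¬? (lookup χ v ≟F lookup χ' v)) (¬? (lookup χ' v ≟F lookup χ v)) (_∘ sym) (_∘ sym))

    D-ψ : ∀ a b χ → a ≢ b → D f χ (ψ a b χ) ≡ ∑ vertices λ v → does (kempe? a b χ v) ▸ 1ℚ
    D-ψ a b χ a≢b = ∑-cong vertices λ v → trans (sym (▸-∧ (does (nonRoot? f v)) _ 1ℚ)) (cong (_▸ 1ℚ)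
      (does-iff (nonRoot? f v ×-dec ¬? (lookup χ v ≟F lookup (ψ a b χ) v)) (kempe? a b χ v)
        (λ (_ , ne) → inK v ne (kempe? a b χ v))
        (λ k → K-edge k , λ e → tr-moves a≢b (K-holds k) (trans (sym (ψ-in a b χ k)) (sym e)))))
      where
      inK : ∀ v → lookup χ v ≢ lookup (ψ a b χ) v → Dec (K f r (Ab χ a b) v) → K f r (Ab χ a b) v
      inK v ne (yes k) = k
      inK v ne (no ¬k) = contradiction (sym (ψ-out a b χ ¬k)) ne

    Y : Colouring → ℚ
    Y χ = ∑ vertices λ w → does (child? f r w) ▸ ∑ vertices λ v → does (path? w χ v) ▸ 1ℚ

    moved : ∀ χ → Proper f' χ → ∑ vertices (λ w → does (child? f r w) ▸ D f χ (ψ (lookup χ w) (lookup χ r) χ)) ≡ Y χ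
    moved χ pr = ∑-cong vertices λ w → ▸-cong? (child? f r w) λ wr → D-ψ (lookup χ w) (lookup χ r) χ (child-≢ χ pr wr)

    D-resample : ∀ χ β χ' → D f (χ [ r ]≔ β) χ' ≡ D f χ χ'
    D-resample χ β χ' = ∑-cong vertices λ v → ▸-cong? (nonRoot? f v) λ nr →
      cong (λ z → does (¬? (z ≟F lookup χ' v)) ▸ 1ℚ) (resample-inc χ β (inj₁ (refl , nr)))

    S : ℚ
    S = ∑ vertices (wt f' r n)

    expected-insertR : ∀ {Φ} (U : Unif Φ f) → Φ (λ s → expect (insertR s p r) (λ s' → ℕtoℚ (recourse s s'))) ≡ frac 1 κ *ℚ S
    expected-insertR U = trans (insertR-N U (λ s s' → ℕtoℚ (recourse s s')) (D f) (λ s χ pr s≗ t χ' pr' t≗ → recourse-link {χ} {χ'} s≗ t≗)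
        (λ χ β χ' _ → D-resample χ β χ'))
      (trans (cong (λ z → weight *ℚ (uₚ *ℚ (K# *ℚ z))) (trans (N-cong f' body) (N-* f' t Y)))
      (trans (collect (frac 1 κ) K# weight uₚ t (N f' Y) frac-κ) (cong (frac 1 κ *ℚ_) (expected-path nz (unif-insertR U)))))
      where
      open Unif U
      body : ∀ χ → Proper f' χ → D f χ χ +ℚ t *ℚ ∑ vertices (λ w → does (child? f r w) ▸ D f (ψ (lookup χ w) (lookup χ r) χ) χ) ≡ t *ℚ Y χ
      body χ pr = trans (cong (_+ℚ t *ℚ ∑ vertices (λ w → does (child? f r w) ▸ D f (ψ (lookup χ w) (lookup χ r) χ) χ)) (D-refl χ))
        (trans (ℚₚ.+-identityˡ _) (cong (t *ℚ_) (trans (∑-cong vertices λ w → cong (does (child? f r w) ▸_)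
          (D-sym (ψ (lookup χ w) (lookup χ r) χ) χ)) (moved χ pr))))

    expected-deleteR : ∀ {Φ} (U : Unif Φ f') q → Φ (λ s → expect (deleteR s q r) (λ s' → ℕtoℚ (recourse s s'))) ≡ frac 1 κ *ℚ S
    expected-deleteR U q = trans (deleteR-N U (λ s s' → ℕtoℚ (recourse s s')) (D f) (λ s χ pr s≗ t χ' pr' t≗ → recourse-unlink {χ} {χ'} s≗ t≗) q)
      (trans (cong (weight *ℚ_) (trans (N-cong f' body) (N-* f' (frac 1 κ) Y)))
      (trans (exchange weight (frac 1 κ) (N f' Y)) (cong (frac 1 κ *ℚ_) (expected-path nz U))))
      where
      open Unif U
      body : ∀ χ → Proper f' χ → stay *ℚ D f χ χ +ℚ frac 1 κ *ℚ ∑ vertices (λ w → does (child? f r w) ▸ D f χ (ψ (lookup χ w) (lookup χ r) χ)) ≡ frac 1 κ *ℚ Y χ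
      body χ pr = trans (cong (_+ℚ frac 1 κ *ℚ ∑ vertices (λ w → does (child? f r w) ▸ D f χ (ψ (lookup χ w) (lookup χ r) χ)))
          (trans (cong (stay *ℚ_) (D-refl χ)) (ℚₚ.*-zeroʳ stay)))
        (trans (ℚₚ.+-identityˡ _) (cong (frac 1 κ *ℚ_) (moved χ pr)))

-- Roots and ranks

filterᵇ-⊆ : ∀ {A : Set} (p q : A → Bool) xs → (∀ x → p x ≡ true → q x ≡ true) → length (filterᵇ p xs) ≤ length (filterᵇ q xs)
filterᵇ-⊆ p q []       i = z≤n
filterᵇ-⊆ p q (x ∷ xs) i with p x in px | q x in qx
... | true  | true  = s≤s (filterᵇ-⊆ p q xs i)
... | true  | false = case trans (sym (i x px)) qx of λ ()
... | false | true  = ℕₚ.m≤n⇒m≤1+n (filterᵇ-⊆ p q xs i)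
... | false | false = filterᵇ-⊆ p q xs i

filterᵇ-⊂ : ∀ {A : Set} (p q : A → Bool) {xs y} → (∀ x → p x ≡ true → q x ≡ true) → y ∈ xs → p y ≡ false → q y ≡ true →
  length (filterᵇ p xs) < length (filterᵇ q xs)
filterᵇ-⊂ p q {x ∷ xs} i (Any.here refl) py qy rewrite py | qy = s≤s (filterᵇ-⊆ p q xs i)
filterᵇ-⊂ p q {x ∷ xs} i (Any.there y∈) py qy with p x in px | q x in qx
... | true  | true  = s≤s (filterᵇ-⊂ p q i y∈ py qy)
... | true  | false = case trans (sym (i x px)) qx of λ ()
... | false | true  = ℕₚ.m≤n⇒m≤1+n (filterᵇ-⊂ p q i y∈ py qy)
... | false | false = filterᵇ-⊂ p q i y∈ py qy

climb : ∀ {n} {L : Set} → Forest.Rooted n L → ℕ → Fin n → Fin n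
climb s zero    x = x
climb s (suc k) x with s x
... | nothing      = x
... | just (p , _) = climb s k p

-- The local function of rootOf is reached through unification: after one unfolding its vertex
-- count is suc k while its fuel is k, so abstracting suc k separates the two.
mutual
  rootOf≡climb : ∀ n {L : Set} (s : Forest.Rooted n L) v → Forest.rootOf n s v ≡ climb s n v
  rootOf≡climb (suc k) s v with s v
  ... | nothing = refl
  ... | just (p , l) with suc k | s | v | p
  ... | w | s' | v' | p' = go≡climb w s' v' k p'

  go≡climb : ∀ w {L : Set} (s : Forest.Rooted w L) (v : Fin w) k (x : Fin w) → _ ≡ climb s k x
  go≡climb w s v zero    x = refl
  go≡climb w s v (suc k) x with s x
  ... | nothing      = refl
  ... | just (p , _) = go≡climb w s v k p

module Roots (n Δ c : ℕ) where
  open DistMaint n Δ c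
  open Kempe n κ
  open Colourings n κ
  open Painting n Δ c
  open Steps n Δ c

  -- Replacing each rank by the number of vertices of strictly smaller rank keeps the order and
  -- brings all values below `n`. New forests may thus be ranked by any convenient numbers.
  normalise : ∀ {f : Shape} (rank : V → ℕ) → (∀ {v q} → f v ≡ just (q , tt) → rank q < rank v) → Ranked f
  normalise {f} rank par = record
    { rank = count
    ; rank-par = λ {v} {q} e → filterᵇ-⊂ (below q) (below v)
        (λ u h → dec-true (rank u ℕ.<? rank v) (ℕₚ.<-trans (witness (rank u ℕ.<? rank q) h) (par e)))
        (∈-allFin q) (dec-false (rank q ℕ.<? rank q) (ℕₚ.<-irrefl refl)) (dec-true (rank q ℕ.<? rank v) (par e))
    ; rank-bound = λ v → ℕₚ.<-≤-trans (filterᵇ-⊂ (below v) (λ _ → true) (λ _ _ → refl) (∈-allFin v)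
        (dec-false (rank v ℕ.<? rank v) (ℕₚ.<-irrefl refl)) refl)
        (ℕₚ.≤-trans (Listₚ.length-filter _ vertices) (ℕₚ.≤-reflexive (length-allFin n)))
    }
    where
    below : V → V → Bool
    below v u = does (rank u ℕ.<? rank v)
    count : V → ℕ
    count v = length (filterᵇ (below v) vertices)

  Ranked-cong : ∀ {f g : Shape} → f ≗ g → Ranked f → Ranked g
  Ranked-cong f≗g rk = record { rank = rank ; rank-par = λ e → rank-par (trans (f≗g _) e) ; rank-bound = rank-bound }
    where open Ranked rk

  -- Roots, degrees, tree sizes and `orient` depend on parents alone. Hence the algorithm, looking
  -- at a coloured state, decides exactly as validity does on the bare shape, and the random colours
  -- never influence the shape.
  SamePar : ∀ {L L' : Set} → Rooted L → Rooted L' → Set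
  SamePar s f = ∀ v → M.map proj₁ (s v) ≡ M.map proj₁ (f v)

  paint-SamePar : ∀ {f χ s} → s ≗ paint f χ → SamePar s f
  paint-SamePar {f} {χ} s≗ v rewrite s≗ v with f v
  ... | nothing = refl
  ... | just _  = refl

  ≗-SamePar : ∀ {f g : Shape} → f ≗ g → SamePar f g
  ≗-SamePar e v = cong (M.map proj₁) (e v)

  module _ {L L' : Set} {s : Rooted L} {f : Rooted L'} (e : SamePar s f) where

    climb-cong : ∀ k v → climb s k v ≡ climb f k v
    climb-cong zero v = refl
    climb-cong (suc k) v with s v | f v | e v
    ... | nothing | nothing | _ = refl
    ... | just (q , _) | just (.q , _) | refl = climb-cong k q

    rootOf-cong : ∀ v → rootOf s v ≡ rootOf f v
    rootOf-cong v = trans (rootOf≡climb n s v) (trans (climb-cong n v) (sym (rootOf≡climb n f v)))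

    isChildOf-cong : ∀ v w → isChildOf s v w ≡ isChildOf f v w
    isChildOf-cong v w with s w | f w | e w
    ... | nothing | nothing | _ = refl
    ... | just (q , _) | just (.q , _) | refl = refl

    children-cong : ∀ v → children s v ≡ children f v
    children-cong v = filterᵇ-cong vertices (isChildOf-cong v)

    degree-cong : ∀ v → degree s v ≡ degree f v
    degree-cong v with s v | f v | e v
    ... | nothing | nothing | _ = cong length (children-cong v)
    ... | just (q , _) | just (.q , _) | refl = cong (suc ∘ length) (children-cong v)

    treeEdges-cong : ∀ v → treeEdges s v ≡ treeEdges f v
    treeEdges-cong v = cong (λ l → length l ∸ 1) (filterᵇ-cong vertices λ y → cong₂ eqᵇ (rootOf-cong y) (rootOf-cong v))

    orient-cong : ∀ u v → orient s u v ≡ orient f u v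
    orient-cong u v rewrite treeEdges-cong u | treeEdges-cong v | degree-cong u | degree-cong v = refl

  orderEnds : ℕ → ℕ → ℕ → ℕ → V → V → V × V
  orderEnds eᵤ eᵥ dᵤ dᵥ u v = if (eᵤ ℕ.≤ᵇ Δ) ∧ (eᵥ ℕ.≤ᵇ Δ) then (if dᵥ ℕ.≤ᵇ dᵤ then (u , v) else (v , u)) else (if eᵥ ℕ.≤ᵇ eᵤ then (u , v) else (v , u))

  orderEnds-isolated : ∀ eᵤ dᵤ u v → orderEnds eᵤ 0 dᵤ 0 u v ≡ (u , v)
  orderEnds-isolated eᵤ dᵤ u v with (eᵤ ℕ.≤ᵇ Δ) ∧ true
  ... | true  = refl
  ... | false = refl

  orient-isolated : ∀ {L : Set} (f : Rooted L) u v → treeEdges f v ≡ 0 → degree f v ≡ 0 → orient f u v ≡ (u , v)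
  orient-isolated f u v e d = trans (cong₂ (λ x y → orderEnds (treeEdges f u) x (degree f u) y u v) e d) (orderEnds-isolated (treeEdges f u) (degree f u) u v)

  treeEdges-isolated : ∀ {L : Set} (f : Rooted L) v → f v ≡ nothing → (∀ k y → climb f k y ≡ v → y ≡ v) → treeEdges f v ≡ 0
  treeEdges-isolated f v e alone = ℕₚ.n≤0⇒n≡0 (ℕₚ.∸-monoˡ-≤ 1 (ℕₚ.≤-trans (filterᵇ-⊆ (λ y → sameTree f y v) (eqᵇ v) vertices same) (ℕₚ.≤-reflexive one)))
    where
    rooted : rootOf f v ≡ v
    rooted = trans (rootOf≡climb n f v) (loop n)
      where
      loop : ∀ k → climb f k v ≡ v
      loop zero = refl
      loop (suc k) rewrite e = refl
    same : ∀ y → sameTree f y v ≡ true → eqᵇ v y ≡ true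
    same y h = dec-true (v ≟F y) (sym (alone n y (trans (sym (rootOf≡climb n f y)) (trans (witness (rootOf f y ≟F rootOf f v) h) rooted))))
    one : length (filterᵇ (eqᵇ v) vertices) ≡ 1
    one = ℕtoℚ-injective (trans (length-filterᵇ (eqᵇ v) vertices) (∑-δ n v (λ _ → 1ℚ)))

  climb-root : ∀ {L : Set} (s : Rooted L) k {v} → s v ≡ nothing → climb s k v ≡ v
  climb-root s zero e = refl
  climb-root s (suc k) e rewrite e = refl

  climb-step : ∀ {L : Set} (s : Rooted L) k {v q l} → s v ≡ just (q , l) → climb s (suc k) v ≡ climb s k q
  climb-step s k e rewrite e = refl

  rootOf-root : ∀ {L : Set} (s : Rooted L) {v} → s v ≡ nothing → rootOf s v ≡ v
  rootOf-root s {v} e = trans (rootOf≡climb n s v) (climb-root s n e)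

  module _ {f : Shape} (rk : Ranked f) where
    open Ranked rk

    climb-fuel : ∀ k k' v → rank v ≤ k → rank v ≤ k' → climb f k v ≡ climb f k' v
    climb-fuel k k' v h h' = cases (f v) refl k k' h h'
      where
      cases : ∀ m → f v ≡ m → ∀ k k' → rank v ≤ k → rank v ≤ k' → climb f k v ≡ climb f k' v
      cases nothing e k k' h h' = trans (climb-root f k e) (sym (climb-root f k' e))
      cases (just (q , tt)) e zero k' h h' = case ℕₚ.<-≤-trans (rank-par e) h of λ ()
      cases (just (q , tt)) e (suc k) zero h h' = case ℕₚ.<-≤-trans (rank-par e) h' of λ ()
      cases (just (q , tt)) e (suc k) (suc k') h h' = trans (climb-step f k e) (trans
        (climb-fuel k k' q (ℕₚ.≤-pred (ℕₚ.<-≤-trans (rank-par e) h)) (ℕₚ.≤-pred (ℕₚ.<-≤-trans (rank-par e) h')))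
        (sym (climb-step f k' e)))

    rootOf-par : ∀ {v q} → f v ≡ just (q , tt) → rootOf f v ≡ rootOf f q
    rootOf-par {v} {q} e = trans (rootOf≡climb n f v) (trans (climb-fuel n (suc n) v (ℕₚ.<⇒≤ (rank-bound v)) (ℕₚ.m≤n⇒m≤1+n (ℕₚ.<⇒≤ (rank-bound v))))
      (trans (climb-step f n e) (sym (rootOf≡climb n f q))))

    rank-induction : ∀ (P : V → Set) → (∀ v → f v ≡ nothing → P v) → (∀ v q → f v ≡ just (q , tt) → P q → P v) → ∀ v → P v
    rank-induction P base step v = go n v (rank-bound v)
      where
      go : ∀ k v → rank v < k → P v
      cases : ∀ k v m → rank v < suc k → f v ≡ m → P v
      go (suc k) v h = cases k v (f v) h refl
      cases k v nothing h e = base v e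
      cases k v (just (q , tt)) h e = step v q e (go k q (ℕₚ.<-≤-trans (rank-par e) (ℕₚ.≤-pred h)))

    rootOf-isRoot : ∀ v → f (rootOf f v) ≡ nothing
    rootOf-isRoot = rank-induction _ (λ v e → trans (cong f (rootOf-root f e)) e) (λ v q e h → trans (cong f (rootOf-par e)) h)

    rootOf-unique : ∀ (ρ : V → V) → (∀ {v} → f v ≡ nothing → ρ v ≡ v) → (∀ {v q} → f v ≡ just (q , tt) → ρ v ≡ ρ q) →
      ∀ v → rootOf f v ≡ ρ v
    rootOf-unique ρ r₀ r₁ = rank-induction _ (λ v e → trans (rootOf-root f e) (sym (r₀ e)))
      (λ v q e h → trans (rootOf-par e) (trans h (sym (r₁ e))))

    rootOf-K : ∀ {u Q v} → K f u Q v → rootOf f v ≡ rootOf f u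
    rootOf-K (here e _)    = rootOf-par e
    rootOf-K (there e _ k) = trans (rootOf-par e) (rootOf-K k)

    module LinkRank (p r : V) (fr : f r ≡ nothing) (pr : rootOf f p ≢ r) where

      link-≢ : p ≢ r
      link-≢ refl = pr (rootOf-root f fr)

      link-¬below : ¬ Below f r p
      link-¬below k = pr (trans (rootOf-K k) (rootOf-root f fr))

      -- All ranks in the tree of `r` are raised by `suc (rank p)`, which lifts the tree above `p`
      -- and keeps its internal order.
      link-ranked : Ranked (update f r (just (p , tt)))
      link-ranked = normalise rank₁ par
        where
        rank₁ : V → ℕ
        rank₁ v = if does (rootOf f v ≟F r) then rank v + suc (rank p) else rank v
        rank₁-in : ∀ v → rootOf f v ≡ r → rank₁ v ≡ rank v + suc (rank p)
        rank₁-in v e rewrite dec-true (rootOf f v ≟F r) e = refl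
        rank₁-out : ∀ v → rootOf f v ≢ r → rank₁ v ≡ rank v
        rank₁-out v e rewrite dec-false (rootOf f v ≟F r) e = refl
        old : ∀ {v q} → f v ≡ just (q , tt) → Dec (rootOf f q ≡ r) → rank₁ q < rank₁ v
        old {v} {q} e (yes h) = subst₂ _<_ (sym (rank₁-in q h)) (sym (rank₁-in v (trans (rootOf-par e) h))) (ℕₚ.+-monoˡ-< (suc (rank p)) (rank-par e))
        old {v} {q} e (no ¬h) = subst₂ _<_ (sym (rank₁-out q ¬h)) (sym (rank₁-out v (λ h → ¬h (trans (sym (rootOf-par e)) h)))) (rank-par e)
        par : ∀ {v q} → update f r (just (p , tt)) v ≡ just (q , tt) → rank₁ q < rank₁ v
        par {v} {q} e = cases (v ≟F r)
          where
          cases : Dec (v ≡ r) → rank₁ q < rank₁ v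
          cases (no v≢r) = old (trans (sym (upd-diff f (just (p , tt)) v≢r)) e) (rootOf f q ≟F r)
          cases (yes refl) with refl ← par-unique (upd-same f {v} (just (p , tt)) refl) e =
            subst₂ _<_ (sym (rank₁-out p pr)) (sym (rank₁-in v (rootOf-root f fr))) (ℕₚ.m≤n+m (suc (rank p)) (rank v))

    module UnlinkRank (p r : V) (fr : f r ≡ just (p , tt)) where

      unlink-par : ∀ {v q} → update f r nothing v ≡ just (q , tt) → f v ≡ just (q , tt)
      unlink-par {v} {q} e = cases (v ≟F r)
        where
        cases : Dec (v ≡ r) → f v ≡ just (q , tt)
        cases (yes refl) = case trans (sym (upd-same f {v} nothing refl)) e of λ ()
        cases (no v≢r)   = trans (sym (upd-diff f nothing v≢r)) e

      unlink-ranked : Ranked (update f r nothing)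
      unlink-ranked = record { rank = rank ; rank-par = λ e → rank-par (unlink-par e) ; rank-bound = rank-bound }

      unlink-≢ : p ≢ r
      unlink-≢ refl = ℕₚ.<-irrefl refl (rank-par fr)

      unlink-¬below : ¬ Below (update f r nothing) r p
      unlink-¬below k = ℕₚ.<-asym (K-rank unlink-ranked k) (rank-par fr)

      unlink-root : update f r nothing r ≡ nothing
      unlink-root = upd-same f {r} nothing refl

      relink : update (update f r nothing) r (just (p , tt)) ≗ f
      relink v with v ≟F r
      ... | yes refl = sym fr
      ... | no _     = refl

      relink-ranked : Ranked (update (update f r nothing) r (just (p , tt)))
      relink-ranked = Ranked-cong (λ v → sym (relink v)) rk

-- Rerooting as a sequence of reversals of single edges

rerootLoop : ∀ {n} {L : Set} → ℕ → Fin n → Maybe (Fin n × L) → Forest.Rooted n L → Forest.Rooted n L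
rerootLoop {n} zero    x m t = Forest.update n t x m
rerootLoop {n} (suc k) x m t with t x
... | nothing      = Forest.update n t x m
... | just (y , l) = rerootLoop k y (just (x , l)) (Forest.update n t x m)

mutual
  reroot≡loop : ∀ n {L : Set} (s : Forest.Rooted n L) v → Forest.reroot n s v ≡ rerootLoop n v nothing s
  reroot≡loop (suc k) s v with s v
  ... | nothing = refl
  ... | just (y , l) with suc k | s | v | y | Forest.update (suc k) s v nothing | just (v , l)
  ... | w | s' | v' | y' | t | m = go≡loop w s' v' k y' m t

  go≡loop : ∀ w {L : Set} (s : Forest.Rooted w L) (v : Fin w) k (x : Fin w) m t → _ ≡ rerootLoop k x m t
  go≡loop w s v zero    x m t = refl
  go≡loop w s v (suc k) x m t with t x
  ... | nothing      = refl
  ... | just (p , l) = go≡loop w s v k p (just (x , l)) (Forest.update w t x m)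

module Rerooting (n Δ c : ℕ) where
  open DistMaint n Δ c
  open Kempe n κ
  open Colourings n κ
  open Painting n Δ c
  open Steps n Δ c
  open Uniformity n Δ c
  open Recourse n Δ c
  open Roots n Δ c

  module _ {L : Set} where

    upd-swap : ∀ (s : Rooted L) {x y} m m' → x ≢ y → update (update s x m) y m' ≗ update (update s y m') x m
    upd-swap s {x} {y} m m' x≢y z with z ≟F x | z ≟F y
    ... | yes refl | yes refl = contradiction refl x≢y
    ... | yes _    | no _     = refl
    ... | no _     | yes _    = refl
    ... | no _     | no _     = refl

    reverse : Rooted L → V → Rooted L
    reverse s x with s x
    ... | nothing      = s
    ... | just (y , l) = update (update s y (just (x , l))) x nothing

    reverse-just : ∀ (s : Rooted L) {x y l} → s x ≡ just (y , l) → reverse s x ≡ update (update s y (just (x , l))) x nothing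
    reverse-just s e rewrite e = refl

    -- The loop of `reroot` works upwards from the new root and always carries one edge that is
    -- missing from the map. Reversing edges from the old root downwards has the same result, and
    -- each intermediate map is a forest with all its edges, so colourings can be followed through
    -- one reversal at a time.
    reversals : ℕ → V → Rooted L → Rooted L
    reversals zero    x s = s
    reversals (suc k) x s with s x
    ... | nothing      = s
    ... | just (y , _) = reverse (reversals k y s) x

    reversals-root : ∀ k x (s : Rooted L) → s x ≡ nothing → reversals k x s ≡ s
    reversals-root zero    x s e = refl
    reversals-root (suc k) x s e rewrite e = refl

    reversals-step : ∀ k {x y l} (s : Rooted L) → s x ≡ just (y , l) → reversals (suc k) x s ≡ reverse (reversals k y s) x
    reversals-step k s e rewrite e = refl

    reverse-cong : ∀ {s t : Rooted L} {x} → s ≗ t → reverse s x ≗ reverse t x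
    reverse-cong {s} {t} {x} e z with s x in sx | t x in tx
    ... | nothing | nothing = e z
    ... | nothing | just _  = case trans (sym sx) (trans (e x) tx) of λ ()
    ... | just _  | nothing = case trans (sym sx) (trans (e x) tx) of λ ()
    ... | just (y , l) | just (y' , l') with refl ← just-injective (trans (sym sx) (trans (e x) tx)) =
      upd-cong {x = x} (upd-cong {x = y} e) z

    module _ (rank : V → ℕ) where

      -- On its way up the loop has already turned edges round at vertices of larger rank, so
      -- parents have smaller rank only up to the current vertex.
      RankedUpTo : Rooted L → V → Set
      RankedUpTo t x = ∀ {v q l} → rank v ≤ rank x → t v ≡ just (q , l) → rank q < rank v

      lower : ∀ {t x y l} → RankedUpTo t x → t x ≡ just (y , l) → RankedUpTo t y
      lower R e h = R (ℕₚ.≤-trans h (ℕₚ.<⇒≤ (R ℕₚ.≤-refl e)))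

      <-≢ : ∀ {x y} → rank y < rank x → x ≢ y
      <-≢ h refl = ℕₚ.<-irrefl refl h

      reversals-above : ∀ k {x y} t → RankedUpTo t y → rank y < rank x → reversals k y t x ≡ t x
      reversals-above zero t R h = refl
      reversals-above (suc k) {x} {y} t R h = cases (t y) refl
        where
        cases : ∀ m → t y ≡ m → reversals (suc k) y t x ≡ t x
        cases nothing e = cong (λ u → u x) (reversals-root (suc k) y t e)
        cases (just (z , l)) e = begin
          reversals (suc k) y t x                                        ≡⟨ cong (λ u → u x) (reversals-step k t e) ⟩
          reverse (reversals k z t) y x                                  ≡⟨ cong (λ u → u x) (reverse-just (reversals k z t) (trans (reversals-above k t (lower R e) (R ℕₚ.≤-refl e)) e)) ⟩
          update (update (reversals k z t) z (just (y , l))) y nothing x ≡⟨ upd-diff (update (reversals k z t) z (just (y , l))) nothing (<-≢ h) ⟩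
          update (reversals k z t) z (just (y , l)) x                    ≡⟨ upd-diff (reversals k z t) (just (y , l)) (<-≢ (ℕₚ.<-trans (R ℕₚ.≤-refl e) h)) ⟩
          reversals k z t x                                              ≡⟨ reversals-above k t (lower R e) (ℕₚ.<-trans (R ℕₚ.≤-refl e) h) ⟩
          t x                                                            ∎
          where open ≡-Reasoning

      reversals-update : ∀ k {x y} m t → RankedUpTo t y → rank y < rank x → reversals k y (update t x m) ≗ update (reversals k y t) x m
      reversals-update zero m t R h z = refl
      reversals-update (suc k) {x} {y} m t R h = cases (t y) refl
        where
        cases : ∀ m' → t y ≡ m' → reversals (suc k) y (update t x m) ≗ update (reversals (suc k) y t) x m
        cases nothing e v = trans (cong (λ u → u v) (reversals-root (suc k) y (update t x m) (trans (upd-diff t m (<-≢ h ∘ sym)) e)))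
          (cong (λ u → update u x m v) (sym (reversals-root (suc k) y t e)))
        cases (just (z , l)) e v = begin
          reversals (suc k) y (update t x m) v
            ≡⟨ cong (λ u → u v) (reversals-step k (update t x m) (trans (upd-diff t m (<-≢ h ∘ sym)) e)) ⟩
          reverse (reversals k z (update t x m)) y v
            ≡⟨ reverse-cong (reversals-update k m t (lower R e) z<x) v ⟩
          reverse (update (reversals k z t) x m) y v
            ≡⟨ cong (λ u → u v) (reverse-just (update (reversals k z t) x m) (trans (upd-diff (reversals k z t) m (<-≢ h ∘ sym)) at-y)) ⟩
          update (update (update (reversals k z t) x m) z (just (y , l))) y nothing v
            ≡⟨ upd-cong {x = y} (upd-swap (reversals k z t) m (just (y , l)) (<-≢ z<x)) v ⟩
          update (update (update (reversals k z t) z (just (y , l))) x m) y nothing v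
            ≡⟨ upd-swap (update (reversals k z t) z (just (y , l))) m nothing (<-≢ h) v ⟩
          update (update (update (reversals k z t) z (just (y , l))) y nothing) x m v
            ≡⟨ cong (λ u → update u x m v) (sym (trans (reversals-step k t e) (reverse-just (reversals k z t) at-y))) ⟩
          update (reversals (suc k) y t) x m v ∎
          where
          open ≡-Reasoning
          z<x : rank z < rank x
          z<x = ℕₚ.<-trans (R ℕₚ.≤-refl e) h
          at-y : reversals k z t y ≡ just (z , l)
          at-y = trans (reversals-above k t (lower R e) (R ℕₚ.≤-refl e)) e

      loop-reversals : ∀ k x m t → RankedUpTo t x → rerootLoop k x m t ≗ update (reversals k x t) x m
      loop-reversals zero x m t R v = refl
      loop-reversals (suc k) x m t R v with t x in e
      ... | nothing = refl
      ... | just (y , l) = begin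
        rerootLoop k y (just (x , l)) (update t x m) v
          ≡⟨ loop-reversals k y (just (x , l)) (update t x m) R' v ⟩
        update (reversals k y (update t x m)) y (just (x , l)) v
          ≡⟨ upd-cong {x = y} (reversals-update k m t (lower R e) y<x) v ⟩
        update (update (reversals k y t) x m) y (just (x , l)) v
          ≡⟨ upd-swap (reversals k y t) m (just (x , l)) (<-≢ y<x) v ⟩
        update (update (reversals k y t) y (just (x , l))) x m v
          ≡⟨ overwrite (update (reversals k y t) y (just (x , l))) v ⟩
        update (update (update (reversals k y t) y (just (x , l))) x nothing) x m v
          ≡⟨ cong (λ u → update u x m v) (sym (reverse-just (reversals k y t) (trans (reversals-above k t (lower R e) y<x) e))) ⟩
        update (reverse (reversals k y t) x) x m v ∎
        where
        open ≡-Reasoning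
        y<x : rank y < rank x
        y<x = R ℕₚ.≤-refl e
        R' : RankedUpTo (update t x m) y
        R' {w} h e' = R (ℕₚ.≤-trans h (ℕₚ.<⇒≤ y<x)) (trans (sym (upd-diff t m λ { refl → ℕₚ.<-irrefl refl (ℕₚ.<-≤-trans y<x h) })) e')
        overwrite : ∀ u → update u x m ≗ update (update u x nothing) x m
        overwrite u z with z ≟F x
        ... | yes _ = refl
        ... | no _  = refl

  reroot≗ : ∀ {L : Set} (s : Rooted L) b → s b ≡ nothing → reroot s b ≗ s
  reroot≗ s b e v = trans (cong (λ u → u v) (trans (reroot≡loop n s b) (loop-root n))) (same (v ≟F b))
    where
    loop-root : ∀ k → rerootLoop k b nothing s ≡ update s b nothing
    loop-root zero = refl
    loop-root (suc k) rewrite e = refl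
    same : Dec (v ≡ b) → update s b nothing v ≡ s v
    same (yes refl) = trans (upd-same s {v} nothing refl) (sym e)
    same (no v≢b)   = upd-diff s nothing v≢b

  module Reverse {f : Shape} (rk : Ranked f) {x y : V} (fx : f x ≡ just (y , tt)) (fy : f y ≡ nothing) where
    open Ranked rk

    x≢y : x ≢ y
    x≢y refl = par-irrefl rk fx

    g : Shape
    g = reverse f x

    g-upd : g ≡ update (update f y (just (x , tt))) x nothing
    g-upd = reverse-just f fx

    gx : g x ≡ nothing
    gx = trans (cong (λ u → u x) g-upd) (upd-same (update f y (just (x , tt))) {x} nothing refl)

    gy : g y ≡ just (x , tt)
    gy = trans (cong (λ u → u y) g-upd) (trans (upd-diff (update f y (just (x , tt))) nothing (x≢y ∘ sym)) (upd-same f (just (x , tt)) refl))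

    g-other : ∀ {v} → v ≢ x → v ≢ y → g v ≡ f v
    g-other {v} v≢x v≢y = trans (cong (λ u → u v) g-upd) (trans (upd-diff (update f y (just (x , tt))) nothing v≢x) (upd-diff f (just (x , tt)) v≢y))

    -- The reversed edge is stored at y instead of x; σ renames the edges accordingly.
    σ : V → V
    σ = tr x y

    σ-other : ∀ {v} → v ≢ x → v ≢ y → σ v ≡ v
    σ-other v≢x v≢y = tr-other λ { (inj₁ e) → v≢x e ; (inj₂ e) → v≢y e }

    data Position (v : V) : Set where
      at-x : v ≡ x → Position v
      at-y : v ≡ y → Position v
      away : v ≢ x → v ≢ y → Position v

    position : ∀ v → Position v
    position v with v ≟F x | v ≟F y
    ... | yes e | _     = at-x e
    ... | no _  | yes e = at-y e
    ... | no e  | no e' = away e e'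

    ranked : Ranked g
    ranked = normalise rank₁ par
      where
      rank₁ : V → ℕ
      rank₁ v = if does (v ≟F x) then 0 else suc (rank v)
      rank₁-x : rank₁ x ≡ 0
      rank₁-x rewrite dec-true (x ≟F x) refl = refl
      rank₁-o : ∀ {v} → v ≢ x → rank₁ v ≡ suc (rank v)
      rank₁-o {v} h rewrite dec-false (v ≟F x) h = refl
      par : ∀ {v q} → g v ≡ just (q , tt) → rank₁ q < rank₁ v
      par {v} {q} e with position v
      ... | at-x refl = case trans (sym gx) e of λ ()
      ... | at-y refl with refl ← par-unique gy e = subst₂ _<_ (sym rank₁-x) (sym (rank₁-o (x≢y ∘ sym))) (s≤s z≤n)
      ... | away v≢x v≢y = cases (q ≟F x)
        where
        cases : Dec (q ≡ x) → rank₁ q < rank₁ v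
        cases (yes refl) = subst₂ _<_ (sym rank₁-x) (sym (rank₁-o v≢x)) (s≤s z≤n)
        cases (no q≢x) = subst₂ _<_ (sym (rank₁-o q≢x)) (sym (rank₁-o v≢x)) (s≤s (rank-par (trans (sym (g-other v≢x v≢y)) e)))

    -- Since `σ` exchanges the entries at `x` and `y`, the spare entry of the old root becomes that
    -- of the new one, and the count of colourings keeps its scale.
    perm : Colouring → Colouring
    perm χ = tabulate (λ v → lookup χ (σ v))

    lookup-perm : ∀ χ v → lookup (perm χ) v ≡ lookup χ (σ v)
    lookup-perm χ v = Vecₚ.lookup∘tabulate _ v

    perm-involutive : ∀ χ → perm (perm χ) ≡ χ
    perm-involutive χ = lookup-ext λ v → trans (lookup-perm (perm χ) v) (trans (lookup-perm χ (σ v)) (cong (lookup χ) (tr-involutive x y v)))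

    reverse-paint : ∀ {s χ} → s ≗ paint f χ → reverse s x ≗ paint g (perm χ)
    reverse-paint {s} {χ} s≗ v = trans (cong (λ u → u v) (reverse-just s (trans (s≗ x) (paint-just f χ fx)))) (at v (position v))
      where
      s₁ = update s y (just (x , lookup χ x))
      at : ∀ v → Position v → update s₁ x nothing v ≡ paint g (perm χ) v
      at v (at-x refl) = trans (upd-same s₁ {x} nothing refl) (sym (paint-nothing g (perm χ) gx))
      at v (at-y refl) = trans (upd-diff s₁ nothing (x≢y ∘ sym)) (trans (upd-same s (just (x , lookup χ x)) refl)
        (sym (trans (paint-just g (perm χ) gy) (cong (λ l → just (x , l)) (trans (lookup-perm χ y) (cong (lookup χ) (tr-snd x y)))))))
      at v (away v≢x v≢y) = trans (upd-diff s₁ nothing v≢x) (trans (upd-diff s (just (x , lookup χ x)) v≢y) (trans (s≗ v)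
        (sym (cong₂ (λ l m → M.map (λ q → proj₁ q , l) m) (trans (lookup-perm χ v) (cong (lookup χ) (σ-other v≢x v≢y))) (g-other v≢x v≢y)))))

    Inc-σ : ∀ {p e} → Inc f p e → Inc g p (σ e)
    Inc-σ {p} {e} i with position e
    Inc-σ (inj₁ (refl , q , h)) | at-x refl = inj₂ (subst (λ z → g z ≡ just (x , tt)) (sym (tr-fst x y)) gy)
    Inc-σ (inj₂ h) | at-x refl with refl ← par-unique fx h = inj₁ (tr-fst x y , _ , subst (λ z → g z ≡ just (x , tt)) (sym (tr-fst x y)) gy)
    Inc-σ (inj₁ (refl , q , h)) | at-y refl = case trans (sym fy) h of λ ()
    Inc-σ (inj₂ h) | at-y refl = case trans (sym fy) h of λ ()
    Inc-σ {p} {e} (inj₁ (refl , q , h)) | away a b = inj₁ (σ-other a b , q , trans (cong g (σ-other a b)) (trans (g-other a b) h))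
    Inc-σ {p} {e} (inj₂ h) | away a b = inj₂ (trans (cong g (σ-other a b)) (trans (g-other a b) h))

    Inc-σ⁻ : ∀ {p e} → Inc g p e → Inc f p (σ e)
    Inc-σ⁻ {p} {e} i with position e
    Inc-σ⁻ (inj₁ (refl , q , h)) | at-x refl = case trans (sym gx) h of λ ()
    Inc-σ⁻ (inj₂ h) | at-x refl = case trans (sym gx) h of λ ()
    Inc-σ⁻ (inj₁ (refl , q , h)) | at-y refl = inj₂ (subst (λ z → f z ≡ just (y , tt)) (sym (tr-snd x y)) fx)
    Inc-σ⁻ (inj₂ h) | at-y refl with refl ← par-unique gy h = inj₁ (tr-snd x y , _ , subst (λ z → f z ≡ just (y , tt)) (sym (tr-snd x y)) fx)
    Inc-σ⁻ {p} {e} (inj₁ (refl , q , h)) | away a b = inj₁ (σ-other a b , q , trans (cong f (σ-other a b)) (trans (sym (g-other a b)) h))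
    Inc-σ⁻ {p} {e} (inj₂ h) | away a b = inj₂ (trans (cong f (σ-other a b)) (trans (sym (g-other a b)) h))

    proper-perm : ∀ χ → Proper f χ → Proper g (perm χ)
    proper-perm χ pr p e e' i i' eq = tr-injective x y (pr p (σ e) (σ e') (Inc-σ⁻ i) (Inc-σ⁻ i')
      (trans (sym (lookup-perm χ e)) (trans eq (lookup-perm χ e'))))

    proper-perm⁻ : ∀ χ → Proper g (perm χ) → Proper f χ
    proper-perm⁻ χ pr p e e' i i' eq = tr-injective x y (pr p (σ e) (σ e') (Inc-σ i) (Inc-σ i')
      (trans (back e) (trans eq (sym (back e')))))
      where
      back : ∀ e → lookup (perm χ) (σ e) ≡ lookup χ e
      back e = trans (lookup-perm χ (σ e)) (cong (lookup χ) (tr-involutive x y e))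

    N-perm : ∀ h → N f (h ∘ perm) ≡ N g h
    N-perm h = trans (∑-cong colourings λ χ → cong (_▸ h (perm χ)) (does-iff (proper? f χ) (proper? g (perm χ)) (proper-perm χ) (proper-perm⁻ χ)))
      (∑-colourings-involution perm perm-involutive (λ χ → does (proper? g χ) ▸ h χ))

    degree-reverse : ∀ v → degree g v ≡ degree f v
    degree-reverse v = ℕtoℚ-injective (trans (degree-degℚ ranked v) (trans
      (sym (∑-involution vertices _≟F_ (enum-allFin n) σ (tr-involutive x y) (λ e → does (inc? g v e) ▸ 1ℚ)))
      (trans (∑-cong vertices λ e → cong (_▸ 1ℚ) (does-iff (inc? g v (σ e)) (inc? f v e)
          (λ i → subst (Inc f v) (tr-involutive x y e) (Inc-σ⁻ i)) Inc-σ)) (sym (degree-degℚ rk v)))))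

    edgeColor-reverse : ∀ {s t χ} → s ≗ paint f χ → t ≗ paint g (perm χ) → ∀ u v → edgeColor t u v ≡ edgeColor s u v
    edgeColor-reverse {s} {t} {χ} s≗ t≗ u v = cases (child? f v u) (child? f u v)
      where
      module Es = Edges rk {χ} {s} s≗
      module Et = Edges ranked {perm χ} {t} t≗
      cp : ∀ {v} → v ≢ x → v ≢ y → just (lookup (perm χ) v) ≡ just (lookup χ v)
      cp {v} a b = cong just (trans (lookup-perm χ v) (cong (lookup χ) (σ-other a b)))
      cy : just (lookup (perm χ) y) ≡ just (lookup χ x)
      cy = cong just (trans (lookup-perm χ y) (cong (lookup χ) (tr-snd x y)))
      fst : ∀ u v → f u ≡ just (v , tt) → Position u → edgeColor t u v ≡ just (lookup χ u)
      fst u v e (at-x refl) with refl ← par-unique fx e = trans (Et.edge-snd gy) cy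
      fst u v e (at-y refl) = case trans (sym fy) e of λ ()
      fst u v e (away a b) = trans (Et.edge-fst (trans (g-other a b) e)) (cp a b)
      snd : ∀ u v → f v ≡ just (u , tt) → Position v → edgeColor t u v ≡ just (lookup χ v)
      snd u v e (at-x refl) with refl ← par-unique fx e = trans (Et.edge-fst gy) cy
      snd u v e (at-y refl) = case trans (sym fy) e of λ ()
      snd u v e (away a b) = trans (Et.edge-snd (trans (g-other a b) e)) (cp a b)
      old : ∀ u v → f u ≢ just (v , tt) → f v ≢ just (u , tt) → Position u → g u ≢ just (v , tt)
      old u v nu nv (at-x refl) e = case trans (sym gx) e of λ ()
      old u v nu nv (at-y refl) e with refl ← par-unique gy e = nv fx
      old u v nu nv (away a b) e = nu (trans (sym (g-other a b)) e)
      cases : Dec (f u ≡ just (v , tt)) → Dec (f v ≡ just (u , tt)) → edgeColor t u v ≡ edgeColor s u v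
      cases (yes e) _ = trans (fst u v e (position u)) (sym (Es.edge-fst e))
      cases (no _) (yes e) = trans (snd u v e (position v)) (sym (Es.edge-snd e))
      cases (no nu) (no nv) = trans (Et.edge-none (old u v nu nv (position u)) (old v u nv nu (position v))) (sym (Es.edge-none nu nv))

    rootOf-reverse : ∀ z → rootOf g z ≡ x → rootOf f z ≡ y
    rootOf-reverse z e = cases (rootOf f z ≟F y)
      where
      ρ : V → V
      ρ z = if does (rootOf f z ≟F y) then x else rootOf f z
      ρ-in : ∀ {z} → rootOf f z ≡ y → ρ z ≡ x
      ρ-in {z} h rewrite dec-true (rootOf f z ≟F y) h = refl
      ρ-out : ∀ {z} → rootOf f z ≢ y → ρ z ≡ rootOf f z
      ρ-out {z} h rewrite dec-false (rootOf f z ≟F y) h = refl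
      rx : rootOf f x ≡ y
      rx = trans (rootOf-par rk fx) (rootOf-root f fy)
      ρ-root : ∀ {z} → g z ≡ nothing → ρ z ≡ z
      ρ-root {z} h with position z
      ... | at-x refl = ρ-in rx
      ... | at-y refl = case trans (sym gy) h of λ ()
      ... | away a b = trans (ρ-out (λ r → b (trans (sym (rootOf-root f h')) r))) (rootOf-root f h')
        where
        h' : f z ≡ nothing
        h' = trans (sym (g-other a b)) h
      ρ-par : ∀ {z q} → g z ≡ just (q , tt) → ρ z ≡ ρ q
      ρ-par {z} {q} h with position z
      ... | at-x refl = case trans (sym gx) h of λ ()
      ... | at-y refl with refl ← par-unique gy h = trans (ρ-in (rootOf-root f fy)) (sym (ρ-in rx))
      ... | away a b = cong (λ r → if does (r ≟F y) then x else r) (rootOf-par rk (trans (sym (g-other a b)) h))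
      cases : Dec (rootOf f z ≡ y) → rootOf f z ≡ y
      cases (yes h) = h
      -- Outside the tree of `y` the root is unchanged, so `x` would already be a root of `f`,
      -- although its parent there is `y`.
      cases (no ¬h) = case trans (sym (rootOf-isRoot rk z)) (trans (cong f (trans (sym (ρ-out ¬h)) (trans (sym (rootOf-unique ranked ρ ρ-root ρ-par z)) e))) fx) of λ ()

  record Rerooted (f : Shape) (b : V) (move : State → State) (g : Shape) : Set where
    field
      ranked  : Ranked g
      root    : g b ≡ nothing
      perm    : Colouring → Colouring
      proper  : ∀ χ → Proper f χ → Proper g (perm χ)
      N-perm  : ∀ h → N f (h ∘ perm) ≡ N g h
      repaint : ∀ {s χ} → s ≗ paint f χ → move s ≗ paint g (perm χ)
      degrees : ∀ v → degree g v ≡ degree f v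
      edges   : ∀ {s χ} → s ≗ paint f χ → ∀ u v → edgeColor (move s) u v ≡ edgeColor s u v
      roots   : ∀ z → rootOf g z ≡ b → rootOf f z ≡ rootOf f b

  reversals-rerooted : ∀ {f : Shape} (rk : Ranked f) k b → Ranked.rank rk b ≤ k → Rerooted f b (reversals k b) (reversals k b f)
  reversals-rerooted {f} rk k b h = cases (f b) refl k h
    where
    open Ranked rk
    cases : ∀ m → f b ≡ m → ∀ k → rank b ≤ k → Rerooted f b (reversals k b) (reversals k b f)
    cases nothing e k h rewrite reversals-root k b f e = record
      { ranked = rk ; root = e ; perm = id ; proper = λ _ pr → pr ; N-perm = λ _ → refl
      ; repaint = λ {s} {χ} s≗ v → trans (cong (λ u → u v) (same {χ = χ} s≗)) (s≗ v)
      ; degrees = λ _ → refl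
      ; edges = λ {s} {χ} s≗ u v → cong (λ t → edgeColor t u v) (same {χ = χ} s≗)
      ; roots = λ z r → trans r (sym (rootOf-root f e)) }
      where
      same : ∀ {s χ} → s ≗ paint f χ → reversals k b s ≡ s
      same {s} {χ} s≗ = reversals-root k b s (trans (s≗ b) (paint-nothing f χ e))
    cases (just (y , tt)) e zero h = case ℕₚ.<-≤-trans (rank-par e) h of λ ()
    cases (just (y , tt)) e (suc k) h rewrite reversals-step k f e = record
      { ranked = R.ranked ; root = R.gx ; perm = R.perm ∘ IH.perm
      ; proper = λ χ pr → R.proper-perm (IH.perm χ) (IH.proper χ pr)
      ; N-perm = λ h → trans (IH.N-perm (h ∘ R.perm)) (R.N-perm h)
      ; repaint = λ {s} {χ} s≗ v → trans (cong (λ u → u v) (step {χ = χ} s≗)) (R.reverse-paint {χ = IH.perm χ} (IH.repaint {χ = χ} s≗) v)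
      ; degrees = λ v → trans (R.degree-reverse v) (IH.degrees v)
      ; edges = λ {s} {χ} s≗ u v → trans (cong (λ t → edgeColor t u v) (step {χ = χ} s≗))
          (trans (R.edgeColor-reverse {χ = IH.perm χ} (IH.repaint {χ = χ} s≗) (R.reverse-paint {χ = IH.perm χ} (IH.repaint {χ = χ} s≗)) u v) (IH.edges {χ = χ} s≗ u v))
      ; roots = λ z r → trans (IH.roots z (R.rootOf-reverse z r)) (sym (rootOf-par rk e)) }
      where
      module IH = Rerooted (reversals-rerooted rk k y (ℕₚ.≤-pred (ℕₚ.<-≤-trans (rank-par e) h)))
      g₁b : reversals k y f b ≡ just (y , tt)
      g₁b = trans (reversals-above rank k f (λ _ → rank-par) (rank-par e)) e
      module R = Reverse IH.ranked g₁b IH.root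
      step : ∀ {s χ} → s ≗ paint f χ → reversals (suc k) b s ≡ reverse (reversals k y s) b
      step {s} {χ} s≗ = reversals-step k s (trans (s≗ b) (paint-just f χ e))

  reroot-reversals : ∀ {L : Set} (s : Rooted L) b (rank : V → ℕ) → (∀ {v q l} → s v ≡ just (q , l) → rank q < rank v) →
    reversals n b s b ≡ nothing → reroot s b ≗ reversals n b s
  reroot-reversals s b rank R e v = trans (cong (λ u → u v) (reroot≡loop n s b)) (trans (loop-reversals rank n b nothing s (λ _ → R) v) (clean (v ≟F b)))
    where
    clean : Dec (v ≡ b) → update (reversals n b s) b nothing v ≡ reversals n b s v
    clean (yes refl) = trans (upd-same (reversals n b s) nothing refl) (sym e)
    clean (no v≢b)   = upd-diff (reversals n b s) nothing v≢b

  changed-cong : ∀ {s s₀ t} → (∀ u v → edgeColor s u v ≡ edgeColor s₀ u v) → ∀ u v → changed s t u v ≡ changed s₀ t u v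
  changed-cong e u v rewrite e u v = refl

  recourse-cong : ∀ {s s₀ t} → (∀ u v → edgeColor s u v ≡ edgeColor s₀ u v) → recourse s t ≡ recourse s₀ t
  recourse-cong {s} {s₀} {t} e = cong length (filterᵇ-cong (cartesianProduct vertices vertices)
    (λ uv → cong ((toℕ (proj₁ uv) ℕ.<ᵇ toℕ (proj₂ uv)) ∧_) (changed-cong {s} {s₀} {t} e (proj₁ uv) (proj₂ uv))))

  edgeColor-cong : ∀ {s t : State} → s ≗ t → ∀ u v → edgeColor s u v ≡ edgeColor t u v
  edgeColor-cong e u v rewrite e u | e v = refl

  reroot-rerooted : ∀ {f : Shape} → Ranked f → ∀ b → Rerooted f b (λ s → reroot s b) (reroot f b)
  reroot-rerooted {f} rk b = record
    { ranked = Ranked-cong (λ v → sym (same v)) R.ranked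
    ; root = trans (same b) R.root
    ; perm = R.perm
    ; proper = λ χ pr → Proper-cong (λ v → sym (same v)) (R.perm χ) (R.proper χ pr)
    ; N-perm = λ h → trans (R.N-perm h) (N-shape (λ v → sym (same v)) h)
    ; repaint = λ {s} {χ} s≗ v → trans (sameS {s} {χ} s≗ v) (trans (R.repaint {χ = χ} s≗ v)
        (paint-cong {reversals n b f} {reroot f b} {R.perm χ} {R.perm χ} (λ v → sym (same v)) (λ _ → refl) v))
    ; degrees = λ v → trans (degree-cong {s = reroot f b} {f = reversals n b f} (≗-SamePar same) v) (R.degrees v)
    ; edges = λ {s} {χ} s≗ u v → trans (edgeColor-cong (sameS {s} {χ} s≗) u v) (R.edges {χ = χ} s≗ u v)
    ; roots = λ z r → R.roots z (trans (sym (rootOf-cong {s = reroot f b} {f = reversals n b f} (≗-SamePar same) z)) r)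
    }
    where
    open Ranked rk
    module R = Rerooted (reversals-rerooted rk n b (ℕₚ.<⇒≤ (rank-bound b)))
    same : reroot f b ≗ reversals n b f
    same = reroot-reversals f b rank rank-par R.root
    sameS : ∀ {s χ} → s ≗ paint f χ → reroot s b ≗ reversals n b s
    sameS {s} {χ} s≗ = reroot-reversals s b rank
      (λ e → rank-par (Edges.read rk {χ} {s} s≗ e)) (trans (R.repaint {χ = χ} s≗ b) (paint-nothing (reversals n b f) (R.perm χ) R.root))

-- Running the algorithm

module Running (n Δ c : ℕ) (3≤Δ : 3 ≤ Δ) where
  open DistMaint n Δ c
  open Kempe n κ
  open Colourings n κ
  open Painting n Δ c
  open Steps n Δ c
  open Uniformity n Δ c
  open Recourse n Δ c
  open Roots n Δ c
  open Rerooting n Δ c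

  Δ≤κ : Δ ≤ κ
  Δ≤κ = ℕₚ.m≤m+n Δ c

  κ-1-nonZero : NonZero (κ ∸ 1)
  κ-1-nonZero = ℕ.>-nonZero (ℕₚ.m<n⇒0<n∸m (ℕₚ.≤-trans (s≤s (s≤s z≤n)) (ℕₚ.≤-trans 3≤Δ Δ≤κ)))

  -- The expected recourse as a function of the shape alone. Once `expRecR-value` and
  -- `expRecG-value` are established, only weights in deterministic forests remain to be estimated.
  value : Shape → V → ℚ
  value F r = frac 1 κ *ℚ ∑ vertices (wt F r n)

  wt-cong : ∀ {f g : Shape} → f ≗ g → ∀ r k v → wt f r k v ≡ wt g r k v
  wt-cong e r zero v = refl
  wt-cong {f} {g} e r (suc k) v with f v | g v | e v
  ... | nothing | .nothing | refl = refl
  ... | just (q , _) | .(just (q , _)) | refl with q ≟F r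
  ...   | yes _ = refl
  ...   | no _  = cong (frac 1 (κ ∸ 1) *ℚ_) (wt-cong e r k q)

  value-cong : ∀ {f g : Shape} → f ≗ g → ∀ r → value f r ≡ value g r
  value-cong {f} {g} e r = cong (frac 1 κ *ℚ_) (∑-cong vertices (wt-cong {f} {g} e r n))

  record Sound (F : Shape) (r : V) : Set where
    field
      ranked  : Ranked F
      maxdeg  : ∀ v → degree F v ≤ Δ
      nonroot : ∃ λ q → F r ≡ just q

  record Good (Φ : (State → ℚ) → ℚ) (f : Shape) : Set where
    field
      unif   : Unif Φ f
      ranked : Ranked f
      maxdeg : ∀ v → degree f v ≤ Δ

  Unif-≗ : ∀ {Φ Ψ : (State → ℚ) → ℚ} {f} → (∀ g → Ψ g ≡ Φ g) → Unif Φ f → Unif Ψ f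
  Unif-≗ e U = record { weight = weight ; mass = mass ; expectation = λ g h sp → trans (e g) (expectation g h sp) }
    where open Unif U

  -- `Φ` is known only through values on painted states, so integrands that agree there have equal
  -- expectations. Kernels need to be identified no further than that.
  painted-cong : ∀ {Φ f} → Unif Φ f → ∀ {g₁ g₂ h} → Spec f g₂ h →
    (∀ s χ → Proper f χ → s ≗ paint f χ → g₁ s ≡ g₂ s) → Φ g₁ ≡ Φ g₂
  painted-cong U {g₁} {g₂} {h} sp e = trans (expectation g₁ h (λ s χ pr s≗ → trans (e s χ pr s≗) (sp s χ pr s≗))) (sym (expectation g₂ h sp))
    where open Unif U

  module LinkDegree {f : Shape} (rk : Ranked f) (p r : V) (fr : f r ≡ nothing) (p≢r : p ≢ r) (¬below : ¬ Below f r p)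
      (rk' : Ranked (update f r (just (p , tt)))) where
    open Link rk p r fr p≢r ¬below

    end? : ∀ v → Dec (v ≡ r ⊎ v ≡ p)
    end? v = (v ≟F r) ⊎-dec (v ≟F p)

    degree-link : ∀ v → ℕtoℚ (degree f' v) ≡ ℕtoℚ (degree f v) +ℚ (does (end? v) ▸ 1ℚ)
    degree-link v = begin
      ℕtoℚ (degree f' v)
        ≡⟨ degree-degℚ rk' v ⟩
      ∑ vertices (λ e → does (inc? f' v e) ▸ 1ℚ)
        ≡⟨ ∑-cong vertices (λ e → at e (e ≟F r)) ⟩
      ∑ vertices (λ e → (does (inc? f v e) ▸ 1ℚ) +ℚ (does (r ≟F e) ▸ does (end? v) ▸ 1ℚ))
        ≡⟨ ∑-+ vertices (λ e → does (inc? f v e) ▸ 1ℚ) (λ e → does (r ≟F e) ▸ does (end? v) ▸ 1ℚ) ⟩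
      degℚ f v +ℚ ∑ vertices (λ e → does (r ≟F e) ▸ does (end? v) ▸ 1ℚ)
        ≡⟨ cong₂ _+ℚ_ (sym (degree-degℚ rk v)) (∑-δ n r (λ _ → does (end? v) ▸ 1ℚ)) ⟩
      ℕtoℚ (degree f v) +ℚ (does (end? v) ▸ 1ℚ) ∎
      where
      open ≡-Reasoning
      Inc-r⁺ : v ≡ r ⊎ v ≡ p → Inc f' v r
      Inc-r⁺ (inj₁ refl) = inj₁ (refl , _ , f'-r)
      Inc-r⁺ (inj₂ refl) = inj₂ f'-r
      at : ∀ e → Dec (e ≡ r) → does (inc? f' v e) ▸ 1ℚ ≡ (does (inc? f v e) ▸ 1ℚ) +ℚ (does (r ≟F e) ▸ does (end? v) ▸ 1ℚ)
      at e (yes refl) = trans (cong (_▸ 1ℚ) (does-iff (inc? f' v e) (end? v) Inc-r Inc-r⁺))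
        (sym (trans (cong₂ _+ℚ_ (▸-no (inc? f v e) 1ℚ (λ i → Inc-≢ i refl)) (▸-yes (e ≟F e) (does (end? v) ▸ 1ℚ) refl)) (ℚₚ.+-identityˡ _)))
      at e (no e≢r) = trans (cong (_▸ 1ℚ) (does-iff (inc? f' v e) (inc? f v e) (Inc-lower e≢r) Inc-lift))
        (sym (trans (cong ((does (inc? f v e) ▸ 1ℚ) +ℚ_) (▸-no (r ≟F e) (does (end? v) ▸ 1ℚ) (e≢r ∘ sym))) (ℚₚ.+-identityʳ _)))

    degree-end : ∀ {v} → v ≡ r ⊎ v ≡ p → degree f' v ≡ suc (degree f v)
    degree-end {v} h = trans (ℕtoℚ-injective (trans (degree-link v) (trans (cong (ℕtoℚ (degree f v) +ℚ_) (▸-yes (end? v) 1ℚ h))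
      (sym (ℕtoℚ-+ (degree f v) 1))))) (ℕₚ.+-comm (degree f v) 1)

    degree-inner : ∀ {v} → ¬ (v ≡ r ⊎ v ≡ p) → degree f' v ≡ degree f v
    degree-inner {v} h = ℕtoℚ-injective (trans (degree-link v) (trans (cong (ℕtoℚ (degree f v) +ℚ_) (▸-no (end? v) 1ℚ h)) (ℚₚ.+-identityʳ _)))

    degree-≤ : ∀ v → degree f v ≤ degree f' v
    degree-≤ v with end? v
    ... | yes h = ℕₚ.≤-trans (ℕₚ.n≤1+n _) (ℕₚ.≤-reflexive (sym (degree-end h)))
    ... | no ¬h = ℕₚ.≤-reflexive (sym (degree-inner ¬h))

  module Insert {Φ : (State → ℚ) → ℚ} {f : Shape} (G : Good Φ f) (p r : V) (fr : f r ≡ nothing) (pr : rootOf f p ≢ r)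
      (dₚ : degree f p < Δ) (dᵣ : degree f r < Δ) where
    open Good G
    open LinkRank ranked p r fr pr
    private
      module L = LinkDegree ranked p r fr link-≢ link-¬below link-ranked
      module U = UnifLink ranked p r fr link-≢ link-¬below link-ranked (ℕₚ.<-≤-trans dₚ Δ≤κ) (ℕₚ.<-≤-trans dᵣ Δ≤κ)
      module R = RecourseLink ranked p r fr link-≢ link-¬below link-ranked (ℕₚ.<-≤-trans dₚ Δ≤κ) (ℕₚ.<-≤-trans dᵣ Δ≤κ) κ-1-nonZero
      module Ev = Evaluate ranked p r fr link-≢ link-¬below link-ranked

    F : Shape
    F = update f r (just (p , tt))

    F-maxdeg : ∀ v → degree F v ≤ Δ
    F-maxdeg v with L.end? v
    ... | yes h@(inj₁ refl) = ℕₚ.≤-trans (ℕₚ.≤-reflexive (L.degree-end h)) dᵣ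
    ... | yes h@(inj₂ refl) = ℕₚ.≤-trans (ℕₚ.≤-reflexive (L.degree-end h)) dₚ
    ... | no ¬h = ℕₚ.≤-trans (ℕₚ.≤-reflexive (L.degree-inner ¬h)) (maxdeg v)

    good : Good (λ g → Φ (λ s → expect (insertR s p r) g)) F
    good = record { unif = U.unif-insertR unif ; ranked = link-ranked ; maxdeg = F-maxdeg }

    sound : Sound F r
    sound = record { ranked = link-ranked ; maxdeg = F-maxdeg ; nonroot = _ , upd-same f {r} (just (p , tt)) refl }

    expected : Φ (λ s → expect (insertR s p r) (λ s' → ℕtoℚ (recourse s s'))) ≡ value F r
    expected = R.expected-insertR unif

    insert-spec : ∀ (g : State → State → ℚ) (H : Colouring → Colouring → ℚ) →
      (∀ s χ → Proper f χ → s ≗ paint f χ → Spec F (g s) (H χ)) → ∃ λ h → Spec f (λ s → expect (insertR s p r) (g s)) h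
    insert-spec g H sp = _ , λ s χ pr s≗ → Ev.insertR-eval (g s) (H χ) (sp s χ pr s≗) s χ pr s≗

    recourse-spec : ∃ λ h → Spec f (λ s → expect (insertR s p r) (λ s' → ℕtoℚ (recourse s s'))) h
    recourse-spec = insert-spec (λ s s' → ℕtoℚ (recourse s s')) (D f) (λ s χ pr s≗ t χ' pr' t≗ → R.recourse-link {χ} {χ'} s≗ t≗)

  -- The kernel `k` is required to be `deleteR` only on states painted over `f`: in the general
  -- model the lower endpoint is found by inspecting the state.
  module Delete {Φ : (State → ℚ) → ℚ} {f : Shape} (G : Good Φ f) (p r : V) (fr : f r ≡ just (p , tt))
      (k : State → Dist State) (q : V) (k-del : ∀ s χ → s ≗ paint f χ → k s ≡ deleteR s q r) where
    open Good G
    open UnlinkRank ranked p r fr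
    private
      f₀ f₁ : Shape
      f₀ = update f r nothing
      f₁ = update f₀ r (just (p , tt))
      module L = LinkDegree unlink-ranked p r unlink-root unlink-≢ unlink-¬below relink-ranked

      degree-f₁ : ∀ v → degree f₁ v ≡ degree f v
      degree-f₁ = degree-cong {s = f₁} {f = f} (≗-SamePar relink)

      d : ∀ {v} → v ≡ r ⊎ v ≡ p → degree f₀ v < κ
      d {v} h = ℕₚ.≤-trans (ℕₚ.≤-reflexive (sym (L.degree-end h))) (ℕₚ.≤-trans (ℕₚ.≤-reflexive (degree-f₁ v)) (ℕₚ.≤-trans (maxdeg v) Δ≤κ))

      module U = UnifLink unlink-ranked p r unlink-root unlink-≢ unlink-¬below relink-ranked (d (inj₂ refl)) (d (inj₁ refl))
      module R = RecourseLink unlink-ranked p r unlink-root unlink-≢ unlink-¬below relink-ranked (d (inj₂ refl)) (d (inj₁ refl)) κ-1-nonZero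
      module Ev = Evaluate unlink-ranked p r unlink-root unlink-≢ unlink-¬below relink-ranked

      unif₁ : Unif Φ f₁
      unif₁ = Unif-cong (λ v → sym (relink v)) unif

      kernel : ∀ s χ → s ≗ paint f₁ χ → k s ≡ deleteR s q r
      kernel s χ s≗ = k-del s χ (λ v → trans (s≗ v) (paint-cong {f₁} {f} {χ} {χ} relink (λ _ → refl) v))

      same : ∀ (g : State → State → ℚ) (H : Colouring → Colouring → ℚ) → (∀ s χ → Proper f₁ χ → s ≗ paint f₁ χ → Spec f₀ (g s) (H χ)) →
        Φ (λ s → expect (k s) (g s)) ≡ Φ (λ s → expect (deleteR s q r) (g s))
      same g H sp = painted-cong unif₁ (λ s χ pr s≗ → Ev.deleteR-eval (g s) (H χ) (sp s χ pr s≗) s χ pr s≗ q)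
        (λ s χ pr s≗ → cong (λ d → expect d (g s)) (kernel s χ s≗))

    good : Good (λ g → Φ (λ s → expect (k s) g)) f₀
    good = record
      { unif = record
        { weight = V.weight ; mass = V.mass
        ; expectation = λ g h sp → trans (same (λ _ → g) (λ _ → h) (λ _ _ _ _ → sp)) (V.expectation g h sp) }
      ; ranked = unlink-ranked
      ; maxdeg = λ v → ℕₚ.≤-trans (L.degree-≤ v) (ℕₚ.≤-trans (ℕₚ.≤-reflexive (degree-f₁ v)) (maxdeg v)) }
      where module V = Unif (U.unif-deleteR unif₁ q)

    sound : Sound f r
    sound = record { ranked = ranked ; maxdeg = maxdeg ; nonroot = _ , fr }

    expected : Φ (λ s → expect (k s) (λ s' → ℕtoℚ (recourse s s'))) ≡ value f r
    expected = trans (same (λ s s' → ℕtoℚ (recourse s s')) (D f₀) (λ s χ pr s≗ t χ' pr' t≗ → R.recourse-unlink {χ} {χ'} s≗ t≗))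
      (trans (R.expected-deleteR unif₁ q) (value-cong {f₁} {f} relink r))

  module RerootInsert {Φ : (State → ℚ) → ℚ} {f : Shape} (G : Good Φ f) (a b : V) (ab : rootOf f a ≢ rootOf f b)
      (dₐ : degree f a < Δ) (d_b : degree f b < Δ)
      (k : State → Dist State) (k-ins : ∀ s χ → s ≗ paint f χ → k s ≡ insertR (reroot s b) a b) where
    open Good G
    private
      module R = Rerooted (reroot-rerooted ranked b)

      Φ₁ : (State → ℚ) → ℚ
      Φ₁ g = Φ (λ s → g (reroot s b))

      f₁ : Shape
      f₁ = reroot f b

      unif₁ : Unif Φ₁ f₁
      unif₁ = record
        { weight = weight
        ; mass = trans (cong (weight *ℚ_) (sym (R.N-perm (λ _ → 1ℚ)))) mass
        ; expectation = λ g h sp → trans (expectation (λ s → g (reroot s b)) (h ∘ R.perm) (lift sp)) (cong (weight *ℚ_) (R.N-perm h)) }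
        where
        open Unif unif
        lift : ∀ {g h} → Spec f₁ g h → Spec f (λ s → g (reroot s b)) (h ∘ R.perm)
        lift sp s χ pr s≗ = sp (reroot s b) (R.perm χ) (R.proper χ pr) (R.repaint {s} {χ} s≗)

      good₁ : Good Φ₁ f₁
      good₁ = record { unif = unif₁ ; ranked = R.ranked ; maxdeg = λ v → ℕₚ.≤-trans (ℕₚ.≤-reflexive (R.degrees v)) (maxdeg v) }

      module In = Insert good₁ a b R.root (ab ∘ R.roots a) (ℕₚ.≤-<-trans (ℕₚ.≤-reflexive (R.degrees a)) dₐ) (ℕₚ.≤-<-trans (ℕₚ.≤-reflexive (R.degrees b)) d_b)

      same : ∀ (g : State → State → ℚ) (g₁ : State → State → ℚ) → (∃ λ h → Spec f₁ (λ s → expect (insertR s a b) (g₁ s)) h) →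
        (∀ s χ → s ≗ paint f χ → ∀ t → g s t ≡ g₁ (reroot s b) t) →
        Φ (λ s → expect (k s) (g s)) ≡ Φ₁ (λ s → expect (insertR s a b) (g₁ s))
      same g g₁ (h , sp) e = painted-cong unif {h = h ∘ R.perm} (λ s χ pr s≗ → sp (reroot s b) (R.perm χ) (R.proper χ pr) (R.repaint {s} {χ} s≗))
        (λ s χ pr s≗ → trans (cong (λ d → expect d (g s)) (k-ins s χ s≗)) (expect-cong (insertR (reroot s b) a b) (e s χ s≗)))

    open In public using (F; sound)

    good : Good (λ g → Φ (λ s → expect (k s) g)) F
    good = record
      { unif = record
        { weight = W.weight ; mass = W.mass
        ; expectation = λ g h sp → trans (same (λ _ → g) (λ _ → g) (In.insert-spec (λ _ → g) (λ _ → h) (λ _ _ _ _ → sp)) (λ _ _ _ _ → refl))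
            (W.expectation g h sp) }
      ; ranked = Good.ranked In.good ; maxdeg = Good.maxdeg In.good }
      where module W = Unif (Good.unif In.good)

    expected : Φ (λ s → expect (k s) (λ s' → ℕtoℚ (recourse s s'))) ≡ value F b
    expected = trans (same (λ s s' → ℕtoℚ (recourse s s')) (λ s s' → ℕtoℚ (recourse s s')) In.recourse-spec
        -- Recourse is measured against the state before rerooting; rerooting moves entries but
        -- changes the colour of no edge.
        (λ s χ s≗ t → cong ℕtoℚ (sym (recourse-cong {reroot s b} {s} {t} (R.edges {s} {χ} s≗))))) In.expected

  good-empty : Good (expect (returnD emptyForest)) emptyForest
  good-empty = record
    { unif = record
      { weight = frac 1 (length colourings)
      ; mass = trans (cong (frac 1 (length colourings) *ℚ_) (trans (all-proper (λ _ → 1ℚ)) (∑-length colourings))) (frac-* 1 (length colourings) {{nonempty}})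
      ; expectation = λ g h sp → trans (expect-return emptyForest g) (sym (trans (cong (frac 1 (length colourings) *ℚ_)
          (trans (all-proper h) (trans (∑-cong colourings λ χ → sym (sp emptyForest χ (none-proper χ) (λ _ → refl))) (∑-const colourings (g emptyForest)))))
          (trans (sym (ℚₚ.*-assoc (frac 1 (length colourings)) (ℕtoℚ (length colourings)) (g emptyForest)))
            (trans (cong (_*ℚ g emptyForest) (frac-* 1 (length colourings) {{nonempty}})) (ℚₚ.*-identityˡ (g emptyForest)))))) }
    ; ranked = normalise {emptyForest} (λ _ → 0) (λ ())
    ; maxdeg = λ v → ℕₚ.≤-trans (ℕₚ.≤-reflexive (no-children vertices)) z≤n }
    where
    none-proper : ∀ χ → Proper emptyForest χ
    none-proper χ p e e' (inj₁ (_ , _ , ())) i' eq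
    none-proper χ p e e' (inj₂ ()) i' eq
    all-proper : ∀ h → N emptyForest h ≡ ∑ colourings h
    all-proper h = ∑-cong colourings λ χ → ▸-yes (proper? emptyForest χ) (h χ) (none-proper χ)
    no-children : ∀ (xs : List V) → length (filterᵇ (λ _ → false) xs) ≡ 0
    no-children []       = refl
    no-children (x ∷ xs) = no-children xs
    nonempty : NonZero (length colourings)
    nonempty = go colourings (enum-allVecs κ n)
      where
      x₀ : Colouring
      x₀ = Vec.replicate n (fromℕ< (ℕₚ.<-≤-trans (s≤s z≤n) (ℕₚ.≤-trans 3≤Δ Δ≤κ)))
      go : ∀ xs → IsEnum xs → NonZero (length xs)
      go [] en = case trans (en x₀ (λ y → does (Vecₚ.≡-dec _≟F_ y x₀) ▸ 1ℚ) (λ y → ▸-no (Vecₚ.≡-dec _≟F_ y x₀) 1ℚ))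
        (▸-yes (Vecₚ.≡-dec _≟F_ x₀ x₀) 1ℚ refl) of λ ()
      go (x ∷ xs) en = _

  Good-≗ : ∀ {Φ Ψ : (State → ℚ) → ℚ} {f} → (∀ g → Ψ g ≡ Φ g) → Good Φ f → Good Ψ f
  Good-≗ e G = record { unif = Unif-≗ e unif ; ranked = ranked ; maxdeg = maxdeg }
    where open Good G

  -- The forest containing the updated edge, and the lower endpoint of that edge.
  edgeR : Shape → RUpdate → Shape × V
  edgeR f (rins p r) = update f r (just (p , tt)) , r
  edgeR f (rdel p r) = f , r

  stepR-good : ∀ {Φ f} u → Good Φ f → ValidR f u →
    Good (λ g → Φ (λ s → expect (stepR s u) g)) (stepShapeR f u)
    × Sound (proj₁ (edgeR f u)) (proj₂ (edgeR f u))
    × Φ (λ s → expect (stepR s u) (λ s' → ℕtoℚ (recourse s s'))) ≡ value (proj₁ (edgeR f u)) (proj₂ (edgeR f u))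
  stepR-good (rins p r) G (fr , pr , dₚ , dᵣ) = In.good , In.sound , In.expected
    where module In = Insert G p r fr pr dₚ dᵣ
  stepR-good (rdel p r) G fr = X.good , X.sound , X.expected
    where module X = Delete G p r fr (λ s → deleteR s p r) p (λ _ _ _ → refl)

  shapeR : Shape → List RUpdate → Shape
  shapeR = foldl stepShapeR

  runR-good : ∀ us u d f → Good (expect d) f → ValidSeqR f (us ∷ʳ u) →
    Good (expect (foldl (λ d u → bindD d (λ s → stepR s u)) d us)) (shapeR f us) × ValidR (shapeR f us) u
  runR-good [] u d f G (v , _) = G , v
  runR-good (u' ∷ us) u d f G (v , vs) = runR-good us u (bindD d (λ s → stepR s u')) (stepShapeR f u')
    (Good-≗ (expect-bind d (λ s → stepR s u')) (proj₁ (stepR-good u' G v))) vs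

  expRecR-value : ∀ us u → ValidSeqR emptyForest (us ∷ʳ u) → let F,r = edgeR (shapeR emptyForest us) u in
    Sound (proj₁ F,r) (proj₂ F,r) × expRecR us u ≡ value (proj₁ F,r) (proj₂ F,r)
  expRecR-value us u vs = proj₂ (stepR-good u (proj₁ run) (proj₂ run))
    where run = runR-good us u (returnD emptyForest) emptyForest good-empty vs

  edgeG : Shape → GUpdate → Shape × V
  edgeG f (gins u v) = stepShapeG f (gins u v) , proj₂ (orient f u v)
  edgeG f (gdel u v) = f , (if isChildOf f u v then v else u)

  orient-cases : ∀ (f : Shape) u v → orient f u v ≡ (u , v) ⊎ orient f u v ≡ (v , u)
  orient-cases f u v with (treeEdges f u ℕ.≤ᵇ Δ) ∧ (treeEdges f v ℕ.≤ᵇ Δ) | degree f v ℕ.≤ᵇ degree f u | treeEdges f v ℕ.≤ᵇ treeEdges f u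
  ... | true  | true  | _     = inj₁ refl
  ... | true  | false | _     = inj₂ refl
  ... | false | _     | true  = inj₁ refl
  ... | false | _     | false = inj₂ refl

  stepG-ins : ∀ s u v {a b} → orient s u v ≡ (a , b) → stepG s (gins u v) ≡ insertR (reroot s b) a b
  stepG-ins s u v e rewrite e = refl

  stepShapeG-ins : ∀ f u v {a b} → orient f u v ≡ (a , b) → stepShapeG f (gins u v) ≡ update (reroot f b) b (just (a , tt))
  stepShapeG-ins f u v e rewrite e = refl

  GoodStepG : ((State → ℚ) → ℚ) → Shape → GUpdate → Set
  GoodStepG Φ f u = Good (λ g → Φ (λ s → expect (stepG s u) g)) (stepShapeG f u)
    × Sound (proj₁ (edgeG f u)) (proj₂ (edgeG f u))
    × Φ (λ s → expect (stepG s u) (λ s' → ℕtoℚ (recourse s s'))) ≡ value (proj₁ (edgeG f u)) (proj₂ (edgeG f u))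

  stepG-good : ∀ {Φ f} u → Good Φ f → ValidG f u → GoodStepG Φ f u
  stepG-good {Φ} {f} (gins u v) G (uv , dᵤ , dᵥ) = cases (orient-cases f u v)
    where
    link : ∀ a b → orient f u v ≡ (a , b) → rootOf f a ≢ rootOf f b → degree f a < Δ → degree f b < Δ → GoodStepG Φ f (gins u v)
    link a b o ab dₐ d_b = subst (Good _) (sym (stepShapeG-ins f u v o)) X.good ,
        subst₂ Sound (sym (stepShapeG-ins f u v o)) (sym (cong proj₂ o)) X.sound ,
        trans X.expected (sym (cong₂ value (stepShapeG-ins f u v o) (cong proj₂ o)))
      where
      module X = RerootInsert G a b ab dₐ d_b (λ s → stepG s (gins u v))
        (λ s χ s≗ → stepG-ins s u v (trans (orient-cong {s = s} {f = f} (paint-SamePar {f} {χ} s≗) u v) o))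
    cases : orient f u v ≡ (u , v) ⊎ orient f u v ≡ (v , u) → GoodStepG Φ f (gins u v)
    cases (inj₁ o) = link u v o uv dᵤ dᵥ
    cases (inj₂ o) = link v u o (uv ∘ sym) dᵥ dᵤ
  stepG-good {Φ} {f} (gdel u v) G valid = cases (isChildOf f u v) refl
    where
    pick : ∀ {b} (s : State) → isChildOf s u v ≡ b → stepG s (gdel u v) ≡ (if b then deleteR s u v else deleteR s v u)
    pick s e rewrite e = refl
    childOf : ∀ {b} s χ → isChildOf f u v ≡ b → s ≗ paint f χ → isChildOf s u v ≡ b
    childOf s χ e s≗ = trans (isChildOf-cong {s = s} {f = f} (paint-SamePar {f} {χ} s≗) u v) e
    cases : ∀ b → isChildOf f u v ≡ b → GoodStepG Φ f (gdel u v)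
    cases true e = subst (Good _) (sym (cong (λ b → if b then update f v nothing else update f u nothing) e)) X.good ,
        subst (Sound f) (sym (cong (λ b → if b then v else u) e)) X.sound ,
        trans X.expected (sym (cong (λ b → value f (if b then v else u)) e))
      where
      module X = Delete G u v (witness (child? f u v) (trans (sym (isChildOf-child? f u v)) e)) (λ s → stepG s (gdel u v)) u
        (λ s χ s≗ → pick s (childOf s χ e s≗))
    cases false e = subst (Good _) (sym (cong (λ b → if b then update f v nothing else update f u nothing) e)) X.good ,
        subst (Sound f) (sym (cong (λ b → if b then v else u) e)) X.sound ,
        trans X.expected (sym (cong (λ b → value f (if b then v else u)) e))
      where
      other : (f v ≡ just (u , tt)) ⊎ (f u ≡ just (v , tt)) → f u ≡ just (v , tt)
      other (inj₁ h) = case trans (sym e) (trans (isChildOf-child? f u v) (dec-true (child? f u v) h)) of λ ()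
      other (inj₂ h) = h
      module X = Delete G v u (other valid) (λ s → stepG s (gdel u v)) v
        (λ s χ s≗ → pick s (childOf s χ e s≗))

  shapeG : Shape → List GUpdate → Shape
  shapeG = foldl stepShapeG

  runG-good : ∀ us u d f → Good (expect d) f → ValidSeqG f (us ∷ʳ u) →
    Good (expect (foldl (λ d u → bindD d (λ s → stepG s u)) d us)) (shapeG f us) × ValidG (shapeG f us) u
  runG-good [] u d f G (v , _) = G , v
  runG-good (u' ∷ us) u d f G (v , vs) = runG-good us u (bindD d (λ s → stepG s u')) (stepShapeG f u')
    (Good-≗ (expect-bind d (λ s → stepG s u')) (proj₁ (stepG-good u' G v))) vs

  expRecG-value : ∀ us u → ValidSeqG emptyForest (us ∷ʳ u) → let F,r = edgeG (shapeG emptyForest us) u in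
    Sound (proj₁ F,r) (proj₂ F,r) × expRecG us u ≡ value (proj₁ F,r) (proj₂ F,r)
  expRecG-value us u vs = proj₂ (stepG-good u (proj₁ run) (proj₂ run))
    where run = runG-good us u (returnD emptyForest) emptyForest good-empty vs

-- Upper bounds

_^ℚ_ : ℚ → ℕ → ℚ
x ^ℚ zero  = 1ℚ
x ^ℚ suc k = x *ℚ (x ^ℚ k)

^ℚ-nonneg : ∀ {x} → 0ℚ ≤ℚ x → ∀ k → 0ℚ ≤ℚ x ^ℚ k
^ℚ-nonneg h zero    = ℕtoℚ-nonneg 1
^ℚ-nonneg h (suc k) = *-nonneg h (^ℚ-nonneg h k)

^ℚ-inverse : ∀ x b → x *ℚ ℕtoℚ b ≡ 1ℚ → ∀ k → (x ^ℚ k) *ℚ ℕtoℚ (b ^ k) ≡ 1ℚ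
^ℚ-inverse x b e zero    = refl
^ℚ-inverse x b e (suc k) = trans (cong ((x *ℚ (x ^ℚ k)) *ℚ_) (ℕtoℚ-* b (b ^ k)))
  (trans (regroup x (x ^ℚ k) (ℕtoℚ b) (ℕtoℚ (b ^ k))) (trans (cong₂ _*ℚ_ e (^ℚ-inverse x b e k)) refl))
  where
  regroup : ∀ x y b z → x *ℚ y *ℚ (b *ℚ z) ≡ x *ℚ b *ℚ (y *ℚ z)
  regroup = solve 4 (λ x y b z → x :* y :* (b :* z) := x :* b :* (y :* z)) refl
    where open +-*-Solver

frac1-anti : ∀ {a b} → .{{_ : NonZero a}} → .{{_ : NonZero b}} → a ≤ b → frac 1 b ≤ℚ frac 1 a
frac1-anti {a} {b} a≤b = begin
  frac 1 b                            ≡⟨ sym (ℚₚ.*-identityʳ (frac 1 b)) ⟩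
  frac 1 b *ℚ 1ℚ                      ≡⟨ cong (frac 1 b *ℚ_) (sym (trans (ℚₚ.*-comm (ℕtoℚ a) (frac 1 a)) (frac-* 1 a))) ⟩
  frac 1 b *ℚ (ℕtoℚ a *ℚ frac 1 a)    ≡⟨ sym (ℚₚ.*-assoc (frac 1 b) (ℕtoℚ a) (frac 1 a)) ⟩
  frac 1 b *ℚ ℕtoℚ a *ℚ frac 1 a      ≤⟨ *-monoˡ (frac1-nonneg a) (*-monoʳ (frac1-nonneg b) (ℕtoℚ-mono a≤b)) ⟩
  frac 1 b *ℚ ℕtoℚ b *ℚ frac 1 a      ≡⟨ trans (cong (_*ℚ frac 1 a) (frac-* 1 b)) (ℚₚ.*-identityˡ (frac 1 a)) ⟩
  frac 1 a                            ∎
  where open ℚₚ.≤-Reasoning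

-- Comparisons with logarithms

numerator-eq : ∀ x {p} → ℚ.numerator x ≡ + p → x *ℚ ℕtoℚ (ℚ.denominatorℕ x) ≡ ℕtoℚ p
numerator-eq x {p} e = trans (cong (_*ℚ ℕtoℚ (ℚ.denominatorℕ x)) (trans (sym (ℚₚ.↥p/↧p≡p x)) (cong (λ z → z ℚ./ ℚ.denominatorℕ x) e)))
  (frac-* p (ℚ.denominatorℕ x))

numerator-≤ : ∀ x {p} a m → ℚ.numerator x ≡ + p → ℕtoℚ a *ℚ x ≤ℚ ℕtoℚ m → a * p ≤ m * ℚ.denominatorℕ x
numerator-≤ x {p} a m e h = ℕtoℚ-cancel (begin
  ℕtoℚ (a * p)                                    ≡⟨ ℕtoℚ-* a p ⟩
  ℕtoℚ a *ℚ ℕtoℚ p                                ≡⟨ cong (ℕtoℚ a *ℚ_) (sym (numerator-eq x e)) ⟩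
  ℕtoℚ a *ℚ (x *ℚ ℕtoℚ (ℚ.denominatorℕ x))        ≡⟨ sym (ℚₚ.*-assoc (ℕtoℚ a) x _) ⟩
  ℕtoℚ a *ℚ x *ℚ ℕtoℚ (ℚ.denominatorℕ x)          ≤⟨ *-monoˡ (ℕtoℚ-nonneg (ℚ.denominatorℕ x)) h ⟩
  ℕtoℚ m *ℚ ℕtoℚ (ℚ.denominatorℕ x)               ≡⟨ sym (ℕtoℚ-* m (ℚ.denominatorℕ x)) ⟩
  ℕtoℚ (m * ℚ.denominatorℕ x)                     ∎)
  where open ℚₚ.≤-Reasoning

LeLog-intro : ∀ x C b n → (∀ p → ℚ.numerator x ≡ + p → b ^ p ≤ n ^ (C * ℚ.denominatorℕ x)) → LeLog x C b n
LeLog-intro x C b n h with ℚ.numerator x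
... | + p      = h p refl
... | -[1+ _ ] = tt

^-cancel-≤ : ∀ a b k → .{{_ : NonZero k}} → a ^ k ≤ b ^ k → a ≤ b
^-cancel-≤ a b k h with a ℕ.≤? b
... | yes p = p
... | no ¬p = contradiction h (ℕₚ.<⇒≱ (ℕₚ.^-monoˡ-< k (ℕₚ.≰⇒> ¬p)))

1+t≤n^t : ∀ n t → 2 ≤ n → suc t ≤ n ^ t
1+t≤n^t n zero    h = ℕₚ.≤-refl
1+t≤n^t n (suc t) h = ℕₚ.≤-trans (s≤s (s≤s (ℕₚ.m≤m+n t (t + 0)))) (ℕₚ.≤-trans (ℕₚ.≤-reflexive (sym (ℕₚ.+-suc (suc t) (t + 0))))
  (ℕₚ.*-mono-≤ h (1+t≤n^t n t h)))

-- Up to the factor 2, `x / log x` is increasing: `n / log n ≤ 2 * b / log b`. With `t` the integer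
-- part of `b / n`, one has `b ≤ (t + 1) * n ≤ n ^ (t + 1) ≤ n ^ (2 * t)` and `t * n ≤ b`.
b^n≤n^2b : ∀ b n → 2 ≤ n → n ≤ b → b ^ n ≤ n ^ (2 * b)
b^n≤n^2b b n@(suc _) 2≤n n≤b = begin
  b ^ n                ≤⟨ ℕₚ.^-monoˡ-≤ n b≤ ⟩
  (n ^ (2 * t)) ^ n    ≡⟨ ℕₚ.^-*-assoc n (2 * t) n ⟩
  n ^ (2 * t * n)      ≡⟨ cong (n ^_) (ℕₚ.*-assoc 2 t n) ⟩
  n ^ (2 * (t * n))    ≤⟨ ℕₚ.^-monoʳ-≤ n (ℕₚ.*-monoʳ-≤ 2 (ℕD.m/n*n≤m b n)) ⟩
  n ^ (2 * b)          ∎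
  where
  open ℕₚ.≤-Reasoning
  t = b ℕD./ n
  1≤t : 1 ≤ t
  1≤t = ℕD.m≥n⇒m/n>0 n≤b
  b≤ : b ≤ n ^ (2 * t)
  b≤ = begin
    b                    ≡⟨ ℕD.m≡m%n+[m/n]*n b n ⟩
    b ℕD.% n + t * n     ≤⟨ ℕₚ.+-monoˡ-≤ (t * n) (ℕₚ.<⇒≤ (ℕD.m%n<n b n)) ⟩
    suc t * n            ≡⟨ ℕₚ.*-comm (suc t) n ⟩
    n * suc t            ≤⟨ ℕₚ.*-monoʳ-≤ n (1+t≤n^t n t 2≤n) ⟩
    n ^ suc t            ≤⟨ ℕₚ.^-monoʳ-≤ n (ℕₚ.+-monoˡ-≤ t 1≤t) ⟩
    n ^ (t + t)          ≡⟨ cong (λ z → n ^ (t + z)) (sym (ℕₚ.+-identityʳ t)) ⟩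
    n ^ (2 * t)          ∎

floor-log : ∀ b n → 2 ≤ b → 1 ≤ n → ∃ λ D → b ^ D ≤ n × n < b ^ suc D
floor-log b (suc zero) 2≤b _ = 0 , ℕₚ.≤-refl , ℕₚ.≤-trans 2≤b (ℕₚ.≤-reflexive (sym (ℕₚ.*-identityʳ b)))
floor-log b (suc (suc n)) 2≤b _ with floor-log b (suc n) 2≤b (s≤s z≤n)
... | D , lo , hi with suc (suc n) ℕ.<? b ^ suc D
...   | yes p = D , ℕₚ.m≤n⇒m≤1+n lo , p
...   | no ¬p = suc D , ℕₚ.≮⇒≥ ¬p , ℕₚ.≤-<-trans hi (ℕₚ.^-monoʳ-< b 2≤b {suc D} {suc (suc D)} ℕₚ.≤-refl)

-- Take for `D` the integer part of the logarithm of `n` to base `b`. The hypothesis gives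
-- `x ≤ D + n / b ^ (D + 1) ≤ D + 1`, which is at most `2 * D` unless `D` is zero.
log-bound : ∀ x b n → 2 ≤ b → 2 ≤ n →
  (∀ D → ℕtoℚ (b ^ suc D) *ℚ x ≤ℚ ℕtoℚ (D * b ^ suc D + n)) → LeLog x 2 b n
log-bound x b n 2≤b 2≤n bound = LeLog-intro x 2 b n λ p e → cases p e (floor-log b n 2≤b (ℕₚ.≤-trans (s≤s z≤n) 2≤n))
  where
  open ℕₚ.≤-Reasoning
  q = ℚ.denominatorℕ x
  instance
    nzb : NonZero b
    nzb = ℕ.>-nonZero (ℕₚ.≤-trans (s≤s z≤n) 2≤b)
    nzn : NonZero n
    nzn = ℕ.>-nonZero (ℕₚ.≤-trans (s≤s z≤n) 2≤n)
  cases : ∀ p → ℚ.numerator x ≡ + p → (∃ λ D → b ^ D ≤ n × n < b ^ suc D) → b ^ p ≤ n ^ (2 * q)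
  -- For `n < b` the logarithm is below one and rounding up to a full level would be too generous.
  -- The bound `x ≤ n / b` is kept instead and compared with the logarithm by `b^n≤n^2b`; powers
  -- with exponent `b` clear its denominator.
  cases p e (zero , lo , hi) = ^-cancel-≤ (b ^ p) (n ^ (2 * q)) b (begin
    (b ^ p) ^ b          ≡⟨ ℕₚ.^-*-assoc b p b ⟩
    b ^ (p * b)          ≤⟨ ℕₚ.^-monoʳ-≤ b bp ⟩
    b ^ (n * q)          ≡⟨ sym (ℕₚ.^-*-assoc b n q) ⟩
    (b ^ n) ^ q          ≤⟨ ℕₚ.^-monoˡ-≤ q (b^n≤n^2b b n 2≤n n≤b) ⟩
    (n ^ (2 * b)) ^ q    ≡⟨ ℕₚ.^-*-assoc n (2 * b) q ⟩
    n ^ (2 * b * q)      ≡⟨ cong (n ^_) (trans (ℕₚ.*-assoc 2 b q) (trans (cong (2 *_) (ℕₚ.*-comm b q)) (sym (ℕₚ.*-assoc 2 q b)))) ⟩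
    n ^ (2 * q * b)      ≡⟨ sym (ℕₚ.^-*-assoc n (2 * q) b) ⟩
    (n ^ (2 * q)) ^ b    ∎)
    where
    n≤b : n ≤ b
    n≤b = ℕₚ.≤-trans (ℕₚ.<⇒≤ hi) (ℕₚ.≤-reflexive (ℕₚ.*-identityʳ b))
    bp : p * b ≤ n * q
    bp = ℕₚ.≤-trans (ℕₚ.≤-reflexive (trans (ℕₚ.*-comm p b) (cong (_* p) (sym (ℕₚ.*-identityʳ b))))) (numerator-≤ x (b ^ 1) n e (bound 0))
  cases p e (suc D , lo , hi) = begin
    b ^ p                     ≤⟨ ℕₚ.^-monoʳ-≤ b p≤ ⟩
    b ^ (suc D * (2 * q))     ≡⟨ sym (ℕₚ.^-*-assoc b (suc D) (2 * q)) ⟩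
    (b ^ suc D) ^ (2 * q)     ≤⟨ ℕₚ.^-monoˡ-≤ (2 * q) lo ⟩
    n ^ (2 * q)               ∎
    where
    a = b ^ suc (suc D)
    instance
      nza : NonZero a
      nza = ℕₚ.m^n≢0 b (suc (suc D))
    p≤ : p ≤ suc D * (2 * q)
    p≤ = ℕₚ.*-cancelˡ-≤ a (begin
      a * p                         ≤⟨ numerator-≤ x a (suc D * a + n) e (bound (suc D)) ⟩
      (suc D * a + n) * q           ≤⟨ ℕₚ.*-monoˡ-≤ q (ℕₚ.+-monoʳ-≤ (suc D * a) (ℕₚ.<⇒≤ hi)) ⟩
      (suc D * a + a) * q           ≤⟨ ℕₚ.*-monoˡ-≤ q (ℕₚ.+-monoʳ-≤ (suc D * a) (ℕₚ.m≤m+n a (D * a))) ⟩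
      (suc D * a + suc D * a) * q   ≡⟨ cong (λ z → (suc D * a + z) * q) (sym (ℕₚ.+-identityʳ (suc D * a))) ⟩
      2 * (suc D * a) * q           ≡⟨ reorder (suc D) a q ⟩
      a * (suc D * (2 * q))         ∎)
      where
      reorder : ∀ d a q → 2 * (d * a) * q ≡ a * (d * (2 * q))
      reorder = solve 3 (λ d a q → con 2 :* (d :* a) :* q := a :* (d :* (con 2 :* q))) refl
        where open ℕSolver

-- The upper bound for the weighted sum over a subtree

module Upper (n Δ c : ℕ) (3≤Δ : 3 ≤ Δ) where
  open DistMaint n Δ c
  open Kempe n κ
  open Colourings n κ
  open Painting n Δ c
  open Steps n Δ c
  open Uniformity n Δ c
  open Roots n Δ c
  open Running n Δ c 3≤Δ

  B : ℕ
  B = κ ∸ 1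

  inv : ℚ
  inv = frac 1 B

  κ≡ : κ ≡ suc B
  κ≡ = sym (ℕₚ.m+[n∸m]≡n (ℕₚ.≤-trans (s≤s z≤n) (ℕₚ.≤-trans 3≤Δ Δ≤κ)))

  instance
    B-nonZero : NonZero B
    B-nonZero = κ-1-nonZero
    κ-nonZero : NonZero κ
    κ-nonZero = ℕ.>-nonZero (ℕₚ.≤-trans (s≤s z≤n) (ℕₚ.≤-trans 3≤Δ Δ≤κ))

  inv-B : inv *ℚ ℕtoℚ B ≡ 1ℚ
  inv-B = frac-* 1 B

  inv-nonneg : 0ℚ ≤ℚ inv
  inv-nonneg = frac1-nonneg B

  module Weights (F : Shape) (r : V) where

    φ : ℕ → V → ℚ
    φ k q = if does (q ≟F r) then 1ℚ else inv *ℚ wt F r k q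

    φ-root : ∀ k {q} → q ≡ r → φ k q ≡ 1ℚ
    φ-root k {q} e rewrite dec-true (q ≟F r) e = refl

    φ-other : ∀ k {q} → q ≢ r → φ k q ≡ inv *ℚ wt F r k q
    φ-other k {q} e rewrite dec-false (q ≟F r) e = refl

    wt-nothing : ∀ k {v} → F v ≡ nothing → wt F r k v ≡ 0ℚ
    wt-nothing zero e = refl
    wt-nothing (suc k) e rewrite e = refl

    wt-just : ∀ k {v q} → F v ≡ just (q , tt) → wt F r (suc k) v ≡ φ k q
    wt-just k e rewrite e = refl

    wt-nonneg : ∀ k v → 0ℚ ≤ℚ wt F r k v
    wt-nonneg zero v = ℚₚ.≤-refl
    wt-nonneg (suc k) v with F v
    ... | nothing = ℚₚ.≤-refl
    ... | just (q , _) with q ≟F r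
    ...   | yes _ = ℕtoℚ-nonneg 1
    ...   | no _  = *-nonneg inv-nonneg (wt-nonneg k q)

    φ-nonneg : ∀ k q → 0ℚ ≤ℚ φ k q
    φ-nonneg k q with q ≟F r
    ... | yes _ = ℕtoℚ-nonneg 1
    ... | no _  = *-nonneg inv-nonneg (wt-nonneg k q)

    wt-parents : ∀ k v → wt F r (suc k) v ≡ ∑ vertices (λ q → does (child? F q v) ▸ φ k q)
    wt-parents k v = cases (F v) refl
      where
      cases : ∀ m → F v ≡ m → wt F r (suc k) v ≡ ∑ vertices (λ q → does (child? F q v) ▸ φ k q)
      cases nothing e = trans (wt-nothing (suc k) e) (sym (trans (∑-cong vertices λ q → ▸-no (child? F q v) (φ k q)
        (λ e' → case trans (sym e) e' of λ ())) (∑-0 vertices)))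
      cases (just (q , tt)) e = trans (wt-just k e) (sym (trans (enum-allFin n q _ (λ q' ne → ▸-no (child? F q' v) (φ k q') (λ e' → ne (par-unique e' e))))
        (▸-yes (child? F q v) (φ k q) e)))

    S : ℕ → ℚ
    S k = ∑ vertices (wt F r k)

    kids : V → ℚ
    kids q = ∑ vertices λ v → does (child? F q v) ▸ 1ℚ

    kids-length : ∀ q → kids q ≡ ℕtoℚ (length (children F q))
    kids-length q = trans (sym (∑-children-shape F q (λ _ → 1ℚ))) (∑-length (children F q))

    -- The weights are regrouped by parents, each `q` passing `φ k q` to every child; degree bounds
    -- enter through the number of children.
    S-suc : ∀ k → S (suc k) ≡ ∑ vertices (λ q → φ k q *ℚ kids q)
    S-suc k = trans (∑-cong vertices (wt-parents k)) (trans (∑-swap vertices vertices (λ v q → does (child? F q v) ▸ φ k q))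
      (∑-cong vertices λ q → trans (∑-cong vertices λ v → trans (cong (does (child? F q v) ▸_) (sym (ℚₚ.*-identityʳ (φ k q))))
        (sym (▸-*ˡ (does (child? F q v)) (φ k q) 1ℚ))) (∑-*ˡ vertices (φ k q) (λ v → does (child? F q v) ▸ 1ℚ))))

    wt-≤1 : inv ≤ℚ 1ℚ → ∀ k v → wt F r k v ≤ℚ 1ℚ
    wt-≤1 h zero v = ℕtoℚ-nonneg 1
    wt-≤1 h (suc k) v with F v
    ... | nothing = ℕtoℚ-nonneg 1
    ... | just (q , _) with q ≟F r
    ...   | yes _ = ℚₚ.≤-refl
    ...   | no _  = ℚₚ.≤-trans (*-monoʳ inv-nonneg (wt-≤1 h k q)) (ℚₚ.≤-trans (ℚₚ.≤-reflexive (ℚₚ.*-identityʳ inv)) h)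

    -- Only vertices deeper than `D` are lost by truncation, and each of them weighs at most
    -- `inv ^ℚ D`.
    wt-truncate : inv ≤ℚ 1ℚ → ∀ k D v → wt F r k v ≤ℚ wt F r D v +ℚ (inv ^ℚ D)
    wt-truncate h k zero v = ℚₚ.≤-trans (wt-≤1 h k v) (ℚₚ.≤-reflexive (sym (ℚₚ.+-identityˡ 1ℚ)))
    wt-truncate h zero (suc D) v = ℚₚ.≤-trans (ℚₚ.≤-reflexive (sym (ℚₚ.+-identityˡ 0ℚ))) (ℚₚ.+-mono-≤ (wt-nonneg (suc D) v) (^ℚ-nonneg inv-nonneg (suc D)))
    wt-truncate h (suc k) (suc D) v with F v
    ... | nothing = ℚₚ.≤-trans (ℚₚ.≤-reflexive (sym (ℚₚ.+-identityˡ 0ℚ))) (ℚₚ.+-mono-≤ (ℚₚ.≤-refl {0ℚ}) (^ℚ-nonneg inv-nonneg (suc D)))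
    ... | just (q , _) with q ≟F r
    ...   | yes _ = ℚₚ.≤-trans (ℚₚ.≤-reflexive (sym (ℚₚ.+-identityʳ 1ℚ))) (ℚₚ.+-mono-≤ (ℚₚ.≤-refl {1ℚ}) (^ℚ-nonneg inv-nonneg (suc D)))
    ...   | no _  = ℚₚ.≤-trans (*-monoʳ inv-nonneg (wt-truncate h k D q)) (ℚₚ.≤-reflexive (ℚₚ.*-distribˡ-+ inv (wt F r D q) (inv ^ℚ D)))

  module _ {F : Shape} {r : V} (sound : Sound F r) where
    open Sound sound
    open Weights F r

    b : ℚ
    b = ℕtoℚ (Δ ∸ 1)

    b-nonneg : 0ℚ ≤ℚ b
    b-nonneg = ℕtoℚ-nonneg (Δ ∸ 1)

    kids-≤ : ∀ {q x} → F q ≡ just x → kids q ≤ℚ b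
    kids-≤ {q} e = ℚₚ.≤-trans (ℚₚ.≤-reflexive (kids-length q)) (ℕtoℚ-mono (ℕₚ.∸-monoˡ-≤ 1 (ℕₚ.≤-trans (ℕₚ.≤-reflexive (sym (deg e))) (maxdeg q))))
      where
      deg : ∀ {x} → F q ≡ just x → degree F q ≡ suc (length (children F q))
      deg e rewrite e = refl

    B≡ : B ≡ Δ ∸ 1 + c
    B≡ = ℕₚ.+-∸-comm c (ℕₚ.≤-trans (s≤s z≤n) 3≤Δ)

    b≤B : b ≤ℚ ℕtoℚ B
    b≤B = ℕtoℚ-mono (ℕₚ.≤-trans (ℕₚ.m≤m+n (Δ ∸ 1) c) (ℕₚ.≤-reflexive (sym B≡)))

    -- The vertex `r` passes 1, and every vertex below it passes `inv` times its weight, to at most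
    -- `Δ ∸ 1` children, because all of them have a parent.
    S-step : ∀ k → S (suc k) ≤ℚ b +ℚ inv *ℚ b *ℚ S k
    S-step k = begin
      S (suc k)
        ≡⟨ S-suc k ⟩
      ∑ vertices (λ q → φ k q *ℚ kids q)
        ≤⟨ ∑-mono vertices (λ q → at q (q ≟F r)) ⟩
      ∑ vertices (λ q → (does (r ≟F q) ▸ b) +ℚ inv *ℚ b *ℚ wt F r k q)
        ≡⟨ ∑-+ vertices (λ q → does (r ≟F q) ▸ b) (λ q → inv *ℚ b *ℚ wt F r k q) ⟩
      ∑ vertices (λ q → does (r ≟F q) ▸ b) +ℚ ∑ vertices (λ q → inv *ℚ b *ℚ wt F r k q)
        ≡⟨ cong₂ _+ℚ_ (∑-δ n r (λ _ → b)) (∑-*ˡ vertices (inv *ℚ b) (wt F r k)) ⟩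
      b +ℚ inv *ℚ b *ℚ S k ∎
      where
      open ℚₚ.≤-Reasoning
      rest : ∀ q → 0ℚ ≤ℚ inv *ℚ b *ℚ wt F r k q
      rest q = *-nonneg (*-nonneg inv-nonneg b-nonneg) (wt-nonneg k q)
      deep : ∀ q m → F q ≡ m → inv *ℚ wt F r k q *ℚ kids q ≤ℚ inv *ℚ b *ℚ wt F r k q
      -- A root may have `Δ` children, but its weight is zero.
      deep q nothing e = ℚₚ.≤-trans (ℚₚ.≤-reflexive (trans (cong (λ z → inv *ℚ z *ℚ kids q) (wt-nothing k e))
        (trans (cong (_*ℚ kids q) (ℚₚ.*-zeroʳ inv)) (ℚₚ.*-zeroˡ (kids q))))) (rest q)
      deep q (just x) e = ℚₚ.≤-trans (*-monoʳ (*-nonneg inv-nonneg (wt-nonneg k q)) (kids-≤ e))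
        (ℚₚ.≤-reflexive (trans (ℚₚ.*-assoc inv (wt F r k q) b) (trans (cong (inv *ℚ_) (ℚₚ.*-comm (wt F r k q) b)) (sym (ℚₚ.*-assoc inv b (wt F r k q))))))
      at : ∀ q → Dec (q ≡ r) → φ k q *ℚ kids q ≤ℚ (does (r ≟F q) ▸ b) +ℚ inv *ℚ b *ℚ wt F r k q
      at q (yes refl) = begin
        φ k q *ℚ kids q                                      ≡⟨ trans (cong (_*ℚ kids q) (φ-root k refl)) (ℚₚ.*-identityˡ (kids q)) ⟩
        kids q                                               ≤⟨ kids-≤ (proj₂ nonroot) ⟩
        b                                                    ≡⟨ sym (ℚₚ.+-identityʳ b) ⟩
        b +ℚ 0ℚ                                              ≤⟨ ℚₚ.+-mono-≤ (ℚₚ.≤-reflexive (sym (▸-yes (q ≟F q) b refl))) (rest q) ⟩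
        (does (q ≟F q) ▸ b) +ℚ inv *ℚ b *ℚ wt F r k q        ∎
      at q (no q≢r) = begin
        φ k q *ℚ kids q                                      ≡⟨ cong (_*ℚ kids q) (φ-other k q≢r) ⟩
        inv *ℚ wt F r k q *ℚ kids q                          ≤⟨ deep q (F q) refl ⟩
        inv *ℚ b *ℚ wt F r k q                               ≡⟨ sym (ℚₚ.+-identityˡ _) ⟩
        0ℚ +ℚ inv *ℚ b *ℚ wt F r k q                         ≡⟨ cong (_+ℚ inv *ℚ b *ℚ wt F r k q) (sym (▸-no (r ≟F q) b (q≢r ∘ sym))) ⟩
        (does (r ≟F q) ▸ b) +ℚ inv *ℚ b *ℚ wt F r k q        ∎

    -- The recursion of `S-step` has the fixed point `b * B / c`, because `B - b` equals `c`, and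
    -- the partial sums stay below it. Multiplying by `c` avoids the division and includes `c = 0`.
    S-c : ∀ k → S k *ℚ ℕtoℚ c ≤ℚ b *ℚ ℕtoℚ B
    S-c zero = ℚₚ.≤-trans (ℚₚ.≤-reflexive (trans (cong (_*ℚ ℕtoℚ c) (∑-0 vertices)) (ℚₚ.*-zeroˡ (ℕtoℚ c)))) (*-nonneg b-nonneg (ℕtoℚ-nonneg B))
    S-c (suc k) = begin
      S (suc k) *ℚ ℕtoℚ c                                    ≤⟨ *-monoˡ (ℕtoℚ-nonneg c) (S-step k) ⟩
      (b +ℚ inv *ℚ b *ℚ S k) *ℚ ℕtoℚ c                       ≡⟨ expand b inv (S k) (ℕtoℚ c) ⟩
      b *ℚ ℕtoℚ c +ℚ inv *ℚ b *ℚ (S k *ℚ ℕtoℚ c)             ≤⟨ ℚₚ.+-mono-≤ (ℚₚ.≤-refl {b *ℚ ℕtoℚ c}) (*-monoʳ (*-nonneg inv-nonneg b-nonneg) (S-c k)) ⟩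
      b *ℚ ℕtoℚ c +ℚ inv *ℚ b *ℚ (b *ℚ ℕtoℚ B)               ≡⟨ regroup b inv (ℕtoℚ c) (ℕtoℚ B) ⟩
      b *ℚ ℕtoℚ c +ℚ b *ℚ b *ℚ (inv *ℚ ℕtoℚ B)               ≡⟨ cong (b *ℚ ℕtoℚ c +ℚ_) (trans (cong (b *ℚ b *ℚ_) inv-B) (ℚₚ.*-identityʳ (b *ℚ b))) ⟩
      b *ℚ ℕtoℚ c +ℚ b *ℚ b                                  ≡⟨ trans (sym (ℚₚ.*-distribˡ-+ b (ℕtoℚ c) b)) (cong (b *ℚ_) (ℚₚ.+-comm (ℕtoℚ c) b)) ⟩
      b *ℚ (b +ℚ ℕtoℚ c)                                     ≡⟨ cong (b *ℚ_) (trans (sym (ℕtoℚ-+ (Δ ∸ 1) c)) (cong ℕtoℚ (sym B≡))) ⟩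
      b *ℚ ℕtoℚ B                                            ∎
      where
      open ℚₚ.≤-Reasoning
      expand : ∀ b i s c → (b +ℚ i *ℚ b *ℚ s) *ℚ c ≡ b *ℚ c +ℚ i *ℚ b *ℚ (s *ℚ c)
      expand = solve 4 (λ b i s c → (b :+ i :* b :* s) :* c := b :* c :+ i :* b :* (s :* c)) refl
        where open +-*-Solver
      regroup : ∀ b i c B → b *ℚ c +ℚ i *ℚ b *ℚ (b *ℚ B) ≡ b *ℚ c +ℚ b *ℚ b *ℚ (i *ℚ B)
      regroup = solve 4 (λ b i c B → b :* c :+ i :* b :* (b :* B) := b :* c :+ b :* b :* (i :* B)) refl
        where open +-*-Solver

    value-c : value F r *ℚ ℕtoℚ c ≤ℚ ℕtoℚ (2 * Δ)
    value-c = begin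
      frac 1 κ *ℚ S n *ℚ ℕtoℚ c         ≡⟨ ℚₚ.*-assoc (frac 1 κ) (S n) (ℕtoℚ c) ⟩
      frac 1 κ *ℚ (S n *ℚ ℕtoℚ c)       ≤⟨ *-monoʳ (frac1-nonneg κ) (S-c n) ⟩
      frac 1 κ *ℚ (b *ℚ ℕtoℚ B)         ≤⟨ *-monoˡ (*-nonneg b-nonneg (ℕtoℚ-nonneg B)) (frac1-anti {B} {κ} (ℕₚ.m∸n≤m κ 1)) ⟩
      inv *ℚ (b *ℚ ℕtoℚ B)              ≡⟨ exchange inv b (ℕtoℚ B) ⟩
      b *ℚ (inv *ℚ ℕtoℚ B)              ≡⟨ trans (cong (b *ℚ_) inv-B) (ℚₚ.*-identityʳ b) ⟩
      b                                 ≤⟨ ℕtoℚ-mono (ℕₚ.≤-trans (ℕₚ.m∸n≤m Δ 1) (ℕₚ.m≤m+n Δ (Δ + 0))) ⟩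
      ℕtoℚ (2 * Δ)                      ∎
      where open ℚₚ.≤-Reasoning

    inv≤1 : inv ≤ℚ 1ℚ
    inv≤1 = frac1-anti {1} {B} (ℕ.>-nonZero⁻¹ B)

    S-linear : ∀ k → S k ≤ℚ ℕtoℚ k *ℚ ℕtoℚ B
    S-linear zero = ℚₚ.≤-reflexive (trans (∑-0 vertices) (sym (ℚₚ.*-zeroˡ (ℕtoℚ B))))
    S-linear (suc k) = begin
      S (suc k)                                   ≤⟨ S-step k ⟩
      b +ℚ inv *ℚ b *ℚ S k                        ≤⟨ ℚₚ.+-mono-≤ b≤B (*-monoˡ (∑-nonneg vertices (wt-nonneg k)) (*-monoʳ inv-nonneg b≤B)) ⟩
      ℕtoℚ B +ℚ inv *ℚ ℕtoℚ B *ℚ S k              ≡⟨ cong (ℕtoℚ B +ℚ_) (trans (cong (_*ℚ S k) inv-B) (ℚₚ.*-identityˡ (S k))) ⟩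
      ℕtoℚ B +ℚ S k                               ≤⟨ ℚₚ.+-mono-≤ (ℚₚ.≤-refl {ℕtoℚ B}) (S-linear k) ⟩
      ℕtoℚ B +ℚ ℕtoℚ k *ℚ ℕtoℚ B                  ≡⟨ trans (cong (_+ℚ ℕtoℚ k *ℚ ℕtoℚ B) (sym (ℚₚ.*-identityˡ (ℕtoℚ B)))) (sym (ℚₚ.*-distribʳ-+ (ℕtoℚ B) 1ℚ (ℕtoℚ k))) ⟩
      (1ℚ +ℚ ℕtoℚ k) *ℚ ℕtoℚ B                    ≡⟨ cong (_*ℚ ℕtoℚ B) (sym (ℕtoℚ-+ 1 k)) ⟩
      ℕtoℚ (suc k) *ℚ ℕtoℚ B                      ∎
      where open ℚₚ.≤-Reasoning

    -- The first `D` levels weigh at most `B` each, and the at most `n` deeper vertices at most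
    -- `inv ^ℚ D` each; replacing `1 / κ` by `1 / B` gives `D + n / B ^ (D + 1)`, the form required
    -- by `log-bound`.
    value-log : ∀ D → ℕtoℚ (B ^ suc D) *ℚ value F r ≤ℚ ℕtoℚ (D * B ^ suc D + n)
    value-log D = begin
      P *ℚ (frac 1 κ *ℚ S n)
        ≤⟨ *-monoʳ (ℕtoℚ-nonneg (B ^ suc D)) (ℚₚ.≤-trans (*-monoˡ (∑-nonneg vertices (wt-nonneg n)) (frac1-anti {B} {κ} (ℕₚ.m∸n≤m κ 1)))
             (*-monoʳ inv-nonneg tail)) ⟩
      P *ℚ (inv *ℚ (ℕtoℚ D *ℚ ℕtoℚ B +ℚ ℕtoℚ n *ℚ (inv ^ℚ D)))
        ≡⟨ regroup P inv (ℕtoℚ D) (ℕtoℚ B) (ℕtoℚ n) (inv ^ℚ D) ⟩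
      ℕtoℚ D *ℚ P *ℚ (inv *ℚ ℕtoℚ B) +ℚ ℕtoℚ n *ℚ ((inv ^ℚ suc D) *ℚ P)
        ≡⟨ cong₂ _+ℚ_ (trans (cong (ℕtoℚ D *ℚ P *ℚ_) inv-B) (ℚₚ.*-identityʳ (ℕtoℚ D *ℚ P)))
             (trans (cong (ℕtoℚ n *ℚ_) (^ℚ-inverse inv B inv-B (suc D))) (ℚₚ.*-identityʳ (ℕtoℚ n))) ⟩
      ℕtoℚ D *ℚ P +ℚ ℕtoℚ n
        ≡⟨ trans (cong (_+ℚ ℕtoℚ n) (sym (ℕtoℚ-* D (B ^ suc D)))) (sym (ℕtoℚ-+ (D * B ^ suc D) n)) ⟩
      ℕtoℚ (D * B ^ suc D + n) ∎
      where
      open ℚₚ.≤-Reasoning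
      P = ℕtoℚ (B ^ suc D)
      tail : S n ≤ℚ ℕtoℚ D *ℚ ℕtoℚ B +ℚ ℕtoℚ n *ℚ (inv ^ℚ D)
      tail = begin
        S n                                                        ≤⟨ ∑-mono vertices (wt-truncate inv≤1 n D) ⟩
        ∑ vertices (λ v → wt F r D v +ℚ (inv ^ℚ D))                ≡⟨ ∑-+ vertices (wt F r D) (λ _ → inv ^ℚ D) ⟩
        S D +ℚ ∑ vertices (λ _ → inv ^ℚ D)                         ≡⟨ cong (S D +ℚ_) (trans (∑-const vertices (inv ^ℚ D)) (cong (λ z → ℕtoℚ z *ℚ (inv ^ℚ D)) (length-allFin n))) ⟩
        S D +ℚ ℕtoℚ n *ℚ (inv ^ℚ D)                                ≤⟨ ℚₚ.+-mono-≤ (S-linear D) (ℚₚ.≤-refl {ℕtoℚ n *ℚ (inv ^ℚ D)}) ⟩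
        ℕtoℚ D *ℚ ℕtoℚ B +ℚ ℕtoℚ n *ℚ (inv ^ℚ D)                   ∎
      regroup : ∀ P i d B n x → P *ℚ (i *ℚ (d *ℚ B +ℚ n *ℚ x)) ≡ d *ℚ P *ℚ (i *ℚ B) +ℚ n *ℚ (i *ℚ x *ℚ P)
      regroup = solve 6 (λ P i d B n x → P :* (i :* (d :* B :+ n :* x)) := d :* P :* (i :* B) :+ n :* (i :* x :* P)) refl
        where open +-*-Solver

    -- The size of the vertex set is not assumed but read off the updated edge, which has two
    -- distinct endpoints.
    two-vertices : 2 ≤ n
    two-vertices = go n r (proj₁ (proj₁ nonroot)) (λ { refl → par-irrefl ranked (proj₂ nonroot) })
      where
      go : ∀ m (x y : Fin m) → x ≢ y → 2 ≤ m
      go (suc zero) zero zero ne = contradiction refl ne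
      go (suc (suc m)) x y ne = s≤s (s≤s z≤n)

    value-upper : UpperBound 2 Δ c n (value F r)
    value-upper = value-c , log-bound (value F r) B n (ℕₚ.≤-pred (ℕₚ.≤-trans (ℕₚ.≤-trans 3≤Δ Δ≤κ) (ℕₚ.≤-reflexive κ≡))) two-vertices value-log

  upperR : ∀ us u → ValidSeqR emptyForest (us ∷ʳ u) → UpperBound 2 Δ c n (expRecR us u)
  upperR us u vs = subst (UpperBound 2 Δ c n) (sym (proj₂ (expRecR-value us u vs))) (value-upper (proj₁ (expRecR-value us u vs)))

  upperG : ∀ us u → ValidSeqG emptyForest (us ∷ʳ u) → UpperBound 2 Δ c n (expRecG us u)
  upperG us u vs = subst (UpperBound 2 Δ c n) (sym (proj₂ (expRecG-value us u vs))) (value-upper (proj₁ (expRecG-value us u vs)))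

-- Lower bounds

≤-cancelʳ : ∀ {x y} z → x +ℚ z ≤ℚ y +ℚ z → x ≤ℚ y
≤-cancelʳ {x} {y} z h = ℚₚ.≤-trans (ℚₚ.≤-reflexive (sym (undo x z))) (ℚₚ.≤-trans (ℚₚ.+-mono-≤ h (ℚₚ.≤-refl { -ℚ z })) (ℚₚ.≤-reflexive (undo y z)))
  where
  undo : ∀ x z → x +ℚ z +ℚ -ℚ z ≡ x
  undo x z = trans (ℚₚ.+-assoc x z (-ℚ z)) (trans (cong (x +ℚ_) (ℚₚ.+-inverseʳ z)) (ℚₚ.+-identityʳ x))

*-cancel-ℕ : ∀ {x y} k → .{{_ : NonZero k}} → ℕtoℚ k *ℚ x ≤ℚ ℕtoℚ k *ℚ y → x ≤ℚ y
*-cancel-ℕ {x} {y} k h = ℚₚ.≤-trans (ℚₚ.≤-reflexive (sym (undo x))) (ℚₚ.≤-trans (*-monoʳ (frac1-nonneg k) h) (ℚₚ.≤-reflexive (undo y)))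
  where
  undo : ∀ x → frac 1 k *ℚ (ℕtoℚ k *ℚ x) ≡ x
  undo x = trans (sym (ℚₚ.*-assoc (frac 1 k) (ℕtoℚ k) x)) (trans (cong (_*ℚ x) (frac-* 1 k)) (ℚₚ.*-identityˡ x))

∑-below : ∀ n h → ∑ (allFin n) (λ v → does (toℕ v ℕ.<? h) ▸ 1ℚ) ≡ ℕtoℚ (n ℕ.⊓ h)
∑-below zero    h       = refl
∑-below (suc n) zero    = trans (∑-cong (allFin (suc n)) λ v → ▸-no (toℕ v ℕ.<? 0) 1ℚ λ ()) (∑-0 (allFin (suc n)))
∑-below (suc n) (suc h) = trans (cong (1ℚ +ℚ_) (trans (cong (λ l → ∑ l inside) (sym (Listₚ.map-tabulate id suc)))
    (trans (∑-map suc (allFin n) inside) (trans (∑-cong (allFin n) λ v → cong (_▸ 1ℚ)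
      (does-iff (toℕ (suc v) ℕ.<? suc h) (toℕ v ℕ.<? h) ℕₚ.≤-pred s≤s)) (∑-below n h)))))
  (sym (ℕtoℚ-+ 1 (n ℕ.⊓ h)))
  where
  inside : Fin (suc n) → ℚ
  inside v = does (toℕ v ℕ.<? suc h) ▸ 1ℚ

within? : ∀ lo d x → Dec (lo ≤ x × x < lo + d)
within? lo d x = (lo ℕ.≤? x) ×-dec (x ℕ.<? (lo + d))

∑-within : ∀ n lo d → ∑ (allFin n) (λ v → does (within? lo d (toℕ v)) ▸ 1ℚ) +ℚ ℕtoℚ (n ℕ.⊓ lo) ≡ ℕtoℚ (n ℕ.⊓ (lo + d))
∑-within n lo d = trans (cong (∑ (allFin n) (λ v → does (within? lo d (toℕ v)) ▸ 1ℚ) +ℚ_) (sym (∑-below n lo)))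
  (trans (sym (∑-+ (allFin n) (λ v → does (within? lo d (toℕ v)) ▸ 1ℚ) (λ v → does (toℕ v ℕ.<? lo) ▸ 1ℚ)))
  (trans (∑-cong (allFin n) λ v → at (toℕ v) (toℕ v ℕ.<? lo)) (∑-below n (lo + d))))
  where
  at : ∀ x → Dec (x < lo) → (does (within? lo d x) ▸ 1ℚ) +ℚ (does (x ℕ.<? lo) ▸ 1ℚ) ≡ does (x ℕ.<? (lo + d)) ▸ 1ℚ
  at x (yes h) = trans (cong₂ _+ℚ_ (▸-no (within? lo d x) 1ℚ (λ w → ℕₚ.<⇒≱ h (proj₁ w))) (▸-yes (x ℕ.<? lo) 1ℚ h))
    (trans (ℚₚ.+-identityˡ 1ℚ) (sym (▸-yes (x ℕ.<? (lo + d)) 1ℚ (ℕₚ.<-≤-trans h (ℕₚ.m≤m+n lo d)))))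
  at x (no ¬h) = trans (cong₂ _+ℚ_ (cong (_▸ 1ℚ) (does-iff (within? lo d x) (x ℕ.<? (lo + d)) proj₂ (λ l → ℕₚ.≮⇒≥ ¬h , l))) (▸-no (x ℕ.<? lo) 1ℚ ¬h))
    (ℚₚ.+-identityʳ _)

∑-within-≤ : ∀ n lo d → ∑ (allFin n) (λ v → does (within? lo d (toℕ v)) ▸ 1ℚ) ≤ℚ ℕtoℚ d
∑-within-≤ n lo d = ≤-cancelʳ (ℕtoℚ (n ℕ.⊓ lo)) (ℚₚ.≤-trans (ℚₚ.≤-reflexive (∑-within n lo d))
  (ℚₚ.≤-trans (ℕtoℚ-mono bound) (ℚₚ.≤-reflexive (ℕtoℚ-+ d (n ℕ.⊓ lo)))))
  where
  bound : n ℕ.⊓ (lo + d) ≤ d + n ℕ.⊓ lo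
  bound = ℕₚ.≤-trans (ℕₚ.⊓-mono-≤ (ℕₚ.m≤n+m n d) (ℕₚ.≤-reflexive (ℕₚ.+-comm lo d))) (ℕₚ.≤-reflexive (sym (ℕₚ.+-distribˡ-⊓ d n lo)))

∑-within-≡ : ∀ n lo d → lo + d ≤ n → ∑ (allFin n) (λ v → does (within? lo d (toℕ v)) ▸ 1ℚ) ≡ ℕtoℚ d
∑-within-≡ n lo d h = +ℚ-cancelʳ (ℕtoℚ lo) _ _ (trans (cong (λ z → ∑ (allFin n) (λ v → does (within? lo d (toℕ v)) ▸ 1ℚ) +ℚ ℕtoℚ z) (sym (ℕₚ.m≥n⇒m⊓n≡n (ℕₚ.≤-trans (ℕₚ.m≤m+n lo d) h))))
  (trans (∑-within n lo d) (trans (cong ℕtoℚ (trans (ℕₚ.m≥n⇒m⊓n≡n h) (ℕₚ.+-comm lo d))) (ℕtoℚ-+ d lo))))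

-- The number of vertices on the first k levels below the two roots, together with the roots.
levels : ℕ → ℕ → ℕ
levels b zero    = 2
levels b (suc k) = 2 + b * levels b k

levels-2≤ : ∀ b k → 2 ≤ levels b k
levels-2≤ b zero    = ℕₚ.≤-refl
levels-2≤ b (suc k) = ℕₚ.m≤m+n 2 _

levels-mono-≤ : ∀ b {j k} → j ≤ k → levels b j ≤ levels b k
levels-mono-≤ b {zero}  {k}     h       = levels-2≤ b k
levels-mono-≤ b {suc j} {suc k} (s≤s h) = ℕₚ.+-monoʳ-≤ 2 (ℕₚ.*-monoʳ-≤ b (levels-mono-≤ b h))

k<levels : ∀ b k → 1 ≤ b → k < levels b k
k<levels b zero    h = s≤s z≤n
k<levels b (suc k) h = s≤s (ℕₚ.≤-trans (k<levels b k h) (ℕₚ.≤-trans (ℕₚ.≤-trans (ℕₚ.≤-reflexive (sym (ℕₚ.*-identityˡ _))) (ℕₚ.*-monoˡ-≤ (levels b k) h)) (ℕₚ.n≤1+n _)))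

-- Two heaps of prescribed arity, and the weight below their joined roots

module Lower (n' Δ c m : ℕ) (3≤Δ : 3 ≤ Δ) (b<Δ : suc m < Δ) where
  n b : ℕ
  n = suc (suc n')
  b = suc m
  open DistMaint n Δ c
  open Kempe n κ
  open Colourings n κ
  open Painting n Δ c
  open Steps n Δ c
  open Uniformity n Δ c
  open Roots n Δ c
  open Running n Δ c 3≤Δ
  open Upper n Δ c 3≤Δ using (B; inv; inv-B; inv-nonneg; module Weights)

  v₀ v₁ : V
  v₀ = zero
  v₁ = suc zero

  pv-< : ∀ (i : Fin n') → toℕ i ℕD./ b < n
  pv-< i = ℕₚ.≤-<-trans (ℕD.m/n≤m (toℕ i) b) (ℕₚ.<-trans (toℕ<n i) (ℕₚ.<-trans (ℕₚ.n<1+n n') (ℕₚ.n<1+n (suc n'))))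

  -- Vertices 0 and 1 are the roots, and the children of `q` form the block of `b` vertices that
  -- starts at `2 + b * q`. Hence the first `levels b k` vertices are the top of both trees down to
  -- level `k`, and an initial segment of the vertices is closed under parents.
  pv : Fin n' → V
  pv i = fromℕ< (pv-< i)

  toℕ-pv : ∀ i → toℕ (pv i) ≡ toℕ i ℕD./ b
  toℕ-pv i = Fₚ.toℕ-fromℕ< (pv-< i)

  node : Fin n' → V
  node i = suc (suc i)

  pv<node : ∀ i → toℕ (pv i) < toℕ (node i)
  pv<node i = ℕₚ.≤-<-trans (ℕₚ.≤-trans (ℕₚ.≤-reflexive (toℕ-pv i)) (ℕD.m/n≤m (toℕ i) b)) (ℕₚ.<-trans (ℕₚ.n<1+n _) (ℕₚ.n<1+n _))

  -- The first j edges of two b-ary heaps with roots 0 and 1, stored level by level.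
  heap : ℕ → Shape
  heap j zero          = nothing
  heap j (suc zero)    = nothing
  heap j (suc (suc i)) = if does (toℕ i ℕ.<? j) then just (pv i , tt) else nothing

  heap-in : ∀ {j i} → toℕ i < j → heap j (node i) ≡ just (pv i , tt)
  heap-in {j} {i} h rewrite dec-true (toℕ i ℕ.<? j) h = refl

  heap-out : ∀ {j i} → ¬ toℕ i < j → heap j (node i) ≡ nothing
  heap-out {j} {i} h rewrite dec-false (toℕ i ℕ.<? j) h = refl

  heap-just : ∀ j v {q} → heap j v ≡ just (q , tt) → ∃ λ i → v ≡ node i × toℕ i < j × q ≡ pv i
  heap-just j (suc (suc i)) {q} e = cases (toℕ i ℕ.<? j)
    where
    cases : Dec (toℕ i < j) → ∃ λ x → node i ≡ node x × toℕ x < j × q ≡ pv x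
    cases (yes h) = i , refl , h , par-unique e (heap-in {j} {i} h)
    cases (no ¬h) = case trans (sym e) (heap-out {j} {i} ¬h) of λ ()

  heap-suc : ∀ i {f : Shape} → f ≗ heap (toℕ i) → update f (node i) (just (pv i , tt)) ≗ heap (suc (toℕ i))
  heap-suc i {f} e v = cases (v ≟F node i)
    where
    cases : Dec (v ≡ node i) → update f (node i) (just (pv i , tt)) v ≡ heap (suc (toℕ i)) v
    cases (yes refl) = trans (upd-same f {node i} (just (pv i , tt)) refl) (sym (heap-in {suc (toℕ i)} {i} (ℕₚ.n<1+n (toℕ i))))
    cases (no v≢) = trans (upd-diff f (just (pv i , tt)) v≢) (trans (e v) (other v v≢))
      where
      other : ∀ v → v ≢ node i → heap (toℕ i) v ≡ heap (suc (toℕ i)) v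
      other zero          ne = refl
      other (suc zero)    ne = refl
      other (suc (suc x)) ne = cong (λ z → if z then just (pv x , tt) else nothing) (does-iff (toℕ x ℕ.<? toℕ i) (toℕ x ℕ.<? suc (toℕ i)) ℕₚ.m≤n⇒m≤1+n
        (λ l → ℕₚ.≤∧≢⇒< (ℕₚ.≤-pred l) (λ e → ne (cong node (Fₚ.toℕ-injective e)))))

  module AtHeap {j : ℕ} {f : Shape} (f≗ : f ≗ heap j) where

    f-just : ∀ {v q} → f v ≡ just (q , tt) → ∃ λ i → v ≡ node i × toℕ i < j × q ≡ pv i
    f-just {v} e = heap-just j v (trans (sym (f≗ v)) e)

    f-decreasing : ∀ {v q} → f v ≡ just (q , tt) → toℕ q < toℕ v
    f-decreasing e with f-just e
    ... | i , refl , _ , refl = pv<node i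

    climb-≤ : ∀ k v → toℕ (climb f k v) ≤ toℕ v
    climb-≤ zero v = ℕₚ.≤-refl
    climb-≤ (suc k) v with f v in e
    ... | nothing = ℕₚ.≤-refl
    ... | just (q , tt) = ℕₚ.≤-trans (climb-≤ k q) (ℕₚ.<⇒≤ (f-decreasing e))

    rootOf-≤ : ∀ v → toℕ (rootOf f v) ≤ toℕ v
    rootOf-≤ v = ℕₚ.≤-trans (ℕₚ.≤-reflexive (cong toℕ (rootOf≡climb n f v))) (climb-≤ n v)

    -- All children of `q` lie in one block of consecutive vertices. The length `d` is `b` in
    -- general, `m` for a vertex about to receive a further child, and 0 for a vertex not yet
    -- attached.
    kids-≤ : ∀ q d → (∀ i → toℕ i < j → toℕ i ℕD./ b ≡ toℕ q → toℕ i < b * toℕ q + d) → length (children f q) ≤ d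
    kids-≤ q d h = ℕtoℚ-cancel (begin
      ℕtoℚ (length (children f q))                                            ≡⟨ sym (∑-length (children f q)) ⟩
      ∑ (children f q) (λ _ → 1ℚ)                                             ≡⟨ ∑-children-shape f q (λ _ → 1ℚ) ⟩
      ∑ vertices (λ v → does (child? f q v) ▸ 1ℚ)                             ≤⟨ ∑-mono vertices at ⟩
      ∑ vertices (λ v → does (within? (2 + b * toℕ q) d (toℕ v)) ▸ 1ℚ)        ≤⟨ ∑-within-≤ n (2 + b * toℕ q) d ⟩
      ℕtoℚ d                                                                  ∎)
      where
      open ℚₚ.≤-Reasoning
      inside : ∀ {v} → f v ≡ just (q , tt) → 2 + b * toℕ q ≤ toℕ v × toℕ v < 2 + b * toℕ q + d
      inside e with f-just e
      ... | i , refl , i<j , refl = s≤s (s≤s (ℕₚ.≤-trans (ℕₚ.≤-reflexive (trans (cong (b *_) (toℕ-pv i)) (ℕₚ.*-comm b _))) (ℕD.m/n*n≤m (toℕ i) b))) ,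
        s≤s (s≤s (h i i<j (sym (toℕ-pv i))))
      at : ∀ v → does (child? f q v) ▸ 1ℚ ≤ℚ does (within? (2 + b * toℕ q) d (toℕ v)) ▸ 1ℚ
      at v = cases (child? f q v)
        where
        cases : Dec (f v ≡ just (q , tt)) → does (child? f q v) ▸ 1ℚ ≤ℚ does (within? (2 + b * toℕ q) d (toℕ v)) ▸ 1ℚ
        cases (yes e) = ℚₚ.≤-reflexive (trans (▸-yes (child? f q v) 1ℚ e) (sym (▸-yes (within? (2 + b * toℕ q) d (toℕ v)) 1ℚ (inside e))))
        cases (no ¬e) = ℚₚ.≤-trans (ℚₚ.≤-reflexive (▸-no (child? f q v) 1ℚ ¬e)) (▸-nonneg (does (within? (2 + b * toℕ q) d (toℕ v))) (ℕtoℚ-nonneg 1))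

    degree-≤ : ∀ q → degree f q ≤ suc (length (children f q))
    degree-≤ q with f q
    ... | nothing = ℕₚ.n≤1+n _
    ... | just _  = ℕₚ.≤-refl

    degree-root-≤ : ∀ q → f q ≡ nothing → degree f q < Δ
    degree-root-≤ q e = ℕₚ.≤-<-trans (ℕₚ.≤-trans (ℕₚ.≤-reflexive (degree-root f q e)) (kids-≤ q b inside)) b<Δ
      where
      inside : ∀ i → toℕ i < j → toℕ i ℕD./ b ≡ toℕ q → toℕ i < b * toℕ q + b
      inside i _ e = subst (λ z → toℕ i < b * z + b) e (ℕₚ.<-≤-trans (ℕₚ.≤-<-trans (ℕₚ.≤-reflexive (ℕD.m≡m%n+[m/n]*n (toℕ i) b)) (ℕₚ.+-monoˡ-< _ (ℕD.m%n<n (toℕ i) b)))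
        (ℕₚ.≤-reflexive (trans (ℕₚ.+-comm b _) (cong (_+ b) (ℕₚ.*-comm (toℕ i ℕD./ b) b)))))

  module Grow (i : Fin n') {f : Shape} (f≗ : f ≗ heap (toℕ i)) where
    open AtHeap f≗

    f-node : f (node i) ≡ nothing
    f-node = trans (f≗ (node i)) (heap-out {toℕ i} {i} (ℕₚ.<-irrefl refl))

    rootOf-node : rootOf f (node i) ≡ node i
    rootOf-node = rootOf-root f f-node

    rootOf-pv : rootOf f (pv i) ≢ node i
    rootOf-pv e = ℕₚ.<⇒≱ (pv<node i) (ℕₚ.≤-trans (ℕₚ.≤-reflexive (cong toℕ (sym e))) (rootOf-≤ (pv i)))

    degree-pv : degree f (pv i) < Δ
    degree-pv = ℕₚ.≤-<-trans (ℕₚ.≤-trans (degree-≤ (pv i)) (s≤s (kids-≤ (pv i) m inside))) b<Δ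
      where
      -- The attached nodes precede `i`, so at most `toℕ i` modulo `b`, hence at most `m`, places of
      -- the block are taken. This leaves the degree of the parent at most `b`.
      inside : ∀ x → toℕ x < toℕ i → toℕ x ℕD./ b ≡ toℕ (pv i) → toℕ x < b * toℕ (pv i) + m
      inside x x<i _ = ℕₚ.<-≤-trans x<i (ℕₚ.≤-trans (ℕₚ.≤-reflexive (ℕD.m≡m%n+[m/n]*n (toℕ i) b)) (ℕₚ.≤-trans (ℕₚ.+-monoˡ-≤ _ (ℕₚ.≤-pred (ℕD.m%n<n (toℕ i) b)))
        (ℕₚ.≤-reflexive (trans (ℕₚ.+-comm m _) (cong (_+ m) (trans (ℕₚ.*-comm (toℕ i ℕD./ b) b) (cong (b *_) (sym (toℕ-pv i)))))))))

    kids-node : length (children f (node i)) ≡ 0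
    kids-node = ℕₚ.n≤0⇒n≡0 (kids-≤ (node i) 0 inside)
      where
      inside : ∀ x → toℕ x < toℕ i → toℕ x ℕD./ b ≡ toℕ (node i) → toℕ x < b * toℕ (node i) + 0
      inside x x<i e = contradiction (ℕₚ.≤-trans (ℕₚ.≤-reflexive (sym e)) (ℕD.m/n≤m (toℕ x) b)) (ℕₚ.<⇒≱ (ℕₚ.<-trans x<i (ℕₚ.<-trans (ℕₚ.n<1+n _) (ℕₚ.n<1+n _))))

    degree-node : degree f (node i) ≡ 0
    degree-node = trans (degree-root f (node i) f-node) kids-node

    degree-node-< : degree f (node i) < Δ
    degree-node-< = ℕₚ.≤-<-trans (ℕₚ.≤-reflexive degree-node) (ℕₚ.≤-trans (s≤s z≤n) 3≤Δ)

    isolated : ∀ k y → climb f k y ≡ node i → y ≡ node i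
    isolated zero y e = e
    isolated (suc k) y e with f y in h
    ... | nothing = e
    ... | just (q , tt) with f-just h
    ...   | x , refl , x<i , refl = contradiction (cong toℕ (isolated k (pv x) e)) (ℕₚ.<⇒≢ (ℕₚ.<-trans (pv<node x) (s≤s (s≤s x<i))))

    -- A vertex without edges is named second by both rules, and rerooting it does nothing, so the
    -- heap grows in the general model just as in the rooted one.
    orient-node : orient f (pv i) (node i) ≡ (pv i , node i)
    orient-node = orient-isolated f (pv i) (node i) (treeEdges-isolated f (node i) f-node isolated) degree-node

  module Centre {f : Shape} (f≗ : f ≗ heap n') where
    open AtHeap f≗

    f₀ : f v₀ ≡ nothing
    f₀ = f≗ v₀

    f₁ : f v₁ ≡ nothing
    f₁ = f≗ v₁

    root₀ : rootOf f v₀ ≡ v₀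
    root₀ = rootOf-root f f₀

    root₁ : rootOf f v₁ ≡ v₁
    root₁ = rootOf-root f f₁

    deg₀ : degree f v₀ < Δ
    deg₀ = degree-root-≤ v₀ f₀

    deg₁ : degree f v₁ < Δ
    deg₁ = degree-root-≤ v₁ f₁

  -- t k bounds from below the expected number of recoloured edges on the first k levels, times κ.
  t : ℕ → ℚ
  t zero    = 0ℚ
  t (suc k) = ℕtoℚ b *ℚ (1ℚ +ℚ inv *ℚ t k)

  t-nonneg : ∀ k → 0ℚ ≤ℚ t k
  t-nonneg zero    = ℚₚ.≤-refl
  t-nonneg (suc k) = *-nonneg (ℕtoℚ-nonneg b) (ℚₚ.+-mono-≤ (ℕtoℚ-nonneg 1) (*-nonneg inv-nonneg (t-nonneg k)))

  -- `r` is the root that becomes a child and `r'` the other one. Both assignments occur, as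
  -- `orient` decides between them; the two heaps carry the same lower bound.
  module Linked (r r' : V) (r<2 : toℕ r < 2) (r'≢r : r' ≢ r) (hr' : heap n' r' ≡ nothing) {F : Shape}
      (F≗ : F ≗ update (heap n') r (just (r' , tt))) where
    open Weights F r

    node-≢ : ∀ {i} → node i ≢ r
    node-≢ {i} e = ℕₚ.<⇒≱ r<2 (ℕₚ.≤-trans (s≤s (s≤s z≤n)) (ℕₚ.≤-reflexive (cong toℕ e)))

    F-node : ∀ i → F (node i) ≡ just (pv i , tt)
    F-node i = trans (F≗ (node i)) (trans (upd-diff (heap n') (just (r' , tt)) node-≢) (heap-in {n'} {i} (toℕ<n i)))

    F-r : F r ≡ just (r' , tt)
    F-r = trans (F≗ r) (upd-same (heap n') {r} (just (r' , tt)) refl)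

    F-r' : F r' ≡ nothing
    F-r' = trans (F≗ r') (trans (upd-diff (heap n') (just (r' , tt)) r'≢r) hr')

    wt-r : ∀ k → wt F r k r ≡ 0ℚ
    wt-r zero    = refl
    wt-r (suc k) = trans (wt-just k F-r) (trans (φ-other k r'≢r) (trans (cong (inv *ℚ_) (wt-nothing k F-r')) (ℚₚ.*-zeroʳ inv)))

    child-block : ∀ q {v} → 2 + b * toℕ q ≤ toℕ v × toℕ v < 2 + b * toℕ q + b → F v ≡ just (q , tt)
    child-block q {suc (suc i)} (s≤s (s≤s lo) , s≤s (s≤s hi)) = trans (F-node i) (cong (λ z → just (z , tt)) (Fₚ.toℕ-injective (trans (toℕ-pv i) quotient)))
      where
      quotient : toℕ i ℕD./ b ≡ toℕ q
      quotient = ℕₚ.≤-antisym (ℕₚ.≤-pred (ℕD.m<n*o⇒m/o<n (ℕₚ.<-≤-trans hi (ℕₚ.≤-reflexive (trans (ℕₚ.+-comm (b * toℕ q) b) (cong (λ z → b + z) (ℕₚ.*-comm b (toℕ q))))))))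
        (ℕₚ.≤-trans (ℕₚ.≤-reflexive (sym (ℕD.m*n/n≡m (toℕ q) b))) (ℕD./-monoˡ-≤ b (ℕₚ.≤-trans (ℕₚ.≤-reflexive (ℕₚ.*-comm (toℕ q) b)) lo)))

    T : ℕ → ℚ
    T k = ∑ vertices λ v → does (toℕ v ℕ.<? levels b k) ▸ wt F r k v

    T-nonneg : ∀ k → 0ℚ ≤ℚ T k
    T-nonneg k = ∑-nonneg vertices λ v → ▸-nonneg (does (toℕ v ℕ.<? levels b k)) (wt-nonneg k v)

    -- Each of the first `levels b k` vertices has a full block of `b` children among the first
    -- `levels b (suc k)`, and `fits` ensures that the block exists. The summand 1 is what `r`
    -- passes on; its own weight is zero.
    T-step : ∀ k → levels b (suc k) ≤ n → ℕtoℚ b *ℚ (1ℚ +ℚ inv *ℚ T k) ≤ℚ T (suc k)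
    T-step k fits = begin
      ℕtoℚ b *ℚ (1ℚ +ℚ inv *ℚ T k)
        ≡⟨ cong (ℕtoℚ b *ℚ_) (sym (trans (∑-+ vertices (λ q → does (r ≟F q) ▸ 1ℚ) (λ q → inv *ℚ (low q ▸ wt F r k q)))
             (cong₂ _+ℚ_ (∑-δ n r (λ _ → 1ℚ)) (∑-*ˡ vertices inv (λ q → low q ▸ wt F r k q))))) ⟩
      ℕtoℚ b *ℚ ∑ vertices (λ q → (does (r ≟F q) ▸ 1ℚ) +ℚ inv *ℚ (low q ▸ wt F r k q))
        ≤⟨ *-monoʳ (ℕtoℚ-nonneg b) (∑-mono vertices λ q → parent q (q ≟F r)) ⟩
      ℕtoℚ b *ℚ ∑ vertices (λ q → low q ▸ φ k q)
        ≡⟨ sym (∑-*ˡ vertices (ℕtoℚ b) (λ q → low q ▸ φ k q)) ⟩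
      ∑ vertices (λ q → ℕtoℚ b *ℚ (low q ▸ φ k q))
        ≤⟨ ∑-mono vertices kids' ⟩
      ∑ vertices (λ q → ∑ vertices λ v → high v ▸ does (child? F q v) ▸ φ k q)
        ≡⟨ ∑-swap vertices vertices (λ q v → high v ▸ does (child? F q v) ▸ φ k q) ⟩
      ∑ vertices (λ v → ∑ vertices λ q → high v ▸ does (child? F q v) ▸ φ k q)
        ≡⟨ ∑-cong vertices (λ v → trans (∑-▸ vertices (high v) (λ q → does (child? F q v) ▸ φ k q)) (cong (high v ▸_) (sym (wt-parents k v)))) ⟩
      T (suc k) ∎
      where
      open ℚₚ.≤-Reasoning
      low high : V → Bool
      low q = does (toℕ q ℕ.<? levels b k)
      high v = does (toℕ v ℕ.<? levels b (suc k))
      parent : ∀ q → Dec (q ≡ r) → (does (r ≟F q) ▸ 1ℚ) +ℚ inv *ℚ (low q ▸ wt F r k q) ≤ℚ low q ▸ φ k q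
      parent q (yes refl) = ℚₚ.≤-reflexive (trans (cong₂ _+ℚ_ (▸-yes (q ≟F q) 1ℚ refl)
          (trans (cong (inv *ℚ_) (trans (▸-yes (toℕ q ℕ.<? levels b k) (wt F r k q) q<) (wt-r k))) (ℚₚ.*-zeroʳ inv)))
        (trans (ℚₚ.+-identityʳ 1ℚ) (sym (trans (▸-yes (toℕ q ℕ.<? levels b k) (φ k q) q<) (φ-root k refl)))))
        where
        q< : toℕ q < levels b k
        q< = ℕₚ.<-≤-trans r<2 (levels-2≤ b k)
      parent q (no q≢r) = ℚₚ.≤-reflexive (trans (cong (_+ℚ inv *ℚ (low q ▸ wt F r k q)) (▸-no (r ≟F q) 1ℚ (q≢r ∘ sym)))
        (trans (ℚₚ.+-identityˡ _) (trans (▸-*ˡ (low q) inv (wt F r k q)) (cong (low q ▸_) (sym (φ-other k q≢r))))))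
      kids' : ∀ q → ℕtoℚ b *ℚ (low q ▸ φ k q) ≤ℚ ∑ vertices (λ v → high v ▸ does (child? F q v) ▸ φ k q)
      kids' q = cases (toℕ q ℕ.<? levels b k)
        where
        cases : Dec (toℕ q < levels b k) → ℕtoℚ b *ℚ (low q ▸ φ k q) ≤ℚ ∑ vertices (λ v → high v ▸ does (child? F q v) ▸ φ k q)
        cases (no ¬l) = ℚₚ.≤-trans (ℚₚ.≤-reflexive (trans (cong (ℕtoℚ b *ℚ_) (▸-no (toℕ q ℕ.<? levels b k) (φ k q) ¬l)) (ℚₚ.*-zeroʳ (ℕtoℚ b))))
          (∑-nonneg vertices λ v → ▸-nonneg (high v) (▸-nonneg (does (child? F q v)) (φ-nonneg k q)))
        cases (yes l) = begin
          ℕtoℚ b *ℚ (low q ▸ φ k q)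
            ≡⟨ cong₂ _*ℚ_ (sym (∑-within-≡ n (2 + b * toℕ q) b (ℕₚ.≤-trans block fits))) (▸-yes (toℕ q ℕ.<? levels b k) (φ k q) l) ⟩
          ∑ vertices (λ v → does (within? (2 + b * toℕ q) b (toℕ v)) ▸ 1ℚ) *ℚ φ k q
            ≡⟨ sym (∑-*ʳ vertices (φ k q) (λ v → does (within? (2 + b * toℕ q) b (toℕ v)) ▸ 1ℚ)) ⟩
          ∑ vertices (λ v → (does (within? (2 + b * toℕ q) b (toℕ v)) ▸ 1ℚ) *ℚ φ k q)
            ≤⟨ ∑-mono vertices (λ v → at v (within? (2 + b * toℕ q) b (toℕ v))) ⟩
          ∑ vertices (λ v → high v ▸ does (child? F q v) ▸ φ k q) ∎
          where
          block : 2 + b * toℕ q + b ≤ levels b (suc k)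
          block = s≤s (s≤s (ℕₚ.≤-trans (ℕₚ.≤-reflexive (trans (ℕₚ.+-comm (b * toℕ q) b) (sym (ℕₚ.*-suc b (toℕ q))))) (ℕₚ.*-monoʳ-≤ b l)))
          at : ∀ v → Dec (2 + b * toℕ q ≤ toℕ v × toℕ v < 2 + b * toℕ q + b) →
            (does (within? (2 + b * toℕ q) b (toℕ v)) ▸ 1ℚ) *ℚ φ k q ≤ℚ high v ▸ does (child? F q v) ▸ φ k q
          at v (yes w) = ℚₚ.≤-reflexive (trans (cong (_*ℚ φ k q) (▸-yes (within? (2 + b * toℕ q) b (toℕ v)) 1ℚ w)) (trans (ℚₚ.*-identityˡ (φ k q))
            (sym (trans (▸-yes (toℕ v ℕ.<? levels b (suc k)) _ (ℕₚ.<-≤-trans (proj₂ w) block)) (▸-yes (child? F q v) (φ k q) (child-block q w))))))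
          at v (no ¬w) = ℚₚ.≤-trans (ℚₚ.≤-reflexive (trans (cong (_*ℚ φ k q) (▸-no (within? (2 + b * toℕ q) b (toℕ v)) 1ℚ ¬w)) (ℚₚ.*-zeroˡ (φ k q))))
            (▸-nonneg (high v) (▸-nonneg (does (child? F q v)) (φ-nonneg k q)))

    t≤T : ∀ k → levels b k ≤ n → t k ≤ℚ T k
    t≤T zero    fits = T-nonneg 0
    t≤T (suc k) fits = ℚₚ.≤-trans (*-monoʳ (ℕtoℚ-nonneg b) (ℚₚ.+-mono-≤ (ℚₚ.≤-refl {1ℚ}) (*-monoʳ inv-nonneg (t≤T k (ℕₚ.≤-trans (levels-mono-≤ b (ℕₚ.n≤1+n k)) fits))))) (T-step k fits)

    wt-mono : ∀ k k' v → k ≤ k' → wt F r k v ≤ℚ wt F r k' v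
    wt-mono zero k' v h = wt-nonneg k' v
    wt-mono (suc k) (suc k') v (s≤s h) with F v
    ... | nothing = ℚₚ.≤-refl
    ... | just (q , _) with q ≟F r
    ...   | yes _ = ℚₚ.≤-refl
    ...   | no _  = *-monoʳ inv-nonneg (wt-mono k k' q h)

    value-≥ : ∀ k → levels b k ≤ n → frac 1 κ *ℚ t k ≤ℚ value F r
    value-≥ k fits = *-monoʳ (frac1-nonneg κ) (ℚₚ.≤-trans (t≤T k fits) (∑-mono vertices λ v →
      ℚₚ.≤-trans (▸-≤ (does (toℕ v ℕ.<? levels b k)) (wt-nonneg k v)) (wt-mono k n v (ℕₚ.≤-trans (ℕₚ.<⇒≤ (k<levels b k (s≤s z≤n))) fits))))

-- Growth of the weights with the number of levels

module Growth (n' Δ c m : ℕ) (3≤Δ : 3 ≤ Δ) (b<Δ : suc m < Δ) where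
  open Lower n' Δ c m 3≤Δ b<Δ
  open Upper n Δ c 3≤Δ using (B; inv; inv-B; inv-nonneg)

  private
    β γ : ℚ
    β = ℕtoℚ b
    γ = ℕtoℚ c

  module _ (B≡ : B ≡ b + c) where

    inv-β+γ : inv *ℚ (β +ℚ γ) ≡ 1ℚ
    inv-β+γ = trans (cong (inv *ℚ_) (trans (sym (ℕtoℚ-+ b c)) (cong ℕtoℚ (sym B≡)))) inv-B

    inv-β : inv *ℚ β ≤ℚ 1ℚ
    inv-β = ℚₚ.≤-trans (*-monoʳ inv-nonneg (ℕtoℚ-mono {b} {B} (ℕₚ.≤-trans (ℕₚ.m≤m+n b c) (ℕₚ.≤-reflexive (sym B≡))))) (ℚₚ.≤-reflexive inv-B)

    t-upper : ∀ k → t k ≤ℚ ℕtoℚ k *ℚ β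
    t-upper zero    = ℚₚ.≤-reflexive (sym (ℚₚ.*-zeroˡ β))
    t-upper (suc k) = begin
      β *ℚ (1ℚ +ℚ inv *ℚ t k)      ≡⟨ expand β inv (t k) ⟩
      β +ℚ inv *ℚ β *ℚ t k         ≤⟨ ℚₚ.+-mono-≤ (ℚₚ.≤-refl {β}) (*-monoˡ (t-nonneg k) inv-β) ⟩
      β +ℚ 1ℚ *ℚ t k               ≤⟨ ℚₚ.+-mono-≤ (ℚₚ.≤-refl {β}) (*-monoʳ (ℕtoℚ-nonneg 1) (t-upper k)) ⟩
      β +ℚ 1ℚ *ℚ (ℕtoℚ k *ℚ β)     ≡⟨ collect₁ β (ℕtoℚ k) ⟩
      (1ℚ +ℚ ℕtoℚ k) *ℚ β          ≡⟨ cong (_*ℚ β) (sym (ℕtoℚ-+ 1 k)) ⟩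
      ℕtoℚ (suc k) *ℚ β            ∎
      where
      open ℚₚ.≤-Reasoning
      expand : ∀ b i t → b *ℚ (1ℚ +ℚ i *ℚ t) ≡ b +ℚ i *ℚ b *ℚ t
      expand = solve 3 (λ b i t → b :* (con 1ℚ :+ i :* t) := b :+ i :* b :* t) refl
        where open +-*-Solver
      collect₁ : ∀ b k → b +ℚ 1ℚ *ℚ (k *ℚ b) ≡ (1ℚ +ℚ k) *ℚ b
      collect₁ = solve 2 (λ b k → b :+ con 1ℚ :* (k :* b) := (con 1ℚ :+ k) :* b) refl
        where open +-*-Solver

    -- As long as 2kc ≤ B the loss c·t k / B of one more level is at most half of its gain b.
    t-lower : ∀ k → 2 * (k ∸ 1) * c ≤ B → ℕtoℚ k *ℚ β ≤ℚ ℕtoℚ 2 *ℚ t k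
    t-lower zero    h = ℚₚ.≤-reflexive (ℚₚ.*-zeroˡ β)
    t-lower (suc k) h = ≤-cancelʳ β (begin
      ℕtoℚ (suc k) *ℚ β +ℚ β                            ≡⟨ cong (λ z → z *ℚ β +ℚ β) (ℕtoℚ-+ 1 k) ⟩
      (1ℚ +ℚ ℕtoℚ k) *ℚ β +ℚ β                          ≡⟨ split β (ℕtoℚ k) ⟩
      ℕtoℚ 2 *ℚ β +ℚ ℕtoℚ k *ℚ β                        ≤⟨ ℚₚ.+-mono-≤ (ℚₚ.≤-refl {ℕtoℚ 2 *ℚ β}) (t-lower k (ℕₚ.≤-trans (ℕₚ.*-monoˡ-≤ c (ℕₚ.*-monoʳ-≤ 2 (ℕₚ.m∸n≤m k 1))) h)) ⟩
      ℕtoℚ 2 *ℚ β +ℚ ℕtoℚ 2 *ℚ t k                      ≡⟨ cong (ℕtoℚ 2 *ℚ β +ℚ_) (sym (trans (cong (λ z → ℕtoℚ 2 *ℚ (z *ℚ t k)) inv-β+γ) (cong (ℕtoℚ 2 *ℚ_) (ℚₚ.*-identityˡ (t k))))) ⟩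
      ℕtoℚ 2 *ℚ β +ℚ ℕtoℚ 2 *ℚ (inv *ℚ (β +ℚ γ) *ℚ t k) ≡⟨ separate (ℕtoℚ 2) β γ inv (t k) ⟩
      ℕtoℚ 2 *ℚ t (suc k) +ℚ ℕtoℚ 2 *ℚ γ *ℚ inv *ℚ t k  ≤⟨ ℚₚ.+-mono-≤ (ℚₚ.≤-refl {ℕtoℚ 2 *ℚ t (suc k)}) loss ⟩
      ℕtoℚ 2 *ℚ t (suc k) +ℚ β                          ∎)
      where
      open ℚₚ.≤-Reasoning
      split : ∀ b k → (1ℚ +ℚ k) *ℚ b +ℚ b ≡ ℕtoℚ 2 *ℚ b +ℚ k *ℚ b
      split = solve 2 (λ b k → (con 1ℚ :+ k) :* b :+ b := con (ℕtoℚ 2) :* b :+ k :* b) refl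
        where open +-*-Solver
      separate : ∀ z b g i t → z *ℚ b +ℚ z *ℚ (i *ℚ (b +ℚ g) *ℚ t) ≡ z *ℚ (b *ℚ (1ℚ +ℚ i *ℚ t)) +ℚ z *ℚ g *ℚ i *ℚ t
      separate = solve 5 (λ z b g i t → z :* b :+ z :* (i :* (b :+ g) :* t) := z :* (b :* (con 1ℚ :+ i :* t)) :+ z :* g :* i :* t) refl
        where open +-*-Solver
      regroup : ∀ z g i k b → z *ℚ g *ℚ i *ℚ (k *ℚ b) ≡ z *ℚ k *ℚ g *ℚ (i *ℚ b)
      regroup = solve 5 (λ z g i k b → z :* g :* i :* (k :* b) := z :* k :* g :* (i :* b)) refl
        where open +-*-Solver
      loss : ℕtoℚ 2 *ℚ γ *ℚ inv *ℚ t k ≤ℚ β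
      loss = begin
        ℕtoℚ 2 *ℚ γ *ℚ inv *ℚ t k                     ≤⟨ *-monoʳ (*-nonneg (*-nonneg (ℕtoℚ-nonneg 2) (ℕtoℚ-nonneg c)) inv-nonneg) (t-upper k) ⟩
        ℕtoℚ 2 *ℚ γ *ℚ inv *ℚ (ℕtoℚ k *ℚ β)           ≡⟨ regroup (ℕtoℚ 2) γ inv (ℕtoℚ k) β ⟩
        ℕtoℚ 2 *ℚ ℕtoℚ k *ℚ γ *ℚ (inv *ℚ β)           ≡⟨ cong (_*ℚ (inv *ℚ β)) (sym (trans (ℕtoℚ-* (2 * k) c) (cong (_*ℚ γ) (ℕtoℚ-* 2 k)))) ⟩
        ℕtoℚ (2 * k * c) *ℚ (inv *ℚ β)                ≤⟨ *-monoˡ (*-nonneg inv-nonneg (ℕtoℚ-nonneg b)) (ℕtoℚ-mono {2 * k * c} {B} h) ⟩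
        ℕtoℚ B *ℚ (inv *ℚ β)                          ≡⟨ trans (sym (ℚₚ.*-assoc (ℕtoℚ B) inv β)) (trans (cong (_*ℚ β) (trans (ℚₚ.*-comm (ℕtoℚ B) inv) inv-B)) (ℚₚ.*-identityˡ β)) ⟩
        β                                             ∎

-- Update sequences of either model

module Totals {S U : Set} (Valid : S → U → Set) (step : S → U → S) (e : List U → U → ℚ) (val : S → U → ℚ) (s₀ : S) where

  ValidSeq : S → List U → Set
  ValidSeq s []       = ⊤
  ValidSeq s (u ∷ us) = Valid s u × ValidSeq (step s u) us

  total : List U → List U → ℚ
  total pre []       = 0ℚ
  total pre (u ∷ us) = e pre u +ℚ total (pre ∷ʳ u) us

  tv : S → List U → ℚ
  tv s []       = 0ℚ
  tv s (u ∷ us) = val s u +ℚ tv (step s u) us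

  ValidSeq-prefix : ∀ s xs ys → ValidSeq s (xs ++ ys) → ValidSeq s xs
  ValidSeq-prefix s []       ys v       = tt
  ValidSeq-prefix s (x ∷ xs) ys (v , w) = v , ValidSeq-prefix (step s x) xs ys w

  total-tv : (∀ us u → ValidSeq s₀ (us ∷ʳ u) → e us u ≡ val (foldl step s₀ us) u) →
    ∀ pre us → ValidSeq s₀ (pre ++ us) → total pre us ≡ tv (foldl step s₀ pre) us
  total-tv ev pre []       v = refl
  total-tv ev pre (u ∷ us) v = cong₂ _+ℚ_ (ev pre u (ValidSeq-prefix s₀ (pre ∷ʳ u) us v'))
      (trans (total-tv ev (pre ∷ʳ u) us v') (cong (λ s → tv s us) (Listₚ.foldl-∷ʳ step s₀ u pre)))
    where
    v' : ValidSeq s₀ ((pre ∷ʳ u) ++ us)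
    v' = subst (ValidSeq s₀) (sym (Listₚ.∷ʳ-++ pre u us)) v

-- The hard update sequences and their amortised cost

module HardSequence (n' Δ c m : ℕ) (3≤Δ : 3 ≤ Δ) (b<Δ : suc m < Δ) where
  open Lower n' Δ c m 3≤Δ b<Δ
  open DistMaint n Δ c
  open Kempe n κ
  open Roots n Δ c
  open Rerooting n Δ c using (reroot≗)
  open Running n Δ c 3≤Δ
  open Upper n Δ c 3≤Δ using (B; inv; inv-nonneg; κ-nonZero; module Weights)

  value-nonneg : ∀ F r → 0ℚ ≤ℚ value F r
  value-nonneg F r = *-nonneg (frac1-nonneg κ) (∑-nonneg vertices (Weights.wt-nonneg F r n))

  -- Common to both models: all that matters is that `grow` extends the heap, that `ins` followed by
  -- `del` restores it, and that `ins` costs at least `D / 8`. Every other update is bounded below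
  -- by zero.
  module Amortise {U : Set} (Valid : Shape → U → Set) (step : Shape → U → Shape) (e : List U → U → ℚ) (val : Shape → U → ℚ)
      (grow : Fin n' → U) (ins del : U) (val-nonneg : ∀ f u → 0ℚ ≤ℚ val f u)
      (grow-ok : ∀ i f → f ≗ heap (toℕ i) → Valid f (grow i) × step f (grow i) ≗ heap (suc (toℕ i)))
      (centre-ok : ∀ f → f ≗ heap n' → Valid f ins × Valid (step f ins) del × step (step f ins) del ≗ heap n')
      (D : ℕ) (centre-val : ∀ f → f ≗ heap n' → ℕtoℚ D ≤ℚ ℕtoℚ 8 *ℚ val f ins) where
    open Totals Valid step e val emptyForest public

    tv-nonneg : ∀ f us → 0ℚ ≤ℚ tv f us
    tv-nonneg f []       = ℚₚ.≤-refl
    tv-nonneg f (u ∷ us) = ℚₚ.+-mono-≤ (val-nonneg f u) (tv-nonneg (step f u) us)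

    next : ∀ k j → suc k + j ≡ n' → Fin n'
    next k j e = fromℕ< (ℕₚ.≤-trans (s≤s (ℕₚ.m≤n+m j k)) (ℕₚ.≤-reflexive e))

    toℕ-next : ∀ k j e → toℕ (next k j e) ≡ j
    toℕ-next k j e = Fₚ.toℕ-fromℕ< _

    build : ∀ k j → k + j ≡ n' → List U
    build zero    j e = []
    build (suc k) j e = grow (next k j e) ∷ build k (suc j) (trans (ℕₚ.+-suc k j) e)

    cycle : ℕ → List U
    cycle zero    = []
    cycle (suc M) = ins ∷ del ∷ cycle M

    cycle-valid : ∀ M f → f ≗ heap n' → ValidSeq f (cycle M)
    cycle-valid zero    f h = tt
    cycle-valid (suc M) f h = let (v , w , h') = centre-ok f h in v , w , cycle-valid M _ h'

    cycle-tv : ∀ M f → f ≗ heap n' → ℕtoℚ M *ℚ ℕtoℚ D ≤ℚ ℕtoℚ 8 *ℚ tv f (cycle M)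
    cycle-tv zero    f h = ℚₚ.≤-reflexive (trans (ℚₚ.*-zeroˡ (ℕtoℚ D)) (sym (ℚₚ.*-zeroʳ (ℕtoℚ 8))))
    cycle-tv (suc M) f h = begin
      ℕtoℚ (suc M) *ℚ ℕtoℚ D                                      ≡⟨ trans (cong (_*ℚ ℕtoℚ D) (ℕtoℚ-+ 1 M)) (ℚₚ.*-distribʳ-+ (ℕtoℚ D) 1ℚ (ℕtoℚ M)) ⟩
      1ℚ *ℚ ℕtoℚ D +ℚ ℕtoℚ M *ℚ ℕtoℚ D                            ≡⟨ cong (_+ℚ ℕtoℚ M *ℚ ℕtoℚ D) (ℚₚ.*-identityˡ (ℕtoℚ D)) ⟩
      ℕtoℚ D +ℚ ℕtoℚ M *ℚ ℕtoℚ D                                  ≤⟨ ℚₚ.+-mono-≤ (centre-val f h) (cycle-tv M (step (step f ins) del) (proj₂ (proj₂ (centre-ok f h)))) ⟩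
      ℕtoℚ 8 *ℚ val f ins +ℚ ℕtoℚ 8 *ℚ rest                       ≡⟨ sym (ℚₚ.*-distribˡ-+ (ℕtoℚ 8) (val f ins) rest) ⟩
      ℕtoℚ 8 *ℚ (val f ins +ℚ rest)                               ≤⟨ *-monoʳ (ℕtoℚ-nonneg 8) (ℚₚ.+-mono-≤ (ℚₚ.≤-refl {val f ins})
                                                                       (ℚₚ.≤-trans (ℚₚ.≤-reflexive (sym (ℚₚ.+-identityˡ rest))) (ℚₚ.+-mono-≤ (val-nonneg (step f ins) del) (ℚₚ.≤-refl {rest})))) ⟩
      ℕtoℚ 8 *ℚ (val f ins +ℚ (val (step f ins) del +ℚ rest))     ∎
      where
      open ℚₚ.≤-Reasoning
      rest : ℚ
      rest = tv (step (step f ins) del) (cycle M)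

    grow-next : ∀ k j e f → f ≗ heap j → Valid f (grow (next k j e)) × step f (grow (next k j e)) ≗ heap (suc j)
    grow-next k j e f h = proj₁ ok , λ v → trans (proj₂ ok v) (cong (λ z → heap (suc z) v) (toℕ-next k j e))
      where ok = grow-ok (next k j e) f (λ v → trans (h v) (cong (λ z → heap z v) (sym (toℕ-next k j e))))

    build-valid : ∀ k j e f us → f ≗ heap j → (∀ g → g ≗ heap n' → ValidSeq g us) → ValidSeq f (build k j e ++ us)
    build-valid zero    j e f us h r = r f (λ v → trans (h v) (cong (λ z → heap z v) e))
    build-valid (suc k) j e f us h r = proj₁ (grow-next k j e f h) ,
      build-valid k (suc j) (trans (ℕₚ.+-suc k j) e) _ us (proj₂ (grow-next k j e f h)) r

    build-tv : ∀ k j e f us x → f ≗ heap j → (∀ g → g ≗ heap n' → x ≤ℚ ℕtoℚ 8 *ℚ tv g us) → x ≤ℚ ℕtoℚ 8 *ℚ tv f (build k j e ++ us)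
    build-tv zero    j e f us x h r = r f (λ v → trans (h v) (cong (λ z → heap z v) e))
    build-tv (suc k) j e f us x h r = ℚₚ.≤-trans (build-tv k (suc j) (trans (ℕₚ.+-suc k j) e) (step f (grow (next k j e))) us x (proj₂ (grow-next k j e f h)) r)
      (*-monoʳ {x = ℕtoℚ 8} {y = rest} (ℕtoℚ-nonneg 8) (ℚₚ.≤-trans (ℚₚ.≤-reflexive (sym (ℚₚ.+-identityˡ rest))) (ℚₚ.+-mono-≤ (val-nonneg f (grow (next k j e))) (ℚₚ.≤-refl {rest}))))
      where
      rest : ℚ
      rest = tv (step f (grow (next k j e))) (build k (suc j) (trans (ℕₚ.+-suc k j) e) ++ us)

    updates : List U
    -- With `n` repetitions the building phase is at most a third of the sequence: `n` of at most
    -- `3 * n` updates cost `D / 8`, whence the factor 24 in `amortised`.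
    updates = build n' 0 (ℕₚ.+-identityʳ n') ++ cycle n

    empty≗heap : emptyForest ≗ heap 0
    empty≗heap zero          = refl
    empty≗heap (suc zero)    = refl
    empty≗heap (suc (suc i)) = refl

    updates-valid : ValidSeq emptyForest updates
    updates-valid = build-valid n' 0 (ℕₚ.+-identityʳ n') emptyForest (cycle n) empty≗heap (cycle-valid n)

    build-length : ∀ k j e → length (build k j e) ≡ k
    build-length zero    j e = refl
    build-length (suc k) j e = cong suc (build-length k (suc j) (trans (ℕₚ.+-suc k j) e))

    cycle-length : ∀ M → length (cycle M) ≡ 2 * M
    cycle-length zero    = refl
    cycle-length (suc M) = trans (cong (λ z → suc (suc z)) (cycle-length M)) (cong suc (sym (ℕₚ.+-suc M (M + 0))))

    updates-length : length updates ≡ n' + 2 * n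
    updates-length = trans (Listₚ.length-++ (build n' 0 (ℕₚ.+-identityʳ n'))) (cong₂ _+_ (build-length n' 0 (ℕₚ.+-identityʳ n')) (cycle-length n))

    updates-nonempty : updates ≢ []
    updates-nonempty eq = case trans (sym updates-length) (cong length eq) of λ h → contradiction (ℕₚ.m+n≡0⇒n≡0 n' h) λ ()

    amortised : (∀ us u → ValidSeq emptyForest (us ∷ʳ u) → e us u ≡ val (foldl step emptyForest us) u) →
      ℕtoℚ D ≤ℚ ℕtoℚ 24 *ℚ (total [] updates *ℚ frac 1 (length updates))
    amortised ev = *-cancel-ℕ n (begin
      ℕtoℚ n *ℚ ℕtoℚ D                         ≤⟨ build-tv n' 0 (ℕₚ.+-identityʳ n') emptyForest (cycle n) (ℕtoℚ n *ℚ ℕtoℚ D) empty≗heap (cycle-tv n) ⟩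
      ℕtoℚ 8 *ℚ tv emptyForest updates         ≡⟨ cong (ℕtoℚ 8 *ℚ_) (sym (total-tv ev [] updates updates-valid)) ⟩
      ℕtoℚ 8 *ℚ total [] updates               ≡⟨ cong (ℕtoℚ 8 *ℚ_) (sym x-length) ⟩
      ℕtoℚ 8 *ℚ (x *ℚ ℕtoℚ (length updates))   ≤⟨ *-monoʳ (ℕtoℚ-nonneg 8) (*-monoʳ x-nonneg (ℕtoℚ-mono (ℕₚ.≤-trans (ℕₚ.≤-reflexive updates-length) 3n))) ⟩
      ℕtoℚ 8 *ℚ (x *ℚ ℕtoℚ (3 * n))            ≡⟨ cong (λ z → ℕtoℚ 8 *ℚ (x *ℚ z)) (ℕtoℚ-* 3 n) ⟩
      ℕtoℚ 8 *ℚ (x *ℚ (ℕtoℚ 3 *ℚ ℕtoℚ n))      ≡⟨ regroup x (ℕtoℚ n) ⟩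
      ℕtoℚ n *ℚ (ℕtoℚ 24 *ℚ x)                 ∎)
      where
      open ℚₚ.≤-Reasoning
      x : ℚ
      x = total [] updates *ℚ frac 1 (length updates)
      nz : NonZero (length updates)
      nz = ℕ.>-nonZero (ℕₚ.≤-trans (ℕₚ.≤-trans (s≤s z≤n) (ℕₚ.m≤n+m (2 * n) n')) (ℕₚ.≤-reflexive (sym updates-length)))
      x-length : x *ℚ ℕtoℚ (length updates) ≡ total [] updates
      x-length = trans (ℚₚ.*-assoc (total [] updates) (frac 1 (length updates)) _)
        (trans (cong (total [] updates *ℚ_) (frac-* 1 (length updates) {{nz}})) (ℚₚ.*-identityʳ _))
      x-nonneg : 0ℚ ≤ℚ x
      x-nonneg = *-nonneg (ℚₚ.≤-trans (tv-nonneg emptyForest updates) (ℚₚ.≤-reflexive (sym (total-tv ev [] updates updates-valid)))) (frac1-nonneg (length updates))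
      3n : n' + 2 * n ≤ 3 * n
      3n = ℕₚ.+-monoˡ-≤ (2 * n) (ℕₚ.≤-trans (ℕₚ.n≤1+n n') (ℕₚ.n≤1+n (suc n')))
      regroup : ∀ x n → ℕtoℚ 8 *ℚ (x *ℚ (ℕtoℚ 3 *ℚ n)) ≡ n *ℚ (ℕtoℚ 24 *ℚ x)
      regroup = solve 2 (λ x n → con (ℕtoℚ 8) :* (x :* (con (ℕtoℚ 3) :* n)) := n :* (con (ℕtoℚ 24) :* x)) refl
        where open +-*-Solver

  module _ (D : ℕ) (fits : levels b D ≤ n) (t-large : ℕtoℚ (κ * D) ≤ℚ ℕtoℚ 8 *ℚ t D) where

    linked-value : ∀ r r' → toℕ r < 2 → r' ≢ r → heap n' r' ≡ nothing → ∀ {F} → F ≗ update (heap n') r (just (r' , tt)) → ℕtoℚ D ≤ℚ ℕtoℚ 8 *ℚ value F r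
    linked-value r r' r<2 r'≢r hr' {F} F≗ = *-cancel-ℕ κ (begin
      ℕtoℚ κ *ℚ ℕtoℚ D                           ≡⟨ sym (ℕtoℚ-* κ D) ⟩
      ℕtoℚ (κ * D)                               ≤⟨ t-large ⟩
      ℕtoℚ 8 *ℚ t D                              ≡⟨ cong (ℕtoℚ 8 *ℚ_) (sym (trans (sym (ℚₚ.*-assoc (ℕtoℚ κ) (frac 1 κ) (t D)))
                                                      (trans (cong (_*ℚ t D) (trans (ℚₚ.*-comm (ℕtoℚ κ) (frac 1 κ)) (frac-* 1 κ))) (ℚₚ.*-identityˡ (t D))))) ⟩
      ℕtoℚ 8 *ℚ (ℕtoℚ κ *ℚ (frac 1 κ *ℚ t D))    ≤⟨ *-monoʳ (ℕtoℚ-nonneg 8) (*-monoʳ (ℕtoℚ-nonneg κ) (Linked.value-≥ r r' r<2 r'≢r hr' F≗ D fits)) ⟩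
      ℕtoℚ 8 *ℚ (ℕtoℚ κ *ℚ value F r)            ≡⟨ exchange (ℕtoℚ 8) (ℕtoℚ κ) (value F r) ⟩
      ℕtoℚ κ *ℚ (ℕtoℚ 8 *ℚ value F r)            ∎)
      where open ℚₚ.≤-Reasoning

    cut : ∀ {f : Shape} r m → f ≗ update (heap n') r m → heap n' r ≡ nothing → update f r nothing ≗ heap n'
    cut {f} r m e h v = cases (v ≟F r)
      where
      cases : Dec (v ≡ r) → update f r nothing v ≡ heap n' v
      cases (yes refl) = trans (upd-same f {v} nothing refl) (sym h)
      cases (no v≢r) = trans (upd-diff f nothing v≢r) (trans (e v) (upd-diff (heap n') m v≢r))

    valueR : Shape → RUpdate → ℚ
    valueR f u = value (proj₁ (edgeR f u)) (proj₂ (edgeR f u))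

    valueR-nonneg : ∀ f u → 0ℚ ≤ℚ valueR f u
    valueR-nonneg f u = value-nonneg (proj₁ (edgeR f u)) (proj₂ (edgeR f u))

    growR : ∀ i f → f ≗ heap (toℕ i) → ValidR f (rins (pv i) (node i)) × stepShapeR f (rins (pv i) (node i)) ≗ heap (suc (toℕ i))
    growR i f h = (f-node , rootOf-pv , degree-pv , degree-node-<) , heap-suc i h
      where open Grow i h

    centreR : ∀ f → f ≗ heap n' → ValidR f (rins v₀ v₁) × ValidR (stepShapeR f (rins v₀ v₁)) (rdel v₀ v₁)
      × stepShapeR (stepShapeR f (rins v₀ v₁)) (rdel v₀ v₁) ≗ heap n'
    centreR f h = (f₁ , (λ r → case trans (sym root₀) r of λ ()) , deg₀ , deg₁) , upd-same f {v₁} (just (v₀ , tt)) refl ,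
        cut v₁ (just (v₀ , tt)) (upd-cong h) refl
      where open Centre h

    centreR-value : ∀ f → f ≗ heap n' → ℕtoℚ D ≤ℚ ℕtoℚ 8 *ℚ valueR f (rins v₀ v₁)
    centreR-value f h = linked-value v₁ v₀ (s≤s (s≤s z≤n)) (λ ()) refl (upd-cong h)

    growOpR : Fin n' → RUpdate
    growOpR i = rins (pv i) (node i)

    module SeqR = Amortise ValidR stepShapeR expRecR valueR growOpR (rins v₀ v₁) (rdel v₀ v₁) valueR-nonneg growR centreR D centreR-value

    validR : ∀ f us → SeqR.ValidSeq f us → ValidSeqR f us
    validR f []       v       = tt
    validR f (u ∷ us) (v , w) = v , validR (stepShapeR f u) us w

    totalR : ∀ pre us → totalRecR pre us ≡ SeqR.total pre us
    totalR pre []       = refl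
    totalR pre (u ∷ us) = cong (expRecR pre u +ℚ_) (totalR (pre ∷ʳ u) us)

    hardR : ∃ λ us → us ≢ [] × ValidSeqR emptyForest us × ℕtoℚ D ≤ℚ ℕtoℚ 24 *ℚ amortRecR us
    hardR = SeqR.updates , SeqR.updates-nonempty , validR emptyForest SeqR.updates SeqR.updates-valid ,
      ℚₚ.≤-trans (SeqR.amortised (λ us u v → proj₂ (expRecR-value us u (validR emptyForest (us ∷ʳ u) v))))
        (ℚₚ.≤-reflexive (cong (λ z → ℕtoℚ 24 *ℚ (z *ℚ frac 1 (length SeqR.updates))) (sym (totalR [] SeqR.updates))))

    growG : ∀ i f → f ≗ heap (toℕ i) → ValidG f (gins (pv i) (node i)) × stepShapeG f (gins (pv i) (node i)) ≗ heap (suc (toℕ i))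
    growG i f h = ((λ e → rootOf-pv (trans e rootOf-node)) , degree-pv , degree-node-<) ,
      λ v → trans (cong (λ u → u v) (stepShapeG-ins f (pv i) (node i) orient-node)) (trans (upd-cong (reroot≗ f (node i) f-node) v) (heap-suc i h v))
      where open Grow i h

    linkG : ∀ f → f ≗ heap n' → (a b : V) → orient f v₀ v₁ ≡ (a , b) → f b ≡ nothing → stepShapeG f (gins v₀ v₁) ≗ update (heap n') b (just (a , tt))
    linkG f h a b o fb v = trans (cong (λ u → u v) (stepShapeG-ins f v₀ v₁ o)) (upd-cong (λ x → trans (reroot≗ f b fb x) (h x)) v)

    -- Whichever root `orient` puts below, both ends are roots already, so rerooting does nothing
    -- and the deletion leads back to the same heap.
    centreG : ∀ f → f ≗ heap n' → ValidG f (gins v₀ v₁) × ValidG (stepShapeG f (gins v₀ v₁)) (gdel v₀ v₁)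
      × stepShapeG (stepShapeG f (gins v₀ v₁)) (gdel v₀ v₁) ≗ heap n'
    centreG f h = ((λ e → case trans (sym root₀) (trans e root₁) of λ ()) , deg₀ , deg₁) , cases (orient-cases f v₀ v₁)
      where
      open Centre h
      g : Shape
      g = stepShapeG f (gins v₀ v₁)
      delete : ∀ x → isChildOf g v₀ v₁ ≡ x → stepShapeG g (gdel v₀ v₁) ≡ (if x then update g v₁ nothing else update g v₀ nothing)
      delete x e = cong (λ z → if z then update g v₁ nothing else update g v₀ nothing) e
      cases : orient f v₀ v₁ ≡ (v₀ , v₁) ⊎ orient f v₀ v₁ ≡ (v₁ , v₀) → ValidG g (gdel v₀ v₁) × stepShapeG g (gdel v₀ v₁) ≗ heap n'
      cases (inj₁ o) = inj₁ g₁ , λ v → trans (cong (λ u → u v) (delete true (trans (isChildOf-child? g v₀ v₁) (dec-true (child? g v₀ v₁) g₁))))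
          (cut v₁ (just (v₀ , tt)) (linkG f h v₀ v₁ o f₁) refl v)
        where
        open Painting n Δ c using (isChildOf-child?)
        g₁ : g v₁ ≡ just (v₀ , tt)
        g₁ = trans (linkG f h v₀ v₁ o f₁ v₁) refl
      cases (inj₂ o) = inj₂ g₀ , λ v → trans (cong (λ u → u v) (delete false (trans (isChildOf-child? g v₀ v₁) (dec-false (child? g v₀ v₁) λ e → case trans (sym g₁) e of λ ()))))
          (cut v₀ (just (v₁ , tt)) (linkG f h v₁ v₀ o f₀) refl v)
        where
        open Painting n Δ c using (isChildOf-child?)
        g₀ : g v₀ ≡ just (v₁ , tt)
        g₀ = trans (linkG f h v₁ v₀ o f₀ v₀) refl
        g₁ : g v₁ ≡ nothing
        g₁ = trans (linkG f h v₁ v₀ o f₀ v₁) refl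

    centreG-value : ∀ f → f ≗ heap n' → ℕtoℚ D ≤ℚ ℕtoℚ 8 *ℚ value (stepShapeG f (gins v₀ v₁)) (proj₂ (orient f v₀ v₁))
    centreG-value f h = cases (orient-cases f v₀ v₁)
      where
      open Centre h
      cases : orient f v₀ v₁ ≡ (v₀ , v₁) ⊎ orient f v₀ v₁ ≡ (v₁ , v₀) →
        ℕtoℚ D ≤ℚ ℕtoℚ 8 *ℚ value (stepShapeG f (gins v₀ v₁)) (proj₂ (orient f v₀ v₁))
      cases (inj₁ o) = subst (λ z → ℕtoℚ D ≤ℚ ℕtoℚ 8 *ℚ value (stepShapeG f (gins v₀ v₁)) z) (sym (cong proj₂ o))
        (linked-value v₁ v₀ (s≤s (s≤s z≤n)) (λ ()) refl (linkG f h v₀ v₁ o f₁))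
      cases (inj₂ o) = subst (λ z → ℕtoℚ D ≤ℚ ℕtoℚ 8 *ℚ value (stepShapeG f (gins v₀ v₁)) z) (sym (cong proj₂ o))
        (linked-value v₀ v₁ (s≤s z≤n) (λ ()) refl (linkG f h v₁ v₀ o f₀))

    valueG : Shape → GUpdate → ℚ
    valueG f u = value (proj₁ (edgeG f u)) (proj₂ (edgeG f u))

    valueG-nonneg : ∀ f u → 0ℚ ≤ℚ valueG f u
    valueG-nonneg f u = value-nonneg (proj₁ (edgeG f u)) (proj₂ (edgeG f u))

    growOpG : Fin n' → GUpdate
    growOpG i = gins (pv i) (node i)

    module SeqG = Amortise ValidG stepShapeG expRecG valueG growOpG (gins v₀ v₁) (gdel v₀ v₁) valueG-nonneg growG centreG D centreG-value

    validG : ∀ f us → SeqG.ValidSeq f us → ValidSeqG f us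
    validG f []       v       = tt
    validG f (u ∷ us) (v , w) = v , validG (stepShapeG f u) us w

    totalG : ∀ pre us → totalRecG pre us ≡ SeqG.total pre us
    totalG pre []       = refl
    totalG pre (u ∷ us) = cong (expRecG pre u +ℚ_) (totalG (pre ∷ʳ u) us)

    hardG : ∃ λ us → us ≢ [] × ValidSeqG emptyForest us × ℕtoℚ D ≤ℚ ℕtoℚ 24 *ℚ amortRecG us
    hardG = SeqG.updates , SeqG.updates-nonempty , validG emptyForest SeqG.updates SeqG.updates-valid ,
      ℚₚ.≤-trans (SeqG.amortised (λ us u v → proj₂ (expRecG-value us u (validG emptyForest (us ∷ʳ u) v))))
        (ℚₚ.≤-reflexive (cong (λ z → ℕtoℚ 24 *ℚ (z *ℚ frac 1 (length SeqG.updates))) (sym (totalG [] SeqG.updates))))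

-- From a number of levels to the two forms of the lower bound

numerator-nonneg : ∀ x → 0ℚ ≤ℚ x → ∃ λ p → ℚ.numerator x ≡ + p
numerator-nonneg (ℚ.mkℚ (+ p) _ _)    h           = p , refl
numerator-nonneg (ℚ.mkℚ -[1+ _ ] _ _) (ℚ.*≤* ())

numerator-≥ : ∀ x {p} a m → ℚ.numerator x ≡ + p → ℕtoℚ a ≤ℚ ℕtoℚ m *ℚ x → a * ℚ.denominatorℕ x ≤ m * p
numerator-≥ x {p} a m e h = ℕtoℚ-cancel (begin
  ℕtoℚ (a * ℚ.denominatorℕ x)                     ≡⟨ ℕtoℚ-* a (ℚ.denominatorℕ x) ⟩
  ℕtoℚ a *ℚ ℕtoℚ (ℚ.denominatorℕ x)               ≤⟨ *-monoˡ (ℕtoℚ-nonneg (ℚ.denominatorℕ x)) h ⟩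
  ℕtoℚ m *ℚ x *ℚ ℕtoℚ (ℚ.denominatorℕ x)          ≡⟨ ℚₚ.*-assoc (ℕtoℚ m) x _ ⟩
  ℕtoℚ m *ℚ (x *ℚ ℕtoℚ (ℚ.denominatorℕ x))        ≡⟨ cong (ℕtoℚ m *ℚ_) (numerator-eq x e) ⟩
  ℕtoℚ m *ℚ ℕtoℚ p                                ≡⟨ sym (ℕtoℚ-* m p) ⟩
  ℕtoℚ (m * p)                                    ∎)
  where open ℚₚ.≤-Reasoning

GeLog-intro : ∀ x K b n {p} → ℚ.numerator x ≡ + p → n ^ ℚ.denominatorℕ x ≤ b ^ (K * p) → GeLog x K b n
GeLog-intro x K b n e h with ℚ.numerator x
GeLog-intro x K b n refl h | + p = h

-- `D` is at most `24 * x` and the logarithm of `n` at most `4 * D`, hence at most `96 * x`; the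
-- power with exponent `q` clears the denominator of `x`.
lower-log : ∀ x b n D → .{{_ : NonZero b}} → ℕtoℚ D ≤ℚ ℕtoℚ 24 *ℚ x → n ≤ b ^ (4 * D) → GeLog x 96 b n
lower-log x b n D h n≤ = GeLog-intro x 96 b n e (begin
  n ^ q                    ≤⟨ ℕₚ.^-monoˡ-≤ q n≤ ⟩
  (b ^ (4 * D)) ^ q        ≡⟨ ℕₚ.^-*-assoc b (4 * D) q ⟩
  b ^ (4 * D * q)          ≡⟨ cong (b ^_) (ℕₚ.*-assoc 4 D q) ⟩
  b ^ (4 * (D * q))        ≤⟨ ℕₚ.^-monoʳ-≤ b (ℕₚ.*-monoʳ-≤ 4 (numerator-≥ x D 24 e h)) ⟩
  b ^ (4 * (24 * p))       ≡⟨ cong (b ^_) (sym (ℕₚ.*-assoc 4 24 p)) ⟩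
  b ^ (96 * p)             ∎)
  where
  open ℕₚ.≤-Reasoning
  x-nonneg : 0ℚ ≤ℚ x
  x-nonneg = *-cancel-ℕ 24 (ℚₚ.≤-trans (ℚₚ.≤-reflexive (ℚₚ.*-zeroʳ (ℕtoℚ 24))) (ℚₚ.≤-trans (ℕtoℚ-nonneg D) h))
  q p : ℕ
  q = ℚ.denominatorℕ x
  p = proj₁ (numerator-nonneg x x-nonneg)
  e : ℚ.numerator x ≡ + p
  e = proj₂ (numerator-nonneg x x-nonneg)

lower-ratio : ∀ x Δ c D → ℕtoℚ D ≤ℚ ℕtoℚ 24 *ℚ x → Δ ≤ 4 * c * D → ℕtoℚ Δ ≤ℚ ℕtoℚ (96 * c) *ℚ x
lower-ratio x Δ c D h Δ≤ = begin
  ℕtoℚ Δ                                    ≤⟨ ℕtoℚ-mono Δ≤ ⟩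
  ℕtoℚ (4 * c * D)                          ≡⟨ ℕtoℚ-* (4 * c) D ⟩
  ℕtoℚ (4 * c) *ℚ ℕtoℚ D                    ≤⟨ *-monoʳ (ℕtoℚ-nonneg (4 * c)) h ⟩
  ℕtoℚ (4 * c) *ℚ (ℕtoℚ 24 *ℚ x)            ≡⟨ sym (ℚₚ.*-assoc (ℕtoℚ (4 * c)) (ℕtoℚ 24) x) ⟩
  ℕtoℚ (4 * c) *ℚ ℕtoℚ 24 *ℚ x              ≡⟨ cong (_*ℚ x) (sym (ℕtoℚ-* (4 * c) 24)) ⟩
  ℕtoℚ (4 * c * 24) *ℚ x                    ≡⟨ cong (λ z → ℕtoℚ z *ℚ x) (trans (ℕₚ.*-comm (4 * c) 24) (sym (ℕₚ.*-assoc 24 4 c))) ⟩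
  ℕtoℚ (96 * c) *ℚ x                        ∎
  where open ℚₚ.≤-Reasoning

-- The added 2 makes the induction close: multiplying it by `b ≥ 2` yields the 4 that the next level
-- costs.
levels-bound : ∀ b k → 2 ≤ b → levels b k + 2 ≤ 4 * b ^ k
levels-bound b zero    h = ℕₚ.≤-refl
levels-bound b (suc k) h = ℕₚ.+-cancelʳ-≤ (b * 2) _ _ (begin
  2 + b * levels b k + 2 + b * 2     ≡⟨ rearrange b (levels b k) ⟩
  b * (levels b k + 2) + 4           ≤⟨ ℕₚ.+-mono-≤ (ℕₚ.*-monoʳ-≤ b (levels-bound b k h)) (ℕₚ.*-monoˡ-≤ 2 h) ⟩
  b * (4 * b ^ k) + b * 2            ≡⟨ cong (_+ b * 2) (swap b (b ^ k)) ⟩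
  4 * b ^ suc k + b * 2              ∎)
  where
  open ℕₚ.≤-Reasoning
  rearrange : ∀ b l → 2 + b * l + 2 + b * 2 ≡ b * (l + 2) + 4
  rearrange = solve 2 (λ b l → con 2 :+ b :* l :+ con 2 :+ b :* con 2 := b :* (l :+ con 2) :+ con 4) refl
    where open ℕSolver
  swap : ∀ b x → b * (4 * x) ≡ 4 * (b * x)
  swap = solve 2 (λ b x → b :* (con 4 :* x) := con 4 :* (b :* x)) refl
    where open ℕSolver

floor-levels : ∀ b n → 1 ≤ b → levels b 1 ≤ n → ∃ λ D → levels b (suc D) ≤ n × n < levels b (suc (suc D))
floor-levels b n 1≤b h = search n 0 (ℕₚ.≤-trans (ℕₚ.≤-reflexive (sym (ℕₚ.+-identityʳ n))) ℕₚ.≤-refl) h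
  where
  search : ∀ fuel k → n ≤ fuel + k → levels b (suc k) ≤ n → ∃ λ D → levels b (suc D) ≤ n × n < levels b (suc (suc D))
  search zero k n≤k h = contradiction (ℕₚ.≤-trans h n≤k) (ℕₚ.<⇒≱ (ℕₚ.<-trans (ℕₚ.n<1+n k) (k<levels b (suc k) 1≤b)))
  search (suc fuel) k n≤ h with levels b (suc (suc k)) ℕ.≤? n
  ... | yes h' = search fuel (suc k) (ℕₚ.≤-trans n≤ (ℕₚ.≤-reflexive (sym (ℕₚ.+-suc fuel k)))) h'
  ... | no ¬h' = k , h , ℕₚ.≰⇒> ¬h'

HardR HardG : (Δ c n : ℕ) → Set
HardR Δ c n = ∃ λ (us : List (DistMaint.RUpdate n Δ c)) → us ≢ [] × DistMaint.ValidSeqR n Δ c (Forest.emptyForest n) us × LowerBound 96 Δ c n (DistMaint.amortRecR n Δ c us)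
HardG Δ c n = ∃ λ (us : List (DistMaint.GUpdate n Δ c)) → us ≢ [] × DistMaint.ValidSeqG n Δ c (Forest.emptyForest n) us × LowerBound 96 Δ c n (DistMaint.amortRecG n Δ c us)

module Assemble (n' Δ c m : ℕ) (3≤Δ : 3 ≤ Δ) (b<Δ : suc m < Δ) where
  open Lower n' Δ c m 3≤Δ b<Δ
  open DistMaint n Δ c using (κ)
  open HardSequence n' Δ c m 3≤Δ b<Δ

  hard : ∀ D → levels b D ≤ n → ℕtoℚ (κ * D) ≤ℚ ℕtoℚ 8 *ℚ t D →
    (∀ x → ℕtoℚ D ≤ℚ ℕtoℚ 24 *ℚ x → LowerBound 96 Δ c n x) → HardR Δ c n × HardG Δ c n
  hard D fits tl conclude =
    (proj₁ R , proj₁ (proj₂ R) , proj₁ (proj₂ (proj₂ R)) , conclude _ (proj₂ (proj₂ (proj₂ R)))) ,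
    (proj₁ G , proj₁ (proj₂ G) , proj₁ (proj₂ (proj₂ G)) , conclude _ (proj₂ (proj₂ (proj₂ G))))
    where
    R = hardR D fits tl
    G = hardG D fits tl

-- The roots have room for `Δ ∸ 1` children each, so `D + 1` full levels fit for some `D`. If
-- `t-lower` covers them all, the height decides and the bound is logarithmic. Otherwise it is
-- applied to the `E + 1` levels it does cover, and the bound is `Δ / c`.
hard-large : ∀ d c n' → c ≤ suc d → 2 * (3 + d) ≤ 2 + n' → HardR (3 + d) c (2 + n') × HardG (3 + d) c (2 + n')
hard-large d c n' c≤ large = choose (floor-levels b (2 + n') (s≤s z≤n) one-level)
  where
  Δ b B κ : ℕ
  Δ = 3 + d
  b = 2 + d
  B = b + c
  κ = Δ + c
  3≤Δ : 3 ≤ Δ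
  3≤Δ = s≤s (s≤s (s≤s z≤n))
  open Lower n' Δ c (suc d) 3≤Δ ℕₚ.≤-refl using (t; t-nonneg)
  open Growth n' Δ c (suc d) 3≤Δ ℕₚ.≤-refl using (t-lower)
  open Assemble n' Δ c (suc d) 3≤Δ ℕₚ.≤-refl using (hard)

  one-level : levels b 1 ≤ 2 + n'
  one-level = ℕₚ.≤-trans (ℕₚ.≤-reflexive (rearrange d)) large
    where
    rearrange : ∀ d → 2 + (2 + d) * 2 ≡ 2 * (3 + d)
    rearrange = solve 1 (λ d → con 2 :+ (con 2 :+ d) :* con 2 := con 2 :* (con 3 :+ d)) refl
      where open ℕSolver

  -- Here `c ≤ Δ - 2` enters: the palette is at most twice the arity, so dividing by `κ` costs only
  -- a constant.
  κ≤2b : κ ≤ 2 * b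
  κ≤2b = ℕₚ.≤-trans (ℕₚ.+-monoʳ-≤ Δ c≤) (ℕₚ.≤-reflexive (rearrange d))
    where
    rearrange : ∀ d → (3 + d) + suc d ≡ 2 * (2 + d)
    rearrange = solve 1 (λ d → (con 3 :+ d) :+ (con 1 :+ d) := con 2 :* (con 2 :+ d)) refl
      where open ℕSolver

  t-large : ∀ D → 2 * (D ∸ 1) * c ≤ B → ℕtoℚ (κ * D) ≤ℚ ℕtoℚ 8 *ℚ t D
  t-large D h = begin
    ℕtoℚ (κ * D)                            ≤⟨ ℕtoℚ-mono (ℕₚ.≤-trans (ℕₚ.*-monoˡ-≤ D κ≤2b) (ℕₚ.≤-reflexive (trans (ℕₚ.*-assoc 2 b D) (cong (2 *_) (ℕₚ.*-comm b D))))) ⟩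
    ℕtoℚ (2 * (D * b))                      ≡⟨ trans (ℕtoℚ-* 2 (D * b)) (cong (ℕtoℚ 2 *ℚ_) (ℕtoℚ-* D b)) ⟩
    ℕtoℚ 2 *ℚ (ℕtoℚ D *ℚ ℕtoℚ b)            ≤⟨ *-monoʳ (ℕtoℚ-nonneg 2) (t-lower refl D h) ⟩
    ℕtoℚ 2 *ℚ (ℕtoℚ 2 *ℚ t D)               ≡⟨ sym (ℚₚ.*-assoc (ℕtoℚ 2) (ℕtoℚ 2) (t D)) ⟩
    -- The factor 4 is weakened to 8 to share the constant with `hard-small`.
    ℕtoℚ 2 *ℚ ℕtoℚ 2 *ℚ t D                 ≤⟨ *-monoˡ (t-nonneg D) (ℕtoℚ-mono {4} {8} (s≤s (s≤s (s≤s (s≤s z≤n))))) ⟩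
    ℕtoℚ 8 *ℚ t D                           ∎
    where open ℚₚ.≤-Reasoning

  choose : (∃ λ D → levels b (suc D) ≤ 2 + n' × 2 + n' < levels b (suc (suc D))) → HardR Δ c (2 + n') × HardG Δ c (2 + n')
  choose (D , fits , beyond) = split (2 * D * c ℕ.≤? B)
    where
    n≤ : 2 + n' ≤ B ^ (4 * suc D)
    n≤ = begin
      2 + n'                        ≤⟨ ℕₚ.<⇒≤ beyond ⟩
      levels b (suc (suc D))        ≤⟨ ℕₚ.≤-trans (ℕₚ.m≤m+n _ 2) (levels-bound b (suc (suc D)) (s≤s (s≤s z≤n))) ⟩
      4 * b ^ (2 + D)               ≤⟨ ℕₚ.*-monoˡ-≤ (b ^ (2 + D)) (ℕₚ.≤-trans (ℕₚ.*-mono-≤ {2} {b} {2} {b} (s≤s (s≤s z≤n)) (s≤s (s≤s z≤n))) (ℕₚ.≤-reflexive (cong (b *_) (sym (ℕₚ.*-identityʳ b))))) ⟩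
      b ^ 2 * b ^ (2 + D)           ≡⟨ sym (ℕₚ.^-distribˡ-+-* b 2 (2 + D)) ⟩
      b ^ (4 + D)                   ≤⟨ ℕₚ.^-monoˡ-≤ (4 + D) (ℕₚ.m≤m+n b c) ⟩
      B ^ (4 + D)                   ≤⟨ ℕₚ.^-monoʳ-≤ B (ℕₚ.≤-trans (ℕₚ.+-monoʳ-≤ 4 (ℕₚ.m≤m+n D (3 * D))) (ℕₚ.≤-reflexive (sym (ℕₚ.*-suc 4 D)))) ⟩
      B ^ (4 * suc D)               ∎
      where open ℕₚ.≤-Reasoning
    split : Dec (2 * D * c ≤ B) → HardR Δ c (2 + n') × HardG Δ c (2 + n')
    split (yes h) = hard (suc D) fits (t-large (suc D) h) (λ x hx → inj₂ (lower-log x B (2 + n') (suc D) hx n≤))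
    split (no ¬h) = short c refl
      where
      short : ∀ c' → c ≡ c' → HardR Δ c (2 + n') × HardG Δ c (2 + n')
      -- For `c = 0` the test always succeeds, in keeping with an infinite `Δ / c`; in the other
      -- case division by `2 * c` is legitimate.
      short zero     refl = contradiction (ℕₚ.≤-trans (ℕₚ.≤-reflexive (ℕₚ.*-zeroʳ (2 * D))) z≤n) ¬h
      short (suc c₁) refl = hard (suc E) (ℕₚ.≤-trans (levels-mono-≤ b (s≤s E≤D)) fits) (t-large (suc E) E-small)
          (λ x hx → inj₁ (lower-ratio x Δ c (suc E) hx Δ≤))
        where
        -- `suc E` is the largest number of levels allowed by `t-lower`, whose condition reads
        -- `2 * E * c ≤ B`. Since `D` fails that condition, `E` lies below `D` and these levels fit.
        E : ℕ
        E = B ℕD./ (2 * c)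
        E-small : 2 * E * c ≤ B
        E-small = ℕₚ.≤-trans (ℕₚ.≤-reflexive (rearrange E c)) (ℕD.m/n*n≤m B (2 * c))
          where
          rearrange : ∀ e c → 2 * e * c ≡ e * (2 * c)
          rearrange = solve 2 (λ e c → con 2 :* e :* c := e :* (con 2 :* c)) refl
            where open ℕSolver
        E≤D : E ≤ D
        E≤D = ℕₚ.<⇒≤ (ℕₚ.*-cancelˡ-< 2 E D (ℕₚ.*-cancelʳ-< c (2 * E) (2 * D) (ℕₚ.≤-<-trans E-small (ℕₚ.≰⇒> ¬h))))
        B≤ : B ≤ 2 * c * suc E
        B≤ = begin
          B                                        ≡⟨ ℕD.m≡m%n+[m/n]*n B (2 * c) ⟩
          B ℕD.% (2 * c) + E * (2 * c)             ≤⟨ ℕₚ.+-monoˡ-≤ (E * (2 * c)) (ℕₚ.<⇒≤ (ℕD.m%n<n B (2 * c))) ⟩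
          suc E * (2 * c)                          ≡⟨ ℕₚ.*-comm (suc E) (2 * c) ⟩
          2 * c * suc E                            ∎
          where open ℕₚ.≤-Reasoning
        Δ≤ : Δ ≤ 4 * c * suc E
        Δ≤ = begin
          3 + d                          ≤⟨ ℕₚ.≤-trans (s≤s (s≤s (s≤s (ℕₚ.m≤m+n d (suc d))))) (ℕₚ.≤-reflexive (rearrange₁ d)) ⟩
          2 * b                          ≤⟨ ℕₚ.*-monoʳ-≤ 2 (ℕₚ.m≤m+n b c) ⟩
          2 * B                          ≤⟨ ℕₚ.*-monoʳ-≤ 2 B≤ ⟩
          2 * (2 * c * suc E)            ≡⟨ rearrange₂ c (suc E) ⟩
          4 * c * suc E                  ∎
          where
          open ℕₚ.≤-Reasoning
          rearrange₁ : ∀ d → 3 + (d + suc d) ≡ 2 * (2 + d)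
          rearrange₁ = solve 1 (λ d → con 3 :+ (d :+ (con 1 :+ d)) := con 2 :* (con 2 :+ d)) refl
            where open ℕSolver
          rearrange₂ : ∀ c e → 2 * (2 * c * e) ≡ 4 * c * e
          rearrange₂ = solve 2 (λ c e → con 2 :* (con 2 :* c :* e) := con 4 :* c :* e) refl
            where open ℕSolver

-- Fewer than 2Δ vertices: two stars of equal size already force constant recourse.
hard-small : ∀ d c n' → 3 + d + c ≤ 2 + n' → 2 ≤ n' → 2 + n' < 2 * (3 + d) → HardR (3 + d) c (2 + n') × HardG (3 + d) c (2 + n')
hard-small d c n' κ≤n 2≤n' small = stars (n' ℕD./ 2) refl
  where
  Δ B κ : ℕ
  Δ = 3 + d
  B = 2 + d + c
  κ = Δ + c
  3≤Δ : 3 ≤ Δ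
  3≤Δ = s≤s (s≤s (s≤s z≤n))

  stars : ∀ h → n' ℕD./ 2 ≡ h → HardR Δ c (2 + n') × HardG Δ c (2 + n')
  stars zero    e = contradiction (ℕₚ.≤-trans (ℕD.m≥n⇒m/n>0 2≤n') (ℕₚ.≤-reflexive e)) λ ()
  stars (suc m) e = hard 1 fits t-large (λ x hx → inj₂ (lower-log x B (2 + n') 1 hx n≤))
    where
    b : ℕ
    b = suc m
    2b≤n' : b * 2 ≤ n'
    2b≤n' = ℕₚ.≤-trans (ℕₚ.≤-reflexive (cong (_* 2) (sym e))) (ℕD.m/n*n≤m n' 2)
    n'≤2b+1 : n' ≤ suc (b * 2)
    n'≤2b+1 = ℕₚ.≤-trans (ℕₚ.≤-reflexive (ℕD.m≡m%n+[m/n]*n n' 2)) (ℕₚ.+-mono-≤ (ℕₚ.≤-pred (ℕD.m%n<n n' 2)) (ℕₚ.≤-reflexive (cong (_* 2) e)))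
    b<Δ : b < Δ
    b<Δ = ℕₚ.*-cancelʳ-< 2 b Δ (ℕₚ.≤-<-trans 2b≤n' (ℕₚ.<-trans (ℕₚ.<-trans (ℕₚ.n<1+n n') (ℕₚ.n<1+n (suc n'))) (ℕₚ.<-≤-trans small (ℕₚ.≤-reflexive (ℕₚ.*-comm 2 Δ)))))
    open Lower n' Δ c m 3≤Δ b<Δ using (t)
    open Upper (2 + n') Δ c 3≤Δ using (inv)
    open Assemble n' Δ c m 3≤Δ b<Δ using (hard)
    fits : levels b 1 ≤ 2 + n'
    fits = s≤s (s≤s 2b≤n')
    -- Here `n ≥ κ` enters: two stars that use up almost all `n` vertices have a number of leaves
    -- proportional to `κ`.
    κ≤8b : κ * 1 ≤ 8 * b
    κ≤8b = begin
      κ * 1              ≡⟨ ℕₚ.*-identityʳ κ ⟩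
      κ                  ≤⟨ κ≤n ⟩
      2 + n'             ≤⟨ s≤s (s≤s n'≤2b+1) ⟩
      3 + (suc m * 2)    ≤⟨ ℕₚ.m≤m+n _ (3 + 6 * m) ⟩
      3 + suc m * 2 + (3 + 6 * m) ≡⟨ rearrange m ⟩
      8 * b              ∎
      where
      open ℕₚ.≤-Reasoning
      rearrange : ∀ m → 3 + suc m * 2 + (3 + 6 * m) ≡ 8 * suc m
      rearrange = solve 1 (λ m → con 3 :+ (con 1 :+ m) :* con 2 :+ (con 3 :+ con 6 :* m) := con 8 :* (con 1 :+ m)) refl
        where open ℕSolver
    t₁ : t 1 ≡ ℕtoℚ b
    t₁ = trans (cong (λ z → ℕtoℚ b *ℚ (1ℚ +ℚ z)) (ℚₚ.*-zeroʳ inv)) (trans (cong (ℕtoℚ b *ℚ_) (ℚₚ.+-identityʳ 1ℚ)) (ℚₚ.*-identityʳ (ℕtoℚ b)))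
    t-large : ℕtoℚ (κ * 1) ≤ℚ ℕtoℚ 8 *ℚ t 1
    t-large = ℚₚ.≤-trans (ℕtoℚ-mono κ≤8b) (ℚₚ.≤-reflexive (trans (ℕtoℚ-* 8 b) (cong (ℕtoℚ 8 *ℚ_) (sym t₁))))
    n≤ : 2 + n' ≤ B ^ (4 * 1)
    n≤ = begin
      2 + n'                       ≤⟨ ℕₚ.<⇒≤ small ⟩
      2 * (3 + d)                  ≤⟨ ℕₚ.*-monoʳ-≤ 2 (ℕₚ.≤-trans (s≤s (s≤s (s≤s (ℕₚ.m≤m+n d (suc d))))) (ℕₚ.≤-reflexive (rearrange d))) ⟩
      2 * (2 * (2 + d))            ≤⟨ ℕₚ.*-mono-≤ 2≤B (ℕₚ.*-mono-≤ 2≤B (ℕₚ.≤-trans (ℕₚ.m≤m+n (2 + d) c) (ℕₚ.m≤m*n B (B * 1)))) ⟩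
      B ^ (4 * 1)                  ∎
      where
      open ℕₚ.≤-Reasoning
      2≤B : 2 ≤ B
      2≤B = s≤s (s≤s z≤n)
      rearrange : ∀ d → 3 + (d + suc d) ≡ 2 * (2 + d)
      rearrange = solve 1 (λ d → con 3 :+ (d :+ (con 1 :+ d)) := con 2 :* (con 2 :+ d)) refl
        where open ℕSolver

-- κ = n = 3, where two stars do not fit.
hard-three : HardR 3 0 3 × HardG 3 0 3
hard-three =
  (rs , (λ ()) , ((refl , (λ ()) , s≤s z≤n , s≤s z≤n) , (refl , (λ ()) , s≤s z≤n , s≤s (s≤s z≤n)) , tt) ,
    inj₂ (lower-log (DistMaint.amortRecR 3 3 0 rs) 2 3 1 (toWitness {a? = ℕtoℚ 1 ℚₚ.≤? ℕtoℚ 24 *ℚ DistMaint.amortRecR 3 3 0 rs} tt) 3≤16)) ,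
  (gs , (λ ()) , (((λ ()) , s≤s z≤n , s≤s z≤n) , ((λ ()) , s≤s (s≤s z≤n) , s≤s z≤n) , inj₁ refl , tt) ,
    inj₂ (lower-log (DistMaint.amortRecG 3 3 0 gs) 2 3 1 (toWitness {a? = ℕtoℚ 1 ℚₚ.≤? ℕtoℚ 24 *ℚ DistMaint.amortRecG 3 3 0 gs} tt) 3≤16))
  where
  v₀ v₁ v₂ : Fin 3
  v₀ = zero
  v₁ = suc zero
  v₂ = suc (suc zero)
  rs : List (DistMaint.RUpdate 3 3 0)
  rs = DistMaint.rins v₁ v₂ ∷ DistMaint.rins v₀ v₁ ∷ []
  -- In the general model both insertions make an isolated vertex the child and recolour nothing.
  -- The recourse comes from the deletion, whose lower endpoint `v₁` has the child `v₂`. Its value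
  -- is found by evaluating the algorithm.
  gs : List (DistMaint.GUpdate 3 3 0)
  gs = DistMaint.gins v₀ v₁ ∷ DistMaint.gins v₁ v₂ ∷ DistMaint.gdel v₀ v₁ ∷ []
  3≤16 : 3 ≤ 16
  3≤16 = s≤s (s≤s (s≤s z≤n))

-- Three vertices force `Δ = 3` and `c = 0`. Beyond that the threshold is `2 * Δ`, the least number
-- of vertices for which both roots can have `Δ ∸ 1` children.
hard-sequences : ∀ Δ c n → 3 ≤ Δ → c + 2 ≤ Δ → Δ + c ≤ n → HardR Δ c n × HardG Δ c n
hard-sequences (suc (suc (suc d))) c (suc (suc (suc zero))) _ _ (s≤s (s≤s (s≤s h)))
  with refl ← ℕₚ.m+n≡0⇒m≡0 d (ℕₚ.n≤0⇒n≡0 h) | refl ← ℕₚ.m+n≡0⇒n≡0 d (ℕₚ.n≤0⇒n≡0 h) = hard-three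
hard-sequences (suc (suc (suc d))) c (suc (suc n'@(suc (suc _)))) _ c≤ κ≤n with 2 * (3 + d) ℕ.≤? 2 + n'
... | yes large = hard-large d c n' (ℕₚ.+-cancelʳ-≤ 2 c (suc d) (ℕₚ.≤-trans c≤ (ℕₚ.≤-reflexive (ℕₚ.+-comm 2 (suc d))))) large
... | no small  = hard-small d c n' κ≤n (s≤s (s≤s z≤n)) (ℕₚ.≰⇒> small)
hard-sequences (suc zero) c n (s≤s ())
hard-sequences (suc (suc zero)) c n (s≤s (s≤s ()))
hard-sequences (suc (suc (suc d))) c (suc (suc zero)) _ _ (s≤s (s≤s ()))
hard-sequences (suc (suc (suc d))) c (suc zero) _ _ (s≤s ())

theorem2p12 : (∃ λ (C : ℕ) → ∀ (Δ c n : ℕ) → 3 ≤ Δ → c + 2 ≤ Δ →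
    (∀ (us : List (DistMaint.RUpdate n Δ c)) (u : DistMaint.RUpdate n Δ c) →
    DistMaint.ValidSeqR n Δ c (Forest.emptyForest n) (us ∷ʳ u) →
    UpperBound C Δ c n (DistMaint.expRecR n Δ c us u))
    × (∀ (us : List (DistMaint.GUpdate n Δ c)) (u : DistMaint.GUpdate n Δ c) →
    DistMaint.ValidSeqG n Δ c (Forest.emptyForest n) (us ∷ʳ u) →
    UpperBound C Δ c n (DistMaint.expRecG n Δ c us u)))
    ×
    (∃ λ (K : ℕ) → 1 ≤ K × (∀ (Δ c n : ℕ) → 3 ≤ Δ → c + 2 ≤ Δ → Δ + c ≤ n →
    (∃ λ (us : List (DistMaint.RUpdate n Δ c)) → us ≢ [] ×
    DistMaint.ValidSeqR n Δ c (Forest.emptyForest n) us ×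
    LowerBound K Δ c n (DistMaint.amortRecR n Δ c us))
    × (∃ λ (us : List (DistMaint.GUpdate n Δ c)) → us ≢ [] ×
    DistMaint.ValidSeqG n Δ c (Forest.emptyForest n) us ×
    LowerBound K Δ c n (DistMaint.amortRecG n Δ c us))))
theorem2p12 = (2 , λ Δ c n 3≤Δ _ → Upper.upperR n Δ c 3≤Δ , Upper.upperG n Δ c 3≤Δ) , 96 , s≤s z≤n , hard-sequences
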